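{- Let $p$ be a prime, $q$ a prime power with $p\nmid q$, $d$ the multiplicative order of $q$ modulo $p$, and $\lambda_i=v_p(q^{dp^i}-1)$ for $i\ge0$. Let $G=\prod_{j=1}^{r}C_{p^j}^{k_j}$ with $k_j\ge0$, $k_r>0$, and $c_i=\sum_{j=1}^{r}\min(i,j)k_j$. Let $b_i=c_{\lambda_i}-\lambda_i-i$, and let $l$ be the smallest index $i\ge0$ minimizing $p^{ -i}\left(b_i-\frac{1}{p-1}\right)$. Then for every $n\ge0$, $$v_p([z^n]F(G,q;z))\geq b_l\left\lfloor\frac{n}{dp^l}\right\rfloor-v_p\left(\left\lfloor\frac{n}{dp^l}\right\rfloor!\right).$$
   Context: $C_m$ is the cyclic group of order $m$; $v_p$ is the $p$-adic valuation on $\mathbb{Q}$ (with $v_p(0)=+\infty$); $[z^n]$ denotes the coefficient of $z^n$. With $(q;q)_n=\prod_{i=1}^n(1-q^i)$, define the power series $F(G,q;z)=\sum_{n\ge0}\frac{(-1)^n\#\operatorname{Hom}(G,GL_n(\mathbb{F}_q))}{q^{\binom n2}(q;q)_n}z^n\in\mathbb{Q}[[z]]$, where $\#\operatorname{Hom}$ counts group homomorphisms. -}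

module Defs where

open import Data.Nat as ℕ using (ℕ; zero; suc; _∸_; _^_; _≤_; _<_; _!)
open import Data.Nat.Divisibility using (_∣_)
open import Data.Nat.DivMod using (_/_; _%_)
open import Data.Nat.Primality using (Prime)
open import Data.Nat.Combinatorics using (_C_)
open import Data.Integer as ℤ using (ℤ; +_; -[1+_]; +[1+_])
open import Data.Rational as ℚ using (ℚ; mkℚ)
open import Data.Fin using (Fin)
open import Data.Vec as Vec using (Vec; []; _∷_)
import Data.Vec.Properties as VecP
open import Data.List as List using (List; []; _∷_; [_]; concatMap; upTo; replicate; length; filter; zipWith; concat)
import Data.List.Properties as ListP
open import Data.List.Relation.Unary.All as All using (All; all?)
open import Data.List.Relation.Unary.Any as Any using (Any; any?)
open import Data.List.Membership.Propositional using (_∈_)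
open import Data.List.Relation.Unary.Unique.Propositional using (Unique)
open import Data.Product using (Σ; _×_; _,_; ∃)
open import Data.Product.Properties using (≡-dec)
open import Relation.Nullary using (¬_; Dec; yes; no)
open import Relation.Nullary.Decidable using (_×-dec_)
open import Relation.Binary.PropositionalEquality using (_≡_; _≢_)
open import Relation.Binary.Definitions using (DecidableEquality)
open import Algebra.Structures using (IsCommutativeRing)
open import Level using (0ℓ)

-- Small arithmetic helpers (total versions; only used with nonzero divisors)

-- ⌊ n / m ⌋, with the (unused) convention ⌊ n / 0 ⌋ = 0
divℕ : ℕ → ℕ → ℕ
divℕ n zero    = 0
divℕ n (suc m) = n / suc m

-- the rational a / b for integers a, b, with the (unused) convention a / 0 = 0
divℤ : ℤ → ℤ → ℚ
divℤ a (+ zero)     = ℚ.0ℚ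
divℤ a +[1+ m ]     = a ℚ./ suc m
divℤ a -[1+ m ]     = (ℤ.- a) ℚ./ suc m

-- fuel-based computation of v_p(m) for m ≥ 1 and p ≥ 2 (fuel m suffices)
vpAux : ℕ → ℕ → ℕ → ℕ
vpAux zero     p             m = 0
vpAux (suc f)  zero          m = 0
vpAux (suc f)  (suc zero)    m = 0
vpAux (suc f)  (suc (suc k)) zero = 0
vpAux (suc f)  (suc (suc k)) (suc m) with (suc m) % suc (suc k) ℕ.≟ 0
... | yes _ = suc (vpAux f (suc (suc k)) (suc m / suc (suc k)))
... | no  _ = 0

-- v_p on positive naturals (value on 0 is irrelevant and never used)
vpℕ : ℕ → ℕ → ℕ
vpℕ p m = vpAux m p m

data ℤ∞ : Set where
  fin : ℤ → ℤ∞
  ∞   : ℤ∞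

data _≤∞_ : ℤ∞ → ℤ∞ → Set where
  fin≤fin : ∀ {a b} → a ℤ.≤ b → fin a ≤∞ fin b
  _≤∞∞    : ∀ x → x ≤∞ ∞

vpℚ : ℕ → ℚ → ℤ∞
vpℚ p (mkℚ (+ zero) _ _) = ∞
vpℚ p (mkℚ a d-1 _) = fin (+ vpℕ p ℤ.∣ a ∣ ℤ.- + vpℕ p (suc d-1))

IsPrimePower : ℕ → Set
IsPrimePower q = Σ ℕ λ ℓ → Σ ℕ λ e → Prime ℓ × 1 ≤ e × q ≡ ℓ ^ e

IsMultOrder : ℕ → ℕ → ℕ → Set
IsMultOrder p q d =
  1 ≤ d × p ∣ (q ^ d ∸ 1) × (∀ e → 1 ≤ e → e < d → ¬ (p ∣ (q ^ e ∸ 1)))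

sum1 : ℕ → (ℕ → ℕ) → ℕ
sum1 zero    f = 0
sum1 (suc r) f = sum1 r f ℕ.+ f (suc r)

lam : (p q d : ℕ) → ℕ → ℕ
lam p q d i = vpℕ p (q ^ (d ℕ.* p ^ i) ∸ 1)

cc : (r : ℕ) (k : ℕ → ℕ) → ℕ → ℕ
cc r k i = sum1 r (λ j → ℕ._⊓_ i j ℕ.* k j)

bb : (p q d r : ℕ) (k : ℕ → ℕ) → ℕ → ℤ
bb p q d r k i = (+ cc r k (lam p q d i) ℤ.- + lam p q d i) ℤ.- + i

objective : (p q d r : ℕ) (k : ℕ → ℕ) → ℕ → ℚ
objective p q d r k i =
  (divℤ (bb p q d r k i) (+ 1) ℚ.- divℤ (+ 1) (+ (p ∸ 1))) ℚ.* divℤ (+ 1) (+ (p ^ i))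

IsLeastMinimizer : (ℕ → ℚ) → ℕ → Set
IsLeastMinimizer f l = (∀ i → f l ℚ.≤ f i) × (∀ i → i < l → f l ℚ.< f i)

record FiniteField : Set₁ where
  field
    Carrier  : Set
    _+_ _*_  : Carrier → Carrier → Carrier
    -_       : Carrier → Carrier
    0# 1#    : Carrier
    isCommutativeRing : IsCommutativeRing _≡_ _+_ _*_ -_ 0# 1#
    0≢1      : 0# ≢ 1#
    inverse  : ∀ x → x ≢ 0# → ∃ λ y → x * y ≡ 1#
    _≟_      : DecidableEquality Carrier
    elements : List Carrier
    complete : ∀ x → x ∈ elements
    unique   : Unique elements

  size : ℕ
  size = length elements

module Matrices (K : FiniteField) where
  open FiniteField K

  Mat : ℕ → Set
  Mat n = Vec (Vec Carrier n) n

  _≟M_ : ∀ {n} → DecidableEquality (Mat n)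
  _≟M_ = VecP.≡-dec (VecP.≡-dec _≟_)

  allVecs : {A : Set} → List A → (m : ℕ) → List (Vec A m)
  allVecs xs zero    = [ [] ]
  allVecs xs (suc m) = concatMap (λ x → List.map (x ∷_) (allVecs xs m)) xs

  allMats : (n : ℕ) → List (Mat n)
  allMats n = allVecs (allVecs elements n) n

  sumK : ∀ {m} → Vec Carrier m → Carrier
  sumK = Vec.foldr _ _+_ 0#

  _·_ : ∀ {n} → Mat n → Mat n → Mat n
  A · B = Vec.map (λ row → Vec.map (λ col → sumK (Vec.zipWith _*_ row col)) (Vec.transpose B)) A

  idM : ∀ {n} → Mat n
  idM {n} = Vec.tabulate (λ i → Vec.tabulate (λ j → δ i j))
    where
    δ : Fin n → Fin n → Carrier
    δ i j with i Data.Fin.≟ j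
    ... | yes _ = 1#
    ... | no  _ = 0#

  IsInvertible : ∀ {n} → Mat n → Set
  IsInvertible {n} A = Any (λ B → (A · B ≡ idM) × (B · A ≡ idM)) (allMats n)

  isInvertible? : ∀ {n} (A : Mat n) → Dec (IsInvertible A)
  isInvertible? {n} A = any? (λ B → ((A · B) ≟M idM) ×-dec ((B · A) ≟M idM)) (allMats n)

-- The finite abelian group G = ∏_{j=1}^r C_{p^j}^{k_j}, as tuples of residues

cyclicOrders : (p r : ℕ) (k : ℕ → ℕ) → List ℕ
cyclicOrders p zero    k = []
cyclicOrders p (suc r) k = cyclicOrders p r k List.++ replicate (k (suc r)) (p ^ suc r)

-- elements of ∏ C_{m_t}: lists of residues a_t ∈ {0, …, m_t - 1}
groupElems : List ℕ → List (List ℕ)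
groupElems []       = [ [] ]
groupElems (m ∷ ms) = concatMap (λ a → List.map (a ∷_) (groupElems ms)) (upTo m)

groupMul : List ℕ → List ℕ → List ℕ → List ℕ
groupMul []       _        _        = []
groupMul (m ∷ ms) []       _        = []
groupMul (m ∷ ms) (_ ∷ _)  []       = []
groupMul (m ∷ ms) (a ∷ as) (b ∷ bs) = divmod m (a ℕ.+ b) ∷ groupMul ms as bs
  where
  divmod : ℕ → ℕ → ℕ
  divmod zero    x = x
  divmod (suc m) x = x % suc m

module HomCount (K : FiniteField) where
  open FiniteField K
  open Matrices K

  -- a candidate map G → Mat n, as a table of (element, image) pairs
  Table : ℕ → Set
  Table n = List (List ℕ × Mat n)

  -- evaluate a table at g (the default is never used for g ∈ G)
  eval : ∀ {n} → Table n → List ℕ → Mat n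
  eval []              g = idM
  eval ((h , A) ∷ tbl) g with ListP.≡-dec ℕ._≟_ h g
  ... | yes _ = A
  ... | no  _ = eval tbl g

  allMaps : (ms : List ℕ) (n : ℕ) → List (Table n)
  allMaps ms n = List.map (λ v → List.zip (groupElems ms) (Vec.toList v))
                          (allVecs (allMats n) (length (groupElems ms)))

  IsHom : (ms : List ℕ) {n : ℕ} → Table n → Set
  IsHom ms f =
    All (λ g → IsInvertible (eval f g)) (groupElems ms) ×
    All (λ g → All (λ h → eval f (groupMul ms g h) ≡ eval f g · eval f h)
                   (groupElems ms)) (groupElems ms)

  isHom? : (ms : List ℕ) {n : ℕ} (f : Table n) → Dec (IsHom ms f)
  isHom? ms f =
    all? (λ g → isInvertible? (eval f g)) (groupElems ms) ×-dec
    all? (λ g → all? (λ h → eval f (groupMul ms g h) ≟M (eval f g · eval f h))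
                     (groupElems ms)) (groupElems ms)

  numHom : List ℕ → ℕ → ℕ
  numHom ms n = length (filter (isHom? ms) (allMaps ms n))

qPoch : ℕ → ℕ → ℤ
qPoch q zero    = + 1
qPoch q (suc n) = qPoch q n ℤ.* (+ 1 ℤ.- + (q ^ suc n))

coeffF : (K : FiniteField) → List ℕ → ℕ → ℚ
coeffF K ms n =
  divℤ (sgn n ℤ.* + HomCount.numHom K ms n)
       (+ (q ^ (n C 2)) ℤ.* qPoch q n)
  where
  q = FiniteField.size K
  sgn : ℕ → ℤ
  sgn zero    = + 1
  sgn (suc m) = ℤ.- sgn m

{-# OPTIONS --safe #-}
-- Put E_Q(z) = Σ zⁿ/|GLₙ(𝔽_Q)|. Sorting the representations of G over 𝔽_q by isomorphism type gives, up to signs,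
-- F = ∏_S E_{q^{d_S}}(z^{d_S}) over the simple 𝔽_q[G]-modules S. If p^a is the exponent of the image of G on S, then
-- d_S is the order of q modulo p^a, so 1 or d pⁱ with i least such that λᵢ ≥ a, and the d_S with a ≤ b add up to p^{c_b}.
-- For C_{p^N} over the field with q^{d pⁱ} elements (with q elements if i = −1) one obtains likewise a series Jᵢ, whose
-- coefficients are p-integral by Frobenius' theorem on the number of solutions of x^{p^N} = 1 in a finite group.
-- Comparing logarithmic derivatives, F^d = J₋₁^d J₀⁻¹ ∏_{i ≥ 0} Jᵢ^{p^{bᵢ}} Jᵢ₊₁^{−p^{bᵢ − 1}} to any given degree if N is
-- large, where Jᵢ is taken at z^{d pⁱ}. The binomial series bounds the denominators of the p-power roots that occur, and
-- the choice of l (which forces b_l ≤ 0) makes all of these bounds at most |b_l| T + v_p(T!) for T = ⌊n/(d p^l)⌋. This is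
-- superadditive in n, so the bound is inherited by products, quotients and, since p ∤ d, d-th roots.
module Submission where

open import Algebra.Bundles using (CommutativeRing; AbelianGroup)
import Algebra.Properties.Group as GroupP
import Algebra.Solver.Ring.NaturalCoefficients.Default as NaturalSolver
open import Algebra.Structures using (IsCommutativeRing; IsAbelianGroup)
open import Data.Bool using (Bool; true; false)
import Data.Bool.Properties as Boolₚ
open import Data.Empty using (⊥-elim; ⊥)
open import Data.Fin as Fin using (Fin; zero; suc; toℕ; fromℕ; inject₁; punchIn; fromℕ<)
open import Data.Fin.Permutation using (↔⇒≡; Permutation; _⟨$⟩ʳ_)
import Data.Fin.Properties as Finₚ
import Data.Integer.Tactic.RingSolver as ℤSolver
open import Data.List as List using (List; []; _∷_; length; filter; _++_; replicate; concatMap; cartesianProductWith; upTo; allFin)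
open import Data.List.Membership.Propositional using (_∈_; lose; _∉_)
open import Data.List.Membership.Propositional.Properties using (∈-filter⁺; ∈-filter⁻; ∈-lookup; ∈-cartesianProductWith⁺; ∈-tabulate⁺; ∈-upTo⁺; ∈-upTo⁻; ∈-cartesianProductWith⁻; ∈-map⁺; ∈-map⁻; ∈-++⁺ˡ; ∈-++⁺ʳ; ∈-++⁻)
import Data.List.Properties as Listₚ
open import Data.List.Relation.Unary.All as All using (All; []; _∷_)
import Data.List.Relation.Unary.All.Properties as Allₚ
open import Data.List.Relation.Unary.AllPairs using ([]; _∷_; AllPairs)
import Data.List.Relation.Unary.AllPairs.Properties as AllPairsₚ
open import Data.List.Relation.Unary.Any using (index; here; satisfied; there)
open import Data.List.Relation.Unary.Any.Properties using (lookup-index)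
open import Data.List.Relation.Unary.Unique.Propositional using (Unique)
import Data.List.Relation.Unary.Unique.Propositional.Properties as Uniqueₚ
open import Data.Nat.Combinatorics using (nCk+nC[k+1]≡[n+1]C[k+1]; nCn≡1; k>n⇒nCk≡0; k![n∸k]!∣n!; nC1≡n)
open import Data.Nat.Coprimality using (Coprime; coprime-divisor)
open import Data.Nat.DivMod as DivMod using (m≡m%n+[m/n]*n; m%n<n; %-distribˡ-*; m%n%n≡m%n; m<n⇒m%n≡m; m/n<m; m*n/n≡m; /-monoˡ-≤; m/n*n≤m; m*n/m*o≡n/o)
open import Data.Nat.Divisibility using (_∣_; divides; ∣⇒≤; m∣m*n; ∣-trans; ∣-refl; ∣1⇒≡1; _∣?_; ∣m+n∣m⇒∣n; n∣m*n; *-cancelˡ-∣; ∣m⇒∣m*n; ∣m∣n⇒∣m+n; ∣n⇒∣m*n; _∣0; 1∣_; m%n≡0⇒n∣m; n∣m⇒m%n≡0)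
open import Data.Nat.GCD using (gcd; gcd[m,n]∣m; gcd[m,n]∣n; gcd-GCD; module Bézout)
open import Data.Nat.Induction using (<-wellFounded)
open import Data.Nat.Primality using (Prime; euclidsLemma; prime⇒nonZero; prime⇒irreducible; prime⇒nonTrivial)
open import Data.Nat.Tactic.RingSolver using (solve-∀)
open import Data.Product using (Σ; _×_; _,_; proj₁; proj₂; ∃)
open import Data.Product.Function.NonDependent.Propositional using (_×-↔_)
open import Data.Rational as ℚ using (ℚ; toℚᵘ; mkℚ)
import Data.Rational.Properties as ℚₚ
open import Data.Rational.Unnormalised as ℚᵘ using (mkℚᵘ; *≡*; ℚᵘ; *≤*; *<*)
import Data.Rational.Unnormalised.Properties as ℚᵘₚ
open import Data.Sign as Sign using (Sign)
import Data.Sign.Properties as Signₚ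
open import Data.Sum using (_⊎_; inj₁; inj₂)
open import Data.Sum.Function.Propositional using (_⊎-↔_)
open import Data.Unit using (⊤; tt)
open import Data.Vec as Vec using (Vec; []; _∷_; tabulate)
import Data.Vec.Properties as Vecₚ
open import Function using (_∘_)
open import Function.Bundles using (_↔_; Inverse; mk↔ₛ′)
open import Function.Properties.Inverse using (↔-refl; ↔-sym; ↔-trans)
open import Induction.WellFounded using (Acc; acc)
open import Relation.Binary.Definitions using (DecidableEquality; tri<; tri≈; tri>)
open import Relation.Nullary using (¬_; Dec; yes; no)
open import Relation.Nullary.Decidable using (True; toWitness; fromWitness; map′; ¬?; _×-dec_)
open import Relation.Binary.PropositionalEquality hiding (J)

-- The coefficients of the series `E` have large `p`-denominators, while Frobenius' theorem makes
-- those of the `J` integral; the task is to express `F` through the latter. Let `ε b` be the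
-- logarithmic derivative of the `E` of level `b`, divided by the degree of that level. What is
-- known about the simple modules are accumulated degrees: `p^(C b)` for the given group, `p^(Λ b)`
-- for a large cyclic group. So everything is written as an Abel sum. `F` gives
-- `∑ p^(C b) (ε b − ε (b+1))`, and a cyclic group over the field of level `e` gives
-- `η e = ∑_(b ≥ e) p^(Λ b) (ε b − ε (b+1))`. Now `η e − η (e+1)` isolates one difference, and this
-- eliminates the `ε`. The power `F^d` arises because the logarithmic derivative of the `J` of
-- degree `d p^i` is `d p^i · η`. Only degrees up to the given `n` are considered, which permits a
-- cyclic group of finite order. Of the fields only `K` is given; its extensions are found inside
-- group algebras. The estimates below `l` must allow for `p = 2`, where `λ` can jump by more than 1
-- at the start.

module Nat where
  open import Data.Nat public
  open import Data.Nat.Properties public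
open Nat using (ℕ; zero; suc; _≤_; _<_; z≤n; s≤s; _∸_; _⊓_; NonZero)
module Int where
  open import Data.Integer public
  open import Data.Integer.Properties public
open Int using (ℤ; -[1+_]; +[1+_]; _◃_)

-- Finite sets and counting by bijections

module Counting where
 open Nat using (_+_; _*_; _^_)
 open import Data.List using (lookup)
 open import Algebra.Properties.CommutativeMonoid.Sum Nat.+-0-commutativeMonoid using (sum; sum-cong-≗; sum-permute)

 uip : ∀ {a} {A : Set a} {x y : A} (p q : x ≡ y) → p ≡ q
 uip refl refl = refl

 IsProp : Set → Set
 IsProp P = (a b : P) → a ≡ b

 Σ-prop-≡ : {X : Set} {P : X → Set} → (∀ x → IsProp (P x)) →
            {s t : Σ X P} → proj₁ s ≡ proj₁ t → s ≡ t
 Σ-prop-≡ pr {x , a} {.x , b} refl = cong (x ,_) (pr x a b)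

 True-prop : {P : Set} (d : Dec P) → IsProp (True d)
 True-prop (yes _) tt tt = refl

 -- An explicit bijection with `Fin card`: it makes search decidable and reduces equalities of
 -- cardinalities to bijections.
 record Finite (X : Set) : Set where
   constructor finite
   field
     card : ℕ
     iso  : X ↔ Fin card
   open Inverse iso public using () renaming (to to idx; from to enum)

   idx-enum : ∀ i → idx (enum i) ≡ i
   idx-enum = Inverse.strictlyInverseˡ iso

   enum-idx : ∀ x → enum (idx x) ≡ x
   enum-idx = Inverse.strictlyInverseʳ iso

   idx-injective : ∀ {x y} → idx x ≡ idx y → x ≡ y
   idx-injective {x} {y} e = trans (sym (enum-idx x)) (trans (cong enum e) (enum-idx y))

   _≟ᶠ_ : DecidableEquality X
   x ≟ᶠ y = map′ idx-injective (cong idx) (idx x Fin.≟ idx y)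

   any? : {P : X → Set} → (∀ x → Dec (P x)) → Dec (Σ X P)
   any? {P} P? = map′ (λ (i , p) → enum i , p) (λ (x , p) → idx x , subst P (sym (enum-idx x)) p)
                      (Finₚ.any? (λ i → P? (enum i)))

   all? : {P : X → Set} → (∀ x → Dec (P x)) → Dec (∀ x → P x)
   all? {P} P? = map′ (λ f x → subst P (enum-idx x) (f (idx x))) (λ f i → f (enum i))
                      (Finₚ.all? (λ i → P? (enum i)))

 open Finite using (card; iso) public

 ∑ : {X : Set} → Finite X → (X → ℕ) → ℕ
 ∑ F f = sum (λ i → f (Finite.enum F i))

 finite-↔ : {X Y : Set} → X ↔ Y → Finite Y → Finite X
 finite-↔ e F = finite (card F) (↔-trans e (iso F))

 card-cong : {X Y : Set} (F : Finite X) (G : Finite Y) → X ↔ Y → card F ≡ card G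
 card-cong F G e = ↔⇒≡ (↔-trans (↔-sym (iso F)) (↔-trans e (iso G)))

 injective⇒card≤ : {X Y : Set} (F : Finite X) (G : Finite Y) (f : X → Y) →
                   (∀ {x y} → f x ≡ f y → x ≡ y) → card F ≤ card G
 injective⇒card≤ F G f inj = Finₚ.injective⇒≤ {f = λ i → Finite.idx G (f (Finite.enum F i))}
   (λ e → trans (sym (Finite.idx-enum F _))
      (trans (cong (Finite.idx F) (inj (Finite.idx-injective G e))) (Finite.idx-enum F _)))

 -- A missed point `y` would extend `f` to an injection defined on one point more than `Y` has.
 injective⇒surjective : {X Y : Set} (F : Finite X) (G : Finite Y) (f : X → Y) →
                        (∀ {x y} → f x ≡ f y → x ≡ y) → card F ≡ card G → ∀ y → Σ X (λ x → f x ≡ y)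
 injective⇒surjective {X} {Y} F G f inj e y with Finite.any? F (λ x → Finite._≟ᶠ_ G (f x) y)
 ... | yes p = p
 ... | no np = ⊥-elim (Nat.<-irrefl e (Finₚ.injective⇒≤ {f = g} g-inj))
   where
   g : Fin (suc (card F)) → Fin (card G)
   g zero    = Finite.idx G y
   g (suc i) = Finite.idx G (f (Finite.enum F i))
   g-inj : ∀ {i j} → g i ≡ g j → i ≡ j
   g-inj {zero}  {zero}  _ = refl
   g-inj {zero}  {suc j} h = ⊥-elim (np (_ , sym (Finite.idx-injective G h)))
   g-inj {suc i} {zero}  h = ⊥-elim (np (_ , Finite.idx-injective G h))
   g-inj {suc i} {suc j} h = cong suc (trans (sym (Finite.idx-enum F _))
      (trans (cong (Finite.idx F) (inj (Finite.idx-injective G h))) (Finite.idx-enum F _)))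

 bijective⇒↔ : {X Y : Set} (f : X → Y) → (∀ {x y} → f x ≡ f y → x ≡ y) →
               (∀ y → Σ X (λ x → f x ≡ y)) → X ↔ Y
 bijective⇒↔ f inj sur = mk↔ₛ′ f (λ y → proj₁ (sur y)) (λ y → proj₂ (sur y))
                               (λ x → inj (proj₂ (sur (f x))))

 finite-Fin : ∀ n → Finite (Fin n)
 finite-Fin n = finite n ↔-refl

 finite-⊤ : Finite ⊤
 finite-⊤ = finite 1 (↔-sym Finₚ.1↔⊤)

 finite-⊎ : {X Y : Set} → Finite X → Finite Y → Finite (X ⊎ Y)
 finite-⊎ F G = finite (card F + card G) (↔-trans (iso F ⊎-↔ iso G) (↔-sym Finₚ.+↔⊎))

 finite-× : {X Y : Set} → Finite X → Finite Y → Finite (X × Y)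
 finite-× F G = finite (card F * card G) (↔-trans (iso F ×-↔ iso G) (↔-sym Finₚ.*↔×))

 Σ-Fin-↔ : ∀ n (Y : Fin n → Set) (f : Fin n → ℕ) → (∀ i → Y i ↔ Fin (f i)) →
           Σ (Fin n) Y ↔ Fin (sum f)
 Σ-Fin-↔ zero    Y f h = mk↔ₛ′ (λ ()) (λ ()) (λ ()) (λ ())
 Σ-Fin-↔ (suc n) Y f h = ↔-trans split
   (↔-trans (h zero ⊎-↔ Σ-Fin-↔ n (Y ∘ suc) (f ∘ suc) (h ∘ suc)) (↔-sym Finₚ.+↔⊎))
   where
   split : Σ (Fin (suc n)) Y ↔ (Y zero ⊎ Σ (Fin n) (Y ∘ suc))
   split = mk↔ₛ′ (λ { (zero , y) → inj₁ y ; (suc i , y) → inj₂ (i , y) })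
                 (λ { (inj₁ y) → zero , y ; (inj₂ (i , y)) → suc i , y })
                 (λ { (inj₁ y) → refl ; (inj₂ (i , y)) → refl })
                 (λ { (zero , y) → refl ; (suc i , y) → refl })

 finite-Σ : {X : Set} {Y : X → Set} → Finite X → (∀ x → Finite (Y x)) → Finite (Σ X Y)
 finite-Σ {X} {Y} F G = finite (∑ F (λ x → card (G x))) (↔-trans reindex (Σ-Fin-↔ _ _ _ (λ i → iso (G (Finite.enum F i)))))
   where
   open Finite F
   reindex : Σ X Y ↔ Σ (Fin (card F)) (λ i → Y (enum i))
   reindex = mk↔ₛ′ (λ (x , y) → idx x , subst Y (sym (enum-idx x)) y)
                   (λ (i , y) → enum i , y)
                   (λ (i , y) → lem i (enum i) y (idx-enum i) (enum-idx (enum i)))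
                   (λ (x , y) → lem₂ (enum-idx x))
     where
     lem : ∀ i x (y : Y x) → idx x ≡ i → (e : enum (idx x) ≡ x) → {e′ : x ≡ enum i} →
           (idx x , subst Y (sym e) y) ≡ (i , subst Y e′ y)
     lem .(idx x) x y refl e {e′} with uip (sym e) e′
     ... | refl = refl
     lem₂ : ∀ {x x′ y} (e : x′ ≡ x) → (x′ , subst Y (sym e) y) ≡ (x , y)
     lem₂ refl = refl

 finite-Dec : {P : Set} → IsProp P → Dec P → Finite P
 finite-Dec pr (yes p) = finite 1 (mk↔ₛ′ (λ _ → zero) (λ _ → p) (λ { zero → refl }) (λ q → pr p q))
 finite-Dec pr (no np) = finite 0 (mk↔ₛ′ (λ p → ⊥-elim (np p)) (λ ()) (λ ()) (λ p → ⊥-elim (np p)))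

 finite-sub : {X : Set} {P : X → Set} → Finite X → (∀ x → IsProp (P x)) → (∀ x → Dec (P x)) → Finite (Σ X P)
 finite-sub F pr P? = finite-Σ F (λ x → finite-Dec (pr x) (P? x))

 finite-Vec : {X : Set} → Finite X → ∀ n → Finite (Vec X n)
 finite-Vec F zero    = finite 1 (mk↔ₛ′ (λ _ → zero) (λ _ → []) (λ { zero → refl }) (λ { [] → refl }))
 finite-Vec F (suc n) = finite-↔ (mk↔ₛ′ (λ { (x ∷ v) → x , v }) (λ (x , v) → x ∷ v)
                                        (λ _ → refl) (λ { (x ∷ v) → refl }))
                                 (finite-× F (finite-Vec F n))

 card-Vec : {X : Set} (F : Finite X) → ∀ n → card (finite-Vec F n) ≡ card F ^ n
 card-Vec F zero    = refl
 card-Vec F (suc n) = cong (card F *_) (card-Vec F n)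

 ∑-cong : {X : Set} (F : Finite X) {f g : X → ℕ} → (∀ x → f x ≡ g x) → ∑ F f ≡ ∑ F g
 ∑-cong F h = sum-cong-≗ (λ i → h (Finite.enum F i))

 ∑-const : {X : Set} (F : Finite X) (c : ℕ) → ∑ F (λ _ → c) ≡ card F * c
 ∑-const F c = go (card F)
   where
   go : ∀ n → sum {n} (λ _ → c) ≡ n * c
   go zero    = refl
   go (suc n) = cong (c +_) (go n)

 card-complement : {X : Set} {P : X → Set} (F : Finite X) (pr : ∀ x → IsProp (P x)) (P? : ∀ x → Dec (P x))
                   (G : Finite (Σ X P)) (H : Finite (Σ X (λ x → ¬ P x))) → card F ≡ card G + card H
 card-complement {X} {P} F pr P? G H = card-cong F (finite-⊎ G H) (mk↔ₛ′ to from to-from from-to)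
   where
   np-prop : ∀ x → IsProp (¬ P x)
   np-prop x a b = refl
   to : X → Σ X P ⊎ Σ X (λ x → ¬ P x)
   to x with P? x
   ... | yes p = inj₁ (x , p)
   ... | no np = inj₂ (x , np)
   from : Σ X P ⊎ Σ X (λ x → ¬ P x) → X
   from (inj₁ (x , _)) = x
   from (inj₂ (x , _)) = x
   to-from : ∀ s → to (from s) ≡ s
   to-from (inj₁ (x , p)) with P? x
   ... | yes q = cong (λ z → inj₁ (x , z)) (pr x q p)
   ... | no nq = ⊥-elim (nq p)
   to-from (inj₂ (x , np)) with P? x
   ... | yes q = ⊥-elim (np q)
   ... | no nq = cong (λ z → inj₂ (x , z)) (np-prop x nq np)
   from-to : ∀ x → from (to x) ≡ x
   from-to x with P? x
   ... | yes _ = refl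
   ... | no _ = refl

 ¬-prop : {P : Set} → IsProp (¬ P)
 ¬-prop a b = refl

 lookup-unique : {X : Set} {xs : List X} → Unique xs → ∀ {i j} → lookup xs i ≡ lookup xs j → i ≡ j
 lookup-unique (px ∷ u) {zero}  {zero}  e = refl
 lookup-unique {xs = x ∷ xs} (px ∷ u) {zero}  {suc j} e = ⊥-elim (All.lookup px (∈-lookup j) e)
 lookup-unique {xs = x ∷ xs} (px ∷ u) {suc i} {zero}  e = ⊥-elim (All.lookup px (∈-lookup i) (sym e))
 lookup-unique (px ∷ u) {suc i} {suc j} e = cong suc (lookup-unique u e)

 finite-List : {X : Set} {P : X → Set} (xs : List X) → Unique xs → (∀ x → IsProp (P x)) →
               (∀ {x} → x ∈ xs → P x) → (∀ {x} → P x → x ∈ xs) → Finite (Σ X P)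
 finite-List {X} {P} xs u pr sound complete = finite (length xs) (mk↔ₛ′
   (λ (x , p) → index (complete p))
   (λ i → lookup xs i , sound (∈-lookup i))
   (λ i → lookup-unique u (sym (lookup-index (complete (sound (∈-lookup i))))))
   (λ (x , p) → Σ-prop-≡ pr (sym (lookup-index (complete p)))))

 finite-List-all : {X : Set} (xs : List X) → Unique xs → (∀ x → x ∈ xs) → Finite X
 finite-List-all xs u complete = finite (length xs) (mk↔ₛ′
   (λ x → index (complete x)) (lookup xs)
   (λ i → lookup-unique u (sym (lookup-index (complete _))))
   (λ x → sym (lookup-index (complete x))))

 -- The cardinality is by construction the length of the filtered list, which is the form in which
 -- `numHom` counts.
 finite-filter : {X : Set} {P : X → Set} (P? : ∀ x → Dec (P x)) (xs : List X) → Unique xs → (∀ x → x ∈ xs) →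
                 Finite (Σ X (λ x → True (P? x)))
 finite-filter {X} {P} P? xs u complete = finite-List (filter P? xs) (Uniqueₚ.filter⁺ P? u)
   (λ x → True-prop (P? x))
   (λ {x} m → fromWitness (proj₂ (∈-filter⁻ P? {xs = xs} m)))
   (λ {x} t → ∈-filter⁺ P? (complete x) (toWitness t))

-- Finite commutative rings, modules and linear maps

module Rings where
 open import Defs using (FiniteField; module Matrices)
 open Counting
 open import Level using (0ℓ)
 open import Data.Vec using (lookup)

 vec-ext : {X : Set} {n : ℕ} {u v : Vec X n} → (∀ i → lookup u i ≡ lookup v i) → u ≡ v
 vec-ext {u = u} {v} h = trans (sym (Vecₚ.tabulate∘lookup u)) (trans (Vecₚ.tabulate-cong h) (Vecₚ.tabulate∘lookup v))

 record CRing : Set₁ where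
   infixl 6 _⊕_
   infixl 7 _⊗_
   field
     Carrier   : Set
     _⊕_ _⊗_   : Carrier → Carrier → Carrier
     ⊖_        : Carrier → Carrier
     𝟘 𝟙       : Carrier
     isCommutativeRing : IsCommutativeRing _≡_ _⊕_ _⊗_ ⊖_ 𝟘 𝟙
     finiteC   : Finite Carrier

   commutativeRing : CommutativeRing 0ℓ 0ℓ
   commutativeRing = record { isCommutativeRing = isCommutativeRing }

   open CommutativeRing commutativeRing public
     using (+-assoc; +-comm; +-identityˡ; +-identityʳ; -‿inverseˡ; -‿inverseʳ; distribˡ; distribʳ;
            *-assoc; *-comm; *-identityˡ; *-identityʳ; zeroˡ; zeroʳ; semiring; commutativeSemiring;
            ring; +-abelianGroup; +-group)
   open import Algebra.Properties.Semiring.Sum semiring public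
   open import Algebra.Properties.Semiring.Exp semiring public using (_^_; ^-homo-*; ^-assocʳ)
   open import Algebra.Properties.CommutativeSemiring.Exp commutativeSemiring public using (^-distrib-*)

   _≟_ : (x y : Carrier) → Dec (x ≡ y)
   _≟_ = Finite._≟ᶠ_ finiteC

 fieldRing : FiniteField → CRing
 fieldRing K = record
   { isCommutativeRing = isCommutativeRing ; finiteC = finite-List-all elements unique complete }
   where open FiniteField K

 record Module (A : CRing) : Set₁ where
   open CRing A using (_⊕_; _⊗_; 𝟙; 𝟘; ⊖_) renaming (Carrier to R)
   infixl 6 _+ᵥ_
   infixr 7 _·_
   field
     V      : Set
     _+ᵥ_   : V → V → V
     0ᵥ     : V
     -ᵥ_    : V → V
     _·_    : R → V → V
     isAbelianGroup : IsAbelianGroup _≡_ _+ᵥ_ 0ᵥ -ᵥ_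
     ·-distribˡ : ∀ a u v → a · (u +ᵥ v) ≡ a · u +ᵥ a · v
     ·-distribʳ : ∀ a b v → (a ⊕ b) · v ≡ a · v +ᵥ b · v
     ·-assoc    : ∀ a b v → (a ⊗ b) · v ≡ a · (b · v)
     ·-identity : ∀ v → 𝟙 · v ≡ v
     finiteV : Finite V

   abelianGroup : AbelianGroup 0ℓ 0ℓ
   abelianGroup = record { isAbelianGroup = isAbelianGroup }

   open AbelianGroup abelianGroup public
     using () renaming (assoc to +ᵥ-assoc; comm to +ᵥ-comm; identityˡ to +ᵥ-identityˡ; identityʳ to +ᵥ-identityʳ;
            inverseˡ to -ᵥ-inverseˡ; inverseʳ to -ᵥ-inverseʳ; commutativeMonoid to +ᵥ-commutativeMonoid; group to +ᵥ-group)
   open import Algebra.Properties.CommutativeMonoid.Sum +ᵥ-commutativeMonoid public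
     using () renaming (sum to sumᵥ; sum-cong-≗ to sumᵥ-cong; ∑-distrib-+ to sumᵥ-+; ∑-comm to sumᵥ-comm; sum-permute to sumᵥ-permute; sum-replicate-zero to sumᵥ-zero)
   open import Algebra.Properties.Group +ᵥ-group public
     using () renaming (∙-cancelˡ to +ᵥ-cancelˡ; ∙-cancelʳ to +ᵥ-cancelʳ; inverseˡ-unique to -ᵥ-unique)

   _≟ᵥ_ : (x y : V) → Dec (x ≡ y)
   _≟ᵥ_ = Finite._≟ᶠ_ finiteV

   ·-zeroˡ : ∀ v → 𝟘 · v ≡ 0ᵥ
   ·-zeroˡ v = +ᵥ-cancelˡ (𝟘 · v) _ _ (trans (sym (·-distribʳ 𝟘 𝟘 v))
                 (trans (cong (_· v) (CRing.+-identityˡ A 𝟘)) (sym (+ᵥ-identityʳ _))))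

   ·-zeroʳ : ∀ a → a · 0ᵥ ≡ 0ᵥ
   ·-zeroʳ a = +ᵥ-cancelˡ (a · 0ᵥ) _ _ (trans (sym (·-distribˡ a 0ᵥ 0ᵥ))
                 (trans (cong (a ·_) (+ᵥ-identityˡ 0ᵥ)) (sym (+ᵥ-identityʳ _))))

   ·-neg : ∀ a v → (⊖ a) · v ≡ -ᵥ (a · v)
   ·-neg a v = -ᵥ-unique _ _ (trans (sym (·-distribʳ (⊖ a) a v))
                 (trans (cong (_· v) (CRing.-‿inverseˡ A a)) (·-zeroˡ v)))

   ·-sum : ∀ {n} a (f : Fin n → V) → a · sumᵥ f ≡ sumᵥ (λ i → a · f i)
   ·-sum {zero}  a f = ·-zeroʳ a
   ·-sum {suc n} a f = trans (·-distribˡ a _ _) (cong (a · f zero +ᵥ_) (·-sum a (f ∘ suc)))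

   sum-· : ∀ {n} (f : Fin n → R) v → CRing.sum A f · v ≡ sumᵥ (λ i → f i · v)
   sum-· {zero}  f v = ·-zeroˡ v
   sum-· {suc n} f v = trans (·-distribʳ _ _ v) (cong (f zero · v +ᵥ_) (sum-· (f ∘ suc) v))

 selfModule : (A : CRing) → Module A
 selfModule A = record
   { V = Carrier ; _+ᵥ_ = _⊕_ ; 0ᵥ = 𝟘 ; -ᵥ_ = ⊖_ ; _·_ = _⊗_
   ; isAbelianGroup = IsCommutativeRing.+-isAbelianGroup isCommutativeRing
   ; ·-distribˡ = distribˡ ; ·-distribʳ = λ a b v → distribʳ v a b ; ·-assoc = *-assoc
   ; ·-identity = *-identityˡ ; finiteV = finiteC }
   where open CRing A

 vecModule : (A : CRing) (n : ℕ) → Module A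
 vecModule A n = record
   { V = Vec Carrier n ; _+ᵥ_ = _+ᵛ_ ; 0ᵥ = Vec.replicate n 𝟘 ; -ᵥ_ = Vec.map ⊖_ ; _·_ = λ a → Vec.map (a ⊗_)
   ; isAbelianGroup = record
     { isGroup = record
       { isMonoid = record
         { isSemigroup = record
           { isMagma = record { isEquivalence = isEquivalence ; ∙-cong = cong₂ _+ᵛ_ }
           ; assoc = Vecₚ.zipWith-assoc +-assoc }
         ; identity = Vecₚ.zipWith-identityˡ +-identityˡ , Vecₚ.zipWith-identityʳ +-identityʳ }
       ; inverse = Vecₚ.zipWith-inverseˡ -‿inverseˡ , Vecₚ.zipWith-inverseʳ -‿inverseʳ
       ; ⁻¹-cong = cong _ }
     ; comm = Vecₚ.zipWith-comm +-comm }
   ; ·-distribˡ = λ a → map-dl a ; ·-distribʳ = map-dr ; ·-assoc = map-assoc ; ·-identity = map-id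
   ; finiteV = finite-Vec finiteC n }
   where
   open CRing A
   _+ᵛ_ : ∀ {m} → Vec Carrier m → Vec Carrier m → Vec Carrier m
   _+ᵛ_ = Vec.zipWith _⊕_
   map-dl : ∀ {m} a (u v : Vec Carrier m) → Vec.map (a ⊗_) (u +ᵛ v) ≡ Vec.map (a ⊗_) u +ᵛ Vec.map (a ⊗_) v
   map-dl a []      []      = refl
   map-dl a (x ∷ u) (y ∷ v) = cong₂ _∷_ (distribˡ a x y) (map-dl a u v)
   map-dr : ∀ {m} a b (v : Vec Carrier m) → Vec.map ((a ⊕ b) ⊗_) v ≡ Vec.map (a ⊗_) v +ᵛ Vec.map (b ⊗_) v
   map-dr a b []      = refl
   map-dr a b (y ∷ v) = cong₂ _∷_ (distribʳ y a b) (map-dr a b v)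
   map-assoc : ∀ {m} a b (v : Vec Carrier m) → Vec.map ((a ⊗ b) ⊗_) v ≡ Vec.map (a ⊗_) (Vec.map (b ⊗_) v)
   map-assoc a b []      = refl
   map-assoc a b (y ∷ v) = cong₂ _∷_ (*-assoc a b y) (map-assoc a b v)
   map-id : ∀ {m} (v : Vec Carrier m) → Vec.map (𝟙 ⊗_) v ≡ v
   map-id []      = refl
   map-id (y ∷ v) = cong₂ _∷_ (*-identityˡ y) (map-id v)

 module LinearMaps (K : FiniteField) where
   open Matrices K
   open CRing (fieldRing K)

   lookup-transpose : ∀ {X : Set} {m n} (M : Vec (Vec X n) m) i j →
                      lookup (lookup (Vec.transpose M) j) i ≡ lookup (lookup M i) j
   lookup-transpose {X} {suc m} {n} (r ∷ M) i j = trans (cong (λ c → lookup c i) step) (go i)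
     where
     cons : X → Vec X m → Vec X (suc m)
     cons = _∷_
     step : lookup (Vec.transpose (r ∷ M)) j ≡ lookup r j ∷ lookup (Vec.transpose M) j
     step = trans (Vecₚ.lookup-⊛ j (Vec.replicate n cons Vec.⊛ r) (Vec.transpose M))
       (cong (λ f → f (lookup (Vec.transpose M) j))
         (trans (Vecₚ.lookup-⊛ j (Vec.replicate n cons) r)
                (cong (λ f → f (lookup r j)) (Vecₚ.lookup-replicate j cons))))
     go : ∀ i → lookup (lookup r j ∷ lookup (Vec.transpose M) j) i ≡ lookup (lookup (r ∷ M) i) j
     go zero    = refl
     go (suc i) = lookup-transpose M i j

   infixl 8 _!_,_
   _!_,_ : ∀ {n} → Mat n → Fin n → Fin n → Carrier
   A ! i , j = lookup (lookup A i) j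

   mat-ext : ∀ {n} {A B : Mat n} → (∀ i j → A ! i , j ≡ B ! i , j) → A ≡ B
   mat-ext h = vec-ext (λ i → vec-ext (h i))

   sumK-zipWith : ∀ {m} (u v : Vec Carrier m) → sumK (Vec.zipWith _⊗_ u v) ≡ sum (λ i → lookup u i ⊗ lookup v i)
   sumK-zipWith []      []      = refl
   sumK-zipWith (x ∷ u) (y ∷ v) = cong (x ⊗ y ⊕_) (sumK-zipWith u v)

   ·-entry : ∀ {n} (A B : Mat n) i j → (A · B) ! i , j ≡ sum (λ k → A ! i , k ⊗ B ! k , j)
   ·-entry A B i j
     rewrite Vecₚ.lookup-map i (λ row → Vec.map (λ col → sumK (Vec.zipWith _⊗_ row col)) (Vec.transpose B)) A
           | Vecₚ.lookup-map j (λ col → sumK (Vec.zipWith _⊗_ (lookup A i) col)) (Vec.transpose B)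
           | sumK-zipWith (lookup A i) (lookup (Vec.transpose B) j)
     = sum-cong-≗ (λ k → cong (A ! i , k ⊗_) (lookup-transpose B k j))

   -- The Kronecker delta in the definition of `idM` is local to it; `idM-entry` identifies that one
   -- with this copy.
   δ : ∀ {n} → Fin n → Fin n → Carrier
   δ i j with i Fin.≟ j
   ... | yes _ = 𝟙
   ... | no  _ = 𝟘

   δ-refl : ∀ {n} (i : Fin n) → δ i i ≡ 𝟙
   δ-refl i with i Fin.≟ i
   ... | yes _ = refl
   ... | no ne = ⊥-elim (ne refl)

   δ-suc : ∀ {n} (i j : Fin n) → δ (suc i) (suc j) ≡ δ i j
   δ-suc i j with i Fin.≟ j
   ... | yes _ = refl
   ... | no  _ = refl

   δ-sum : ∀ {n} (i : Fin n) (f : Fin n → Carrier) → sum (λ k → δ i k ⊗ f k) ≡ f i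
   δ-sum {suc n} zero f = trans (cong₂ _⊕_ (*-identityˡ _)
       (trans (sum-cong-≗ (λ k → zeroˡ (f (suc k)))) (sum-replicate-zero n))) (+-identityʳ _)
   δ-sum {suc n} (suc i) f = trans (cong₂ _⊕_ (zeroˡ _)
       (trans (sum-cong-≗ (λ k → cong (_⊗ f (suc k)) (δ-suc i k))) (δ-sum i (f ∘ suc)))) (+-identityˡ _)

   idM-entry : ∀ {n} (i j : Fin n) → idM ! i , j ≡ δ i j
   -- Unification fills the underscore with the delta local to `idM`; the case distinction on
   -- `i Fin.≟ j` then evaluates both deltas.
   idM-entry {n} i j with i Fin.≟ j | entry idM _ refl i j
     where
     entry : ∀ (M : Mat n) (f : Fin n → Fin n → Carrier) → M ≡ tabulate (λ i → tabulate (f i)) → ∀ i j → M ! i , j ≡ f i j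
     entry _ f refl i j = trans (cong (λ r → lookup r j) (Vecₚ.lookup∘tabulate (λ i → tabulate (f i)) i)) (Vecₚ.lookup∘tabulate (f i) j)
   ... | yes _ | e = e
   ... | no  _ | e = e

   apply : ∀ {n} → Mat n → Vec Carrier n → Vec Carrier n
   apply A v = tabulate (λ i → sum (λ j → A ! i , j ⊗ lookup v j))

   apply-lookup : ∀ {n} (A : Mat n) v i → lookup (apply A v) i ≡ sum (λ j → A ! i , j ⊗ lookup v j)
   apply-lookup A v i = Vecₚ.lookup∘tabulate _ i

   apply-· : ∀ {n} (A B : Mat n) v → apply (A · B) v ≡ apply A (apply B v)
   apply-· A B v = Vecₚ.tabulate-cong (λ i → begin
     sum (λ j → (A · B) ! i , j ⊗ lookup v j)
       ≡⟨ sum-cong-≗ (λ j → trans (cong (_⊗ lookup v j) (·-entry A B i j)) (*-distribʳ-sum (lookup v j) (λ k → A ! i , k ⊗ B ! k , j))) ⟩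
     sum (λ j → sum (λ k → A ! i , k ⊗ B ! k , j ⊗ lookup v j))
       ≡⟨ ∑-comm (λ j k → A ! i , k ⊗ B ! k , j ⊗ lookup v j) ⟩
     sum (λ k → sum (λ j → A ! i , k ⊗ B ! k , j ⊗ lookup v j))
       ≡⟨ sum-cong-≗ (λ k → trans (sum-cong-≗ (λ j → *-assoc (A ! i , k) (B ! k , j) (lookup v j)))
            (trans (sym (*-distribˡ-sum (A ! i , k) (λ j → B ! k , j ⊗ lookup v j))) (cong (A ! i , k ⊗_) (sym (apply-lookup B v k))))) ⟩
     sum (λ k → A ! i , k ⊗ lookup (apply B v) k) ∎)
     where open ≡-Reasoning

   apply-id : ∀ {n} (v : Vec Carrier n) → apply idM v ≡ v
   apply-id v = vec-ext (λ i → trans (apply-lookup idM v i)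
     (trans (sum-cong-≗ (λ j → cong (_⊗ lookup v j) (idM-entry i j))) (δ-sum i (lookup v))))

   basis : ∀ {n} → Fin n → Vec Carrier n
   basis j = tabulate (δ j)

   apply-basis : ∀ {n} (A : Mat n) i j → lookup (apply A (basis j)) i ≡ A ! i , j
   apply-basis A i j = trans (apply-lookup A (basis j) i)
     (trans (sum-cong-≗ (λ k → trans (cong (A ! i , k ⊗_) (Vecₚ.lookup∘tabulate (δ j) k)) (*-comm (A ! i , k) (δ j k))))
            (δ-sum j (λ k → A ! i , k)))

   -- Matrices are compared through their action on vectors, which turns associativity and the unit
   -- laws into facts about composition of maps.
   apply-injective : ∀ {n} {A B : Mat n} → (∀ v → apply A v ≡ apply B v) → A ≡ B
   apply-injective {A = A} {B} h = mat-ext (λ i j →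
     trans (sym (apply-basis A i j)) (trans (cong (λ w → lookup w i) (h (basis j))) (apply-basis B i j)))

   ·-assocM : ∀ {n} (A B C : Mat n) → (A · B) · C ≡ A · (B · C)
   ·-assocM A B C = apply-injective (λ v → trans (apply-· (A · B) C v)
     (trans (apply-· A B (apply C v)) (sym (trans (apply-· A (B · C) v) (cong (apply A) (apply-· B C v))))))

   ·-idˡ : ∀ {n} (A : Mat n) → idM · A ≡ A
   ·-idˡ A = apply-injective (λ v → trans (apply-· idM A v) (apply-id (apply A v)))

   ·-idʳ : ∀ {n} (A : Mat n) → A · idM ≡ A
   ·-idʳ A = apply-injective (λ v → trans (apply-· A idM v) (cong (apply A) (apply-id v)))

   module _ {n : ℕ} where
     open Module (vecModule (fieldRing K) n) renaming (_·_ to _·ᵥ_)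

     private
       lookup-sumᵥ : ∀ {m} (f : Fin m → V) i → lookup (sumᵥ f) i ≡ sum (λ j → lookup (f j) i)
       lookup-sumᵥ {zero}  f i = Vecₚ.lookup-replicate i 𝟘
       lookup-sumᵥ {suc m} f i = trans (Vecₚ.lookup-zipWith _⊕_ i (f zero) _) (cong (lookup (f zero) i ⊕_) (lookup-sumᵥ (f ∘ suc) i))

     decompose : ∀ (v : V) → v ≡ sumᵥ (λ j → lookup v j ·ᵥ basis j)
     decompose v = vec-ext (λ i → sym (trans (lookup-sumᵥ (λ j → lookup v j ·ᵥ basis j) i)
       (trans (sum-cong-≗ (λ j → trans (Vecₚ.lookup-map i (lookup v j ⊗_) (basis j))
           (trans (cong (lookup v j ⊗_) (trans (Vecₚ.lookup∘tabulate (δ j) i) (δ-sym j i))) (*-comm (lookup v j) (δ i j)))))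
         (δ-sum i (lookup v)))))
       where
       δ-sym : ∀ {n} (i j : Fin n) → δ i j ≡ δ j i
       δ-sym i j with i Fin.≟ j | j Fin.≟ i
       ... | yes _ | yes _ = refl
       ... | no  _ | no  _ = refl
       ... | yes e | no ne = ⊥-elim (ne (sym e))
       ... | no ne | yes e = ⊥-elim (ne (sym e))

     apply-+ : ∀ (A : Mat n) u v → apply A (u +ᵥ v) ≡ apply A u +ᵥ apply A v
     apply-+ A u v = vec-ext (λ i → trans (apply-lookup A (u +ᵥ v) i)
       (trans (sum-cong-≗ (λ j → trans (cong (A ! i , j ⊗_) (Vecₚ.lookup-zipWith _⊕_ j u v)) (distribˡ _ _ _)))
       (trans (∑-distrib-+ (λ j → A ! i , j ⊗ lookup u j) (λ j → A ! i , j ⊗ lookup v j))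
       (sym (trans (Vecₚ.lookup-zipWith _⊕_ i (apply A u) (apply A v)) (cong₂ _⊕_ (apply-lookup A u i) (apply-lookup A v i)))))))

     apply-scale : ∀ (A : Mat n) c u → apply A (c ·ᵥ u) ≡ c ·ᵥ apply A u
     apply-scale A c u = vec-ext (λ i → trans (apply-lookup A (c ·ᵥ u) i)
       (trans (sum-cong-≗ (λ j → trans (cong (A ! i , j ⊗_) (Vecₚ.lookup-map j (c ⊗_) u)) (swap (A ! i , j) c (lookup u j))))
       (trans (sym (*-distribˡ-sum c (λ j → A ! i , j ⊗ lookup u j)))
       (sym (trans (Vecₚ.lookup-map i (c ⊗_) (apply A u)) (cong (c ⊗_) (apply-lookup A u i)))))))
       where
       swap : ∀ a b c → a ⊗ (b ⊗ c) ≡ b ⊗ (a ⊗ c)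
       swap a b c = trans (sym (*-assoc a b c)) (trans (cong (_⊗ c) (*-comm a b)) (*-assoc b a c))

     module _ (f : V → V) (f-+ : ∀ u v → f (u +ᵥ v) ≡ f u +ᵥ f v) (f-scale : ∀ c u → f (c ·ᵥ u) ≡ c ·ᵥ f u) where

       f-sum : ∀ {m} (g : Fin m → V) → f (sumᵥ g) ≡ sumᵥ (λ i → f (g i))
       f-sum {zero}  g = trans (cong f (sym (·-zeroˡ 0ᵥ))) (trans (f-scale 𝟘 0ᵥ) (·-zeroˡ _))
       f-sum {suc m} g = trans (f-+ _ _) (cong (f (g zero) +ᵥ_) (f-sum (g ∘ suc)))

       matrix : Mat n
       matrix = tabulate (λ i → tabulate (λ j → lookup (f (basis j)) i))

       apply-matrix : ∀ v → apply matrix v ≡ f v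
       apply-matrix v = vec-ext (λ i → trans (apply-lookup matrix v i) (sym (begin
         lookup (f v) i ≡⟨ cong (λ w → lookup (f w) i) (decompose v) ⟩
         lookup (f (sumᵥ (λ j → lookup v j ·ᵥ basis j))) i ≡⟨ cong (λ w → lookup w i) (f-sum (λ j → lookup v j ·ᵥ basis j)) ⟩
         lookup (sumᵥ (λ j → f (lookup v j ·ᵥ basis j))) i ≡⟨ lookup-sumᵥ (λ j → f (lookup v j ·ᵥ basis j)) i ⟩
         sum (λ j → lookup (f (lookup v j ·ᵥ basis j)) i)
           ≡⟨ sum-cong-≗ (λ j → trans (cong (λ w → lookup w i) (f-scale (lookup v j) (basis j)))
                (trans (Vecₚ.lookup-map i (lookup v j ⊗_) (f (basis j)))
                (trans (*-comm (lookup v j) (lookup (f (basis j)) i))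
                (cong (_⊗ lookup v j) (sym (trans (cong (λ r → lookup r j) (Vecₚ.lookup∘tabulate _ i)) (Vecₚ.lookup∘tabulate _ j))))))) ⟩
         sum (λ j → matrix ! i , j ⊗ lookup v j) ∎)))
         where open ≡-Reasoning

-- Modules over a product of fields: frames and their number

module Frames where
 open Counting
 open Rings

 mkAbelianGroup : {V : Set} (_+_ : V → V → V) (o : V) (-_ : V → V) →
   (∀ a b c → (a + b) + c ≡ a + (b + c)) → (∀ a → o + a ≡ a) → (∀ a → (- a) + a ≡ o) → (∀ a b → a + b ≡ b + a) →
   IsAbelianGroup _≡_ _+_ o -_
 mkAbelianGroup _+_ o -_ as idl invl cm = record
   { isGroup = record
     { isMonoid = record
       { isSemigroup = record
         { isMagma = record { isEquivalence = isEquivalence ; ∙-cong = cong₂ _+_ }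
         ; assoc = as }
       ; identity = idl , λ a → trans (cm a o) (idl a) }
     ; inverse = invl , λ a → trans (cm a (- a)) (invl a)
     ; ⁻¹-cong = cong -_ }
   ; comm = cm }

 module _ {A : CRing} where
   open CRing A using (_⊕_; _⊗_; 𝟙; 𝟘; ⊖_; *-comm; *-assoc) renaming (Carrier to R)

   ⊤Module : Module A
   ⊤Module = record
     { V = ⊤ ; _+ᵥ_ = λ _ _ → tt ; 0ᵥ = tt ; -ᵥ_ = λ _ → tt ; _·_ = λ _ _ → tt
     ; isAbelianGroup = mkAbelianGroup _ _ _ (λ _ _ _ → refl) (λ _ → refl) (λ _ → refl) (λ _ _ → refl)
     ; ·-distribˡ = λ _ _ _ → refl ; ·-distribʳ = λ _ _ _ → refl ; ·-assoc = λ _ _ _ → refl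
     ; ·-identity = λ _ → refl ; finiteV = finite-⊤ }

   infixr 5 _×Module_
   _×Module_ : Module A → Module A → Module A
   M ×Module N = record
     { V = M.V × N.V
     ; _+ᵥ_ = λ (a , b) (c , d) → (a M.+ᵥ c) , (b N.+ᵥ d)
     ; 0ᵥ = M.0ᵥ , N.0ᵥ ; -ᵥ_ = λ (a , b) → (M.-ᵥ a) , (N.-ᵥ b)
     ; _·_ = λ r (a , b) → (r M.· a) , (r N.· b)
     ; isAbelianGroup = mkAbelianGroup _ _ _
         (λ _ _ _ → cong₂ _,_ (M.+ᵥ-assoc _ _ _) (N.+ᵥ-assoc _ _ _))
         (λ _ → cong₂ _,_ (M.+ᵥ-identityˡ _) (N.+ᵥ-identityˡ _))
         (λ _ → cong₂ _,_ (M.-ᵥ-inverseˡ _) (N.-ᵥ-inverseˡ _))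
         (λ _ _ → cong₂ _,_ (M.+ᵥ-comm _ _) (N.+ᵥ-comm _ _))
     ; ·-distribˡ = λ _ _ _ → cong₂ _,_ (M.·-distribˡ _ _ _) (N.·-distribˡ _ _ _)
     ; ·-distribʳ = λ _ _ _ → cong₂ _,_ (M.·-distribʳ _ _ _) (N.·-distribʳ _ _ _)
     ; ·-assoc = λ _ _ _ → cong₂ _,_ (M.·-assoc _ _ _) (N.·-assoc _ _ _)
     ; ·-identity = λ _ → cong₂ _,_ (M.·-identity _) (N.·-identity _)
     ; finiteV = finite-× M.finiteV N.finiteV }
     where module M = Module M
           module N = Module N

   -- The submodule cut out by a property that is closed under the operations.
   subModule : (M : Module A) (P : Module.V M → Set) → (∀ v → IsProp (P v)) → (∀ v → Dec (P v)) →
               P (Module.0ᵥ M) → (∀ {u v} → P u → P v → P (Module._+ᵥ_ M u v)) →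
               (∀ r {v} → P v → P (Module._·_ M r v)) → Module A
   subModule M P pr P? p0 p+ p· = record
     { V = Σ V P
     ; _+ᵥ_ = λ (a , p) (b , q) → (a +ᵥ b) , p+ p q
     ; 0ᵥ = 0ᵥ , p0
     ; -ᵥ_ = λ (a , p) → (-ᵥ a) , subst P (trans (·-neg 𝟙 a) (cong -ᵥ_ (·-identity a))) (p· (⊖ 𝟙) p)
     ; _·_ = λ r (a , p) → (r · a) , p· r p
     ; isAbelianGroup = mkAbelianGroup _ _ _
         (λ _ _ _ → Σ-prop-≡ pr (+ᵥ-assoc _ _ _)) (λ _ → Σ-prop-≡ pr (+ᵥ-identityˡ _))
         (λ _ → Σ-prop-≡ pr (-ᵥ-inverseˡ _)) (λ _ _ → Σ-prop-≡ pr (+ᵥ-comm _ _))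
     ; ·-distribˡ = λ _ _ _ → Σ-prop-≡ pr (·-distribˡ _ _ _)
     ; ·-distribʳ = λ _ _ _ → Σ-prop-≡ pr (·-distribʳ _ _ _)
     ; ·-assoc = λ _ _ _ → Σ-prop-≡ pr (·-assoc _ _ _)
     ; ·-identity = λ _ → Σ-prop-≡ pr (·-identity _)
     ; finiteV = finite-sub finiteV pr P? }
     where open Module M

   -- For an idempotent `e` this is `e M`. Being fixed by `e` is a decidable equation, so no image
   -- has to be formed.
   fixModule : Module A → R → Module A
   fixModule M e = subModule M (λ v → e · v ≡ v) (λ _ → uip) (λ v → (e · v) ≟ᵥ v) (·-zeroʳ e)
     (λ p q → trans (·-distribˡ e _ _) (cong₂ _+ᵥ_ p q))
     (λ r {v} p → trans (sym (·-assoc e r v)) (trans (cong (_· v) (*-comm e r)) (trans (·-assoc r e v) (cong (r ·_) p))))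
     where open Module M

 restrict : {K A : CRing} (φ : CRing.Carrier K → CRing.Carrier A) →
            (∀ a b → φ (CRing._⊕_ K a b) ≡ CRing._⊕_ A (φ a) (φ b)) →
            (∀ a b → φ (CRing._⊗_ K a b) ≡ CRing._⊗_ A (φ a) (φ b)) →
            φ (CRing.𝟙 K) ≡ CRing.𝟙 A → Module A → Module K
 restrict φ φ-+ φ-* φ-1 M = record
   { V = V ; _+ᵥ_ = _+ᵥ_ ; 0ᵥ = 0ᵥ ; -ᵥ_ = -ᵥ_ ; _·_ = λ a → φ a ·_ ; isAbelianGroup = isAbelianGroup
   ; ·-distribˡ = λ a → ·-distribˡ (φ a) ; ·-distribʳ = λ a b v → trans (cong (_· v) (φ-+ a b)) (·-distribʳ _ _ v)
   ; ·-assoc = λ a b v → trans (cong (_· v) (φ-* a b)) (·-assoc _ _ v)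
   ; ·-identity = λ v → trans (cong (_· v) φ-1) (·-identity v) ; finiteV = finiteV }
   where open Module M

 -- A decomposition of A into fields: eᵢ are the primitive idempotents.
 record Splitting (A : CRing) : Set where
   open CRing A
   field
     k       : ℕ
     e       : Fin k → Carrier
     idem    : ∀ i → e i ⊗ e i ≡ e i
     orth    : ∀ {i j} → i ≢ j → e i ⊗ e j ≡ 𝟘
     total   : sum e ≡ 𝟙
     nonzero : ∀ i → e i ≢ 𝟘
     invert  : ∀ i x → e i ⊗ x ≡ x → x ≢ 𝟘 → ∃ λ y → y ⊗ x ≡ e i

 module SplittingP {A : CRing} (S : Splitting A) where
   open Splitting S
   open CRing A hiding (_^_)

   -- The ideal `e i A`, at once a field and the simple module attached to `e i`; `Q i` is its
   -- order.
   corner : Fin k → Module A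
   corner i = fixModule (selfModule A) (e i)

   Q : Fin k → ℕ
   Q i = card (Module.finiteV (corner i))

   -- Plays two roles: the coefficients of linear combinations along a frame of type `τ`, and the
   -- model of the semisimple modules of that type.
   coefModule : List (Fin k) → Module A
   coefModule []      = ⊤Module
   coefModule (i ∷ τ) = corner i ×Module coefModule τ

   bump : {P : Set} → Dec P → ℕ → ℕ
   bump (yes _) n = suc n
   bump (no  _) n = n

   occ : Fin k → List (Fin k) → ℕ
   occ i []      = 0
   occ i (j ∷ τ) = bump (i Fin.≟ j) (occ i τ)

   Q≥2 : ∀ i → 2 ≤ Q i
   Q≥2 i = injective⇒card≤ (finite-Fin 2) (Module.finiteV (corner i)) f f-inj
     where
     f : Fin 2 → Module.V (corner i)
     f zero       = Module.0ᵥ (corner i)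
     f (suc zero) = e i , idem i
     f-inj : ∀ {x y} → f x ≡ f y → x ≡ y
     f-inj {zero}     {zero}     _ = refl
     f-inj {zero}     {suc zero} h = ⊥-elim (nonzero i (sym (cong proj₁ h)))
     f-inj {suc zero} {zero}     h = ⊥-elim (nonzero i (cong proj₁ h))
     f-inj {suc zero} {suc zero} _ = refl

   -- Bounds the length of an independent sequence by the order of the module; this is what stops
   -- the growth in `full-frame`.
   length<card : ∀ τ → length τ < card (Module.finiteV (coefModule τ))
   length<card []      = s≤s z≤n
   length<card (i ∷ τ) = Nat.≤-trans
     (Nat.≤-trans (Nat.+-mono-≤ (Nat.≤-trans (s≤s z≤n) (length<card τ)) (length<card τ))
        (Nat.≤-reflexive (cong (c Nat.+_) (sym (Nat.+-identityʳ c)))))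
     (Nat.*-monoˡ-≤ c (Q≥2 i))
     where c = card (Module.finiteV (coefModule τ))

   FixCoef : Fin k → List (Fin k) → Set
   FixCoef i τ = Module.V (fixModule (coefModule τ) (e i))

   finite-FixCoef : ∀ i τ → Finite (FixCoef i τ)
   finite-FixCoef i τ = Module.finiteV (fixModule (coefModule τ) (e i))

   fix-coef-same : ∀ i τ → FixCoef i (i ∷ τ) ↔ (Module.V (corner i) × FixCoef i τ)
   fix-coef-same i τ = mk↔ₛ′ to from (λ { (a , as , p) → cong (λ z → a , as , z) (uip _ p) }) (λ _ → Σ-prop-≡ (λ _ → uip) refl)
     where
     to : FixCoef i (i ∷ τ) → Module.V (corner i) × FixCoef i τ
     to ((a , as) , p) = a , as , cong proj₂ p
     from : Module.V (corner i) × FixCoef i τ → FixCoef i (i ∷ τ)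
     from (a , as , p) = (a , as) , cong₂ _,_ (Σ-prop-≡ (λ _ → uip) (proj₂ a)) p

   fix-coef-other : ∀ i j τ → i ≢ j → FixCoef i (j ∷ τ) ↔ FixCoef i τ
   fix-coef-other i j τ i≢j = mk↔ₛ′ to from (λ { (as , p) → cong (as ,_) (uip _ p) }) from-to
     where
     to : FixCoef i (j ∷ τ) → FixCoef i τ
     to ((a , as) , p) = as , cong proj₂ p
     from : FixCoef i τ → FixCoef i (j ∷ τ)
     from (as , p) = (Module.0ᵥ (corner j) , as) , cong₂ _,_ (Σ-prop-≡ (λ _ → uip) (zeroʳ (e i))) p
     killed : (a : Module.V (corner j)) → e i ⊗ proj₁ a ≡ proj₁ a → 𝟘 ≡ proj₁ a
     killed (a , q) p = sym (trans (sym p) (trans (cong (e i ⊗_) (sym q))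
       (trans (sym (*-assoc (e i) (e j) a)) (trans (cong (_⊗ a) (orth i≢j)) (zeroˡ a)))))
     from-to : ∀ x → from (to x) ≡ x
     from-to ((a , as) , p) = Σ-prop-≡ (λ _ → uip) (cong (_, as) (Σ-prop-≡ (λ _ → uip) (killed a (cong (λ z → proj₁ (proj₁ z)) p))))

   -- By orthogonality `e i` annihilates the factors with a label other than `i`, and it is the
   -- identity on those with label `i`.
   card-fix-coef : ∀ i τ → card (finite-FixCoef i τ) ≡ Q i Nat.^ occ i τ
   card-fix-coef i [] = card-cong (finite-FixCoef i []) finite-⊤ (mk↔ₛ′ (λ _ → tt) (λ _ → tt , refl) (λ _ → refl) (λ _ → Σ-prop-≡ (λ _ → uip) refl))
   card-fix-coef i (j ∷ τ) = go j (i Fin.≟ j)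
     where
     go : ∀ j (d : Dec (i ≡ j)) → card (finite-FixCoef i (j ∷ τ)) ≡ Q i Nat.^ bump d (occ i τ)
     go .i (yes refl) = trans (card-cong (finite-FixCoef i (i ∷ τ))
         (finite-× (Module.finiteV (corner i)) (finite-FixCoef i τ)) (fix-coef-same i τ))
       (cong (Q i Nat.*_) (card-fix-coef i τ))
     go j (no i≢j) = trans (card-cong (finite-FixCoef i (j ∷ τ)) (finite-FixCoef i τ) (fix-coef-other i j τ i≢j)) (card-fix-coef i τ)

   module Frame (M : Module A) where
     open Module M

     U : Fin k → Module A
     U i = fixModule M (e i)

     Seq : List (Fin k) → Set
     Seq []      = ⊤
     Seq (i ∷ τ) = Module.V (U i) × Seq τ

     Coef : List (Fin k) → Set
     Coef τ = Module.V (coefModule τ)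

     comb : ∀ τ → Seq τ → Coef τ → V
     comb []      _        _        = 0ᵥ
     comb (i ∷ τ) (v , vs) (a , as) = proj₁ a · proj₁ v +ᵥ comb τ vs as

     Span : ∀ τ → Seq τ → V → Set
     Span τ vs u = Σ (Coef τ) (λ as → comb τ vs as ≡ u)

     Ind : ∀ τ → Seq τ → Set
     Ind []      _        = ⊤
     Ind (i ∷ τ) (v , vs) = Ind τ vs × ¬ Span τ vs (proj₁ v)

     span? : ∀ τ vs u → Dec (Span τ vs u)
     span? τ vs u = Finite.any? (Module.finiteV (coefModule τ)) (λ as → comb τ vs as ≟ᵥ u)

     private
       exchange : ∀ a b c d → (a +ᵥ b) +ᵥ (c +ᵥ d) ≡ (a +ᵥ c) +ᵥ (b +ᵥ d)
       exchange a b c d = trans (+ᵥ-assoc a b _) (trans (cong (a +ᵥ_) (trans (sym (+ᵥ-assoc b c d))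
         (trans (cong (_+ᵥ d) (+ᵥ-comm b c)) (+ᵥ-assoc c b d)))) (sym (+ᵥ-assoc a c _)))

     comb-+ : ∀ τ vs as bs → comb τ vs (Module._+ᵥ_ (coefModule τ) as bs) ≡ comb τ vs as +ᵥ comb τ vs bs
     comb-+ []      vs       as       bs       = sym (+ᵥ-identityˡ _)
     comb-+ (i ∷ τ) (v , vs) (a , as) (b , bs) =
       trans (cong₂ _+ᵥ_ (·-distribʳ _ _ _) (comb-+ τ vs as bs)) (exchange _ _ _ _)

     comb-· : ∀ τ vs r as → comb τ vs (Module._·_ (coefModule τ) r as) ≡ r · comb τ vs as
     comb-· []      vs       r as       = sym (·-zeroʳ r)
     comb-· (i ∷ τ) (v , vs) r (a , as) =
       trans (cong₂ _+ᵥ_ (·-assoc _ _ _) (comb-· τ vs r as)) (sym (·-distribˡ r _ _))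

     comb-0 : ∀ τ vs → comb τ vs (Module.0ᵥ (coefModule τ)) ≡ 0ᵥ
     comb-0 []      vs       = refl
     comb-0 (i ∷ τ) (v , vs) = trans (cong₂ _+ᵥ_ (·-zeroˡ (proj₁ v)) (comb-0 τ vs)) (+ᵥ-identityˡ _)

     comb-neg : ∀ τ vs as → comb τ vs (Module.-ᵥ_ (coefModule τ) as) ≡ -ᵥ comb τ vs as
     comb-neg τ vs as = -ᵥ-unique _ _ (trans (sym (comb-+ τ vs _ as))
       (trans (cong (comb τ vs) (Module.-ᵥ-inverseˡ (coefModule τ) as)) (comb-0 τ vs)))

     -- A nonzero leading coefficient is invertible in the field `e i A`, and dividing by it would
     -- put the leading vector into the span of the others.
     comb-kernel : ∀ τ vs → Ind τ vs → ∀ as → comb τ vs as ≡ 0ᵥ → as ≡ Module.0ᵥ (coefModule τ)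
     comb-kernel []      vs       ind        as       h = refl
     comb-kernel (i ∷ τ) (v , vs) (ind , nv) (a , as) h with proj₁ a ≟ 𝟘
     ... | yes a≡0 = cong₂ _,_ (Σ-prop-≡ (λ _ → uip) a≡0)
       (comb-kernel τ vs ind as (trans (sym (+ᵥ-identityˡ _))
         (trans (cong (_+ᵥ comb τ vs as) (sym (trans (cong (_· proj₁ v) a≡0) (·-zeroˡ _)))) h)))
     ... | no a≢0 with invert i (proj₁ a) (proj₂ a) a≢0
     ... | y , ya = ⊥-elim (nv (C._·_ y (C.-ᵥ_ as) , (begin
         comb τ vs (C._·_ y (C.-ᵥ_ as)) ≡⟨ comb-· τ vs y (C.-ᵥ_ as) ⟩
         y · comb τ vs (C.-ᵥ_ as) ≡⟨ cong (y ·_) (trans (comb-neg τ vs as) (sym (-ᵥ-unique _ _ h))) ⟩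
         y · (proj₁ a · proj₁ v) ≡⟨ sym (·-assoc y _ _) ⟩
         (y ⊗ proj₁ a) · proj₁ v ≡⟨ cong (_· proj₁ v) ya ⟩
         e i · proj₁ v ≡⟨ proj₂ v ⟩
         proj₁ v ∎)))
       where module C = Module (coefModule τ)
             open ≡-Reasoning

     comb-injective : ∀ τ vs → Ind τ vs → ∀ {as bs} → comb τ vs as ≡ comb τ vs bs → as ≡ bs
     comb-injective τ vs ind {as} {bs} h = GroupP.x∙y⁻¹≈ε⇒x≈y C.+ᵥ-group as bs
       (comb-kernel τ vs ind _ (trans (comb-+ τ vs as (C.-ᵥ_ bs))
         (trans (cong₂ _+ᵥ_ h (comb-neg τ vs bs)) (-ᵥ-inverseʳ _))))
       where module C = Module (coefModule τ)

     Span-prop : ∀ τ vs → Ind τ vs → ∀ u → IsProp (Span τ vs u)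
     Span-prop τ vs ind u (as , p) (bs , q) = Σ-prop-≡ (λ _ → uip) (comb-injective τ vs ind (trans p (sym q)))

     Ind-prop : ∀ τ vs → IsProp (Ind τ vs)
     Ind-prop []      vs       tt      tt      = refl
     Ind-prop (i ∷ τ) (v , vs) (a , b) (c , d) = cong₂ _,_ (Ind-prop τ vs a c) (¬-prop b d)

     IndSeq : List (Fin k) → Set
     IndSeq τ = Σ (Seq τ) (Ind τ)

     dimU : Fin k → ℕ
     dimU i = card (Module.finiteV (U i))

     -- A further vector with label `i` is any element of `e i M` outside the span of the previous
     -- ones, and that span meets `e i M` in `Q i ^ occ i τ` elements.
     frames : List (Fin k) → ℕ
     frames []      = 1
     frames (i ∷ τ) = frames τ Nat.* (dimU i ∸ Q i Nat.^ occ i τ)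

     New : ∀ i τ → IndSeq τ → Set
     New i τ (vs , _) = Σ (Module.V (U i)) (λ v → ¬ Span τ vs (proj₁ v))

     finite-New : ∀ i τ s → Finite (New i τ s)
     finite-New i τ (vs , _) = finite-sub (Module.finiteV (U i)) (λ _ → ¬-prop) (λ v → ¬? (span? τ vs (proj₁ v)))

     private
       -- Coefficients are unique, so a combination is fixed by `e i` exactly when its coefficients
       -- are.
       span-fix : ∀ i τ s → Σ (Module.V (U i)) (λ v → Span τ (proj₁ s) (proj₁ v)) ↔ Module.V (fixModule (coefModule τ) (e i))
       span-fix i τ (vs , ind) = mk↔ₛ′
         (λ ((v , p) , as , q) → as , comb-injective τ vs ind (trans (comb-· τ vs (e i) as) (trans (cong (e i ·_) q) (trans p (sym q)))))
         (λ (as , p) → (comb τ vs as , trans (sym (comb-· τ vs (e i) as)) (cong (comb τ vs) p)) , as , refl)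
         (λ (as , p) → Σ-prop-≡ (λ _ → uip) refl)
         (λ { ((v , p) , as , refl) → Σ-prop-≡ (λ v → Span-prop τ vs ind (proj₁ v)) (Σ-prop-≡ (λ _ → uip) refl) })

     card-New : ∀ i τ s → card (finite-New i τ s) ≡ dimU i ∸ Q i Nat.^ occ i τ
     card-New i τ s@(vs , ind) = sym (trans (cong (_∸ Q i Nat.^ occ i τ)
       (trans (card-complement (Module.finiteV (U i)) (λ v → Span-prop τ vs ind (proj₁ v)) (λ v → span? τ vs (proj₁ v)) G (finite-New i τ s))
              (cong (Nat._+ card (finite-New i τ s)) (card-fix-coef i τ))))
       (Nat.m+n∸m≡n (Q i Nat.^ occ i τ) _))
       where
       G : Finite (Σ (Module.V (U i)) (λ v → Span τ vs (proj₁ v)))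
       G = finite-↔ (span-fix i τ s) (Module.finiteV (fixModule (coefModule τ) (e i)))

     finite-IndSeq : ∀ τ → Finite (IndSeq τ)
     finite-IndSeq []      = finite-↔ (mk↔ₛ′ (λ _ → tt) (λ _ → tt , tt) (λ _ → refl) (λ _ → refl)) finite-⊤
     finite-IndSeq (i ∷ τ) = finite-↔ (mk↔ₛ′
       (λ ((v , vs) , ind , nv) → (vs , ind) , v , nv)
       (λ ((vs , ind) , v , nv) → (v , vs) , ind , nv)
       (λ _ → refl) (λ _ → refl)) (finite-Σ (finite-IndSeq τ) (finite-New i τ))

     card-IndSeq : ∀ τ → card (finite-IndSeq τ) ≡ frames τ
     card-IndSeq []      = refl
     card-IndSeq (i ∷ τ) = trans (∑-cong (finite-IndSeq τ) (card-New i τ))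
       (trans (∑-const (finite-IndSeq τ) _) (cong (Nat._* (dimU i ∸ Q i Nat.^ occ i τ)) (card-IndSeq τ)))

     Full : ∀ τ → Seq τ → Set
     Full τ vs = ∀ v → Span τ vs v

     private
       span-sum : ∀ τ vs {n} (f : Fin n → V) → (∀ i → Span τ vs (f i)) → Span τ vs (sumᵥ f)
       span-sum τ vs {zero}  f h = _ , comb-0 τ vs
       span-sum τ vs {suc n} f h with h zero | span-sum τ vs (f ∘ suc) (h ∘ suc)
       ... | as , p | bs , q = _ , trans (comb-+ τ vs as bs) (cong₂ _+ᵥ_ p q)

     -- If all parts `e i · v` lie in the span then so does `v`, because the idempotents add up to
     -- `𝟙`; otherwise some such part continues the frame.
     extend : ∀ τ (s : IndSeq τ) → Full τ (proj₁ s) ⊎ Σ (Fin k) (λ i → New i τ s)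
     extend τ (vs , ind) with Finite.any? (finite-Fin k) (λ i → Finite.any? (Module.finiteV (U i)) (λ v → ¬? (span? τ vs (proj₁ v))))
     ... | yes (i , v , nv) = inj₂ (i , v , nv)
     ... | no none = inj₁ (λ v → subst (Span τ vs)
             (trans (sym (sum-· e v)) (trans (cong (_· v) total) (·-identity v)))
             (span-sum τ vs (λ i → e i · v) (λ i → inside i v)))
       where
       inside : ∀ i v → Span τ vs (e i · v)
       inside i v with span? τ vs (e i · v)
       ... | yes p = p
       ... | no np = ⊥-elim (none (i , (e i · v , trans (sym (·-assoc _ _ v)) (cong (_· v) (idem i))) , np))

     private
       grow : ∀ m → Σ (List (Fin k)) (λ τ → Σ (IndSeq τ) (λ s → Full τ (proj₁ s))) ⊎
                    Σ (List (Fin k)) (λ τ → IndSeq τ × length τ ≡ m)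
       grow zero = inj₂ ([] , (tt , tt) , refl)
       grow (suc m) with grow m
       ... | inj₁ f = inj₁ f
       ... | inj₂ (τ , s@(vs , ind) , l) with extend τ s
       ...   | inj₁ full = inj₁ (τ , s , full)
       ...   | inj₂ (i , v , nv) = inj₂ (i ∷ τ , ((v , vs) , ind , nv) , cong suc l)

     abstract
       -- This is the semisimplicity of `M`: by `full-↔` it is then a copy of `coefModule τ`. A
       -- frame that could always be extended would outgrow `M`.
       full-frame : Σ (List (Fin k)) (λ τ → Σ (IndSeq τ) (λ s → Full τ (proj₁ s)))
       full-frame with grow (card finiteV)
       ... | inj₁ f = f
       ... | inj₂ (τ , (vs , ind) , l) = ⊥-elim (Nat.<-irrefl l (Nat.<-≤-trans (length<card τ)
               (injective⇒card≤ (Module.finiteV (coefModule τ)) finiteV (comb τ vs) (comb-injective τ vs ind))))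

     module _ (τ : List (Fin k)) (s : IndSeq τ) (full : Full τ (proj₁ s)) where
       full-↔ : Coef τ ↔ V
       full-↔ = bijective⇒↔ (comb τ (proj₁ s)) (comb-injective τ (proj₁ s) (proj₂ s)) full

       dimU-full : ∀ i → dimU i ≡ Q i Nat.^ occ i τ
       dimU-full i = trans (card-cong (Module.finiteV (U i)) (Module.finiteV (fixModule (coefModule τ) (e i)))
         (↔-trans (mk↔ₛ′ (λ u → u , full (proj₁ u)) proj₁ (λ (u , sp) → cong (u ,_) (Span-prop τ (proj₁ s) (proj₂ s) (proj₁ u) _ _)) (λ _ → refl)) (span-fix i τ s)))
         (card-fix-coef i τ)

-- General linear groups and the counting of module structures

module GL where
 open import Defs using (FiniteField; module Matrices)
 open Counting
 open Rings
 open Frames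

 concatMap-map : {A B C : Set} (f : A → B → C) (xs : List A) (ys : List B) →
                 concatMap (λ x → List.map (f x) ys) xs ≡ cartesianProductWith f xs ys
 concatMap-map f []       ys = refl
 concatMap-map f (x ∷ xs) ys = cong (List.map (f x) ys ++_) (concatMap-map f xs ys)

 ∈-concatMap-map : {A B C : Set} (f : A → B → C) {xs : List A} {ys : List B} {x : A} {y : B} →
                   x ∈ xs → y ∈ ys → f x y ∈ concatMap (λ x → List.map (f x) ys) xs
 ∈-concatMap-map f {xs} {ys} p q = subst (_ ∈_) (sym (concatMap-map f xs ys)) (∈-cartesianProductWith⁺ f p q)

 unique-concatMap-map : {A B C : Set} (f : A → B → C) → (∀ {w x y z} → f w y ≡ f x z → w ≡ x × y ≡ z) →
                        {xs : List A} {ys : List B} → Unique xs → Unique ys → Unique (concatMap (λ x → List.map (f x) ys) xs)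
 unique-concatMap-map f inj {xs} {ys} u v = subst Unique (sym (concatMap-map f xs ys)) (Uniqueₚ.cartesianProductWith⁺ f inj u v)

 -- The number of linearly independent `m`-tuples in a space with `N` elements over a field of order
 -- `q`.
 glf : ℕ → ℕ → ℕ → ℕ
 glf N q zero    = 1
 glf N q (suc m) = glf N q m Nat.* (N ∸ q Nat.^ m)

 -- |GLₙ(𝔽_q)| = ∏_{j<n} (qⁿ − q^j)
 gl : ℕ → ℕ → ℕ
 gl q n = glf (q Nat.^ n) q n

 module _ {A : CRing} (S : Splitting A) (M : Module A) where
   open Splitting S
   open SplittingP S
   open Frame M

   frames-replicate : ∀ i m τ → occ i τ ≡ 0 →
     (occ i (replicate m i ++ τ) ≡ m) × (frames (replicate m i ++ τ) ≡ frames τ Nat.* glf (dimU i) (Q i) m)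
   frames-replicate i zero    τ h = h , sym (Nat.*-identityʳ _)
   frames-replicate i (suc m) τ h = occ-step (i Fin.≟ i) , step
     where
     ih = frames-replicate i m τ h
     occ-step : (d : Dec (i ≡ i)) → bump d (occ i (replicate m i ++ τ)) ≡ suc m
     occ-step (yes _) = cong suc (proj₁ ih)
     occ-step (no ne) = ⊥-elim (ne refl)
     step : frames (replicate m i ++ τ) Nat.* (dimU i ∸ Q i Nat.^ occ i (replicate m i ++ τ)) ≡
            frames τ Nat.* (glf (dimU i) (Q i) m Nat.* (dimU i ∸ Q i Nat.^ m))
     step = trans (cong₂ Nat._*_ (proj₂ ih) (cong (λ z → dimU i ∸ Q i Nat.^ z) (proj₁ ih)))
                  (Nat.*-assoc (frames τ) (glf (dimU i) (Q i) m) _)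

 -- With `1#` as the only idempotent, a full frame is a basis; linear algebra over `K` thus becomes
 -- a special case of frames.
 fieldSplitting : (K : FiniteField) → Splitting (fieldRing K)
 fieldSplitting K = record
   { k = 1 ; e = λ _ → 1# ; idem = λ _ → *-identityˡ 1# ; orth = λ { {zero} {zero} ne → ⊥-elim (ne refl) }
   ; total = +-identityʳ 1# ; nonzero = λ _ h → 0≢1 (sym h)
   ; invert = λ _ x _ nz → let (y , h) = inverse x nz in y , trans (*-comm y x) h }
   where
   open FiniteField K
   open CRing (fieldRing K) using (*-identityˡ; +-identityʳ; *-comm)

 record LinIso {K : CRing} (V W : Module K) : Set where
   private
     module V = Module V
     module W = Module W
   field
     f     : V.V → W.V
     f-+   : ∀ u v → f (u V.+ᵥ v) ≡ f u W.+ᵥ f v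
     f-·   : ∀ c v → f (c V.· v) ≡ c W.· f v
     inj   : ∀ {u v} → f u ≡ f v → u ≡ v
     surj  : ∀ w → Σ V.V (λ v → f v ≡ w)

   g : W.V → V.V
   g w = proj₁ (surj w)

   f-g : ∀ w → f (g w) ≡ w
   f-g w = proj₂ (surj w)

   g-f : ∀ v → g (f v) ≡ v
   g-f v = inj (f-g (f v))

   g-+ : ∀ u v → g (u W.+ᵥ v) ≡ g u V.+ᵥ g v
   g-+ u v = inj (trans (f-g _) (sym (trans (f-+ _ _) (cong₂ W._+ᵥ_ (f-g u) (f-g v)))))

   g-· : ∀ c v → g (c W.· v) ≡ c V.· g v
   g-· c v = inj (trans (f-g _) (sym (trans (f-· _ _) (cong (c W.·_) (f-g v)))))

 module GLn (K : FiniteField) where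
   open FiniteField K using (elements; complete; unique; size)
   open Matrices K
   open LinearMaps K
   private
     KR = fieldRing K
     module KR = CRing KR
     KS = fieldSplitting K
     module KSP = SplittingP KS

   allVecs-complete : {X : Set} (xs : List X) → (∀ x → x ∈ xs) → ∀ {m} (v : Vec X m) → v ∈ allVecs xs m
   allVecs-complete xs c []      = here refl
   allVecs-complete xs c (x ∷ v) = ∈-concatMap-map _∷_ (c x) (allVecs-complete xs c v)

   allVecs-unique : {X : Set} (xs : List X) → Unique xs → ∀ m → Unique (allVecs xs m)
   allVecs-unique xs u zero    = [] ∷ []
   allVecs-unique xs u (suc m) = unique-concatMap-map _∷_ (λ { refl → refl , refl }) u (allVecs-unique xs u m)

   allMats-complete : ∀ {n} (A : Mat n) → A ∈ allMats n
   allMats-complete = allVecs-complete _ (allVecs-complete elements complete)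

   allMats-unique : ∀ n → Unique (allMats n)
   allMats-unique n = allVecs-unique _ (allVecs-unique elements unique n) n

   GL : ℕ → Set
   GL n = Σ (Mat n) (λ A → True (isInvertible? A))

   abstract
     finite-GL : ∀ n → Finite (GL n)
     finite-GL n = finite-filter isInvertible? (allMats n) (allMats-unique n) allMats-complete

   GL-≡ : ∀ {n} {P R : GL n} → proj₁ P ≡ proj₁ R → P ≡ R
   GL-≡ = Σ-prop-≡ (λ A → True-prop (isInvertible? A))

   mkGL : ∀ {n} (A B : Mat n) → A · B ≡ idM → B · A ≡ idM → GL n
   mkGL A B p q = A , fromWitness (lose (allMats-complete B) (p , q))

   invGL : ∀ {n} → GL n → Mat n
   invGL (A , t) = proj₁ (satisfied (toWitness t))

   invGLʳ : ∀ {n} (P : GL n) → proj₁ P · invGL P ≡ idM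
   invGLʳ (A , t) = proj₁ (proj₂ (satisfied (toWitness t)))

   invGLˡ : ∀ {n} (P : GL n) → invGL P · proj₁ P ≡ idM
   invGLˡ (A , t) = proj₂ (proj₂ (satisfied (toWitness t)))

   apply-inv : ∀ {n} (P : GL n) v → apply (proj₁ P) (apply (invGL P) v) ≡ v
   apply-inv P v = trans (sym (apply-· (proj₁ P) (invGL P) v)) (trans (cong (λ X → apply X v) (invGLʳ P)) (apply-id v))

   inv-apply : ∀ {n} (P : GL n) v → apply (invGL P) (apply (proj₁ P) v) ≡ v
   inv-apply P v = trans (sym (apply-· (invGL P) (proj₁ P) v)) (trans (cong (λ X → apply X v) (invGLˡ P)) (apply-id v))

   Vₙ : ℕ → Module KR
   Vₙ = vecModule KR

   abstract
     isoGL : ∀ {n} → LinIso (Vₙ n) (Vₙ n) → GL n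
     isoGL {n} L = mkGL Mf Mg
       (apply-injective (λ v → trans (apply-· Mf Mg v) (trans (cong (apply Mf) (apply-matrix g g-+ g-· v))
          (trans (apply-matrix f f-+ f-· (g v)) (trans (f-g v) (sym (apply-id v)))))))
       (apply-injective (λ v → trans (apply-· Mg Mf v) (trans (cong (apply Mg) (apply-matrix f f-+ f-· v))
          (trans (apply-matrix g g-+ g-· (f v)) (trans (g-f v) (sym (apply-id v)))))))
       where
       open LinIso L
       Mf Mg : Mat n
       Mf = matrix f f-+ f-·
       Mg = matrix g g-+ g-·

     isoGL-apply : ∀ {n} (L : LinIso (Vₙ n) (Vₙ n)) v → apply (proj₁ (isoGL L)) v ≡ LinIso.f L v
     isoGL-apply L = apply-matrix f f-+ f-·
       where open LinIso L

   -- Coordinates of a vector along a list of (necessarily equal) labels of the splitting of K itself.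
   coords : ∀ τ → Vec KR.Carrier (length τ) → Module.V (KSP.coefModule τ)
   coords []      []      = tt
   coords (i ∷ τ) (x ∷ v) = (x , KR.*-identityˡ x) , coords τ v

   coordsIso : ∀ τ → LinIso (Vₙ (length τ)) (KSP.coefModule τ)
   coordsIso τ = record { f = coords τ ; f-+ = c+ τ ; f-· = c· τ ; inj = cinj τ ; surj = csurj τ }
     where
     pr : ∀ i → {s t : Module.V (KSP.corner i)} → proj₁ s ≡ proj₁ t → s ≡ t
     pr _ = Σ-prop-≡ (λ _ → uip)
     c+ : ∀ τ u v → coords τ (Module._+ᵥ_ (Vₙ (length τ)) u v) ≡ Module._+ᵥ_ (KSP.coefModule τ) (coords τ u) (coords τ v)
     c+ []      []      []      = refl
     c+ (i ∷ τ) (x ∷ u) (y ∷ v) = cong₂ _,_ (pr i refl) (c+ τ u v)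
     c· : ∀ τ c v → coords τ (Module._·_ (Vₙ (length τ)) c v) ≡ Module._·_ (KSP.coefModule τ) c (coords τ v)
     c· []      c []      = refl
     c· (i ∷ τ) c (x ∷ v) = cong₂ _,_ (pr i refl) (c· τ c v)
     cinj : ∀ τ {u v} → coords τ u ≡ coords τ v → u ≡ v
     cinj []      {[]}    {[]}    h = refl
     cinj (i ∷ τ) {x ∷ u} {y ∷ v} h = cong₂ _∷_ (cong (λ z → proj₁ (proj₁ z)) h) (cinj τ (cong proj₂ h))
     csurj : ∀ τ w → Σ (Vec KR.Carrier (length τ)) (λ v → coords τ v ≡ w)
     csurj []      tt = [] , refl
     csurj (i ∷ τ) ((x , p) , w) = let (v , h) = csurj τ w in x ∷ v , cong₂ _,_ (pr i refl) h

   frameIso : (W : Module KR) (τ : List (Fin 1)) (s : KSP.Frame.IndSeq W τ) → KSP.Frame.Full W τ (proj₁ s) → LinIso (Vₙ (length τ)) W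
   frameIso W τ (vs , ind) full = record
     { f = λ v → comb τ vs (C.f v)
     ; f-+ = λ u v → trans (cong (comb τ vs) (C.f-+ u v)) (comb-+ τ vs _ _)
     ; f-· = λ c v → trans (cong (comb τ vs) (C.f-· c v)) (comb-· τ vs c _)
     ; inj = λ h → C.inj (comb-injective τ vs ind h)
     ; surj = λ w → let (as , h) = full w in C.g as , trans (cong (comb τ vs) (C.f-g as)) h }
     where
     open KSP.Frame W
     module C = LinIso (coordsIso τ)

   abstract
     dimension : (W : Module KR) → Σ ℕ (λ n → LinIso (Vₙ n) W)
     dimension W = let (τ , s , full) = KSP.Frame.full-frame W in length τ , frameIso W τ s full

     card-iso : ∀ {n} {W : Module KR} → LinIso (Vₙ n) W → card (Module.finiteV W) ≡ size Nat.^ n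
     card-iso {n} {W} L = trans (sym (card-cong (Module.finiteV (Vₙ n)) (Module.finiteV W) (bijective⇒↔ f inj surj)))
                                (card-Vec (CRing.finiteC KR) n)
       where open LinIso L

     size≥2 : 2 ≤ size
     size≥2 = subst (2 ≤_) (card-cong (Module.finiteV (KSP.corner zero)) (CRing.finiteC KR)
                (mk↔ₛ′ proj₁ (λ x → x , KR.*-identityˡ x) (λ _ → refl) (λ _ → Σ-prop-≡ (λ _ → uip) refl))) (KSP.Q≥2 zero)

     ^-injective : ∀ {m n} → size Nat.^ m ≡ size Nat.^ n → m ≡ n
     ^-injective {m} {n} h with Nat.<-cmp m n
     ... | tri< lt _ _ = ⊥-elim (Nat.<-irrefl h (Nat.^-monoʳ-< size size≥2 lt))
     ... | tri≈ _ e _ = e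
     ... | tri> _ _ gt = ⊥-elim (Nat.<-irrefl (sym h) (Nat.^-monoʳ-< size size≥2 gt))

     -- The number of elements determines the dimension because `size ≥ 2`.
     coordinates : ∀ {n} (W : Module KR) → card (Module.finiteV W) ≡ size Nat.^ n → LinIso (Vₙ n) W
     coordinates {n} W h = subst (λ m → LinIso (Vₙ m) W)
       (^-injective {proj₁ (dimension W)} {n} (trans (sym (card-iso (proj₂ (dimension W)))) h)) (proj₂ (dimension W))

   -- Families of A-module structures on Kⁿ: transporting the structure of ∏ₜ A·e_{τₜ} along all
   -- K-linear isomorphisms counts pairs (structure, frame of type τ) by |GLₙ(K)|.
   module Structures {A : CRing} (S : Splitting A) (φ : KR.Carrier → CRing.Carrier A)
     (φ-+ : ∀ a b → φ (KR._⊕_ a b) ≡ CRing._⊕_ A (φ a) (φ b))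
     (φ-* : ∀ a b → φ (KR._⊗_ a b) ≡ CRing._⊗_ A (φ a) (φ b))
     (φ-1 : φ KR.𝟙 ≡ CRing.𝟙 A) where
     open Splitting S
     open SplittingP S
     open CRing A using (_⊗_; 𝟘; zeroʳ; *-comm)

     asK : Module A → Module KR
     asK = restrict φ φ-+ φ-* φ-1

     record AIso (M N : Module A) : Set where
       private
         module M = Module M
         module N = Module N
       field
         f    : M.V → N.V
         f-+  : ∀ u v → f (u M.+ᵥ v) ≡ f u N.+ᵥ f v
         f-·  : ∀ c v → f (c M.· v) ≡ c N.· f v
         inj  : ∀ {u v} → f u ≡ f v → u ≡ v

     module _ (M : Module A) where
       open Module M
       open Frame M

       -- The images of the standard generators of `coefModule τ`; by `seqOf-comb` the combinations
       -- of this frame recover the given map.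
       seqOf : ∀ τ → AIso (coefModule τ) M → Seq τ
       seqOf []      L = tt
       seqOf (i ∷ τ) L = (f ((e i , idem i) , 0ₜ) , trans (sym (f-· (e i) _)) (cong f (cong₂ _,_ (Σ-prop-≡ (λ _ → uip) (idem i)) (Module.·-zeroʳ (coefModule τ) (e i))))) ,
                         seqOf τ (record
                           { f = λ as → f (Module.0ᵥ (corner i) , as)
                           ; f-+ = λ u v → trans (cong f (cong₂ _,_ (sym (Module.+ᵥ-identityˡ (corner i) (Module.0ᵥ (corner i)))) refl)) (f-+ (Module.0ᵥ (corner i) , u) (Module.0ᵥ (corner i) , v))
                           ; f-· = λ c v → trans (cong f (cong₂ _,_ (sym (Module.·-zeroʳ (corner i) c)) refl)) (f-· c (Module.0ᵥ (corner i) , v))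
                           ; inj = λ h → cong proj₂ (inj h) })
         where
         open AIso L
         0ₜ = Module.0ᵥ (coefModule τ)

       seqOf-comb : ∀ τ (L : AIso (coefModule τ) M) as → comb τ (seqOf τ L) as ≡ AIso.f L as
       seqOf-comb []      L tt = sym (trans (cong f (sym (Module.·-zeroˡ (⊤Module {A}) tt))) (trans (f-· 𝟘 tt) (·-zeroˡ _)))
         where open AIso L
       seqOf-comb (i ∷ τ) L (a , as) = trans (cong₂ _+ᵥ_ (sym (f-· (proj₁ a) _)) (seqOf-comb τ _ as))
         (trans (sym (f-+ _ _)) (cong f (cong₂ _,_
           (Σ-prop-≡ (λ _ → uip) (trans (CRing.+-identityʳ A _) (trans (*-comm (proj₁ a) (e i)) (proj₂ a))))
           (trans (cong (λ z → Module._+ᵥ_ (coefModule τ) z as) (Module.·-zeroʳ (coefModule τ) (proj₁ a))) (Module.+ᵥ-identityˡ (coefModule τ) as)))))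
         where open AIso L

       seqOf-Ind : ∀ τ (L : AIso (coefModule τ) M) → Ind τ (seqOf τ L)
       seqOf-Ind []      L = tt
       seqOf-Ind (i ∷ τ) L = seqOf-Ind τ _ , λ (as , h) →
         nonzero i (cong (λ z → proj₁ (proj₁ z)) (sym (inj (trans (sym (seqOf-comb τ _ as)) h))))
         where open AIso L

       comb-determines : ∀ τ (vs ws : Seq τ) → (∀ as → comb τ vs as ≡ comb τ ws as) → vs ≡ ws
       comb-determines []      tt       tt       h = refl
       comb-determines (i ∷ τ) (v , vs) (w , ws) h = cong₂ _,_
         (Σ-prop-≡ (λ _ → uip) (trans (sym (head v vs)) (trans (h ((e i , idem i) , Module.0ᵥ (coefModule τ))) (head w ws))))
         (comb-determines τ vs ws (λ as → trans (sym (tail v vs as)) (trans (h (Module.0ᵥ (corner i) , as)) (tail w ws as))))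
         where
         head : ∀ (v : Module.V (U i)) (vs : Seq τ) → comb (i ∷ τ) (v , vs) ((e i , idem i) , Module.0ᵥ (coefModule τ)) ≡ proj₁ v
         head v vs = trans (cong₂ _+ᵥ_ (proj₂ v) (comb-0 τ vs)) (+ᵥ-identityʳ _)
         tail : ∀ (v : Module.V (U i)) (vs : Seq τ) as → comb (i ∷ τ) (v , vs) (Module.0ᵥ (corner i) , as) ≡ comb τ vs as
         tail v vs as = trans (cong (_+ᵥ comb τ vs as) (·-zeroˡ (proj₁ v))) (+ᵥ-identityˡ _)

     module Count (n : ℕ) {P : Set} (finiteP : Finite P)
       (M : P → Module A) (V≡ : ∀ ρ → LinIso (asK (M ρ)) (Vₙ n)) where

       act : P → CRing.Carrier A → Vec KR.Carrier n → Vec KR.Carrier n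
       act ρ a v = LinIso.f (V≡ ρ) (Module._·_ (M ρ) a (LinIso.g (V≡ ρ) v))

       module Main
         (act-determines : ∀ ρ ρ′ → (∀ a v → act ρ a v ≡ act ρ′ a v) → ρ ≡ ρ′)
         (transport : ∀ τ (L : LinIso (Vₙ n) (asK (coefModule τ))) →
                      Σ P (λ ρ → ∀ a v → act ρ a v ≡ LinIso.g L (Module._·_ (coefModule τ) a (LinIso.f L v))))
         (τ : List (Fin k)) (card-τ : card (Module.finiteV (coefModule τ)) ≡ size Nat.^ n) where

         private
           β : LinIso (Vₙ n) (asK (coefModule τ))
           β = coordinates (asK (coefModule τ)) card-τ
           module β = LinIso β

         Pairs : Set
         Pairs = Σ P (λ ρ → Frame.IndSeq (M ρ) τ)

         finite-Pairs : Finite Pairs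
         finite-Pairs = finite-Σ finiteP (λ ρ → Frame.finite-IndSeq (M ρ) τ)

         private
           -- Relative to the fixed coordinates `β`, a frame of `M ρ` amounts to an automorphism of
           -- `Kⁿ`: it sends the vector with coordinates `as` to the combination with coefficients
           -- `as`.
           combine : (x : Pairs) → LinIso (Vₙ n) (Vₙ n)
           combine (ρ , vs , ind) = record
             { f = λ v → E.f (comb τ vs (β.f v))
             ; f-+ = λ u v → trans (cong (E.f ∘ comb τ vs) (β.f-+ u v)) (trans (cong E.f (comb-+ τ vs _ _)) (E.f-+ _ _))
             ; f-· = λ c v → trans (cong (E.f ∘ comb τ vs) (β.f-· c v)) (trans (cong E.f (comb-· τ vs _ _)) (E.f-· _ _))
             ; inj = inj′
             ; surj = injective⇒surjective (Module.finiteV (Vₙ n)) (Module.finiteV (Vₙ n)) _ inj′ refl }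
             where
             open Frame (M ρ)
             module E = LinIso (V≡ ρ)
             inj′ : ∀ {u v} → E.f (comb τ vs (β.f u)) ≡ E.f (comb τ vs (β.f v)) → u ≡ v
             inj′ h = β.inj (comb-injective τ vs ind (E.inj h))

           -- The automorphism conjugates the model action on `coefModule τ` into the action of `ρ`.
           -- Hence it determines `ρ`, and with it the frame.
           combine-act : ∀ x a v → act (proj₁ x) a v ≡
                         LinIso.f (combine x) (β.g (Module._·_ (coefModule τ) a (β.f (LinIso.g (combine x) v))))
           combine-act x@(ρ , vs , ind) a v = sym (trans
               (cong (E.f ∘ comb τ vs) (β.f-g _))
               (trans (cong E.f (comb-· τ vs a _)) (cong (λ z → E.f (Module._·_ (M ρ) a z)) (E.inj (trans (LinIso.f-g (combine x) v) (sym (E.f-g v)))))))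
             where
             open Frame (M ρ)
             module E = LinIso (V≡ ρ)

           toGL : Pairs → GL n
           toGL x = isoGL (combine x)

           same-comb : ∀ {x y} → toGL x ≡ toGL y → ∀ v → LinIso.f (combine x) v ≡ LinIso.f (combine y) v
           same-comb {x} {y} h v = trans (sym (isoGL-apply (combine x) v)) (trans (cong (λ P → apply (proj₁ P) v) h) (isoGL-apply (combine y) v))

           same-seq : ∀ ρ (s t : Frame.IndSeq (M ρ) τ) → toGL (ρ , s) ≡ toGL (ρ , t) → s ≡ t
           same-seq ρ (vs , ind) (ws , ind′) h = Σ-prop-≡ (Frame.Ind-prop (M ρ) τ)
             (comb-determines (M ρ) τ vs ws (λ as → LinIso.inj (V≡ ρ)
               (trans (cong (λ z → LinIso.f (V≡ ρ) (Frame.comb (M ρ) τ vs z)) (sym (β.f-g as)))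
               (trans (same-comb {ρ , vs , ind} {ρ , ws , ind′} h (β.g as)) (cong (λ z → LinIso.f (V≡ ρ) (Frame.comb (M ρ) τ ws z)) (β.f-g as))))))

           same-pair : ∀ {ρ ρ′} → ρ ≡ ρ′ → ∀ s t → toGL (ρ , s) ≡ toGL (ρ′ , t) → (ρ , s) ≡ (ρ′ , t)
           same-pair {ρ} refl s t h = cong (ρ ,_) (same-seq ρ s t h)

           same-act : ∀ x y → toGL x ≡ toGL y → ∀ a v → act (proj₁ x) a v ≡ act (proj₁ y) a v
           same-act x y h a v = trans (combine-act x a v)
                   (trans (same-comb {x} {y} h (β.g (Module._·_ (coefModule τ) a (β.f (LinIso.g (combine x) v)))))
                   (trans (cong (λ z → LinIso.f (combine y) (β.g (Module._·_ (coefModule τ) a (β.f z)))) (same-g v)) (sym (combine-act y a v))))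
             where
             same-g : ∀ v → LinIso.g (combine x) v ≡ LinIso.g (combine y) v
             same-g v = LinIso.inj (combine y) (trans (sym (same-comb {x} {y} h _)) (trans (LinIso.f-g (combine x) v) (sym (LinIso.f-g (combine y) v))))

           toGL-injective : ∀ {x y} → toGL x ≡ toGL y → x ≡ y
           toGL-injective {ρ , s} {ρ′ , t} h = same-pair (act-determines ρ ρ′ (same-act (ρ , s) (ρ′ , t) h)) s t h

           -- The model action transported along `R` is the action of some `ρ`, and the images of
           -- the standard generators are the frame that gives back `R`.
           toGL-surjective : ∀ P → Σ Pairs (λ x → toGL x ≡ P)
           toGL-surjective R = x , GL-≡ (apply-injective (λ v → trans (isoGL-apply (combine x) v)
               (trans (cong (E.f) (seqOf-comb (M ρ) τ L (β.f v))) (trans (E.f-g _) (cong (apply (proj₁ R)) (β.g-f v))))))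
             where
             B : LinIso (Vₙ n) (asK (coefModule τ))
             B = record
               { f = λ v → β.f (apply (invGL R) v)
               ; f-+ = λ u v → trans (cong β.f (apply-+ (invGL R) u v)) (β.f-+ _ _)
               ; f-· = λ c v → trans (cong β.f (apply-scale (invGL R) c v)) (β.f-· _ _)
               ; inj = λ h → trans (sym (apply-inv R _)) (trans (cong (apply (proj₁ R)) (β.inj h)) (apply-inv R _))
               ; surj = λ w → apply (proj₁ R) (β.g w) , trans (cong β.f (inv-apply R _)) (β.f-g w) }
             tr = transport τ B
             ρ = proj₁ tr
             module E = LinIso (V≡ ρ)
             f′ : Module.V (coefModule τ) → Module.V (M ρ)
             f′ as = E.g (apply (proj₁ R) (β.g as))
             L : AIso (coefModule τ) (M ρ)
             L = record
               { f = f′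
               ; f-+ = λ u v → trans (cong (E.g ∘ apply (proj₁ R)) (β.g-+ u v)) (trans (cong E.g (apply-+ (proj₁ R) (β.g u) (β.g v))) (E.g-+ (apply (proj₁ R) (β.g u)) (apply (proj₁ R) (β.g v))))
               ; f-· = λ a as → E.inj (trans (E.f-g _) (sym (trans (cong (λ z → E.f (Module._·_ (M ρ) a z)) (refl {x = f′ as}))
                         (trans (proj₂ tr a (apply (proj₁ R) (β.g as)))
                           (cong (λ z → apply (proj₁ R) (β.g (Module._·_ (coefModule τ) a z)))
                             (trans (cong β.f (inv-apply R _)) (β.f-g as)))))))
               ; inj = λ {u} {v} h → trans (sym (β.f-g u)) (trans (cong β.f (trans (sym (inv-apply R _))
                         (trans (cong (apply (invGL R)) (trans (sym (E.f-g _)) (trans (cong E.f h) (E.f-g _)))) (inv-apply R _)))) (β.f-g v)) }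
             x : Pairs
             x = ρ , seqOf (M ρ) τ L , seqOf-Ind (M ρ) τ L

         card-Pairs : ∑ finiteP (λ ρ → Frame.frames (M ρ) τ) ≡ card (finite-GL n)
         card-Pairs = trans (∑-cong finiteP (λ ρ → sym (Frame.card-IndSeq (M ρ) τ)))
           (card-cong finite-Pairs (finite-GL n) (bijective⇒↔ toGL toGL-injective toGL-surjective))

-- Splitting a finite ring into fields

module Split where
 open import Defs using (FiniteField)
 open Counting
 open Rings
 open Frames
 open import Data.List using (lookup)

 -- A finite commutative ring satisfying x^(t+2) = x is a product of fields: x^(t+1) is
 -- idempotent for every x, so an idempotent e splits unless x^(t+1) = e for all 0 ≠ x ∈ eA.
 module _ (A : CRing) (t : ℕ) where
   open CRing A

   private
     mulˡ : ∀ {x y z} w → x ⊗ y ≡ z → w ⊗ x ⊗ y ≡ w ⊗ z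
     mulˡ w h = trans (*-assoc w _ _) (cong (w ⊗_) h)

   Primitive : Carrier → Set
   Primitive f = f ⊗ f ≡ f × f ≢ 𝟘 × (∀ x → f ⊗ x ≡ x → x ≢ 𝟘 → x ^ suc t ≡ f)

   Orth : Carrier → Carrier → Set
   Orth a b = a ⊗ b ≡ 𝟘

   sumL : List Carrier → Carrier
   sumL = List.foldr _⊕_ 𝟘

   sumL-++ : ∀ xs ys → sumL (xs ++ ys) ≡ sumL xs ⊕ sumL ys
   sumL-++ []       ys = sym (+-identityˡ _)
   sumL-++ (x ∷ xs) ys = trans (cong (x ⊕_) (sumL-++ xs ys)) (sym (+-assoc _ _ _))

   record SplitList (e : Carrier) : Set where
     field
       es    : List Carrier
       orth  : AllPairs Orth es
       prim  : All Primitive es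
       below : All (λ a → a ⊗ e ≡ a) es
       total : sumL es ≡ e

   Below : Carrier → Set
   Below e = Σ Carrier (λ x → e ⊗ x ≡ x)

   finite-Below : ∀ e → Finite (Below e)
   finite-Below e = finite-sub finiteC (λ _ → uip) (λ x → (e ⊗ x) ≟ x)

   -- `e` belongs to `e A` but not to `f A`. The decrease is what makes the fuel in `split`
   -- sufficient.
   below-smaller : ∀ {e f} → e ⊗ e ≡ e → e ⊗ f ≡ f → f ≢ e → card (finite-Below f) < card (finite-Below e)
   below-smaller {e} {f} ee ef f≢e = injective⇒card≤ (finite-⊎ finite-⊤ (finite-Below f)) (finite-Below e) h h-inj
     where
     h : ⊤ ⊎ Below f → Below e
     h (inj₁ _) = e , ee
     h (inj₂ (x , p)) = x , trans (cong (e ⊗_) (sym p)) (trans (sym (*-assoc e f x)) (trans (cong (_⊗ x) ef) p))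
     no-e : ∀ x → f ⊗ x ≡ x → e ≢ x
     no-e x p refl = f≢e (trans (sym ef) (trans (*-comm e f) p))
     h-inj : ∀ {x y} → h x ≡ h y → x ≡ y
     h-inj {inj₁ tt} {inj₁ tt} _ = refl
     h-inj {inj₁ tt} {inj₂ (x , p)} q = ⊥-elim (no-e x p (cong proj₁ q))
     h-inj {inj₂ (x , p)} {inj₁ tt} q = ⊥-elim (no-e x p (sym (cong proj₁ q)))
     h-inj {inj₂ (x , p)} {inj₂ (y , p′)} q = cong inj₂ (Σ-prop-≡ (λ _ → uip) (cong proj₁ q))

   module _ (x^X : ∀ x → x ^ suc (suc t) ≡ x) where

     private
       pow-idem : ∀ x → x ^ suc t ⊗ x ^ suc t ≡ x ^ suc t
       pow-idem x = begin
         x ^ suc t ⊗ x ^ suc t   ≡⟨ cong (_⊗ x ^ suc t) (*-comm x (x ^ t)) ⟩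
         x ^ t ⊗ x ⊗ x ^ suc t   ≡⟨ mulˡ (x ^ t) (x^X x) ⟩
         x ^ t ⊗ x               ≡⟨ *-comm (x ^ t) x ⟩
         x ^ suc t ∎
         where open ≡-Reasoning

     split : ∀ fuel e → e ⊗ e ≡ e → card (finite-Below e) ≤ fuel → SplitList e
     split zero e ee c = ⊥-elim (Nat.<⇒≱ (Nat.≤-<-trans z≤n (Fin.toℕ<n (Finite.idx (finite-Below e) (e , ee)))) c)
       where import Data.Fin.Properties as Fin
     split (suc fuel) e ee c = decide (e ≟ 𝟘)
       where
       Bad : Carrier → Set
       Bad x = e ⊗ x ≡ x × x ≢ 𝟘 × x ^ suc t ≢ e
       bad? : ∀ x → Dec (Bad x)
       bad? x = ((e ⊗ x) ≟ x) ×-dec (¬? (x ≟ 𝟘) ×-dec ¬? ((x ^ suc t) ≟ e))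
       search : e ≢ 𝟘 → Dec (Σ Carrier Bad) → SplitList e
       search e≢0 (no none) = record
         { es = e ∷ [] ; orth = [] ∷ [] ; below = ee ∷ [] ; total = +-identityʳ e
         ; prim = (ee , e≢0 , prm) ∷ [] }
         where
         prm : ∀ x → e ⊗ x ≡ x → x ≢ 𝟘 → x ^ suc t ≡ e
         prm x p nz with (x ^ suc t) ≟ e
         ... | yes q = q
         ... | no nq = ⊥-elim (none (x , p , nz , nq))
       search e≢0 (yes (x , p , nz , ne)) = record
         { es = S.es ++ T.es
         ; orth = AllPairsₚ.++⁺ S.orth T.orth (All.map (λ {a} af → All.map (λ {b} bg → cross a b af bg) T.below) S.below)
         ; prim = Allₚ.++⁺ S.prim T.prim
         ; below = Allₚ.++⁺ (All.map (λ {a} af → trans (cong (_⊗ e) (sym af)) (trans (mulˡ a (trans (*-comm f e) ef)) af)) S.below)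
                            (All.map (λ {b} bg → trans (cong (_⊗ e) (sym bg)) (trans (mulˡ b (trans (*-comm g e) eg)) bg)) T.below)
         ; total = trans (sumL-++ S.es T.es) (trans (cong₂ _⊕_ S.total T.total) f+g) }
         where
         -- Since `x · f = x` is nonzero, so is `f`; and `f ≢ e` by the choice of `x`. Thus
         -- `e = f + g` is a proper orthogonal decomposition.
         f = x ^ suc t
         g = e ⊕ ⊖ f
         ff = pow-idem x
         ef : e ⊗ f ≡ f
         ef = trans (sym (*-assoc e x (x ^ t))) (cong (_⊗ x ^ t) p)
         f≢0 : f ≢ 𝟘
         f≢0 q = nz (trans (sym (x^X x)) (trans (cong (x ⊗_) q) (zeroʳ x)))
         f+g : f ⊕ g ≡ e
         f+g = trans (cong (f ⊕_) (+-comm e (⊖ f))) (trans (sym (+-assoc f (⊖ f) e)) (trans (cong (_⊕ e) (-‿inverseʳ f)) (+-identityˡ e)))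
         open import Algebra.Properties.Ring ring using (-‿distribʳ-*)
         mul-g : ∀ a → a ⊗ g ≡ a ⊗ e ⊕ ⊖ (a ⊗ f)
         mul-g a = trans (distribˡ a e (⊖ f)) (cong (a ⊗ e ⊕_) (sym (-‿distribʳ-* a f)))
         eg : e ⊗ g ≡ g
         eg = trans (mul-g e) (cong₂ (λ a b → a ⊕ ⊖ b) ee ef)
         fg : f ⊗ g ≡ 𝟘
         fg = trans (mul-g f) (trans (cong₂ (λ a b → a ⊕ ⊖ b) (trans (*-comm f e) ef) ff) (-‿inverseʳ f))
         gg : g ⊗ g ≡ g
         gg = trans (mul-g g) (trans (cong₂ (λ a b → a ⊕ ⊖ b) (trans (*-comm g e) eg) (trans (*-comm g f) fg))
                (trans (cong (g ⊕_) (trans (sym (+-identityˡ _)) (-‿inverseʳ 𝟘))) (+-identityʳ g)))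
         g≢e : g ≢ e
         g≢e q = f≢0 (trans (sym ef) (trans (cong (_⊗ f) (sym q)) (trans (*-comm g f) fg)))
         cross : ∀ a b → a ⊗ f ≡ a → b ⊗ g ≡ b → a ⊗ b ≡ 𝟘
         cross a b af bg = begin
           a ⊗ b ≡⟨ cong₂ _⊗_ (sym af) (trans (sym bg) (*-comm b g)) ⟩
           a ⊗ f ⊗ (g ⊗ b) ≡⟨ *-assoc a f (g ⊗ b) ⟩
           a ⊗ (f ⊗ (g ⊗ b)) ≡⟨ cong (a ⊗_) (trans (sym (*-assoc f g b)) (trans (cong (_⊗ b) fg) (zeroˡ b))) ⟩
           a ⊗ 𝟘 ≡⟨ zeroʳ a ⟩
           𝟘 ∎
           where open ≡-Reasoning
         module S = SplitList (split fuel f ff (Nat.≤-pred (Nat.<-≤-trans (below-smaller ee ef ne) c)))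
         module T = SplitList (split fuel g gg (Nat.≤-pred (Nat.<-≤-trans (below-smaller ee eg g≢e) c)))
       decide : Dec (e ≡ 𝟘) → SplitList e
       decide (yes e≡0) = record { es = [] ; orth = [] ; prim = [] ; below = [] ; total = sym e≡0 }
       decide (no e≢0) = search e≢0 (Finite.any? finiteC bad?)

     splitting : Splitting A
     splitting = record
       { k = length es ; e = lookup es
       ; idem = λ i → proj₁ (pr i)
       ; orth = λ {i} {j} → pairs orth {i} {j}
       ; total = trans (go es) total
       ; nonzero = λ i → proj₁ (proj₂ (pr i))
       ; invert = λ i x p nz → x ^ t , trans (*-comm (x ^ t) x) (proj₂ (proj₂ (pr i)) x p nz) }
       where
       open SplitList (split (card (finite-Below 𝟙)) 𝟙 (*-identityˡ 𝟙) Nat.≤-refl)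
       pr : ∀ i → Primitive (lookup es i)
       pr i = All.lookup prim (∈-lookup i)
       pairs : ∀ {es} → AllPairs Orth es → ∀ {i j} → i ≢ j → lookup es i ⊗ lookup es j ≡ 𝟘
       pairs (o ∷ os) {zero}  {zero}  ne = ⊥-elim (ne refl)
       pairs {e ∷ es} (o ∷ os) {zero}  {suc j} ne = All.lookup o (∈-lookup j)
       pairs {e ∷ es} (o ∷ os) {suc i} {zero}  ne = trans (*-comm _ _) (All.lookup o (∈-lookup i))
       pairs (o ∷ os) {suc i} {suc j} ne = pairs os (ne ∘ cong suc)
       go : ∀ es → sum (lookup es) ≡ sumL es
       go []       = refl
       go (x ∷ es) = cong (x ⊕_) (go es)

 -- The field e·A attached to a primitive idempotent e.
 module _ {A : CRing} (S : Splitting A) where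
   open CRing A
   open Splitting S
   open SplittingP S using (corner)

   cornerField : Fin k → FiniteField
   cornerField i = record
     { Carrier = V ; _+_ = _+ᵥ_ ; _*_ = _*ᶜ_ ; -_ = -ᵥ_ ; 0# = 0ᵥ ; 1# = e i , idem i
     ; isCommutativeRing = record
       { isRing = record
         { +-isAbelianGroup = isAbelianGroup
         ; *-cong = cong₂ _*ᶜ_
         ; *-assoc = λ a b c → pr (*-assoc _ _ _)
         ; *-identity = (λ a → pr (proj₂ a)) , (λ a → pr (trans (*-comm _ _) (proj₂ a)))
         ; distrib = (λ a b c → pr (distribˡ _ _ _)) , (λ a b c → pr (distribʳ _ _ _)) }
       ; *-comm = λ a b → pr (*-comm _ _) }
     ; 0≢1 = λ h → nonzero i (sym (cong proj₁ h))
     ; inverse = λ (x , p) nz → let (y , h) = invert i x p (nz ∘ pr) in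
         (e i ⊗ y , trans (sym (*-assoc _ _ _)) (cong (_⊗ y) (idem i))) ,
         pr (trans (*-comm x _) (trans (*-assoc (e i) y x) (trans (cong (e i ⊗_) h) (idem i))))
     ; _≟_ = _≟ᵥ_
     ; elements = List.tabulate (Finite.enum finiteV)
     ; complete = λ x → subst (_∈ List.tabulate (Finite.enum finiteV)) (Finite.enum-idx finiteV x) (∈-tabulate⁺ (Finite.idx finiteV x))
     ; unique = Uniqueₚ.tabulate⁺ (λ {i} {j} h → trans (sym (Finite.idx-enum finiteV i)) (trans (cong (Finite.idx finiteV) h) (Finite.idx-enum finiteV j))) }
     where
     open Module (corner i)
     pr : ∀ {s t : V} → proj₁ s ≡ proj₁ t → s ≡ t
     pr = Σ-prop-≡ (λ _ → uip)
     _*ᶜ_ : V → V → V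
     (a , p) *ᶜ (b , q) = a ⊗ b , trans (sym (*-assoc _ _ _)) (cong (_⊗ b) p)

   cornerField-size : ∀ i → FiniteField.size (cornerField i) ≡ SplittingP.Q S i
   cornerField-size i = Listₚ.length-tabulate _

-- The Frobenius map and Fermat's theorem in finite fields

module FieldFacts where
 open import Defs using (FiniteField)
 open Counting
 open Rings
 open import Level using (0ℓ)
 open import Data.Nat.Combinatorics using (_C_)

 absorption : ∀ n k → suc k Nat.* (suc n C suc k) ≡ suc n Nat.* (n C k)
 absorption zero    zero    = refl
 absorption zero    (suc k) = trans (cong (suc (suc k) Nat.*_) (k>n⇒nCk≡0 {1} {suc (suc k)} (s≤s (s≤s z≤n)))) (trans (Nat.*-zeroʳ (suc (suc k))) (sym (trans (cong (1 Nat.*_) (k>n⇒nCk≡0 {0} {suc k} (s≤s z≤n))) refl)))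
 absorption (suc n) zero    = begin
   1 Nat.* (suc (suc n) C 1)              ≡⟨ Nat.*-identityˡ _ ⟩
   suc (suc n) C 1                      ≡⟨ sym (nCk+nC[k+1]≡[n+1]C[k+1] (suc n) 0) ⟩
   (suc n C 0) Nat.+ (suc n C 1)          ≡⟨ cong₂ Nat._+_ (refl {x = 1}) (trans (sym (Nat.*-identityˡ _)) (absorption n 0)) ⟩
   1 Nat.+ suc n Nat.* 1                    ≡⟨⟩
   suc (suc n) Nat.* 1 ∎
   where open ≡-Reasoning
 absorption (suc n) (suc k) = begin
   suc (suc k) Nat.* (suc (suc n) C suc (suc k))
     ≡⟨ cong (suc (suc k) Nat.*_) (sym (nCk+nC[k+1]≡[n+1]C[k+1] (suc n) (suc k))) ⟩
   suc (suc k) Nat.* (c Nat.+ (suc n C suc (suc k)))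
     ≡⟨ Nat.*-distribˡ-+ (suc (suc k)) c _ ⟩
   (c Nat.+ suc k Nat.* c) Nat.+ suc (suc k) Nat.* (suc n C suc (suc k))
     ≡⟨ cong₂ (λ a b → (c Nat.+ a) Nat.+ b) (absorption n k) (absorption n (suc k)) ⟩
   (c Nat.+ suc n Nat.* (n C k)) Nat.+ suc n Nat.* (n C suc k)
     ≡⟨ Nat.+-assoc c _ _ ⟩
   c Nat.+ (suc n Nat.* (n C k) Nat.+ suc n Nat.* (n C suc k))
     ≡⟨ cong (c Nat.+_) (trans (sym (Nat.*-distribˡ-+ (suc n) (n C k) _)) (cong (suc n Nat.*_) (nCk+nC[k+1]≡[n+1]C[k+1] n k))) ⟩
   suc (suc n) Nat.* (suc n C suc k) ∎
   where
   open ≡-Reasoning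
   c = suc n C suc k

 -- By `absorption`, `ℓ` divides `k · (ℓ C k)`, and it does not divide `k`.
 prime∣C : ∀ {ℓ} → Prime ℓ → ∀ k → 0 < k → k < ℓ → ℓ ∣ (ℓ C k)
 prime∣C {suc ℓ} pr (suc k) _ k<ℓ with euclidsLemma (suc k) (suc ℓ C suc k) pr (subst (suc ℓ ∣_) (sym (absorption ℓ k)) (m∣m*n (ℓ C k)))
 ... | inj₁ d = ⊥-elim (Nat.<⇒≱ k<ℓ (∣⇒≤ d))
 ... | inj₂ d = d

 module Frobenius (A : CRing) where
   open CRing A
   open import Algebra.Properties.Semiring.Mult semiring using (×-homo-+; ×-assoc-*; ×1-homo-*; ×-assocˡ) renaming (_×_ to _×ₙ_)
   import Algebra.Properties.CommutativeSemiring.Binomial commutativeSemiring as Bin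

   ×-zero : ∀ n → n ×ₙ 𝟘 ≡ 𝟘
   ×-zero zero    = refl
   ×-zero (suc n) = trans (+-identityˡ _) (×-zero n)

   char-kills : ∀ {ℓ} → ℓ ×ₙ 𝟙 ≡ 𝟘 → ∀ m x → ℓ ∣ m → m ×ₙ x ≡ 𝟘
   char-kills {ℓ} h m x (divides c refl) = trans (sym (×-assocˡ x c ℓ)) (trans (cong (c ×ₙ_)
     (trans (cong (ℓ ×ₙ_) (sym (*-identityˡ x))) (trans (sym (×-assoc-* ℓ 𝟙 x)) (trans (cong (_⊗ x) h) (zeroˡ x))))) (×-zero c))

   module _ {ℓ : ℕ} (pr : Prime ℓ) (h : ℓ ×ₙ 𝟙 ≡ 𝟘) where

     frobenius : ∀ x y → (x ⊕ y) ^ ℓ ≡ x ^ ℓ ⊕ y ^ ℓ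
     frobenius x y = trans (Bin.theorem ℓ x y) (go ℓ pr h)
       where
       go : ∀ ℓ → Prime ℓ → ℓ ×ₙ 𝟙 ≡ 𝟘 → Bin.binomialExpansion x y ℓ ≡ x ^ ℓ ⊕ y ^ ℓ
       go zero pr h = ⊥-elim (Nat.≢-nonZero⁻¹ 0 {{prime⇒nonZero pr}} refl)
       go (suc ℓ) pr h = begin
         sum (Bin.binomialTerm x y (suc ℓ))
           ≡⟨ cong₂ _⊕_ (trans (+-identityʳ _) (*-identityˡ _)) (sum-init-last {suc-n} (Bin.binomialTerm x y (suc ℓ) ∘ suc)) ⟩
         y ^ suc ℓ ⊕ (sum (λ j → Bin.binomialTerm x y (suc ℓ) (suc (inject₁ j))) ⊕ Bin.binomialTerm x y (suc ℓ) (fromℕ (suc ℓ)))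
           ≡⟨ cong (y ^ suc ℓ ⊕_) (cong₂ _⊕_ (trans (sum-cong-≗ middle) (sum-replicate-zero ℓ)) last-term) ⟩
         y ^ suc ℓ ⊕ (𝟘 ⊕ x ^ suc ℓ) ≡⟨ trans (cong (y ^ suc ℓ ⊕_) (+-identityˡ _)) (+-comm _ _) ⟩
         x ^ suc ℓ ⊕ y ^ suc ℓ ∎
         where
         open ≡-Reasoning
         suc-n = ℓ
         middle : ∀ (j : Fin ℓ) → Bin.binomialTerm x y (suc ℓ) (suc (inject₁ j)) ≡ 𝟘
         middle j = char-kills h _ _ (prime∣C pr (suc (toℕ (inject₁ j))) (s≤s z≤n) (s≤s (subst (_< ℓ) (sym (Finₚ.toℕ-inject₁ j)) (Finₚ.toℕ<n j))))
         last-term : Bin.binomialTerm x y (suc ℓ) (fromℕ (suc ℓ)) ≡ x ^ suc ℓ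
         last-term rewrite Finₚ.toℕ-fromℕ ℓ | nCn≡1 (suc ℓ) | Nat.n∸n≡0 ℓ = trans (+-identityʳ _) (*-identityʳ _)

     frobenius^ : ∀ e x y → (x ⊕ y) ^ (ℓ Nat.^ e) ≡ x ^ (ℓ Nat.^ e) ⊕ y ^ (ℓ Nat.^ e)
     frobenius^ zero    x y = trans (*-identityʳ _) (cong₂ _⊕_ (sym (*-identityʳ x)) (sym (*-identityʳ y)))
     frobenius^ (suc e) x y = begin
       (x ⊕ y) ^ (ℓ Nat.* ℓ Nat.^ e) ≡⟨ sym (^-assocʳ (x ⊕ y) ℓ (ℓ Nat.^ e)) ⟩
       ((x ⊕ y) ^ ℓ) ^ (ℓ Nat.^ e) ≡⟨ cong (_^ (ℓ Nat.^ e)) (frobenius x y) ⟩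
       (x ^ ℓ ⊕ y ^ ℓ) ^ (ℓ Nat.^ e) ≡⟨ frobenius^ e _ _ ⟩
       (x ^ ℓ) ^ (ℓ Nat.^ e) ⊕ (y ^ ℓ) ^ (ℓ Nat.^ e) ≡⟨ cong₂ _⊕_ (^-assocʳ x ℓ _) (^-assocʳ y ℓ _) ⟩
       x ^ (ℓ Nat.* ℓ Nat.^ e) ⊕ y ^ (ℓ Nat.* ℓ Nat.^ e) ∎
       where open ≡-Reasoning

     frobenius^-zero : ∀ e → 𝟘 ^ (ℓ Nat.^ e) ≡ 𝟘
     frobenius^-zero e = go (ℓ Nat.^ e) {{Nat.m^n≢0 ℓ e {{prime⇒nonZero pr}}}}
       where
       go : ∀ n → {{Nat.NonZero n}} → 𝟘 ^ n ≡ 𝟘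
       go (suc n) = zeroˡ _

     frobenius^-sum : ∀ e {n} (f : Fin n → Carrier) → sum f ^ (ℓ Nat.^ e) ≡ sum (λ i → f i ^ (ℓ Nat.^ e))
     frobenius^-sum e {zero}  f = frobenius^-zero e
     frobenius^-sum e {suc n} f = trans (frobenius^ e _ _) (cong (f zero ^ (ℓ Nat.^ e) ⊕_) (frobenius^-sum e (f ∘ suc)))

 module FieldOrder (K : FiniteField) where
   open FiniteField K using (size; inverse; 0≢1)
   open CRing (fieldRing K) public hiding (_≟_)
   open CRing (fieldRing K) using (_≟_)
   open Frobenius (fieldRing K)
   open import Algebra.Properties.Semiring.Mult semiring using (×1-homo-*) renaming (_×_ to _×ₙ_)
   open Finite finiteC
   import Algebra.Properties.CommutativeMonoid.Sum (CommutativeRing.*-commutativeMonoid (CRing.commutativeRing (fieldRing K))) as Prod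
   open import Algebra.Properties.Group +-group using (∙-cancelˡ)

   cancelˡ : ∀ c {x y} → c ≢ 𝟘 → c ⊗ x ≡ c ⊗ y → x ≡ y
   cancelˡ c {x} {y} nz h with inverse c nz
   ... | d , cd = trans (sym (lem x)) (trans (cong (d ⊗_) h) (lem y))
     where
     lem : ∀ x → d ⊗ (c ⊗ x) ≡ x
     lem x = trans (sym (*-assoc d c x)) (trans (cong (_⊗ x) (trans (*-comm d c) cd)) (*-identityˡ x))

   no-zero-divisors : ∀ {x y} → x ⊗ y ≡ 𝟘 → x ≢ 𝟘 → y ≡ 𝟘
   no-zero-divisors {x} h nz = cancelˡ x nz (trans h (sym (zeroʳ x)))

   private
     perm : (f g : Carrier → Carrier) → (∀ x → f (g x) ≡ x) → (∀ x → g (f x) ≡ x) → Permutation (card finiteC) (card finiteC)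
     perm f g fg gf = ↔-trans (↔-sym (iso finiteC)) (↔-trans (mk↔ₛ′ f g fg gf) (iso finiteC))

   -- Translation by `𝟙` permutes the field, so the sum of all elements is unchanged when `size`
   -- copies of `𝟙` are added to it.
   size×1 : size ×ₙ 𝟙 ≡ 𝟘
   size×1 = sym (∙-cancelˡ (sum enum) _ _ (trans (+-identityʳ _) (trans (sum-permute enum π)
       (trans (sum-cong-≗ (λ i → enum-idx (enum i ⊕ 𝟙))) (trans (∑-distrib-+ enum (λ _ → 𝟙)) (cong (sum enum ⊕_) (sum-replicate size)))))))
     where
     π = perm (_⊕ 𝟙) (_⊕ ⊖ 𝟙) (λ x → trans (+-assoc x _ _) (trans (cong (x ⊕_) (-‿inverseˡ 𝟙)) (+-identityʳ x)))
                              (λ x → trans (+-assoc x _ _) (trans (cong (x ⊕_) (-‿inverseʳ 𝟙)) (+-identityʳ x)))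

   -- By `size×1` a power of `ℓ ×ₙ 𝟙` vanishes, and a field has no zero divisors.
   char : ∀ ℓ e → size ≡ ℓ Nat.^ e → ℓ ×ₙ 𝟙 ≡ 𝟘
   char ℓ e h = go e (subst (λ n → n ×ₙ 𝟙 ≡ 𝟘) h size×1)
     where
     go : ∀ e → (ℓ Nat.^ e) ×ₙ 𝟙 ≡ 𝟘 → ℓ ×ₙ 𝟙 ≡ 𝟘
     go zero    q = ⊥-elim (0≢1 (sym (trans (sym (+-identityʳ 𝟙)) q)))
     go (suc e) q with (ℓ ×ₙ 𝟙) ≟ 𝟘
     ... | yes z = z
     ... | no nz = go e (no-zero-divisors (trans (sym (×1-homo-* ℓ (ℓ Nat.^ e))) q) nz)

   private
     patch : ∀ {x : Carrier} → Dec (x ≡ 𝟘) → Carrier → Carrier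
     patch (yes _) c = 𝟙
     patch (no  _) c = c

     -- With zero replaced by `𝟙`, the product over the whole field becomes the product of its
     -- nonzero elements.
     unitPart : Carrier → Carrier
     unitPart x = patch (x ≟ 𝟘) x

     at-zero : ∀ {x} c (d : Dec (x ≡ 𝟘)) → x ≡ 𝟘 → patch d c ≡ 𝟙
     at-zero c (yes _) _ = refl
     at-zero c (no n)  p = ⊥-elim (n p)

     off-zero : ∀ {x} c (d : Dec (x ≡ 𝟘)) → x ≢ 𝟘 → patch d c ≡ c
     off-zero c (yes p) n = ⊥-elim (n p)
     off-zero c (no _)  _ = refl

     prod-nonzero : ∀ {n} (f : Fin n → Carrier) → (∀ i → f i ≢ 𝟘) → Prod.sum f ≢ 𝟘
     prod-nonzero {zero}  f h q = 0≢1 (sym q)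
     prod-nonzero {suc n} f h q = prod-nonzero (f ∘ suc) (h ∘ suc) (no-zero-divisors q (h zero))

     unitPart-nonzero : ∀ x → unitPart x ≢ 𝟘
     unitPart-nonzero x = go (x ≟ 𝟘)
       where
       go : (d : Dec (x ≡ 𝟘)) → patch d x ≢ 𝟘
       go (yes _) q = 0≢1 (sym q)
       go (no n)  q = n q

     prod-punched : ∀ {n} c (i₀ : Fin n) (f : Fin n → Carrier) → f i₀ ≡ 𝟙 → (∀ i → i ≢ i₀ → f i ≡ c) → Prod.sum f ≡ c ^ (n ∸ 1)
     prod-punched {suc n} c i₀ f h₀ h = trans (Prod.sum-remove {i = i₀} f) (trans (cong₂ _⊗_ h₀ refl) (trans (*-identityˡ _)
       (trans (Prod.sum-cong-≗ (λ j → h (punchIn i₀ j) (Finₚ.punchInᵢ≢i i₀ j))) (Prod.sum-replicate n))))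

   -- Multiplication by `c` permutes the field and multiplies the product of the nonzero elements by
   -- `c ^ (size ∸ 1)`.
   fermat : ∀ c → c ≢ 𝟘 → c ^ (size ∸ 1) ≡ 𝟙
   fermat c nz = cancelˡ Π Π≢0 (trans (*-comm Π _) (sym (trans (*-identityʳ Π) (trans (Prod.sum-permute (unitPart ∘ enum) π)
       (trans (Prod.sum-cong-≗ scale) (trans (Prod.∑-distrib-+ hc (unitPart ∘ enum)) (cong (_⊗ Π) hc-prod)))))))
     where
     d = proj₁ (inverse c nz)
     cd = proj₂ (inverse c nz)
     Π = Prod.sum (unitPart ∘ enum)
     Π≢0 : Π ≢ 𝟘
     Π≢0 = prod-nonzero (unitPart ∘ enum) (unitPart-nonzero ∘ enum)
     π = perm (c ⊗_) (d ⊗_) (λ x → trans (sym (*-assoc c d x)) (trans (cong (_⊗ x) cd) (*-identityˡ x)))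
                            (λ x → trans (sym (*-assoc d c x)) (trans (cong (_⊗ x) (trans (*-comm d c) cd)) (*-identityˡ x)))
     hc : Fin size → Carrier
     hc i = patch (enum i ≟ 𝟘) c
     scale-patch : ∀ x → unitPart (c ⊗ x) ≡ patch (x ≟ 𝟘) c ⊗ unitPart x
     scale-patch x = go (x ≟ 𝟘)
       where
       go : (e : Dec (x ≡ 𝟘)) → unitPart (c ⊗ x) ≡ patch e c ⊗ patch e x
       go (yes z) = trans (at-zero _ ((c ⊗ x) ≟ 𝟘) (trans (cong (c ⊗_) z) (zeroʳ c))) (sym (*-identityˡ 𝟙))
       go (no n)  = off-zero _ ((c ⊗ x) ≟ 𝟘) (λ q → n (no-zero-divisors q nz))
     scale : ∀ i → unitPart (enum (π ⟨$⟩ʳ i)) ≡ hc i ⊗ unitPart (enum i)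
     scale i = trans (cong unitPart (enum-idx (c ⊗ enum i))) (scale-patch (enum i))
     hc-prod : Prod.sum hc ≡ c ^ (size ∸ 1)
     hc-prod = prod-punched c (idx 𝟘) hc (at-zero c (enum (idx 𝟘) ≟ 𝟘) (enum-idx 𝟘))
       (λ i ne → off-zero c (enum i ≟ 𝟘) (λ q → ne (trans (sym (idx-enum i)) (cong idx q))))

   fermat′ : ∀ c → c ^ size ≡ c
   fermat′ c = go (c ≟ 𝟘) size (Finₚ.toℕ<n (idx 𝟘)) (fermat c)
     where
     go : Dec (c ≡ 𝟘) → ∀ s → toℕ (idx 𝟘) < s → (c ≢ 𝟘 → c ^ (s ∸ 1) ≡ 𝟙) → c ^ s ≡ c
     go (yes z) (suc s) _ _ = trans (cong (_⊗ c ^ s) z) (trans (zeroˡ _) (sym z))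
     go (no nz) (suc s) _ h = trans (cong (c ⊗_) (h nz)) (*-identityʳ c)

-- The group algebra of a finite abelian group

module GroupAlg where
 open import Defs using (FiniteField)
 open Counting
 open Rings
 open Frames using (mkAbelianGroup)
 open FieldFacts
 open import Data.Vec using (lookup)

 -- The carrier is `Fin N` so that elements of the group algebra are vectors of length `N`.
 record AbGroup : Set where
   infixl 7 _∙_
   field
     N    : ℕ
     _∙_  : Fin N → Fin N → Fin N
     ε    : Fin N
     _⁻¹  : Fin N → Fin N
     assoc     : ∀ a b c → (a ∙ b) ∙ c ≡ a ∙ (b ∙ c)
     comm      : ∀ a b → a ∙ b ≡ b ∙ a
     identityˡ : ∀ a → ε ∙ a ≡ a
     inverseˡ  : ∀ a → (a ⁻¹) ∙ a ≡ ε

   cancel₁ : ∀ a b → (a ⁻¹) ∙ (a ∙ b) ≡ b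
   cancel₁ a b = trans (sym (assoc _ a b)) (trans (cong (_∙ b) (inverseˡ a)) (identityˡ b))

   cancel₂ : ∀ a b → a ∙ ((a ⁻¹) ∙ b) ≡ b
   cancel₂ a b = trans (sym (assoc a _ b)) (trans (cong (_∙ b) (trans (comm a _) (inverseˡ a))) (identityˡ b))

   left-cancel : ∀ a {b c} → a ∙ b ≡ a ∙ c → b ≡ c
   left-cancel a {b} {c} h = trans (sym (cancel₁ a b)) (trans (cong ((a ⁻¹) ∙_) h) (cancel₁ a c))

   ⁻¹-∙ : ∀ a b → (a ∙ b) ⁻¹ ≡ (a ⁻¹) ∙ (b ⁻¹)
   ⁻¹-∙ a b = left-cancel (a ∙ b) (trans (trans (comm (a ∙ b) _) (inverseˡ (a ∙ b))) (sym (begin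
     a ∙ b ∙ ((a ⁻¹) ∙ (b ⁻¹)) ≡⟨ cong (_∙ ((a ⁻¹) ∙ (b ⁻¹))) (comm a b) ⟩
     b ∙ a ∙ ((a ⁻¹) ∙ (b ⁻¹)) ≡⟨ assoc b a _ ⟩
     b ∙ (a ∙ ((a ⁻¹) ∙ (b ⁻¹))) ≡⟨ cong (b ∙_) (cancel₂ a _) ⟩
     b ∙ (b ⁻¹) ≡⟨ trans (comm b _) (inverseˡ b) ⟩
     ε ∎)))
     where open ≡-Reasoning

   ⁻¹-⁻¹ : ∀ a → (a ⁻¹) ⁻¹ ≡ a
   ⁻¹-⁻¹ a = left-cancel (a ⁻¹) (trans (trans (comm _ _) (inverseˡ (a ⁻¹))) (sym (inverseˡ a)))

   pow : Fin N → ℕ → Fin N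
   pow g zero    = ε
   pow g (suc n) = g ∙ pow g n

 module GroupAlgebra (K : FiniteField) (G : AbGroup) where
   open AbGroup G
   private
     module K = CRing (fieldRing K)
   open K using (_⊕_; _⊗_; 𝟘; 𝟙; ⊖_)
   open LinearMaps K using (δ; δ-refl; δ-sum)

   A : Set
   A = Vec K.Carrier N

   private
     module V = Module (vecModule (fieldRing K) N)

   coef : A → Fin N → K.Carrier
   coef = lookup

   infixl 7 _⊛_
   _⊛_ : A → A → A
   a ⊛ b = tabulate (λ g → K.sum (λ h → coef a h ⊗ coef b ((h ⁻¹) ∙ g)))

   ⊛-coef : ∀ a b g → coef (a ⊛ b) g ≡ K.sum (λ h → coef a h ⊗ coef b ((h ⁻¹) ∙ g))
   ⊛-coef a b g = Vecₚ.lookup∘tabulate _ g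

   γ : Fin N → A
   γ g = tabulate (δ g)

   γ-⊛ : ∀ g a k → coef (γ g ⊛ a) k ≡ coef a ((g ⁻¹) ∙ k)
   γ-⊛ g a k = trans (⊛-coef (γ g) a k) (trans (K.sum-cong-≗ (λ h → cong (_⊗ coef a ((h ⁻¹) ∙ k)) (Vecₚ.lookup∘tabulate (δ g) h)))
                 (δ-sum g (λ h → coef a ((h ⁻¹) ∙ k))))

   private
     shift : Fin N → Permutation N N
     shift a = mk↔ₛ′ (a ∙_) ((a ⁻¹) ∙_) (cancel₂ a) (cancel₁ a)

     flip : Fin N → Permutation N N
     flip g = mk↔ₛ′ (λ k → (k ⁻¹) ∙ g) (λ k → (k ⁻¹) ∙ g) inv inv
       where
       inv : ∀ k → (((k ⁻¹) ∙ g) ⁻¹) ∙ g ≡ k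
       inv k = trans (cong (_∙ g) (trans (⁻¹-∙ _ g) (cong (_∙ (g ⁻¹)) (⁻¹-⁻¹ k)))) (trans (assoc k _ g) (trans (cong (k ∙_) (inverseˡ g)) (trans (comm k ε) (identityˡ k))))

   ⊛-comm : ∀ a b → a ⊛ b ≡ b ⊛ a
   ⊛-comm a b = vec-ext (λ g → trans (⊛-coef a b g) (trans (K.sum-permute (λ h → coef a h ⊗ coef b ((h ⁻¹) ∙ g)) (flip g))
     (trans (K.sum-cong-≗ (λ k → trans (K.*-comm (coef a ((k ⁻¹) ∙ g)) (coef b ((((k ⁻¹) ∙ g) ⁻¹) ∙ g))) (cong (λ z → coef b z ⊗ coef a ((k ⁻¹) ∙ g)) (inv g k)))) (sym (⊛-coef b a g)))))
     where
     inv : ∀ g k → (((k ⁻¹) ∙ g) ⁻¹) ∙ g ≡ k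
     inv g k = trans (cong (_∙ g) (trans (⁻¹-∙ _ g) (cong (_∙ (g ⁻¹)) (⁻¹-⁻¹ k)))) (trans (assoc k _ g) (trans (cong (k ∙_) (inverseˡ g)) (trans (comm k ε) (identityˡ k))))

   ⊛-assoc : ∀ a b c → (a ⊛ b) ⊛ c ≡ a ⊛ (b ⊛ c)
   ⊛-assoc a b c = vec-ext (λ g → begin
     coef ((a ⊛ b) ⊛ c) g ≡⟨ ⊛-coef (a ⊛ b) c g ⟩
     K.sum (λ k → coef (a ⊛ b) k ⊗ coef c ((k ⁻¹) ∙ g))
       ≡⟨ K.sum-cong-≗ (λ k → trans (cong (_⊗ coef c ((k ⁻¹) ∙ g)) (⊛-coef a b k)) (K.*-distribʳ-sum (coef c ((k ⁻¹) ∙ g)) (λ h → coef a h ⊗ coef b ((h ⁻¹) ∙ k)))) ⟩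
     K.sum (λ k → K.sum (λ h → coef a h ⊗ coef b ((h ⁻¹) ∙ k) ⊗ coef c ((k ⁻¹) ∙ g)))
       ≡⟨ K.∑-comm (λ k h → coef a h ⊗ coef b ((h ⁻¹) ∙ k) ⊗ coef c ((k ⁻¹) ∙ g)) ⟩
     K.sum (λ h → K.sum (λ k → coef a h ⊗ coef b ((h ⁻¹) ∙ k) ⊗ coef c ((k ⁻¹) ∙ g)))
       ≡⟨ K.sum-cong-≗ (λ h → trans (K.sum-cong-≗ (λ k → K.*-assoc (coef a h) (coef b ((h ⁻¹) ∙ k)) (coef c ((k ⁻¹) ∙ g))))
            (trans (sym (K.*-distribˡ-sum (coef a h) (λ k → coef b ((h ⁻¹) ∙ k) ⊗ coef c ((k ⁻¹) ∙ g)))) (cong (coef a h ⊗_) (inner h g)))) ⟩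
     K.sum (λ h → coef a h ⊗ coef (b ⊛ c) ((h ⁻¹) ∙ g)) ≡⟨ sym (⊛-coef a (b ⊛ c) g) ⟩
     coef (a ⊛ (b ⊛ c)) g ∎)
     where
     open ≡-Reasoning
     inner : ∀ h g → K.sum (λ k → coef b ((h ⁻¹) ∙ k) ⊗ coef c ((k ⁻¹) ∙ g)) ≡ coef (b ⊛ c) ((h ⁻¹) ∙ g)
     inner h g = trans (K.sum-permute (λ k → coef b ((h ⁻¹) ∙ k) ⊗ coef c ((k ⁻¹) ∙ g)) (shift h))
       (trans (K.sum-cong-≗ (λ k → cong₂ (λ x y → coef b x ⊗ coef c y) (cancel₁ h k)
          (trans (cong (_∙ g) (trans (⁻¹-∙ h k) (comm _ _))) (assoc _ _ g)))) (sym (⊛-coef b c ((h ⁻¹) ∙ g))))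

   ⊛-identityˡ : ∀ a → γ ε ⊛ a ≡ a
   ⊛-identityˡ a = vec-ext (λ g → trans (γ-⊛ ε a g) (cong (coef a) (trans (cong (_∙ g) ε⁻¹) (identityˡ g))))
     where
     ε⁻¹ : ε ⁻¹ ≡ ε
     ε⁻¹ = trans (trans (sym (identityˡ _)) (comm ε _)) (inverseˡ ε)

   ⊛-distribˡ : ∀ a b c → a ⊛ (b V.+ᵥ c) ≡ (a ⊛ b) V.+ᵥ (a ⊛ c)
   ⊛-distribˡ a b c = vec-ext (λ g → trans (⊛-coef a (b V.+ᵥ c) g) (trans
     (K.sum-cong-≗ (λ h → trans (cong (coef a h ⊗_) (Vecₚ.lookup-zipWith _⊕_ ((h ⁻¹) ∙ g) b c)) (K.distribˡ (coef a h) (coef b ((h ⁻¹) ∙ g)) (coef c ((h ⁻¹) ∙ g)))))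
     (trans (K.∑-distrib-+ (λ h → coef a h ⊗ coef b ((h ⁻¹) ∙ g)) (λ h → coef a h ⊗ coef c ((h ⁻¹) ∙ g)))
     (sym (trans (Vecₚ.lookup-zipWith _⊕_ g (a ⊛ b) (a ⊛ c)) (cong₂ _⊕_ (⊛-coef a b g) (⊛-coef a c g)))))))

   groupRing : CRing
   groupRing = record
     { Carrier = A ; _⊕_ = V._+ᵥ_ ; _⊗_ = _⊛_ ; ⊖_ = V.-ᵥ_ ; 𝟘 = V.0ᵥ ; 𝟙 = γ ε
     ; isCommutativeRing = record
       { isRing = record
         { +-isAbelianGroup = V.isAbelianGroup
         ; *-cong = cong₂ _⊛_ ; *-assoc = ⊛-assoc
         ; *-identity = ⊛-identityˡ , (λ a → trans (⊛-comm a (γ ε)) (⊛-identityˡ a))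
         ; distrib = ⊛-distribˡ , (λ a b c → trans (⊛-comm (b V.+ᵥ c) a) (trans (⊛-distribˡ a b c) (cong₂ V._+ᵥ_ (⊛-comm a b) (⊛-comm a c)))) }
       ; *-comm = ⊛-comm }
     ; finiteC = V.finiteV }

   private
     module R = CRing groupRing

   γ-∙ : ∀ g h → γ g ⊛ γ h ≡ γ (g ∙ h)
   γ-∙ g h = vec-ext (λ k → trans (γ-⊛ g (γ h) k) (trans (Vecₚ.lookup∘tabulate (δ h) _) (trans (δ-cong k) (sym (Vecₚ.lookup∘tabulate (δ (g ∙ h)) k)))))
     where
     δ-cong : ∀ k → δ h ((g ⁻¹) ∙ k) ≡ δ (g ∙ h) k
     δ-cong k with h Fin.≟ ((g ⁻¹) ∙ k) | (g ∙ h) Fin.≟ k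
     ... | yes _ | yes _ = refl
     ... | no  _ | no  _ = refl
     ... | yes p | no np = ⊥-elim (np (trans (cong (g ∙_) p) (cancel₂ g k)))
     ... | no np | yes p = ⊥-elim (np (trans (sym (cancel₁ g h)) (cong ((g ⁻¹) ∙_) p)))

   γ-pow : ∀ g n → γ g R.^ n ≡ γ (pow g n)
   γ-pow g zero    = refl
   γ-pow g (suc n) = trans (cong (γ g ⊛_) (γ-pow g n)) (γ-∙ g (pow g n))

   ι : K.Carrier → A
   ι c = c V.· γ ε

   scale-⊛ : ∀ c a b → (c V.· a) ⊛ b ≡ c V.· (a ⊛ b)
   scale-⊛ c a b = vec-ext (λ g → trans (⊛-coef (c V.· a) b g) (trans
     (K.sum-cong-≗ (λ h → trans (cong (_⊗ coef b ((h ⁻¹) ∙ g)) (Vecₚ.lookup-map h (c ⊗_) a)) (K.*-assoc c (coef a h) (coef b ((h ⁻¹) ∙ g)))))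
     (trans (sym (K.*-distribˡ-sum c (λ h → coef a h ⊗ coef b ((h ⁻¹) ∙ g))))
     (sym (trans (Vecₚ.lookup-map g (c ⊗_) (a ⊛ b)) (cong (c ⊗_) (⊛-coef a b g)))))))

   ι-⊛ : ∀ c a → ι c ⊛ a ≡ c V.· a
   ι-⊛ c a = trans (scale-⊛ c (γ ε) a) (cong (c V.·_) (⊛-identityˡ a))

   ι-+ : ∀ a b → ι (a ⊕ b) ≡ ι a V.+ᵥ ι b
   ι-+ a b = V.·-distribʳ a b (γ ε)

   ι-* : ∀ a b → ι (a ⊗ b) ≡ ι a ⊛ ι b
   ι-* a b = trans (V.·-assoc a b (γ ε)) (sym (ι-⊛ a (ι b)))

   ι-1 : ι 𝟙 ≡ γ ε
   ι-1 = V.·-identity (γ ε)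

   ι-pow : ∀ c n → ι c R.^ n ≡ ι (c K.^ n)
   ι-pow c zero    = sym ι-1
   ι-pow c (suc n) = trans (cong (ι c ⊛_) (ι-pow c n)) (sym (ι-* c (c K.^ n)))

   expand : ∀ a → a ≡ R.sum (λ g → ι (coef a g) ⊛ γ g)
   expand a = trans (LinearMaps.decompose K a) (R.sum-cong-≗ (λ g → sym (ι-⊛ (coef a g) (γ g))))

   -- If every group element satisfies g^(q^m) = g on e·A then so does every element of e·A.
   module _ {ℓ : ℕ} (pr : Prime ℓ) (c : ℕ) (size≡ : FiniteField.size K ≡ ℓ Nat.^ c) where
     private
       q = FiniteField.size K
       open import Algebra.Properties.Semiring.Mult R.semiring using () renaming (_×_ to _×ₙ_)
       open import Algebra.Properties.Semiring.Mult K.semiring using () renaming (_×_ to _×ₖ_)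

       ι-× : ∀ n → n ×ₙ R.𝟙 ≡ ι (n ×ₖ 𝟙)
       ι-× zero    = sym (V.·-zeroˡ (γ ε))
       ι-× (suc n) = trans (cong₂ V._+ᵥ_ (sym ι-1) (ι-× n)) (sym (ι-+ 𝟙 (n ×ₖ 𝟙)))

       char0 : ℓ ×ₙ R.𝟙 ≡ R.𝟘
       char0 = trans (ι-× ℓ) (trans (cong ι (FieldOrder.char K ℓ c size≡)) (V.·-zeroˡ (γ ε)))

       open Frobenius groupRing

       qm : ∀ m → q Nat.^ m ≡ ℓ Nat.^ (c Nat.* m)
       qm m = trans (cong (Nat._^ m) size≡) (Nat.^-*-assoc ℓ c m)

     scalar-fixed : ∀ x m → x K.^ (q Nat.^ m) ≡ x
     scalar-fixed x zero    = K.*-identityʳ x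
     scalar-fixed x (suc m) = trans (sym (K.^-assocʳ x q (q Nat.^ m))) (trans (cong (K._^ (q Nat.^ m)) (FieldOrder.fermat′ K x)) (scalar-fixed x m))

     frobenius-fixed : ∀ m e → e ⊛ e ≡ e → (∀ g → (γ g R.^ (q Nat.^ m)) ⊛ e ≡ γ g ⊛ e) → ∀ x → (x R.^ (q Nat.^ m)) ⊛ e ≡ x ⊛ e
     frobenius-fixed m e ee h x = begin
       (x R.^ (q Nat.^ m)) ⊛ e
         ≡⟨ cong (λ z → (z R.^ (q Nat.^ m)) ⊛ e) (expand x) ⟩
       (R.sum (λ g → ι (coef x g) ⊛ γ g) R.^ (q Nat.^ m)) ⊛ e
         -- The exponent is a power of the characteristic `ℓ`, so raising to it is additive; the
         -- scalars are fixed by `scalar-fixed`.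
         ≡⟨ cong (_⊛ e) (trans (cong (R.sum (λ g → ι (coef x g) ⊛ γ g) R.^_) (qm m))
              (trans (frobenius^-sum pr char0 (c Nat.* m) (λ g → ι (coef x g) ⊛ γ g)) (R.sum-cong-≗ (λ g → cong ((ι (coef x g) ⊛ γ g) R.^_) (sym (qm m)))))) ⟩
       R.sum (λ g → (ι (coef x g) ⊛ γ g) R.^ (q Nat.^ m)) ⊛ e
         ≡⟨ R.*-distribʳ-sum e (λ g → (ι (coef x g) ⊛ γ g) R.^ (q Nat.^ m)) ⟩
       R.sum (λ g → ((ι (coef x g) ⊛ γ g) R.^ (q Nat.^ m)) ⊛ e)
         ≡⟨ R.sum-cong-≗ (λ g → trans (cong (_⊛ e) (trans (R.^-distrib-* (ι (coef x g)) (γ g) (q Nat.^ m))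
              (cong (_⊛ (γ g R.^ (q Nat.^ m))) (trans (ι-pow (coef x g) (q Nat.^ m)) (cong ι (scalar-fixed (coef x g) m))))))
              (trans (R.*-assoc (ι (coef x g)) (γ g R.^ (q Nat.^ m)) e) (trans (cong (ι (coef x g) ⊛_) (h g)) (sym (R.*-assoc (ι (coef x g)) (γ g) e))))) ⟩
       R.sum (λ g → ι (coef x g) ⊛ γ g ⊛ e)
         ≡⟨ sym (R.*-distribʳ-sum e (λ g → ι (coef x g) ⊛ γ g)) ⟩
       R.sum (λ g → ι (coef x g) ⊛ γ g) ⊛ e
         ≡⟨ cong (_⊛ e) (sym (expand x)) ⟩
       x ⊛ e ∎
       where open ≡-Reasoning

-- Products of cyclic groups and the cosets of their power subgroups

module Groups where
 open import Defs using (groupElems; groupMul)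
 open Counting
 open GroupAlg using (AbGroup)
 open GL using (∈-concatMap-map; unique-concatMap-map; concatMap-map)
 open Nat using (_+_; _*_; _^_)
 open import Data.Nat.DivMod
 open import Data.List using (lookup)

 pow∣pow : ∀ p {i k} → i ≤ k → p ^ i ∣ p ^ k
 pow∣pow p {i} {k} le = subst (λ t → p ^ i ∣ p ^ t) (Nat.m+[n∸m]≡n le) (subst (p ^ i ∣_) (sym (Nat.^-distribˡ-+-* p i (k ∸ i))) (m∣m*n (p ^ (k ∸ i))))

 data Valid : List ℕ → List ℕ → Set where
   []  : Valid [] []
   _∷_ : ∀ {m ms a as} → a < m → Valid ms as → Valid (m ∷ ms) (a ∷ as)

 valid⇒∈ : ∀ {ms g} → Valid ms g → g ∈ groupElems ms
 valid⇒∈ []       = here refl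
 valid⇒∈ (a<m ∷ v) = ∈-concatMap-map _∷_ (∈-upTo⁺ a<m) (valid⇒∈ v)

 ∈⇒valid : ∀ ms {g} → g ∈ groupElems ms → Valid ms g
 ∈⇒valid []       (here refl) = []
 ∈⇒valid (m ∷ ms) p with ∈-cartesianProductWith⁻ _∷_ (upTo m) (groupElems ms) (subst (_ ∈_) (concatMap-map _∷_ (upTo m) (groupElems ms)) p)
 ... | a , as , a∈ , as∈ , refl = ∈-upTo⁻ a∈ ∷ ∈⇒valid ms as∈

 groupElems-unique : ∀ ms → Unique (groupElems ms)
 groupElems-unique []       = [] ∷ []
 groupElems-unique (m ∷ ms) = unique-concatMap-map _∷_ (λ { refl → refl , refl }) (Uniqueₚ.upTo⁺ m) (groupElems-unique ms)

 mul-valid : ∀ {ms} → All NonZero ms → ∀ {a b} → Valid ms a → Valid ms b → Valid ms (groupMul ms a b)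
 mul-valid []              []       []       = []
 mul-valid {suc m ∷ ms} (nz ∷ nzs) (_∷_ {a = x} p v) (_∷_ {a = y} q w) = m%n<n (x + y) (suc m) ∷ mul-valid nzs v w

 mul-comm : ∀ {ms} → All NonZero ms → ∀ {a b} → Valid ms a → Valid ms b → groupMul ms a b ≡ groupMul ms b a
 mul-comm []              []       []       = refl
 mul-comm {suc m ∷ ms} (nz ∷ nzs) (_∷_ {a = x} p v) (_∷_ {a = y} q w) = cong₂ _∷_ (cong (_% suc m) (Nat.+-comm x y)) (mul-comm nzs v w)

 mul-assoc : ∀ {ms} → All NonZero ms → ∀ {a b c} → Valid ms a → Valid ms b → Valid ms c →
             groupMul ms (groupMul ms a b) c ≡ groupMul ms a (groupMul ms b c)
 mul-assoc []              []       []       []       = refl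
 mul-assoc {suc m ∷ ms} (nz ∷ nzs) (_∷_ {a = x} p u) (_∷_ {a = y} q v) (_∷_ {a = z} r w) = cong₂ _∷_ step (mul-assoc nzs u v w)
   where
   step : ((x + y) % suc m + z) % suc m ≡ (x + (y + z) % suc m) % suc m
   step = trans (%-distribˡ-+ ((x + y) % suc m) z (suc m)) (trans (cong (λ t → (t + z % suc m) % suc m) (m%n%n≡m%n (x + y) (suc m)))
     (trans (sym (%-distribˡ-+ (x + y) z (suc m))) (trans (cong (_% suc m) (Nat.+-assoc x y z))
     (trans (%-distribˡ-+ x (y + z) (suc m)) (trans (cong (λ t → (x % suc m + t) % suc m) (sym (m%n%n≡m%n (y + z) (suc m))))
     (sym (%-distribˡ-+ x ((y + z) % suc m) (suc m))))))))

 zeros : List ℕ → List ℕ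
 zeros = List.map (λ _ → 0)

 zeros-valid : ∀ {ms} → All NonZero ms → Valid ms (zeros ms)
 zeros-valid []                     = []
 zeros-valid {suc m ∷ ms} (nz ∷ nzs) = s≤s z≤n ∷ zeros-valid nzs

 mul-zeros : ∀ {ms} → All NonZero ms → ∀ {a} → Valid ms a → groupMul ms (zeros ms) a ≡ a
 mul-zeros []              []       = refl
 mul-zeros {suc m ∷ ms} (nz ∷ nzs) (p ∷ v) = cong₂ _∷_ (m<n⇒m%n≡m p) (mul-zeros nzs v)

 negate : List ℕ → List ℕ → List ℕ
 negate (suc m ∷ ms) (a ∷ as) = (suc m ∸ a) % suc m ∷ negate ms as
 negate _            _        = []

 negate-valid : ∀ {ms} → All NonZero ms → ∀ {a} → Valid ms a → Valid ms (negate ms a)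
 negate-valid []              []       = []
 negate-valid {suc m ∷ ms} (nz ∷ nzs) (_∷_ {a = a} p v) = m%n<n (suc m ∸ a) (suc m) ∷ negate-valid nzs v

 mul-negate : ∀ {ms} → All NonZero ms → ∀ {a} → Valid ms a → groupMul ms (negate ms a) a ≡ zeros ms
 mul-negate []              []       = refl
 mul-negate {suc m ∷ ms} (nz ∷ nzs) (_∷_ {a = a} p v) = cong₂ _∷_
   (trans (%-distribˡ-+ ((suc m ∸ a) % suc m) a (suc m)) (trans (cong (λ t → (t + a % suc m) % suc m) (m%n%n≡m%n (suc m ∸ a) (suc m)))
     (trans (sym (%-distribˡ-+ (suc m ∸ a) a (suc m))) (trans (cong (_% suc m) (Nat.m∸n+n≡m (Nat.<⇒≤ p))) (n%n≡0 (suc m))))))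
   (mul-negate nzs v)

 nsmul : List ℕ → ℕ → List ℕ → List ℕ
 nsmul (suc m ∷ ms) n (a ∷ as) = (n * a) % suc m ∷ nsmul ms n as
 nsmul _            n _        = []

 module FromList (ms : List ℕ) (nz : All NonZero ms) where

   el : Fin (length (groupElems ms)) → List ℕ
   el = lookup (groupElems ms)

   el-valid : ∀ i → Valid ms (el i)
   el-valid i = ∈⇒valid ms (∈-lookup i)

   ix : ∀ {g} → Valid ms g → Fin (length (groupElems ms))
   ix v = index (valid⇒∈ v)

   el-ix : ∀ {g} (v : Valid ms g) → el (ix v) ≡ g
   el-ix v = sym (lookup-index (valid⇒∈ v))

   el-injective : ∀ {i j} → el i ≡ el j → i ≡ j
   el-injective = lookup-unique (groupElems-unique ms)

   group : AbGroup
   group = record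
     { N = length (groupElems ms)
     ; _∙_ = _∙_
     ; ε = ix (zeros-valid nz)
     ; _⁻¹ = λ a → ix (negate-valid nz (el-valid a))
     ; assoc = λ a b c → el-injective (trans (el-∙ (a ∙ b) c) (trans (cong (λ z → groupMul ms z (el c)) (el-∙ a b))
         (trans (mul-assoc nz (el-valid a) (el-valid b) (el-valid c)) (sym (trans (el-∙ a (b ∙ c)) (cong (groupMul ms (el a)) (el-∙ b c)))))))
     ; comm = λ a b → el-injective (trans (el-∙ a b) (trans (mul-comm nz (el-valid a) (el-valid b)) (sym (el-∙ b a))))
     ; identityˡ = λ a → el-injective (trans (el-∙ _ a) (trans (cong (λ z → groupMul ms z (el a)) (el-ix (zeros-valid nz))) (mul-zeros nz (el-valid a))))
     ; inverseˡ = λ a → el-injective (trans (el-∙ _ a) (trans (cong (λ z → groupMul ms z (el a)) (el-ix (negate-valid nz (el-valid a)))) (trans (mul-negate nz (el-valid a)) (sym (el-ix (zeros-valid nz)))))) }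
     where
     _∙_ : Fin (length (groupElems ms)) → Fin (length (groupElems ms)) → Fin (length (groupElems ms))
     a ∙ b = ix (mul-valid nz (el-valid a) (el-valid b))
     el-∙ : ∀ a b → el (a ∙ b) ≡ groupMul ms (el a) (el b)
     el-∙ a b = el-ix (mul-valid nz (el-valid a) (el-valid b))

   open AbGroup group public

   el-∙ : ∀ a b → el (a ∙ b) ≡ groupMul ms (el a) (el b)
   el-∙ a b = el-ix (mul-valid nz (el-valid a) (el-valid b))

   el-pow : ∀ g n → el (pow g n) ≡ nsmul ms n (el g)
   el-pow g zero    = trans (el-ix (zeros-valid nz)) (go nz (el-valid g))
     where
     go : ∀ {ms} → All NonZero ms → ∀ {a} → Valid ms a → zeros ms ≡ nsmul ms 0 a
     go []                       []      = refl
     go {suc m ∷ ms} (nz ∷ nzs) (p ∷ v) = cong₂ _∷_ refl (go nzs v)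
   el-pow g (suc n) = trans (el-∙ g (pow g n)) (trans (cong (groupMul ms (el g)) (el-pow g n)) (go nz (el-valid g)))
     where
     go : ∀ {ms} → All NonZero ms → ∀ {a} → Valid ms a → groupMul ms a (nsmul ms n a) ≡ nsmul ms (suc n) a
     go []                       []      = refl
     go {suc m ∷ ms} (nz ∷ nzs) (_∷_ {a = a} p v) = cong₂ _∷_
       (trans (%-distribˡ-+ a _ (suc m)) (trans (cong (λ t → (a % suc m + t) % suc m) (m%n%n≡m%n (n * a) (suc m))) (sym (%-distribˡ-+ a (n * a) (suc m)))))
       (go nzs v)

   pow-ε : ∀ n → All (_∣ n) ms → ∀ g → pow g n ≡ ε
   pow-ε n ds g = el-injective (trans (el-pow g n) (trans (go nz ds (el-valid g)) (sym (el-ix (zeros-valid nz)))))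
     where
     go : ∀ {ms} → All NonZero ms → All (_∣ n) ms → ∀ {a} → Valid ms a → nsmul ms n a ≡ zeros ms
     go []         []       []      = refl
     go {suc m ∷ ms} (nz ∷ nzs) (divides c e ∷ ds) (_∷_ {a = a} p v) = cong₂ _∷_
       (trans (cong (λ z → (z * a) % suc m) e) (trans (cong (_% suc m) (trans (cong (_* a) (Nat.*-comm c (suc m))) (trans (Nat.*-assoc (suc m) c a) (Nat.*-comm (suc m) (c * a))))) (m*n%n≡0 (c * a) (suc m))))
       (go nzs ds v)

 length-cartesianProductWith : {A B C : Set} (f : A → B → C) (xs : List A) (ys : List B) →
                               length (cartesianProductWith f xs ys) ≡ length xs * length ys
 length-cartesianProductWith f []       ys = refl
 length-cartesianProductWith f (x ∷ xs) ys = trans (Listₚ.length-++ (List.map (f x) ys))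
   (cong₂ _+_ (Listₚ.length-map (f x) ys) (length-cartesianProductWith f xs ys))

 length-groupElems : ∀ ms → length (groupElems ms) ≡ List.foldr _*_ 1 ms
 length-groupElems []       = refl
 length-groupElems (m ∷ ms) = trans (cong length (concatMap-map _∷_ (upTo m) (groupElems ms)))
   (trans (length-cartesianProductWith _∷_ (upTo m) (groupElems ms)) (cong₂ _*_ (Listₚ.length-upTo m) (length-groupElems ms)))

 -- Cosets of P·G in G = ∏ ℤ/mₜ, represented by ∏ {0, …, m′ₜ − 1} with m′ = gcd(m, P) .
 data Coset (P : ℕ) : List ℕ → List ℕ → Set where
   []  : Coset P [] []
   cons : ∀ {m m′ ms ms′} .{{_ : NonZero m}} .{{_ : NonZero m′}} → m′ ∣ m → m′ ∣ P →
         (∀ g → g < m → ∃ λ h → h < m × ((P * h) % m + g % m′) % m ≡ g) → Coset P ms ms′ → Coset P (m ∷ ms) (m′ ∷ ms′)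

 module Cosets {P : ℕ} where

   red : List ℕ → List ℕ → List ℕ
   red (suc m ∷ ms) (a ∷ as) = a % suc m ∷ red ms as
   red _            _        = []

   red-valid : ∀ {ms ms′} → Coset P ms ms′ → ∀ {g} → Valid ms g → Valid ms′ (red ms′ g)
   red-valid []                  []      = []
   red-valid (cons {m} {suc m′} _ _ _ c) (_∷_ {a = a} p v) = m%n<n a (suc m′) ∷ red-valid c v

   ∣⇒≤′ : ∀ {m m′} .{{_ : NonZero m}} → m′ ∣ m → m′ ≤ m
   ∣⇒≤′ d = Data.Nat.Divisibility.∣⇒≤ d
     where import Data.Nat.Divisibility

   emb-valid : ∀ {ms ms′} → Coset P ms ms′ → ∀ {g} → Valid ms′ g → Valid ms g
   emb-valid []               []      = []
   emb-valid (cons d _ _ c) (p ∷ v) = Nat.<-≤-trans p (∣⇒≤′ d) ∷ emb-valid c v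

   red-emb : ∀ {ms ms′} → Coset P ms ms′ → ∀ {g} → Valid ms′ g → red ms′ g ≡ g
   red-emb []               []      = refl
   red-emb (cons {m} {suc m′} d _ _ c) (p ∷ v) = cong₂ _∷_ (m<n⇒m%n≡m p) (red-emb c v)

   %-coarse : ∀ x {m m′} .{{_ : NonZero m}} .{{_ : NonZero m′}} → m′ ∣ m → x % m % m′ ≡ x % m′
   %-coarse x {m} {m′} d = m∣n⇒o%n%m≡o%m m′ m x d

   red-mul : ∀ {ms ms′} → Coset P ms ms′ → ∀ {h g} → Valid ms h → Valid ms g → red ms′ (groupMul ms (nsmul ms P h) g) ≡ red ms′ g
   red-mul []               []      []      = refl
   red-mul (cons {suc m} {suc m′} d (divides c e) _ cs) (_∷_ {a = h} _ v) (_∷_ {a = g} _ w) = cong₂ _∷_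
     (trans (%-coarse (P * h % suc m + g) d) (trans (%-distribˡ-+ (P * h % suc m) g (suc m′))
       (trans (cong (λ z → (z + g % suc m′) % suc m′) (trans (%-coarse (P * h) d) (trans (cong (λ z → z * h % suc m′) e)
         (trans (cong (_% suc m′) (trans (Nat.*-assoc c (suc m′) h) (trans (cong (c *_) (Nat.*-comm (suc m′) h)) (sym (Nat.*-assoc c h (suc m′)))))) (m*n%n≡0 (c * h) (suc m′))))))
       (m%n%n≡m%n g (suc m′)))))
     (red-mul cs v w)

   quotient : ∀ {ms ms′} → Coset P ms ms′ → ∀ {g} → Valid ms g →
              ∃ λ h → Valid ms h × groupMul ms (nsmul ms P h) (red ms′ g) ≡ g
   quotient []                     []      = [] , [] , refl
   quotient (cons {suc m} {suc m′} _ _ f c) (_∷_ {a = a} p v) =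
     let (h , h< , e) = f a p ; (hs , vs , es) = quotient c v in h ∷ hs , h< ∷ vs , cong₂ _∷_ e es

 -- If `a ≤ j`, division of `g` by `p^a` with remainder gives `h`. If `j ≤ a`, then `p^a` is zero
 -- modulo `p^j` and each `g` is its own representative.
 pow-coset : ∀ p → .{{_ : NonZero p}} → ∀ a (js : List ℕ) → Coset (p ^ a) (List.map (p ^_) js) (List.map (λ j → p ^ (a ⊓ j)) js)
 pow-coset p a []       = []
 pow-coset p a (j ∷ js) = cons {{Nat.m^n≢0 p j}} {{Nat.m^n≢0 p (a ⊓ j)}} (pow∣pow p (Nat.m⊓n≤n a j)) (pow∣pow p (Nat.m⊓n≤m a j)) (step (Nat.≤-total a j)) (pow-coset p a js)
   where
   instance
     nzj : NonZero (p ^ j)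
     nzj = Nat.m^n≢0 p j
     nza : NonZero (p ^ a)
     nza = Nat.m^n≢0 p a
     nzm : NonZero (p ^ (a ⊓ j))
     nzm = Nat.m^n≢0 p (a ⊓ j)
   step : _ → ∀ g → g < p ^ j → ∃ λ h → h < p ^ j × ((p ^ a * h) % (p ^ j) + g % (p ^ (a ⊓ j))) % (p ^ j) ≡ g
   step (inj₁ a≤j) g g< = g / p ^ a , Nat.≤-<-trans (m/n≤m g (p ^ a)) g< ,
     trans (cong (λ z → z % (p ^ j)) (cong₂ _+_ (m<n⇒m%n≡m (Nat.≤-<-trans qle g<)) (%-congʳ {o = g} (cong (p ^_) (Nat.m≤n⇒m⊓n≡m a≤j)))))
     (trans (cong (_% (p ^ j)) eq) (m<n⇒m%n≡m g<))
     where
     eq : p ^ a * (g / p ^ a) + g % p ^ a ≡ g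
     eq = trans (Nat.+-comm _ (g % p ^ a)) (sym (trans (m≡m%n+[m/n]*n g (p ^ a)) (cong (g % p ^ a +_) (Nat.*-comm (g / p ^ a) (p ^ a)))))
     qle : p ^ a * (g / p ^ a) ≤ g
     qle = subst (p ^ a * (g / p ^ a) ≤_) eq (Nat.m≤m+n _ _)
   step (inj₂ j≤a) g g< = 0 , Nat.≤-<-trans z≤n g< ,
     trans (cong (λ z → (z % (p ^ j) + g % (p ^ (a ⊓ j))) % (p ^ j)) (Nat.*-zeroʳ (p ^ a)))
     (trans (cong₂ (λ x y → (x + y) % (p ^ j)) (m*n%n≡0 0 (p ^ j)) (trans (%-congʳ {o = g} (cong (p ^_) (Nat.m≥n⇒m⊓n≡n j≤a))) (m<n⇒m%n≡m g<))) (m<n⇒m%n≡m g<))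

-- Representations as modules over the group algebra

module Reps where
 open import Defs using (FiniteField; module Matrices; module HomCount; groupElems; groupMul)
 open Counting
 open Rings
 open Frames
 open GL
 open GroupAlg
 open Groups
 open import Data.Vec using (lookup)

 length-filter-map : {X Y : Set} {P : Y → Set} (P? : ∀ y → Dec (P y)) (f : X → Y) (xs : List X) →
                     length (filter P? (List.map f xs)) ≡ length (filter (P? ∘ f) xs)
 length-filter-map P? f [] = refl
 length-filter-map P? f (x ∷ xs) with P? (f x)
 ... | yes _ = cong suc (length-filter-map P? f xs)
 ... | no  _ = length-filter-map P? f xs

 module Homs (K : FiniteField) (ms : List ℕ) (nz : All NonZero ms) where
   open Matrices K
   open HomCount K
   open LinearMaps K
   open GLn K
   open FromList ms nz
   open GroupAlgebra K group using (A; coef; γ; _⊛_; ⊛-coef; groupRing; ι; ι-+; ι-*; ι-1; ι-⊛; expand; γ-∙)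
   private
     KR = fieldRing K
     module K = CRing KR

   table : ∀ {n} → Vec (Mat n) N → Table n
   table v = List.zip (groupElems ms) (Vec.toList v)

   eval-table : ∀ {n} (v : Vec (Mat n) N) i → eval (table v) (el i) ≡ lookup v i
   eval-table v i = go (groupElems ms) (groupElems-unique ms) v i
     where
     go : ∀ {n} (xs : List (List ℕ)) → Unique xs → (v : Vec (Mat n) (length xs)) (i : Fin (length xs)) →
          eval (List.zip xs (Vec.toList v)) (List.lookup xs i) ≡ lookup v i
     go (x ∷ xs) (px ∷ u) (A ∷ v) zero with Listₚ.≡-dec Nat._≟_ x x
     ... | yes _ = refl
     ... | no ne = ⊥-elim (ne refl)
     go (x ∷ xs) (px ∷ u) (A ∷ v) (suc i) with Listₚ.≡-dec Nat._≟_ x (List.lookup xs i)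
     ... | yes e = ⊥-elim (All.lookup px (∈-lookup i) e)
     ... | no _ = go xs u v i

   -- The decision is squashed by `True`, so a representation is determined by its matrices, and the
   -- number of representations is the length of the filtered list behind `numHom`.
   Rep : ℕ → Set
   Rep n = Σ (Vec (Mat n) N) (λ v → True (isHom? ms (table v)))

   abstract
     finite-Rep : ∀ n → Finite (Rep n)
     finite-Rep n = finite-filter (λ v → isHom? ms (table v)) (allVecs (allMats n) N)
       (allVecs-unique (allMats n) (allMats-unique n) N) (allVecs-complete (allMats n) allMats-complete)

     card-Rep : ∀ n → numHom ms n ≡ card (finite-Rep n)
     card-Rep n = length-filter-map (isHom? ms) table (allVecs (allMats n) N)

   infixl 25 _⟪_⟫
   _⟪_⟫ : ∀ {n} → Rep n → Fin N → Mat n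
   ρ ⟪ i ⟫ = lookup (proj₁ ρ) i

   rep-≡ : ∀ {n} {ρ σ : Rep n} → (∀ i → ρ ⟪ i ⟫ ≡ σ ⟪ i ⟫) → ρ ≡ σ
   rep-≡ h = Σ-prop-≡ (λ v → True-prop (isHom? ms (table v))) (vec-ext h)

   rep-inv : ∀ {n} (ρ : Rep n) i → IsInvertible (ρ ⟪ i ⟫)
   rep-inv (v , t) i = subst IsInvertible (eval-table v i) (All.lookup (proj₁ (toWitness t)) (∈-lookup i))

   rep-∙ : ∀ {n} (ρ : Rep n) i j → ρ ⟪ i ∙ j ⟫ ≡ ρ ⟪ i ⟫ · ρ ⟪ j ⟫
   rep-∙ (v , t) i j = trans (sym (eval-table v (i ∙ j))) (trans (cong (eval (table v)) (el-∙ i j))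
     (trans (All.lookup (All.lookup (proj₂ (toWitness t)) (∈-lookup i)) (∈-lookup j)) (cong₂ _·_ (eval-table v i) (eval-table v j))))

   mkRep : ∀ {n} (f : Fin N → Mat n) → (∀ i → IsInvertible (f i)) → (∀ i j → f (i ∙ j) ≡ f i · f j) → Rep n
   mkRep {n} f inv hom = v , fromWitness
     ( All.tabulate (λ {g} m → subst (λ g → IsInvertible (eval (table v) g)) (sym (lookup-index m)) (subst IsInvertible (sym (ev (index m))) (inv (index m))))
     , All.tabulate (λ {g} m → All.tabulate (λ {h} m′ →
         subst₂ (λ g h → eval (table v) (groupMul ms g h) ≡ eval (table v) g · eval (table v) h) (sym (lookup-index m)) (sym (lookup-index m′))
           (trans (cong (eval (table v)) (sym (el-∙ (index m) (index m′)))) (trans (ev _) (trans (hom _ _) (sym (cong₂ _·_ (ev (index m)) (ev (index m′)))))))))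
     )
     where
     v = tabulate f
     ev : ∀ i → eval (table v) (el i) ≡ f i
     ev i = trans (eval-table v i) (Vecₚ.lookup∘tabulate f i)

   mkRep-at : ∀ {n} (f : Fin N → Mat n) inv hom i → mkRep f inv hom ⟪ i ⟫ ≡ f i
   mkRep-at f inv hom i = Vecₚ.lookup∘tabulate f i

   -- The image of `ε` is an invertible idempotent.
   rep-ε : ∀ {n} (ρ : Rep n) v → apply (ρ ⟪ ε ⟫) v ≡ v
   rep-ε ρ v = begin
     apply (ρ ⟪ ε ⟫) v ≡⟨ sym (cancel (apply (ρ ⟪ ε ⟫) v)) ⟩
     apply B (apply (ρ ⟪ ε ⟫) (apply (ρ ⟪ ε ⟫) v)) ≡⟨ cong (apply B) (trans (sym (apply-· (ρ ⟪ ε ⟫) (ρ ⟪ ε ⟫) v)) (cong (λ M → apply M v) (trans (sym (rep-∙ ρ ε ε)) (cong (ρ ⟪_⟫) (identityˡ ε))))) ⟩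
     apply B (apply (ρ ⟪ ε ⟫) v) ≡⟨ cancel v ⟩
     v ∎
     where
     open ≡-Reasoning
     s = satisfied (rep-inv ρ ε)
     B = proj₁ s
     cancel : ∀ v → apply B (apply (ρ ⟪ ε ⟫) v) ≡ v
     cancel v = trans (sym (apply-· B (ρ ⟪ ε ⟫) v)) (trans (cong (λ M → apply M v) (proj₂ (proj₂ s))) (apply-id v))

   rep-apply-∙ : ∀ {n} (ρ : Rep n) i j v → apply (ρ ⟪ i ∙ j ⟫) v ≡ apply (ρ ⟪ i ⟫) (apply (ρ ⟪ j ⟫) v)
   rep-apply-∙ ρ i j v = trans (cong (λ M → apply M v) (rep-∙ ρ i j)) (apply-· (ρ ⟪ i ⟫) (ρ ⟪ j ⟫) v)

   module _ {n : ℕ} where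
     private
       module V = Module (Vₙ n)

     sum-δ : ∀ {m} (i : Fin m) (f : Fin m → V.V) → V.sumᵥ (λ k → δ i k V.· f k) ≡ f i
     sum-δ {suc m} zero f = trans (cong₂ V._+ᵥ_ (V.·-identity _)
         (trans (V.sumᵥ-cong (λ k → V.·-zeroˡ (f (suc k)))) (V.sumᵥ-zero m))) (V.+ᵥ-identityʳ _)
     sum-δ {suc m} (suc i) f = trans (cong₂ V._+ᵥ_ (V.·-zeroˡ _)
         (trans (V.sumᵥ-cong (λ k → cong (V._· f (suc k)) (δ-suc i k))) (sum-δ i (f ∘ suc)))) (V.+ᵥ-identityˡ _)

     actRep : Rep n → A → V.V → V.V
     actRep ρ a v = V.sumᵥ (λ g → coef a g V.· apply (ρ ⟪ g ⟫) v)

     act-γ : ∀ ρ g v → actRep ρ (γ g) v ≡ apply (ρ ⟪ g ⟫) v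
     act-γ ρ g v = trans (V.sumᵥ-cong (λ k → cong (V._· apply (ρ ⟪ k ⟫) v) (Vecₚ.lookup∘tabulate (δ g) k))) (sum-δ g (λ k → apply (ρ ⟪ k ⟫) v))

     act-sum : ∀ (B : Mat n) {m} (f : Fin m → V.V) → apply B (V.sumᵥ f) ≡ V.sumᵥ (λ i → apply B (f i))
     act-sum B f = f-sum (apply B) (apply-+ B) (apply-scale B) f

     -- The convolution is expanded and the summation index `g` is replaced by `h ∙ k`.
     act-assoc : ∀ ρ a b v → actRep ρ (a ⊛ b) v ≡ actRep ρ a (actRep ρ b v)
     act-assoc ρ a b v = begin
       V.sumᵥ (λ g → coef (a ⊛ b) g V.· apply (ρ ⟪ g ⟫) v)
         ≡⟨ V.sumᵥ-cong (λ g → trans (cong (V._· apply (ρ ⟪ g ⟫) v) (⊛-coef a b g)) (V.sum-· (λ h → coef a h K.⊗ coef b ((h ⁻¹) ∙ g)) (apply (ρ ⟪ g ⟫) v))) ⟩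
       V.sumᵥ (λ g → V.sumᵥ (λ h → (coef a h K.⊗ coef b ((h ⁻¹) ∙ g)) V.· apply (ρ ⟪ g ⟫) v))
         ≡⟨ V.sumᵥ-comm (λ g h → (coef a h K.⊗ coef b ((h ⁻¹) ∙ g)) V.· apply (ρ ⟪ g ⟫) v) ⟩
       V.sumᵥ (λ h → V.sumᵥ (λ g → (coef a h K.⊗ coef b ((h ⁻¹) ∙ g)) V.· apply (ρ ⟪ g ⟫) v))
         ≡⟨ V.sumᵥ-cong inner ⟩
       V.sumᵥ (λ h → coef a h V.· apply (ρ ⟪ h ⟫) (actRep ρ b v)) ∎
       where
       open ≡-Reasoning
       inner : ∀ h → V.sumᵥ (λ g → (coef a h K.⊗ coef b ((h ⁻¹) ∙ g)) V.· apply (ρ ⟪ g ⟫) v) ≡ coef a h V.· apply (ρ ⟪ h ⟫) (actRep ρ b v)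
       inner h = begin
         V.sumᵥ (λ g → (coef a h K.⊗ coef b ((h ⁻¹) ∙ g)) V.· apply (ρ ⟪ g ⟫) v)
           ≡⟨ V.sumᵥ-permute (λ g → (coef a h K.⊗ coef b ((h ⁻¹) ∙ g)) V.· apply (ρ ⟪ g ⟫) v) (mk↔ₛ′ (h ∙_) ((h ⁻¹) ∙_) (cancel₂ h) (cancel₁ h)) ⟩
         V.sumᵥ (λ k → (coef a h K.⊗ coef b ((h ⁻¹) ∙ (h ∙ k))) V.· apply (ρ ⟪ h ∙ k ⟫) v)
           ≡⟨ V.sumᵥ-cong (λ k → trans (cong₂ (λ x w → (coef a h K.⊗ coef b x) V.· w) (cancel₁ h k) (rep-apply-∙ ρ h k v))
                (trans (V.·-assoc (coef a h) (coef b k) _) (cong (coef a h V.·_) (sym (apply-scale (ρ ⟪ h ⟫) (coef b k) (apply (ρ ⟪ k ⟫) v)))))) ⟩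
         V.sumᵥ (λ k → coef a h V.· apply (ρ ⟪ h ⟫) (coef b k V.· apply (ρ ⟪ k ⟫) v))
           ≡⟨ sym (V.·-sum (coef a h) (λ k → apply (ρ ⟪ h ⟫) (coef b k V.· apply (ρ ⟪ k ⟫) v))) ⟩
         coef a h V.· V.sumᵥ (λ k → apply (ρ ⟪ h ⟫) (coef b k V.· apply (ρ ⟪ k ⟫) v))
           ≡⟨ cong (coef a h V.·_) (sym (act-sum (ρ ⟪ h ⟫) (λ k → coef b k V.· apply (ρ ⟪ k ⟫) v))) ⟩
         coef a h V.· apply (ρ ⟪ h ⟫) (actRep ρ b v) ∎

     repModule : Rep n → Module groupRing
     repModule ρ = record
       { V = V.V ; _+ᵥ_ = V._+ᵥ_ ; 0ᵥ = V.0ᵥ ; -ᵥ_ = V.-ᵥ_ ; _·_ = actRep ρ ; isAbelianGroup = V.isAbelianGroup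
       ; ·-distribˡ = λ a u v → trans (V.sumᵥ-cong (λ g → trans (cong (coef a g V.·_) (apply-+ (ρ ⟪ g ⟫) u v)) (V.·-distribˡ (coef a g) (apply (ρ ⟪ g ⟫) u) (apply (ρ ⟪ g ⟫) v))))
           (V.sumᵥ-+ (λ g → coef a g V.· apply (ρ ⟪ g ⟫) u) (λ g → coef a g V.· apply (ρ ⟪ g ⟫) v))
       ; ·-distribʳ = λ a b v → trans (V.sumᵥ-cong (λ g → trans (cong (V._· apply (ρ ⟪ g ⟫) v) (Vecₚ.lookup-zipWith K._⊕_ g a b)) (V.·-distribʳ (coef a g) (coef b g) (apply (ρ ⟪ g ⟫) v))))
           (V.sumᵥ-+ (λ g → coef a g V.· apply (ρ ⟪ g ⟫) v) (λ g → coef b g V.· apply (ρ ⟪ g ⟫) v))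
       ; ·-assoc = act-assoc ρ
       ; ·-identity = λ v → trans (act-γ ρ ε v) (rep-ε ρ v)
       ; finiteV = V.finiteV }

     act-ι : ∀ ρ c v → actRep ρ (ι c) v ≡ c V.· v
     act-ι ρ c v = trans (V.sumᵥ-cong (λ g → trans (cong (V._· apply (ρ ⟪ g ⟫) v) (Vecₚ.lookup-map g (c K.⊗_) (γ ε))) (V.·-assoc c (coef (γ ε) g) _)))
       (trans (sym (V.·-sum c (λ g → coef (γ ε) g V.· apply (ρ ⟪ g ⟫) v))) (cong (c V.·_) (trans (act-γ ρ ε v) (rep-ε ρ v))))

   module Counted (S : Splitting groupRing) (n : ℕ) where
     open Splitting S using (k)
     open SplittingP S
     module St = Structures S ι ι-+ ι-* ι-1
     private
       module V = Module (Vₙ n)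

     identityIso : ∀ ρ → LinIso (St.asK (repModule ρ)) (Vₙ n)
     identityIso ρ = record { f = λ v → v ; f-+ = λ _ _ → refl ; f-· = act-ι ρ ; inj = λ h → h ; surj = λ w → w , refl }

     module C = St.Count n (finite-Rep n) repModule identityIso

     act-determines : ∀ ρ σ → (∀ a v → C.act ρ a v ≡ C.act σ a v) → ρ ≡ σ
     act-determines ρ σ h = rep-≡ (λ i → apply-injective (λ v → trans (sym (act-γ ρ i v)) (trans (h (γ i) v) (act-γ σ i v))))

     module _ (τ : List (Fin k)) (L : LinIso (Vₙ n) (St.asK (coefModule τ))) where
       private
         module L = LinIso L
         module W = Module (coefModule τ)

       translate : Fin N → LinIso (Vₙ n) (Vₙ n)
       translate i = record
         { f = λ v → L.g (γ i W.· L.f v)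
         ; f-+ = λ u v → trans (cong L.g (trans (cong (γ i W.·_) (L.f-+ u v)) (W.·-distribˡ (γ i) (L.f u) (L.f v)))) (L.g-+ _ _)
         ; f-· = λ c v → trans (cong L.g (trans (cong (γ i W.·_) (L.f-· c v)) (swap (γ i) (ι c) (L.f v)))) (L.g-· c (γ i W.· L.f v))
         ; inj = λ {u} {v} h → trans (sym (back i u)) (trans (cong (λ w → L.g (γ (i ⁻¹) W.· L.f w)) h) (back i v))
         ; surj = λ w → L.g (γ (i ⁻¹) W.· L.f w) , trans (cong (λ z → L.g (γ i W.· z)) (L.f-g _)) (trans (cong L.g (trans (sym (W.·-assoc (γ i) (γ (i ⁻¹)) (L.f w)))
              (trans (cong (W._· L.f w) (trans (γ-∙ i (i ⁻¹)) (cong γ (trans (comm i (i ⁻¹)) (inverseˡ i))))) (W.·-identity (L.f w))))) (L.g-f w)) }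
         where
         swap : ∀ a b w → a W.· (b W.· w) ≡ b W.· (a W.· w)
         swap a b w = trans (sym (W.·-assoc a b w)) (trans (cong (W._· w) (CRing.*-comm groupRing a b)) (W.·-assoc b a w))
         back : ∀ i u → L.g (γ (i ⁻¹) W.· L.f (L.g (γ i W.· L.f u))) ≡ u
         back i u = trans (cong (λ z → L.g (γ (i ⁻¹) W.· z)) (L.f-g _)) (trans (cong L.g (trans (sym (W.·-assoc (γ (i ⁻¹)) (γ i) (L.f u)))
              (trans (cong (W._· L.f u) (trans (γ-∙ (i ⁻¹) i) (cong γ (inverseˡ i)))) (W.·-identity (L.f u))))) (L.g-f u))

       private
         transportMat : Fin N → Mat n
         transportMat i = proj₁ (isoGL (translate i))

         transportMat-inv : ∀ i → IsInvertible (transportMat i)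
         transportMat-inv i = toWitness (proj₂ (isoGL (translate i)))

         transportMat-hom : ∀ i j → transportMat (i ∙ j) ≡ transportMat i · transportMat j
         transportMat-hom i j = apply-injective (λ v → trans (isoGL-apply (translate (i ∙ j)) v) (trans (lem i j v)
           (sym (trans (apply-· (transportMat i) (transportMat j) v)
              (trans (cong (apply (transportMat i)) (isoGL-apply (translate j) v)) (isoGL-apply (translate i) _))))))
           where
           lem : ∀ i j v → L.g (γ (i ∙ j) W.· L.f v) ≡ L.g (γ i W.· L.f (L.g (γ j W.· L.f v)))
           lem i j v = cong L.g (trans (cong (W._· L.f v) (sym (γ-∙ i j))) (trans (W.·-assoc (γ i) (γ j) (L.f v)) (cong (γ i W.·_) (sym (L.f-g _)))))

       -- The group elements act on `coefModule τ`; carried over to `Kⁿ` by `L`, they become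
       -- invertible matrices.
       transportRep : Rep n
       transportRep = mkRep transportMat transportMat-inv transportMat-hom

       transportRep-γ : ∀ i v → apply (transportRep ⟪ i ⟫) v ≡ L.g (γ i W.· L.f v)
       transportRep-γ i v = trans (cong (λ M → apply M v) (mkRep-at transportMat transportMat-inv transportMat-hom i)) (isoGL-apply (translate i) v)

       transport-act : ∀ a v → C.act transportRep a v ≡ L.g (a W.· L.f v)
       transport-act a v = L-inj (begin
         L.f (V.sumᵥ (λ g → coef a g V.· apply (transportRep ⟪ g ⟫) v))
           ≡⟨ cong L.f (V.sumᵥ-cong (λ g → cong (coef a g V.·_) (transportRep-γ g v))) ⟩
         L.f (V.sumᵥ (λ g → coef a g V.· L.g (γ g W.· L.f v)))
           ≡⟨ L-sum (λ g → coef a g V.· L.g (γ g W.· L.f v)) ⟩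
         W.sumᵥ (λ g → L.f (coef a g V.· L.g (γ g W.· L.f v)))
           ≡⟨ W.sumᵥ-cong (λ g → trans (L.f-· (coef a g) _) (trans (cong (ι (coef a g) W.·_) (L.f-g _)) (sym (W.·-assoc (ι (coef a g)) (γ g) (L.f v))))) ⟩
         W.sumᵥ (λ g → (ι (coef a g) ⊛ γ g) W.· L.f v)
           ≡⟨ sym (W.sum-· (λ g → ι (coef a g) ⊛ γ g) (L.f v)) ⟩
         CRing.sum groupRing (λ g → ι (coef a g) ⊛ γ g) W.· L.f v
           ≡⟨ cong (W._· L.f v) (sym (expand a)) ⟩
         a W.· L.f v ≡⟨ sym (L.f-g _) ⟩
         L.f (L.g (a W.· L.f v)) ∎)
         where
         open ≡-Reasoning
         L-inj : ∀ {u v} → L.f u ≡ L.f v → u ≡ v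
         L-inj = L.inj
         L-sum : ∀ {m} (f : Fin m → V.V) → L.f (V.sumᵥ f) ≡ W.sumᵥ (λ i → L.f (f i))
         L-sum {zero}  f = trans (cong L.f (sym (V.·-zeroˡ V.0ᵥ))) (trans (L.f-· K.𝟘 V.0ᵥ) (trans (cong (W._· L.f V.0ᵥ) ι0) (W.·-zeroˡ _)))
           where
           ι0 : ι K.𝟘 ≡ CRing.𝟘 groupRing
           ι0 = Module.·-zeroˡ (vecModule KR N) (γ ε)
         L-sum {suc m} f = trans (L.f-+ (f zero) (V.sumᵥ (f ∘ suc))) (cong (L.f (f zero) W.+ᵥ_) (L-sum (f ∘ suc)))

     frame-count : ∀ τ → card (Module.finiteV (coefModule τ)) ≡ FiniteField.size K Nat.^ n →
                   ∑ (finite-Rep n) (λ ρ → Frame.frames (repModule ρ) τ) ≡ card (finite-GL n)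
     frame-count τ h = C.Main.card-Pairs act-determines (λ τ L → transportRep τ L , transport-act τ L) τ h

-- Counting the representations of a given type

module Types where
 open import Defs using (FiniteField; module HomCount)
 open Counting
 open Rings
 open Frames
 open GL
 open GroupAlg
 open Groups
 open Reps
 open Nat using (_+_; _*_; _^_)
 open import Data.Vec using (lookup)
 open import Algebra.Properties.CommutativeMonoid.Sum Nat.+-0-commutativeMonoid using (sum; sum-cong-≗; ∑-distrib-+; sum-replicate-zero)

 prod : ∀ {n} → (Fin n → ℕ) → ℕ
 prod {zero}  f = 1
 prod {suc n} f = f zero * prod (f ∘ suc)

 prod-cong : ∀ {n} {f g : Fin n → ℕ} → (∀ i → f i ≡ g i) → prod f ≡ prod g
 prod-cong {zero}  h = refl
 prod-cong {suc n} h = cong₂ _*_ (h zero) (prod-cong (h ∘ suc))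

 prod-zero : ∀ {n} {f : Fin n → ℕ} i → f i ≡ 0 → prod f ≡ 0
 prod-zero {f = f} zero    h = cong (_* prod (f ∘ suc)) h
 prod-zero {f = f} (suc i) h = trans (cong (f zero *_) (prod-zero {f = f ∘ suc} i h)) (Nat.*-zeroʳ (f zero))

 prodL : {X : Set} → (X → ℕ) → List X → ℕ
 prodL f []       = 1
 prodL f (x ∷ xs) = f x * prodL f xs

 prodL-tabulate : ∀ {X : Set} (f : X → ℕ) {n} (g : Fin n → X) → prodL f (List.tabulate g) ≡ prod (f ∘ g)
 prodL-tabulate f {zero}  g = refl
 prodL-tabulate f {suc n} g = cong (f (g zero) *_) (prodL-tabulate f (g ∘ suc))

 ∑-indicator : {X : Set} (F : Finite X) {P : X → Set} (pr : ∀ x → IsProp (P x)) (P? : ∀ x → Dec (P x)) (f : X → ℕ) (c : ℕ) →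
               (∀ x → P x → f x ≡ c) → (∀ x → ¬ P x → f x ≡ 0) → ∑ F f ≡ card (finite-sub F pr P?) * c
 ∑-indicator F pr P? f c on off = go (card F) (Finite.enum F)
   where
   step : ∀ x → f x ≡ card (finite-Dec (pr x) (P? x)) * c
   step x with P? x
   ... | yes p = trans (on x p) (sym (Nat.+-identityʳ c))
   ... | no np = off x np
   go : ∀ n (en : Fin n → _) → sum (λ i → f (en i)) ≡ sum (λ i → card (finite-Dec (pr (en i)) (P? (en i)))) * c
   go zero    en = refl
   go (suc n) en = trans (cong₂ _+_ (step (en zero)) (go n (en ∘ suc))) (sym (Nat.*-distribʳ-+ c (card (finite-Dec (pr (en zero)) (P? (en zero)))) _))

 -- The factor with exponent `t` is `q^t − q^t`: dimension `t` has no room for more than `t`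
 -- independent vectors.
 glf-vanish : ∀ q {m t} → t < m → glf (q ^ t) q m ≡ 0
 glf-vanish q {suc m} {t} (s≤s t≤m) with Nat.m≤n⇒m<n∨m≡n t≤m
 ... | inj₁ t<m  = cong (_* (q ^ t ∸ q ^ m)) (glf-vanish q t<m)
 ... | inj₂ refl = trans (cong (glf (q ^ t) q t *_) (Nat.n∸n≡0 (q ^ t))) (Nat.*-zeroʳ (glf (q ^ t) q t))

 -- Applied to a representation with multiplicities `t` whose type is not `m`: some label then asks
 -- for more vectors than are available, so the number of frames of type `m` is zero by
 -- `glf-vanish`.
 exceeds : ∀ {n} (d m t : Fin n → ℕ) → (∀ i → 0 < d i) → sum (λ i → d i * m i) ≡ sum (λ i → d i * t i) →
           (∀ i → m i ≡ t i) ⊎ ∃ λ i → t i < m i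
 exceeds {n} d m t pos h with Finₚ.any? (λ i → t i Nat.<? m i)
 ... | yes p = inj₂ p
 ... | no none = inj₁ (go d m t pos h (λ i → Nat.≮⇒≥ (λ lt → none (i , lt))))
   where
   mono : ∀ {n} {f g : Fin n → ℕ} → (∀ i → f i ≤ g i) → sum f ≤ sum g
   mono {zero}  le = z≤n
   mono {suc n} le = Nat.+-mono-≤ (le zero) (mono (le ∘ suc))
   go : ∀ {n} (d m t : Fin n → ℕ) → (∀ i → 0 < d i) → sum (λ i → d i * m i) ≡ sum (λ i → d i * t i) → (∀ i → m i ≤ t i) → ∀ i → m i ≡ t i
   go {suc n} d m t pos h le i with Nat.m≤n⇒m<n∨m≡n (le zero)
   ... | inj₁ lt = ⊥-elim (Nat.<-irrefl h (Nat.+-mono-<-≤ (Nat.*-monoʳ-< (d zero) {{Nat.>-nonZero (pos zero)}} lt) (mono (λ j → Nat.*-monoʳ-≤ (d (suc j)) (le (suc j))))))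
   go {suc n} d m t pos h le zero    | inj₂ eq = eq
   go {suc n} d m t pos h le (suc i) | inj₂ eq = go (d ∘ suc) (m ∘ suc) (t ∘ suc) (pos ∘ suc)
     (Nat.+-cancelˡ-≡ (d zero * m zero) _ _ (trans h (cong (λ z → d zero * z + sum (λ j → d (suc j) * t (suc j))) (sym eq)))) (le ∘ suc) i

 module SortedLabels {A : CRing} (S : Splitting A) where
   open Splitting S
   open SplittingP S

   -- With equal labels grouped together, the number of frames factors as a product over the labels.
   sortL : (Fin k → ℕ) → List (Fin k) → List (Fin k)
   sortL m []       = []
   sortL m (i ∷ is) = replicate (m i) i ++ sortL m is

   occ-absent : ∀ m is j → j ∉ is → occ j (sortL m is) ≡ 0
   occ-absent m []       j _  = refl
   occ-absent m (i ∷ is) j nj = go (m i)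
     where
     bump-no : ∀ {x : ℕ} (d : Dec (j ≡ i)) → x ≡ 0 → bump d x ≡ 0
     bump-no (yes e) _ = ⊥-elim (nj (here e))
     bump-no (no _)  h = h
     go : ∀ c → occ j (replicate c i ++ sortL m is) ≡ 0
     go zero    = occ-absent m is j (nj ∘ there)
     go (suc c) = bump-no (j Fin.≟ i) (go c)

   frames-sortL : (M : Module A) → ∀ m is → Unique is →
     Frame.frames M (sortL m is) ≡ prodL (λ i → glf (Frame.dimU M i) (Q i) (m i)) is
   frames-sortL M m []       u        = refl
   frames-sortL M m (i ∷ is) (px ∷ u) = trans
     (proj₂ (frames-replicate S M i (m i) (sortL m is) (occ-absent m is i (λ p → All.lookup px p refl))))
     (trans (cong (_* glf (Frame.dimU M i) (Q i) (m i)) (frames-sortL M m is u)) (Nat.*-comm _ (glf (Frame.dimU M i) (Q i) (m i))))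

   module Weights (q : ℕ) (d : Fin k → ℕ) (Q≡ : ∀ i → Q i ≡ q ^ d i) where
     wt : List (Fin k) → ℕ
     wt []      = 0
     wt (i ∷ τ) = d i + wt τ

     card-coef : ∀ τ → card (Module.finiteV (coefModule τ)) ≡ q ^ wt τ
     card-coef []      = refl
     card-coef (i ∷ τ) = trans (cong₂ _*_ (Q≡ i) (card-coef τ)) (sym (Nat.^-distribˡ-+-* q (d i) (wt τ)))

     wt-++ : ∀ σ τ → wt (σ ++ τ) ≡ wt σ + wt τ
     wt-++ []      τ = refl
     wt-++ (i ∷ σ) τ = trans (cong (d i +_) (wt-++ σ τ)) (sym (Nat.+-assoc (d i) _ _))

     wt-replicate : ∀ c i → wt (replicate c i) ≡ d i * c
     wt-replicate zero    i = sym (Nat.*-zeroʳ (d i))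
     wt-replicate (suc c) i = trans (cong (d i +_) (wt-replicate c i)) (sym (Nat.*-suc (d i) c))

     wt-sortL : ∀ m {c} (g : Fin c → Fin k) → wt (sortL m (List.tabulate g)) ≡ sum (λ j → d (g j) * m (g j))
     wt-sortL m {zero}  g = refl
     wt-sortL m {suc c} g = trans (wt-++ (replicate (m (g zero)) (g zero)) _) (cong₂ _+_ (wt-replicate _ _) (wt-sortL m (g ∘ suc)))

     wt-occ : ∀ τ → wt τ ≡ sum (λ i → d i * occ i τ)
     wt-occ []      = sym (trans (sum-cong-≗ (λ i → Nat.*-zeroʳ (d i))) (sum-replicate-zero k))
     wt-occ (j ∷ τ) = trans (cong₂ _+_ (sym (single k d j (λ i → i Fin.≟ j))) (wt-occ τ)) (trans (sym (∑-distrib-+ (λ i → single-term d j i (i Fin.≟ j)) (λ i → d i * occ i τ)))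
                        (sum-cong-≗ (λ i → merge i (i Fin.≟ j))))
       where
       single-term : ∀ {n} (d : Fin n → ℕ) j i → Dec (i ≡ j) → ℕ
       single-term d j i (yes _) = d i
       single-term d j i (no  _) = 0
       dec-irr : ∀ {n} (d : Fin n → ℕ) j i (a b : Dec (i ≡ j)) → single-term d j i a ≡ single-term d j i b
       dec-irr d j i (yes _) (yes _) = refl
       dec-irr d j i (no  _) (no  _) = refl
       dec-irr d j i (yes p) (no np) = ⊥-elim (np p)
       dec-irr d j i (no np) (yes p) = ⊥-elim (np p)
       single : ∀ n (d : Fin n → ℕ) j (f : ∀ i → Dec (i ≡ j)) → sum (λ i → single-term d j i (f i)) ≡ d j
       single (suc n) d zero f = trans (cong₂ _+_ (dec-irr d zero zero (f zero) (yes refl))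
         (trans (sum-cong-≗ (λ i → dec-irr d zero (suc i) (f (suc i)) (no λ ()))) (sum-replicate-zero n))) (Nat.+-identityʳ _)
       single (suc n) d (suc j) f = cong₂ _+_ (dec-irr d (suc j) zero (f zero) (no λ ()))
         (trans (sum-cong-≗ (λ i → shift i (f (suc i)))) (single n (d ∘ suc) j (λ i → i Fin.≟ j)))
         where
         shift : ∀ i (a : Dec (suc i ≡ suc j)) → single-term d (suc j) (suc i) a ≡ single-term (d ∘ suc) j i (i Fin.≟ j)
         shift i a with i Fin.≟ j
         ... | yes p = dec-irr d (suc j) (suc i) a (yes (cong suc p))
         ... | no np = dec-irr d (suc j) (suc i) a (no (np ∘ Finₚ.suc-injective))
       merge : ∀ i (b : Dec (i ≡ j)) → single-term d j i b + d i * occ i τ ≡ d i * bump b (occ i τ)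
       merge i (yes _) = sym (Nat.*-suc (d i) (occ i τ))
       merge i (no  _) = refl

 module RepTypes (K : FiniteField) (ms : List ℕ) (nz : All NonZero ms)
                 (S : Splitting (GroupAlgebra.groupRing K (FromList.group ms nz))) where
   open Homs K ms nz
   open GLn K
   open Splitting S using (k)
   open SplittingP S
   open SortedLabels S
   open FiniteField K using (size)
   open GroupAlgebra K (FromList.group ms nz) using (ι; ι-+; ι-*; ι-1)
   private
     q = size
     asK = Structures.asK S ι ι-+ ι-* ι-1

   d : Fin k → ℕ
   d i = proj₁ (dimension (asK (corner i)))

   Q≡ : ∀ i → Q i ≡ q ^ d i
   Q≡ i = card-iso (proj₂ (dimension (asK (corner i))))

   open Weights q d Q≡ public

   d>0 : ∀ i → 0 < d i
   d>0 i = go (d i) (Q≡ i)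
     where
     go : ∀ x → Q i ≡ q ^ x → 0 < x
     go zero    h = ⊥-elim (Nat.<-irrefl (sym h) (Q≥2 i))
     go (suc x) h = s≤s z≤n

   module _ {n : ℕ} (ρ : Rep n) where
     open Frame (repModule ρ)
     private
       ff = full-frame

     mult : Fin k → ℕ
     mult i = occ i (proj₁ ff)

     dimU-mult : ∀ i → dimU i ≡ Q i ^ mult i
     dimU-mult = dimU-full (proj₁ ff) (proj₁ (proj₂ ff)) (proj₂ (proj₂ ff))

     mult-total : sum (λ i → d i * mult i) ≡ n
     mult-total = trans (sym (wt-occ (proj₁ ff))) (^-injective (trans (sym (card-coef (proj₁ ff)))
       (trans (card-cong (Module.finiteV (coefModule (proj₁ ff))) (Module.finiteV (Vₙ n)) (full-↔ (proj₁ ff) (proj₁ (proj₂ ff)) (proj₂ (proj₂ ff))))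
              (card-Vec (CRing.finiteC (fieldRing K)) n))))

   -- Dimensions of the isotypic parts rather than multiplicities: they add up to `n`, so the types
   -- are among the compositions of `n`, as in the coefficient of a product of series.
   dims : ∀ {n} → Rep n → Vec ℕ k
   dims ρ = tabulate (λ i → d i * mult ρ i)

   OfType : ∀ n → Vec ℕ k → Set
   OfType n u = Σ (Rep n) (λ ρ → dims ρ ≡ u)

   abstract
     finite-OfType : ∀ n u → Finite (OfType n u)
     finite-OfType n u = finite-sub (finite-Rep n) (λ _ → uip) (λ ρ → Vecₚ.≡-dec Nat._≟_ (dims ρ) u)

     ∑-OfType : ∀ n u (f : Rep n → ℕ) c → (∀ ρ → dims ρ ≡ u → f ρ ≡ c) → (∀ ρ → dims ρ ≢ u → f ρ ≡ 0) →
                ∑ (finite-Rep n) f ≡ card (finite-OfType n u) * c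
     ∑-OfType n u f c = ∑-indicator (finite-Rep n) (λ _ → uip) (λ ρ → Vecₚ.≡-dec Nat._≟_ (dims ρ) u) f c

   type-empty : ∀ n u i → ¬ (d i ∣ lookup u i) → card (finite-OfType n u) ≡ 0
   type-empty n u i nd = Nat.n≤0⇒n≡0 (injective⇒card≤ (finite-OfType n u) (finite-Fin 0) to (λ {x} _ → ⊥-elim (absurd x)))
     where
     absurd : OfType n u → ⊥
     absurd (ρ , e) = nd (subst (d i ∣_) (trans (sym (Vecₚ.lookup∘tabulate (λ i → d i * mult ρ i) i)) (cong (λ v → lookup v i) e)) (m∣m*n (mult ρ i)))
     to : OfType n u → Fin 0
     to x = ⊥-elim (absurd x)

   module TypeCount (n : ℕ) (m : Fin k → ℕ) (tot : sum (λ i → d i * m i) ≡ n) where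
     private
       u : Vec ℕ k
       u = tabulate (λ i → d i * m i)

       τ : List (Fin k)
       τ = sortL m (allFin k)

       fr : ∀ (ρ : Rep n) → Frame.frames (repModule ρ) τ ≡ prod (λ i → glf (Q i ^ mult ρ i) (Q i) (m i))
       fr ρ = trans (frames-sortL (repModule ρ) m (allFin k) (Uniqueₚ.allFin⁺ k)) (trans (prodL-tabulate (λ i → glf (Frame.dimU (repModule ρ) i) (Q i) (m i)) (λ i → i))
         (prod-cong (λ i → cong (λ z → glf z (Q i) (m i)) (dimU-mult ρ i))))

       mult≡m : ∀ (ρ : Rep n) → dims ρ ≡ u → ∀ i → mult ρ i ≡ m i
       mult≡m ρ e i = Nat.*-cancelˡ-≡ (mult ρ i) (m i) (d i) {{Nat.>-nonZero (d>0 i)}}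
         (trans (sym (Vecₚ.lookup∘tabulate (λ i → d i * mult ρ i) i)) (trans (cong (λ v → lookup v i) e) (Vecₚ.lookup∘tabulate (λ i → d i * m i) i)))

       on : ∀ (ρ : Rep n) → dims ρ ≡ u → Frame.frames (repModule ρ) τ ≡ prod (λ i → gl (Q i) (m i))
       on ρ e = trans (fr ρ) (prod-cong (λ i → cong (λ z → glf (Q i ^ z) (Q i) (m i)) (mult≡m ρ e i)))

       off : ∀ (ρ : Rep n) → dims ρ ≢ u → Frame.frames (repModule ρ) τ ≡ 0
       off ρ ne = go (exceeds d m (mult ρ) d>0 (trans tot (sym (mult-total ρ))))
         where
         go : (∀ i → m i ≡ mult ρ i) ⊎ (∃ λ i → mult ρ i < m i) → Frame.frames (repModule ρ) τ ≡ 0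
         go (inj₁ same)     = ⊥-elim (ne (Vecₚ.tabulate-cong (λ i → cong (d i *_) (sym (same i)))))
         go (inj₂ (i , lt)) = trans (fr ρ) (prod-zero i (glf-vanish (Q i) lt))

       card-τ : card (Module.finiteV (coefModule τ)) ≡ q ^ n
       card-τ = trans (card-coef τ) (cong (q ^_) (trans (wt-sortL m (λ i → i)) tot))

     -- A representation of this type has `∏ |GL|` frames along `τ` and any other has none, while
     -- the pairs of a representation and a frame number `|GLₙ(K)|`.
     type-count : card (finite-OfType n (tabulate (λ i → d i * m i))) * prod (λ i → gl (Q i) (m i)) ≡ card (finite-GL n)
     type-count = trans (sym (∑-OfType n u (λ ρ → Frame.frames (repModule ρ) τ) (prod (λ i → gl (Q i) (m i))) on off))
       (Counted.frame-count S n τ card-τ)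

 module _ (K : FiniteField) where
   open GLn K
   open FiniteField K using (size)
   private
     KR = fieldRing K
     KS = fieldSplitting K
     module KSP = SplittingP KS
     module St = Structures KS (λ x → x) (λ _ _ → refl) (λ _ _ → refl) refl
     Q₀ : KSP.Q zero ≡ size
     Q₀ = card-cong (Module.finiteV (KSP.corner zero)) (CRing.finiteC KR) (mk↔ₛ′ proj₁ (λ x → x , CRing.*-identityˡ KR x) (λ _ → refl) (λ _ → Σ-prop-≡ (λ _ → uip) refl))

   -- The same count for the only `K`-module structure on `Kⁿ`: its frames of length `n` are the
   -- bases.
   card-GL : ∀ n → card (finite-GL n) ≡ gl size n
   card-GL n = trans (sym (Main.card-Pairs (λ _ _ _ → refl)
       (λ τ L → tt , λ a v → trans (sym (LinIso.g-f L _)) (cong (LinIso.g L) (LinIso.f-· L a v)))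
       (replicate n zero) (trans (card-coef (replicate n zero)) (cong (size ^_) (trans (wt-replicate n zero) (Nat.+-identityʳ n))))))
     (trans (Nat.+-identityʳ _) (trans (cong (λ τ → Frame.frames M τ) (sym (++-identity (replicate n zero)))) (trans (proj₂ (frames-replicate KS M zero n [] refl))
       (trans (Nat.+-identityʳ _) (cong₂ (λ a b → glf a b n) dimU₀ Q₀)))))
     where
     M : Module KR
     M = Vₙ n
     open KSP using (module Frame)
     idIso : LinIso (St.asK M) (Vₙ n)
     idIso = record { f = λ v → v ; f-+ = λ _ _ → refl ; f-· = λ _ _ → refl ; inj = λ h → h ; surj = λ w → w , refl }
     open St.Count n finite-⊤ (λ _ → M) (λ _ → idIso)
     Q≡size^1 : ∀ i → KSP.Q i ≡ size ^ 1
     Q≡size^1 zero = trans Q₀ (sym (Nat.*-identityʳ size))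
     open SortedLabels.Weights KS size (λ _ → 1) Q≡size^1
     ++-identity : ∀ (xs : List (Fin 1)) → xs ++ [] ≡ xs
     ++-identity []       = refl
     ++-identity (x ∷ xs) = cong (x ∷_) (++-identity xs)
     dimU₀ : Frame.dimU M zero ≡ size ^ n
     dimU₀ = trans (card-cong (Module.finiteV (Frame.U M zero)) (Module.finiteV M) (mk↔ₛ′ proj₁ (λ x → x , Module.·-identity M x) (λ _ → refl) (λ _ → Σ-prop-≡ (λ _ → uip) refl)))
                   (card-Vec (CRing.finiteC KR) n)

-- Degrees of the simple modules

module Degrees where
 open import Defs using (FiniteField; groupElems)
 open Counting
 open Rings
 open Frames
 open GL
 open Split
 open FieldFacts
 open GroupAlg
 open Groups
 open Types
 open Nat using (_+_; _*_; _^_)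
 open import Data.Vec using (lookup)
 open import Algebra.Properties.CommutativeMonoid.Sum Nat.+-0-commutativeMonoid using (sum; sum-cong-≗)

 least : {P : ℕ → Set} → (∀ a → Dec (P a)) → ∀ R → P R → ∃ λ a → a ≤ R × P a × (∀ b → b < a → ¬ P b)
 least P? zero    h = 0 , z≤n , h , λ _ ()
 least {P} P? (suc R) h with P? 0
 ... | yes p = 0 , z≤n , p , λ _ ()
 ... | no np with least (λ a → P? (suc a)) R h
 ... | a , a≤ , p , min = suc a , s≤s a≤ , p , λ { zero _ → np ; (suc b) (s≤s lt) → min b lt }

 p∤⇒coprime : ∀ {p} → Prime p → ∀ {c} → ¬ (p ∣ c) → Coprime c p
 p∤⇒coprime pr {c} nd {i} (i∣c , i∣p) with prime⇒irreducible pr i∣p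
 ... | inj₁ i≡1  = i≡1
 ... | inj₂ refl = ⊥-elim (nd i∣c)

 coprime∣pow : ∀ {p} → Prime p → ∀ {c} → ¬ (p ∣ c) → ∀ {b x} → c ∣ p ^ b * x → c ∣ x
 coprime∣pow pr nd {zero}  {x} h = subst (_ ∣_) (Nat.+-identityʳ x) h
 coprime∣pow {p} pr {c} nd {suc b} {x} h = coprime∣pow pr nd {b} (coprime-divisor (p∤⇒coprime pr nd) (subst (c ∣_) (Nat.*-assoc p (p ^ b) x) h))

 divisor-of-power : ∀ {p} → Prime p → ∀ b g → g ∣ p ^ suc b → (g ≡ p ^ suc b) ⊎ (g ∣ p ^ b)
 divisor-of-power {p} pr b g (divides c eq) with p ∣? c
 ... | yes (divides c′ refl) = inj₂ (divides c′ (Nat.*-cancelˡ-≡ (p ^ b) (c′ * g) p {{prime⇒nonZero pr}}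
         (trans eq (trans (cong (_* g) (Nat.*-comm c′ p)) (Nat.*-assoc p c′ g)))))
 ... | no nd = inj₁ (sym (trans eq (trans (cong (_* g) c≡1) (Nat.+-identityʳ g))))
   where
   c≡1 : c ≡ 1
   c≡1 = ∣1⇒≡1 (coprime∣pow pr nd {suc b} (divides g (trans (Nat.*-identityʳ (p ^ suc b)) (trans eq (Nat.*-comm c g)))))

 module RingPowers (A : CRing) where
   open CRing A renaming (_^_ to _^ʳ_)

   one^ : ∀ n → 𝟙 ^ʳ n ≡ 𝟙
   one^ zero    = refl
   one^ (suc n) = trans (*-identityˡ _) (one^ n)

   pow-mult : ∀ {x m} n → x ^ʳ m ≡ 𝟙 → x ^ʳ (n * m) ≡ 𝟙
   pow-mult {x} {m} n h = trans (cong (x ^ʳ_) (Nat.*-comm n m)) (trans (sym (^-assocʳ x m n)) (trans (cong (_^ʳ n) h) (one^ n)))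

   pow-gcd : ∀ x m n → x ^ʳ m ≡ 𝟙 → x ^ʳ n ≡ 𝟙 → x ^ʳ gcd m n ≡ 𝟙
   pow-gcd x m n hm hn with Bézout.identity (gcd-GCD m n)
   ... | Bézout.+- a b eq = trans (sym (*-identityʳ _)) (trans (cong (x ^ʳ gcd m n ⊗_) (sym (pow-mult {x} {n} b hn)))
           (trans (sym (^-homo-* x (gcd m n) (b * n))) (trans (cong (x ^ʳ_) eq) (pow-mult {x} {m} a hm))))
   ... | Bézout.-+ a b eq = trans (sym (*-identityʳ _)) (trans (cong (x ^ʳ gcd m n ⊗_) (sym (pow-mult {x} {m} a hm)))
           (trans (sym (^-homo-* x (gcd m n) (a * m))) (trans (cong (x ^ʳ_) eq) (pow-mult {x} {n} b hn))))

   -- The greatest common divisor of `p^(b+1)` and `n` also annihilates `x`; were it a proper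
   -- divisor of `p^(b+1)`, it would divide `p^b`.
   exact-order : ∀ {p} → Prime p → ∀ x b n → x ^ʳ (p ^ suc b) ≡ 𝟙 → x ^ʳ (p ^ b) ≢ 𝟙 → x ^ʳ n ≡ 𝟙 → p ^ suc b ∣ n
   exact-order {p} pr x b n h₁ h₀ hn with divisor-of-power pr b (gcd (p ^ suc b) n) (gcd[m,n]∣m (p ^ suc b) n)
   ... | inj₁ e = subst (_∣ n) e (gcd[m,n]∣n (p ^ suc b) n)
   ... | inj₂ (divides c e) = ⊥-elim (h₀ (trans (cong (x ^ʳ_) e) (pow-mult {x} {gcd (p ^ suc b) n} c (pow-gcd x (p ^ suc b) n h₁ hn))))

 -- Monic polynomials of degree n, by their lower coefficients.
 module RootBound (L : FiniteField) where
   open FiniteField L using (size; 0≢1)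
   open FieldOrder L using (no-zero-divisors)
   open CRing (fieldRing L) renaming (_^_ to _^ʳ_)
   open import Algebra.Properties.Ring ring using (-‿distribʳ-*; -‿distribˡ-*)
   open import Algebra.Properties.Group +-group using (x∙y⁻¹≈ε⇒x≈y)

   ev : ∀ {n} → Vec Carrier n → Carrier → Carrier
   ev []       x = 𝟙
   ev (c ∷ cs) x = c ⊕ x ⊗ ev cs x

   quot : ∀ {n} → Vec Carrier (suc n) → Carrier → Vec Carrier n
   quot (c ∷ [])      r = []
   quot (c ∷ c′ ∷ cs) r = ev (c′ ∷ cs) r ∷ quot (c′ ∷ cs) r

   private
     infixl 6 _⊝_
     _⊝_ : Carrier → Carrier → Carrier
     a ⊝ b = a ⊕ ⊖ b

     cancel-c : ∀ c a b → (c ⊕ a) ⊝ (c ⊕ b) ≡ a ⊝ b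
     cancel-c c a b = trans (cong (c ⊕ a ⊕_) (trans (sym (⁻¹-∙-comm c b)) (+-comm (⊖ c) (⊖ b))))
       (trans (cong (_⊕ (⊖ b ⊕ ⊖ c)) (+-comm c a)) (trans (+-assoc a c _) (trans (cong (a ⊕_) (trans (cong (c ⊕_) (+-comm (⊖ b) (⊖ c)))
         (trans (sym (+-assoc c (⊖ c) (⊖ b))) (trans (cong (_⊕ ⊖ b) (-‿inverseʳ c)) (+-identityˡ _))))) refl)))
       where open import Algebra.Properties.AbelianGroup +-abelianGroup using (⁻¹-∙-comm)

     mul-⊝ : ∀ x a b → x ⊗ a ⊝ x ⊗ b ≡ x ⊗ (a ⊝ b)
     mul-⊝ x a b = trans (cong (x ⊗ a ⊕_) (-‿distribʳ-* x b)) (sym (distribˡ x a (⊖ b)))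

     ⊝-mul : ∀ x y a → x ⊗ a ⊝ y ⊗ a ≡ (x ⊝ y) ⊗ a
     ⊝-mul x y a = trans (cong (x ⊗ a ⊕_) (-‿distribˡ-* y a)) (sym (distribʳ a x (⊖ y)))

     telescope : ∀ a b c → a ⊝ c ≡ (b ⊝ c) ⊕ (a ⊝ b)
     telescope a b c = sym (trans (+-comm (b ⊝ c) (a ⊝ b)) (trans (+-assoc a (⊖ b) (b ⊝ c)) (cong (a ⊕_)
       (trans (sym (+-assoc (⊖ b) b (⊖ c))) (trans (cong (_⊕ ⊖ c) (-‿inverseˡ b)) (+-identityˡ _))))))

   division : ∀ {n} (cs : Vec Carrier (suc n)) x r → ev cs x ⊝ ev cs r ≡ (x ⊝ r) ⊗ ev (quot cs r) x
   division (c ∷ [])        x r = trans (cancel-c c (x ⊗ 𝟙) (r ⊗ 𝟙)) (⊝-mul x r 𝟙)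
   division (c ∷ cs@(_ ∷ _)) x r = begin
     (c ⊕ x ⊗ f) ⊝ (c ⊕ r ⊗ g)      ≡⟨ cancel-c c (x ⊗ f) (r ⊗ g) ⟩
     x ⊗ f ⊝ r ⊗ g                  ≡⟨ telescope (x ⊗ f) (x ⊗ g) (r ⊗ g) ⟩
     (x ⊗ g ⊝ r ⊗ g) ⊕ (x ⊗ f ⊝ x ⊗ g) ≡⟨ cong₂ _⊕_ (⊝-mul x r g) (trans (mul-⊝ x f g) (trans (cong (x ⊗_) (division cs x r))
          (trans (sym (*-assoc x (x ⊝ r) h)) (trans (cong (_⊗ h) (*-comm x (x ⊝ r))) (*-assoc (x ⊝ r) x h))))) ⟩
     (x ⊝ r) ⊗ g ⊕ (x ⊝ r) ⊗ (x ⊗ h) ≡⟨ sym (distribˡ (x ⊝ r) g (x ⊗ h)) ⟩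
     (x ⊝ r) ⊗ (g ⊕ x ⊗ h) ∎
     where
     open ≡-Reasoning
     f = ev cs x
     g = ev cs r
     h = ev (quot cs r) x

   -- One root is divided off at a time; the others remain roots of the quotient because their
   -- differences from it are nonzero.
   too-many-roots : ∀ {n} (cs : Vec Carrier n) (r : Fin (suc n) → Carrier) → (∀ {i j} → r i ≡ r j → i ≡ j) →
                    ¬ (∀ i → ev cs (r i) ≡ 𝟘)
   too-many-roots []            r inj h = 0≢1 (sym (h zero))
   too-many-roots {suc n} cs    r inj h = too-many-roots (quot cs (r zero)) (r ∘ suc) (λ e → Finₚ.suc-injective (inj e))
     (λ i → no-zero-divisors {r (suc i) ⊝ r zero} (trans (sym (division cs (r (suc i)) (r zero)))
         (trans (cong₂ _⊝_ (h (suc i)) (h zero)) (-‿inverseʳ 𝟘)))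
       (λ e → Finₚ.0≢1+n (sym (inj (x∙y⁻¹≈ε⇒x≈y _ _ e)))))

   power : ∀ n → Vec Carrier n
   power zero    = []
   power (suc n) = 𝟘 ∷ power n

   ev-power : ∀ n x → ev (power n) x ≡ x ^ʳ n
   ev-power zero    x = refl
   ev-power (suc n) x = trans (+-identityˡ _) (cong (x ⊗_) (ev-power n x))

   fixed⇒size≤ : ∀ N → 2 ≤ N → (∀ x → x ^ʳ N ≡ x) → size ≤ N
   fixed⇒size≤ (suc zero)    (s≤s ()) h
   fixed⇒size≤ (suc (suc n)) _ h with size Nat.≤? suc (suc n)
   ... | yes le = le
   -- The vector lists the lower coefficients of `x^N − x`, where `N` is `suc (suc n)`.
   ... | no gt = ⊥-elim (too-many-roots (𝟘 ∷ ⊖ 𝟙 ∷ power n) r r-inj root)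
     where
     open Finite finiteC
     r : Fin (suc (suc (suc n))) → Carrier
     r i = enum (Fin.inject≤ i (Nat.≰⇒> gt))
     r-inj : ∀ {i j} → r i ≡ r j → i ≡ j
     r-inj {i} {j} e = Finₚ.inject≤-injective _ _ i j (trans (sym (idx-enum _)) (trans (cong idx e) (idx-enum _)))
     root : ∀ i → ev (𝟘 ∷ ⊖ 𝟙 ∷ power n) (r i) ≡ 𝟘
     root i = trans (+-identityˡ _) (trans (distribˡ x (⊖ 𝟙) (x ⊗ ev (power n) x)) (trans (cong₂ _⊕_ (trans (sym (-‿distribʳ-* x 𝟙)) (cong ⊖_ (*-identityʳ x)))
         (trans (cong (λ z → x ⊗ (x ⊗ z)) (ev-power n x)) (h x))) (-‿inverseˡ x)))
       where x = r i

 powers-nonZero : ∀ p .{{_ : NonZero p}} (js : List ℕ) → All NonZero (List.map (p ^_) js)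
 powers-nonZero p []       = []
 powers-nonZero p (j ∷ js) = Nat.m^n≢0 p j ∷ powers-nonZero p js

 reduced-nonZero : ∀ p .{{_ : NonZero p}} a (js : List ℕ) → All NonZero (List.map (λ j → p ^ (a ⊓ j)) js)
 reduced-nonZero p a []       = []
 reduced-nonZero p a (j ∷ js) = Nat.m^n≢0 p (a ⊓ j) ∷ reduced-nonZero p a js

 -- `p^R` annihilates the group and divides `q^M − 1`, so `x ↦ x^(q^M)` is the identity on the group
 -- algebra. This is the hypothesis of `splitting` and takes the place of Maschke's theorem.
 module Degree (K : FiniteField) {ℓ : ℕ} (ℓ-prime : Prime ℓ) (c : ℕ) (size≡ : FiniteField.size K ≡ ℓ ^ c)
   {p : ℕ} (p-prime : Prime p) (js : List ℕ) (R : ℕ) (js≤R : All (_≤ R) js)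
   (M : ℕ) (M>0 : 0 < M) (p^R∣ : p ^ R ∣ FiniteField.size K ^ M ∸ 1) where

   private
     instance
       p≢0 : NonZero p
       p≢0 = prime⇒nonZero p-prime
     q = FiniteField.size K
   open GLn K using (size≥2; Vₙ; dimension; card-iso; ^-injective)

   ms : List ℕ
   ms = List.map (p ^_) js

   nz : All NonZero ms
   nz = powers-nonZero p js

   open FromList ms nz
   open GroupAlgebra K group
   private
     module R = CRing groupRing
     module K = CRing (fieldRing K)

   pow-kill : ∀ n → p ^ R ∣ n → ∀ g → pow g n ≡ ε
   pow-kill n h g = pow-ε n (Allₚ.map⁺ (All.map (λ j≤R → ∣-trans (pow∣pow p j≤R) h) js≤R)) g

   q^>1 : ∀ m → 0 < m → 2 ≤ q ^ m
   q^>1 (suc m) _ = Nat.≤-trans size≥2 (Nat.m≤m*n q (q ^ m) {{Nat.>-nonZero (Nat.m^n>0 q {{Nat.>-nonZero (Nat.≤-trans (s≤s z≤n) size≥2)}} m)}})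

   suc-pred : ∀ m → 0 < m → suc (q ^ m ∸ 1) ≡ q ^ m
   suc-pred m h = Nat.m+[n∸m]≡n (Nat.≤-trans (s≤s z≤n) (q^>1 m h))

   fixed-by-frobenius : ∀ m e → 0 < m → e ⊛ e ≡ e → (∀ g → γ (pow g (q ^ m ∸ 1)) ⊛ e ≡ e) → ∀ x → (x R.^ (q ^ m)) ⊛ e ≡ x ⊛ e
   fixed-by-frobenius m e m>0 ee h = frobenius-fixed ℓ-prime c size≡ m e ee (λ g →
     trans (cong (_⊛ e) (trans (γ-pow g (q ^ m)) (trans (cong (λ z → γ (pow g z)) (sym (suc-pred m m>0))) (sym (γ-∙ g (pow g (q ^ m ∸ 1)))))))
       (trans (R.*-assoc (γ g) (γ (pow g (q ^ m ∸ 1))) e) (cong (γ g ⊛_) (h g))))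

   private
     t : ℕ
     t = q ^ M ∸ 2

     t-eq : suc (suc t) ≡ q ^ M
     t-eq = Nat.m+[n∸m]≡n (q^>1 M M>0)

   x^X : ∀ x → x R.^ suc (suc t) ≡ x
   x^X x = trans (cong (x R.^_) t-eq) (trans (sym (R.*-identityʳ (x R.^ (q ^ M)))) (trans
     (fixed-by-frobenius M (γ ε) M>0 (⊛-identityˡ (γ ε)) (λ g → trans (R.*-identityʳ (γ (pow g (q ^ M ∸ 1)))) (cong γ (pow-kill (q ^ M ∸ 1) p^R∣ g))) x) (R.*-identityʳ x)))

   abstract
     S : Splitting groupRing
     S = splitting groupRing t x^X

   open Splitting S
   open SplittingP S
   open RepTypes K ms nz S public using (d; Q≡; d>0; dims; OfType; finite-OfType; type-empty; module TypeCount; wt; card-coef; wt-occ)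

   Triv : Fin k → ℕ → Set
   Triv i a = ∀ g → γ (pow g (p ^ a)) ⊛ e i ≡ e i

   triv? : ∀ i a → Dec (Triv i a)
   triv? i a = Finₚ.all? (λ g → (γ (pow g (p ^ a)) ⊛ e i) R.≟ e i)

   γ-pow-mult : ∀ g m n e → γ (pow g m) ⊛ e ≡ e → γ (pow g (n * m)) ⊛ e ≡ e
   γ-pow-mult g m zero    e h = R.*-identityˡ e
   γ-pow-mult g m (suc n) e h = trans (cong (_⊛ e) (trans (sym (γ-pow g (m + n * m))) (trans (R.^-homo-* (γ g) m (n * m)) (cong₂ _⊛_ (γ-pow g m) (γ-pow g (n * m))))))
     (trans (R.*-assoc (γ (pow g m)) (γ (pow g (n * m))) e) (trans (cong (γ (pow g m) ⊛_) (γ-pow-mult g m n e h)) h))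

   triv-∣ : ∀ i a n → Triv i a → p ^ a ∣ n → ∀ g → γ (pow g n) ⊛ e i ≡ e i
   triv-∣ i a .(c * p ^ a) h (divides c refl) g = γ-pow-mult g (p ^ a) c (e i) (h g)

   level-data : ∀ i → ∃ λ a → a ≤ R × Triv i a × (∀ b → b < a → ¬ Triv i b)
   level-data i = least (triv? i) R (λ g → trans (cong (λ z → γ z ⊛ e i) (pow-kill (p ^ R) ∣-refl g)) (R.*-identityˡ (e i)))

   -- `p ^ level i` is the exponent of the image of the group in the field `e i A`.
   level : Fin k → ℕ
   level i = proj₁ (level-data i)

   level≤R : ∀ i → level i ≤ R
   level≤R i = proj₁ (proj₂ (level-data i))

   level-triv : ∀ i → Triv i (level i)
   level-triv i = proj₁ (proj₂ (proj₂ (level-data i)))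

   triv⇒level≤ : ∀ i a → Triv i a → level i ≤ a
   triv⇒level≤ i a h = Nat.≮⇒≥ (λ lt → proj₂ (proj₂ (proj₂ (level-data i))) a lt h)

   field′ : Fin k → FiniteField
   field′ = cornerField S

   size-field : ∀ i → FiniteField.size (field′ i) ≡ q ^ d i
   size-field i = trans (cornerField-size S i) (Q≡ i)

   corner-pow : ∀ i (x : FiniteField.Carrier (field′ i)) n → proj₁ (CRing._^_ (fieldRing (field′ i)) x n) ≡ (proj₁ x R.^ n) ⊛ e i
   corner-pow i x zero    = sym (R.*-identityˡ (e i))
   corner-pow i x (suc n) = trans (cong (proj₁ x ⊛_) (corner-pow i x n)) (sym (R.*-assoc (proj₁ x) (proj₁ x R.^ n) (e i)))

   -- If the level is positive, some group element has exact order `p ^ level i` in the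
   -- multiplicative group of the field, whose order is `q ^ d i ∸ 1`.
   degree-divides : ∀ i → p ^ level i ∣ q ^ d i ∸ 1
   degree-divides i = go (level i) refl
     where
     L = field′ i
     module L = CRing (fieldRing L)
     go : ∀ a → level i ≡ a → p ^ a ∣ q ^ d i ∸ 1
     go zero    _ = divides (q ^ d i ∸ 1) (sym (Nat.*-identityʳ _))
     go (suc b) h = moved (Finₚ.¬∀⟶∃¬ N _ (λ g → (γ (pow g (p ^ b)) ⊛ e i) R.≟ e i) (proj₂ (proj₂ (proj₂ (level-data i))) b (subst (b <_) (sym h) Nat.≤-refl)))
       where
       moved : (∃ λ g → ¬ (γ (pow g (p ^ b)) ⊛ e i ≡ e i)) → p ^ suc b ∣ q ^ d i ∸ 1
       moved (g , ne) = RingPowers.exact-order (fieldRing L) p-prime y b (q ^ d i ∸ 1)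
           (y-one (p ^ suc b) (subst (λ z → γ (pow g (p ^ z)) ⊛ e i ≡ e i) h (level-triv i g)))
           (λ z → ne (trans (sym (y-pow (p ^ b))) (cong proj₁ z)))
           (trans (cong (λ z → y L.^ (z ∸ 1)) (sym (size-field i))) (FieldOrder.fermat L y y≢0))
         where
         y : FiniteField.Carrier L
         y = e i ⊛ γ g , trans (sym (R.*-assoc (e i) (e i) (γ g))) (cong (_⊛ γ g) (idem i))
         epow : ∀ n → (e i R.^ n) ⊛ e i ≡ e i
         epow zero    = R.*-identityˡ (e i)
         epow (suc n) = trans (R.*-assoc (e i) (e i R.^ n) (e i)) (trans (cong (e i ⊛_) (epow n)) (idem i))
         y-pow : ∀ n → proj₁ (y L.^ n) ≡ γ (pow g n) ⊛ e i
         y-pow n = trans (corner-pow i y n) (trans (cong (_⊛ e i) (trans (R.^-distrib-* (e i) (γ g) n) (trans (R.*-comm (e i R.^ n) (γ g R.^ n)) (cong (_⊛ (e i R.^ n)) (γ-pow g n)))))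
           (trans (R.*-assoc (γ (pow g n)) (e i R.^ n) (e i)) (cong (γ (pow g n) ⊛_) (epow n))))
         y-one : ∀ n → γ (pow g n) ⊛ e i ≡ e i → y L.^ n ≡ L.𝟙
         y-one n h = Σ-prop-≡ (λ _ → uip) (trans (y-pow n) h)
         y≢0 : y ≢ L.𝟘
         y≢0 z = ne (trans (sym (y-pow (p ^ b))) (⊥-elim (nonzero i (trans (sym (triv-∣ i (suc b) (p ^ suc b) (subst (Triv i) h (level-triv i)) ∣-refl g))
           (trans (sym (y-pow (p ^ suc b))) (trans (cong (λ w → proj₁ (w L.^ (p ^ suc b))) z) (zero-pow (p ^ suc b) {{Nat.m^n≢0 p (suc b)}})))))))
           where
           zero-pow : ∀ n → {{NonZero n}} → proj₁ (L.𝟘 L.^ n) ≡ R.𝟘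
           zero-pow (suc n) = cong proj₁ (L.zeroˡ (L.𝟘 L.^ n))

   -- The `q^m`-th power fixes the images of the group elements and hence the whole field, which by
   -- the root bound has at most `q^m` elements.
   degree-minimal : ∀ i m → 0 < m → p ^ level i ∣ q ^ m ∸ 1 → d i ≤ m
   degree-minimal i m m>0 h = Nat.≮⇒≥ (λ lt → Nat.<⇒≱ (Nat.^-monoʳ-< q size≥2 lt) (subst (_≤ q ^ m) (size-field i)
     (RootBound.fixed⇒size≤ (field′ i) (q ^ m) (q^>1 m m>0) (λ x → Σ-prop-≡ (λ _ → uip) (trans (corner-pow i x (q ^ m))
       (trans (fixed-by-frobenius m (e i) m>0 (idem i) (triv-∣ i (level i) (q ^ m ∸ 1) (level-triv i) h) (proj₁ x)) (trans (R.*-comm (proj₁ x) (e i)) (proj₂ x))))))))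

   -- The elements fixed by all `p^a`-th powers in the group have two descriptions: the sum of the
   -- fields of level at most `a`, and the functions on the quotient group by those powers.
   -- Comparing dimensions yields `degree-sum`.
   module Invariants (a : ℕ) where
     Inv : A → Set
     Inv x = ∀ g → γ (pow g (p ^ a)) ⊛ x ≡ x

     inv? : ∀ x → Dec (Inv x)
     inv? x = Finₚ.all? (λ g → (γ (pow g (p ^ a)) ⊛ x) R.≟ x)

     inv-0 : Inv R.𝟘
     inv-0 g = R.zeroʳ (γ (pow g (p ^ a)))

     inv-+ : ∀ {u v} → Inv u → Inv v → Inv (u R.⊕ v)
     inv-+ {u} {v} hu hv g = trans (R.distribˡ (γ (pow g (p ^ a))) u v) (cong₂ R._⊕_ (hu g) (hv g))

     inv-· : ∀ r {v} → Inv v → Inv (r ⊛ v)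
     inv-· r {v} hv g = let G = γ (pow g (p ^ a)) in
       trans (sym (R.*-assoc G r v)) (trans (cong (_⊛ v) (R.*-comm G r)) (trans (R.*-assoc r G v) (cong (r ⊛_) (hv g))))

     invModule : Module groupRing
     invModule = subModule (selfModule groupRing) (λ x → True (inv? x)) (λ x → True-prop (inv? x)) (λ x → True-dec (inv? x))
       (fromWitness inv-0)
       (λ u v → fromWitness (inv-+ (toWitness u) (toWitness v)))
       (λ r p′ → fromWitness (inv-· r (toWitness p′)))
       where
       True-dec : {P : Set} (d : Dec P) → Dec (True d)
       True-dec (yes _) = yes _
       True-dec (no  _) = no λ ()

     open Frame invModule

     dim-low : ∀ i → level i ≤ a → dimU i ≡ Q i
     dim-low i le = card-cong (Module.finiteV (U i)) (Module.finiteV (corner i)) (mk↔ₛ′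
       (λ ((x , _) , h) → x , cong proj₁ h)
       (λ (x , h) → (x , fromWitness (λ g → trans (cong (γ (pow g (p ^ a)) ⊛_) (sym h)) (trans (sym (R.*-assoc (γ (pow g (p ^ a))) (e i) x))
           (trans (cong (_⊛ x) (triv-∣ i (level i) (p ^ a) (level-triv i) (pow∣pow p le) g)) h)))) , Σ-prop-≡ (λ x → True-prop (inv? x)) h)
       (λ _ → Σ-prop-≡ (λ _ → uip) refl)
       (λ _ → Σ-prop-≡ (λ _ → uip) (Σ-prop-≡ (λ x → True-prop (inv? x)) refl)))

     -- A nonzero invariant in the field `e i A` is invertible there, so `e i` would be invariant as
     -- well, contrary to the level.
     dim-high : ∀ i → a < level i → dimU i ≡ 1
     dim-high i lt = card-cong (Module.finiteV (U i)) (finite-Fin 1) (mk↔ₛ′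
       (λ _ → zero) (λ _ → Module.0ᵥ (U i)) (λ { zero → refl })
       (λ ((x , t) , h) → Σ-prop-≡ (λ _ → uip) (Σ-prop-≡ (λ x → True-prop (inv? x)) (sym (zero-x x (toWitness t) (cong proj₁ h) (x R.≟ R.𝟘))))))
       where
       zero-x : ∀ x → Inv x → e i ⊛ x ≡ x → Dec (x ≡ R.𝟘) → x ≡ R.𝟘
       zero-x x iv h (yes z) = z
       zero-x x iv h (no nz) = ⊥-elim (Nat.<⇒≱ lt (triv⇒level≤ i a (λ g →
         let (y , yx) = invert i x h nz ; G = γ (pow g (p ^ a)) in
         trans (cong (G ⊛_) (sym yx)) (trans (sym (R.*-assoc G y x)) (trans (cong (_⊛ x) (R.*-comm G y)) (trans (R.*-assoc y G x) (trans (cong (y ⊛_) (iv g)) yx)))))))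

     ms′ : List ℕ
     ms′ = List.map (λ j → p ^ (a ⊓ j)) js

     coset : Coset (p ^ a) ms ms′
     coset = pow-coset p a js

     open Cosets {p ^ a}
     open FromList ms′ (reduced-nonZero p a js) using () renaming (el to el′; el-valid to el′-valid; ix to ix′; el-ix to el′-ix; el-injective to el′-injective)
       renaming (N to N′)

     abstract
       invariants : Module.V invModule ↔ Vec K.Carrier (length (groupElems ms′))
       invariants = mk↔ₛ′ to from to-from from-to
         where
         emb : Fin (length (groupElems ms′)) → Fin N
         emb i = ix (emb-valid coset (el′-valid i))
         rd : Fin N → Fin (length (groupElems ms′))
         rd g = ix′ (red-valid coset (el-valid g))
         rd-emb : ∀ i → rd (emb i) ≡ i
         rd-emb i = el′-injective (trans (el′-ix (red-valid coset (el-valid (emb i)))) (trans (cong (red ms′) (el-ix (emb-valid coset (el′-valid i)))) (red-emb coset (el′-valid i))))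
         rd-shift : ∀ h g → rd (pow h (p ^ a) ∙ g) ≡ rd g
         rd-shift h g = el′-injective (trans (el′-ix (red-valid coset (el-valid (pow h (p ^ a) ∙ g)))) (trans (cong (red ms′) (trans (el-∙ (pow h (p ^ a)) g) (cong (λ z → Defs.groupMul ms z (el g)) (el-pow h (p ^ a)))))
           (trans (red-mul coset (el-valid h) (el-valid g)) (sym (el′-ix (red-valid coset (el-valid g)))))))
         quo : ∀ g → ∃ λ h → pow h (p ^ a) ∙ emb (rd g) ≡ g
         quo g = let (h , v , e) = quotient coset (el-valid g) in ix v , el-injective (trans (el-∙ (pow (ix v) (p ^ a)) (emb (rd g)))
           (trans (cong₂ (Defs.groupMul ms) (trans (el-pow (ix v) (p ^ a)) (cong (nsmul ms (p ^ a)) (el-ix v)))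
              (trans (el-ix (emb-valid coset (el′-valid (rd g)))) (el′-ix (red-valid coset (el-valid g))))) e))
         inv-coef : ∀ x → Inv x → ∀ h g → coef x (pow h (p ^ a) ∙ g) ≡ coef x g
         inv-coef x iv h g = trans (cong (λ z → coef z (pow h (p ^ a) ∙ g)) (sym (iv h))) (trans (γ-⊛ (pow h (p ^ a)) x _) (cong (coef x) (cancel₁ (pow h (p ^ a)) g)))
         to : Module.V invModule → Vec K.Carrier (length (groupElems ms′))
         to (x , _) = tabulate (λ i → coef x (emb i))
         from : Vec K.Carrier (length (groupElems ms′)) → Module.V invModule
         from y = x , fromWitness (λ h → vec-ext (λ g → trans (γ-⊛ (pow h (p ^ a)) x g) (trans (at _)
             (trans (cong (lookup y) (trans (sym (rd-shift h _)) (cong rd (cancel₂ (pow h (p ^ a)) g)))) (sym (at g))))))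
           where
           x : A
           x = tabulate (λ g → lookup y (rd g))
           at : ∀ g → coef x g ≡ lookup y (rd g)
           at g = Vecₚ.lookup∘tabulate (λ g → lookup y (rd g)) g
         to-from : ∀ y → to (from y) ≡ y
         to-from y = vec-ext (λ i → trans (Vecₚ.lookup∘tabulate (λ i → coef (proj₁ (from y)) (emb i)) i) (trans (Vecₚ.lookup∘tabulate (λ g → lookup y (rd g)) (emb i)) (cong (lookup y) (rd-emb i))))
         from-to : ∀ x → from (to x) ≡ x
         from-to (x , iv) = Σ-prop-≡ (λ x → True-prop (inv? x)) (vec-ext (λ g → trans (Vecₚ.lookup∘tabulate (λ g → lookup (to (x , iv)) (rd g)) g)
           (trans (Vecₚ.lookup∘tabulate (λ i → coef x (emb i)) (rd g)) (let (h , e) = quo g in trans (sym (inv-coef x (toWitness iv) h (emb (rd g)))) (cong (coef x) e)))))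

     card-inv : card (Module.finiteV invModule) ≡ q ^ length (groupElems ms′)
     card-inv = trans (card-cong (Module.finiteV invModule) (finite-Vec (CRing.finiteC (fieldRing K)) (length (groupElems ms′))) invariants) (card-Vec (CRing.finiteC (fieldRing K)) (length (groupElems ms′)))

     pick : ∀ {P : Set} → Dec P → ℕ → ℕ
     pick (yes _) n = n
     pick (no  _) n = 0

     degree-sum : sum (λ i → pick (level i Nat.≤? a) (d i)) ≡ length (groupElems ms′)
     degree-sum = ^-injective (trans (cong (q ^_) (trans (sum-cong-≗ (λ i → sym (occ-pick i (level i Nat.≤? a)))) (sym (wt-occ τ))))
       (trans (sym (trans (sym (card-cong (Module.finiteV (coefModule τ)) (Module.finiteV invModule) (full-↔ τ (proj₁ (proj₂ ff)) (proj₂ (proj₂ ff))))) (card-coef τ))) card-inv))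
       where
       ff = full-frame
       τ = proj₁ ff
       occ-pick : ∀ i (dec : Dec (level i ≤ a)) → d i * occ i τ ≡ pick dec (d i)
       occ-pick i (yes le) = trans (cong (d i *_) (Qinj i (trans (sym (dimU-full τ (proj₁ (proj₂ ff)) (proj₂ (proj₂ ff)) i)) (trans (dim-low i le) (sym (Nat.*-identityʳ _)))))) (Nat.*-identityʳ _)
         where
         Qinj : ∀ i {m n} → Q i ^ m ≡ Q i ^ n → m ≡ n
         Qinj i {m} {n} h = Nat.*-cancelˡ-≡ m n (d i) {{Nat.>-nonZero (d>0 i)}} (^-injective (trans (sym (q^d m)) (trans h (q^d n))))
           where
           q^d : ∀ m → Q i ^ m ≡ q ^ (d i * m)
           q^d m = trans (cong (_^ m) (Q≡ i)) (Nat.^-*-assoc q (d i) m)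
       occ-pick i (no gt) = trans (cong (d i *_) (zero-exp (occ i τ) (trans (sym (dimU-full τ (proj₁ (proj₂ ff)) (proj₂ (proj₂ ff)) i)) (dim-high i (Nat.≰⇒> gt))))) (Nat.*-zeroʳ (d i))
         where
         zero-exp : ∀ m → Q i ^ m ≡ 1 → m ≡ 0
         zero-exp zero    _ = refl
         zero-exp (suc m) h = ⊥-elim (Nat.<⇒≱ (Q≥2 i) (Nat.≤-trans (Nat.m≤m*n (Q i) (Q i ^ m) {{Nat.>-nonZero (Nat.m^n>0 (Q i) {{Nat.>-nonZero (Nat.≤-trans (s≤s z≤n) (Q≥2 i))}} m)}}) (Nat.≤-reflexive h)))

-- Valuations and binomial coefficients prime to p

module Valuation where
 open FieldFacts using (absorption)
 open Groups using (pow∣pow)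
 open Degrees using (coprime∣pow)
 open Nat using (_+_; _*_; _^_)
 open import Data.Nat.Combinatorics using (_C_)

 module _ {p : ℕ} (pr : Prime p) where
   private
     instance
       p≢0 : NonZero p
       p≢0 = prime⇒nonZero pr

   p>1 : 1 < p
   p>1 = Nat.nonTrivial⇒n>1 p {{prime⇒nonTrivial pr}}

   p∤1 : ¬ (p ∣ 1)
   p∤1 h = Nat.<⇒≱ p>1 (∣⇒≤ h)

   p∤* : ∀ {a b} → ¬ (p ∣ a) → ¬ (p ∣ b) → ¬ (p ∣ a * b)
   p∤* {a} {b} na nb h with euclidsLemma a b pr h
   ... | inj₁ x = na x
   ... | inj₂ x = nb x

   p∤⇒>0 : ∀ {a} → ¬ (p ∣ a) → 0 < a
   p∤⇒>0 {zero}  h = ⊥-elim (h (divides 0 refl))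
   p∤⇒>0 {suc a} h = s≤s z≤n

   record Val (n : ℕ) : Set where
     constructor mkVal
     field
       v    : ℕ
       u    : ℕ
       unit : ¬ (p ∣ u)
       eq   : n ≡ p ^ v * u

   valuation : ∀ n → 0 < n → Val n
   valuation n n>0 = go n n>0 (<-wellFounded n)
     where
     go : ∀ n → 0 < n → Acc _<_ n → Val n
     go n n>0 (acc rs) with p ∣? n
     ... | no nd = mkVal 0 n nd (sym (Nat.+-identityʳ n))
     ... | yes (divides q refl) with go q q>0 (rs (Nat.m<m*n q p {{Nat.>-nonZero q>0}} p>1))
       where
       q>0 : 0 < q
       q>0 = Nat.n≢0⇒n>0 (λ q≡0 → Nat.<-irrefl (sym (cong (_* p) q≡0)) n>0)
     ... | mkVal v u nu e = mkVal (suc v) u nu (trans (cong (_* p) e) (trans (Nat.*-comm _ p) (sym (Nat.*-assoc p (p ^ v) u))))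

   pow∣⇒≤ : ∀ {a v u} → ¬ (p ∣ u) → p ^ a ∣ p ^ v * u → a ≤ v
   pow∣⇒≤ {zero}          nu h = z≤n
   pow∣⇒≤ {suc a} {zero}  {u} nu h = ⊥-elim (nu (subst (p ∣_) (Nat.+-identityʳ u) (∣-trans (m∣m*n (p ^ a)) h)))
   pow∣⇒≤ {suc a} {suc v} {u} nu h = s≤s (pow∣⇒≤ nu (*-cancelˡ-∣ p (subst (p * p ^ a ∣_) (Nat.*-assoc p (p ^ v) u) h)))

   coprime-pow : ∀ {u} → ¬ (p ∣ u) → ∀ s → Coprime (p ^ s) u
   coprime-pow {u} nu s {c} (c∣ps , c∣u) = ∣1⇒≡1 (coprime∣pow pr (λ p∣c → nu (∣-trans p∣c c∣u)) {s} (subst (c ∣_) (sym (Nat.*-identityʳ (p ^ s))) c∣ps))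

   pow∣-unit : ∀ {u} → ¬ (p ∣ u) → ∀ s a → p ^ s ∣ a * u → p ^ s ∣ a
   pow∣-unit {u} nu s a h = coprime-divisor (coprime-pow nu s) (subst (p ^ s ∣_) (Nat.*-comm a u) h)

   -- p ∤ binom(p^s m − 1, j) for j < p^s, because j and p^s m − j have equal valuation.
   private
     next : ∀ n j → suc j * (n C suc j) + suc j * (n C j) ≡ suc n * (n C j)
     next n j = trans (sym (Nat.*-distribˡ-+ (suc j) (n C suc j) (n C j))) (trans (cong (suc j *_)
       (trans (Nat.+-comm (n C suc j) (n C j)) (nCk+nC[k+1]≡[n+1]C[k+1] n j))) (absorption n j))

     p∤binom : ∀ s m n → suc n ≡ p ^ s * m → ∀ j → j < p ^ s → ¬ (p ∣ (n C j))
     p∤binom s m n e zero    lt h = p∤1 (subst (p ∣_) refl h)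
     p∤binom s m n e (suc j) lt h with valuation (suc j) (s≤s z≤n)
     ... | mkVal t u nu eu = p∤binom s m n e j (Nat.<-trans (Nat.n<1+n j) lt) (back (euclidsLemma (n C j) (M ∸ u) pr (subst (p ∣_) (sym reduced) (∣-trans h (n∣m*n u)))))
       where
       t<s : t < s
       t<s = Nat.≰⇒> (λ s≤t → Nat.<⇒≱ lt (subst (p ^ s ≤_) (sym eu) (Nat.≤-trans (Nat.^-monoʳ-≤ p s≤t) (Nat.m≤m*n (p ^ t) u {{Nat.>-nonZero (p∤⇒>0 nu)}}))))
       M = p ^ (s ∸ t) * m
       pM : p ^ t * M ≡ suc n
       pM = trans (sym (Nat.*-assoc (p ^ t) _ m)) (trans (cong (_* m) (trans (sym (Nat.^-distribˡ-+-* p t (s ∸ t))) (cong (p ^_) (Nat.m+[n∸m]≡n (Nat.<⇒≤ t<s))))) (sym e))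
       instance
         pt≢0 : NonZero (p ^ t)
         pt≢0 = Nat.m^n≢0 p t
       scaled : u * (n C suc j) + u * (n C j) ≡ M * (n C j)
       scaled = Nat.*-cancelˡ-≡ _ _ (p ^ t) (trans (Nat.*-distribˡ-+ (p ^ t) _ _) (trans
         (cong₂ _+_ (trans (sym (Nat.*-assoc (p ^ t) u _)) (cong (_* (n C suc j)) (sym eu))) (trans (sym (Nat.*-assoc (p ^ t) u _)) (cong (_* (n C j)) (sym eu))))
         (trans (next n j) (trans (cong (_* (n C j)) (sym pM)) (Nat.*-assoc (p ^ t) M _)))))
       reduced : (n C j) * (M ∸ u) ≡ u * (n C suc j)
       reduced = trans (Nat.*-comm (n C j) (M ∸ u)) (trans (Nat.*-distribʳ-∸ (n C j) M u) (trans (cong (_∸ u * (n C j)) (sym scaled)) (Nat.m+n∸n≡m _ (u * (n C j)))))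
       u≤M : u ≤ M
       u≤M = Nat.*-cancelˡ-≤ (p ^ t) (subst₂ _≤_ eu (sym pM) (Nat.≤-trans (Nat.<⇒≤ lt) (subst (p ^ s ≤_) (sym e) (Nat.m≤m*n (p ^ s) m {{m≢0}}))))
         where
         m≢0 : NonZero m
         m≢0 = Nat.≢-nonZero (λ { refl → Nat.1+n≢0 (trans e (Nat.*-zeroʳ (p ^ s))) })
       p∣M : p ∣ M
       p∣M = ∣m⇒∣m*n m (subst (_∣ p ^ (s ∸ t)) (Nat.*-identityʳ p) (pow∣pow p {1} (Nat.m<n⇒0<n∸m t<s)))
       back : _ → p ∣ (n C j)
       back (inj₁ d) = d
       back (inj₂ d) = ⊥-elim (nu (∣m+n∣m⇒∣n (subst (p ∣_) (sym (Nat.m∸n+n≡m u≤M)) p∣M) d))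

   -- By `absorption` the binomial coefficient is `m` times `binom(p^s m − 1, p^s − 1)`.
   p∤binomial : ∀ s m → ¬ (p ∣ m) → ¬ (p ∣ ((p ^ s * m) C (p ^ s)))
   p∤binomial s m nm h = go (p ^ s * m) (p ^ s) refl refl (Nat.m^n>0 p s) (Nat.*-mono-< (Nat.m^n>0 p s) (p∤⇒>0 nm))
     where
     go : ∀ n k → n ≡ p ^ s * m → k ≡ p ^ s → 0 < k → 0 < n → ⊥
     go (suc n) (suc k) en ek _ _ = p∤* nm (p∤binom s m n en k (subst (k <_) ek (Nat.n<1+n k))) (subst (p ∣_) eq h)
       where
       eq : (p ^ s * m) C (p ^ s) ≡ m * (n C k)
       eq = Nat.*-cancelˡ-≡ _ _ (p ^ s) {{Nat.m^n≢0 p s}} (trans (cong₂ (λ a b → a * (b C a)) (sym ek) (sym en)) (trans (absorption n k)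
         (trans (cong (_* (n C k)) en) (Nat.*-assoc (p ^ s) m _))))

-- Rational numbers and their p-denominators

module Rat where
 open Nat using (_^_)
 open Int using (+_)
 open import Level using (0ℓ)

 private
   module Concrete where
     ⟦_⟧ : ℤ → ℚ
     ⟦ z ⟧ = z ℚ./ 1

     emb : ∀ z → toℚᵘ ⟦ z ⟧ ℚᵘ.≃ mkℚᵘ z 0
     emb z = ℚₚ.toℚᵘ-fromℚᵘ (mkℚᵘ z 0)

     ⟦⟧-* : ∀ a b → ⟦ a Int.* b ⟧ ≡ ⟦ a ⟧ ℚ.* ⟦ b ⟧
     ⟦⟧-* a b = ℚₚ.toℚᵘ-injective (ℚᵘₚ.≃-trans (emb (a Int.* b)) (ℚᵘₚ.≃-sym
       (ℚᵘₚ.≃-trans (ℚₚ.toℚᵘ-homo-* ⟦ a ⟧ ⟦ b ⟧) (ℚᵘₚ.≃-trans (ℚᵘₚ.*-cong (emb a) (emb b)) (*≡* refl)))))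

     ⟦⟧-+ : ∀ a b → ⟦ a Int.+ b ⟧ ≡ ⟦ a ⟧ ℚ.+ ⟦ b ⟧
     ⟦⟧-+ a b = ℚₚ.toℚᵘ-injective (ℚᵘₚ.≃-trans (emb (a Int.+ b)) (ℚᵘₚ.≃-sym
       (ℚᵘₚ.≃-trans (ℚₚ.toℚᵘ-homo-+ ⟦ a ⟧ ⟦ b ⟧) (ℚᵘₚ.≃-trans (ℚᵘₚ.+-cong (emb a) (emb b))
         (*≡* (cong (Int._* + 1) (cong₂ Int._+_ (Int.*-identityʳ a) (Int.*-identityʳ b))))))))

     ⟦⟧-neg : ∀ a → ⟦ Int.- a ⟧ ≡ ℚ.- ⟦ a ⟧
     ⟦⟧-neg a = ℚₚ.toℚᵘ-injective (ℚᵘₚ.≃-trans (emb (Int.- a)) (ℚᵘₚ.≃-sym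
       (ℚᵘₚ.≃-trans (ℚₚ.toℚᵘ-homo‿- ⟦ a ⟧) (ℚᵘₚ.-‿cong (emb a)))))

     ⟦⟧-injective : ∀ {a b} → ⟦ a ⟧ ≡ ⟦ b ⟧ → a ≡ b
     ⟦⟧-injective {a} {b} h with ℚᵘₚ.≃-trans (ℚᵘₚ.≃-sym (emb a)) (ℚᵘₚ.≃-trans (ℚₚ.toℚᵘ-cong h) (emb b))
     ... | *≡* e = trans (sym (Int.*-identityʳ a)) (trans e (Int.*-identityʳ b))

     recip : ℕ → ℚ
     recip zero    = ℚ.0ℚ
     recip (suc n) = + 1 ℚ./ suc n

     recip-inverse : ∀ n → .{{NonZero n}} → ⟦ + n ⟧ ℚ.* recip n ≡ ℚ.1ℚ
     recip-inverse (suc n) = ℚₚ.toℚᵘ-injective (ℚᵘₚ.≃-trans (ℚₚ.toℚᵘ-homo-* ⟦ + suc n ⟧ (recip (suc n)))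
       (ℚᵘₚ.≃-trans (ℚᵘₚ.*-cong (emb (+ suc n)) (ℚₚ.toℚᵘ-fromℚᵘ (mkℚᵘ (+ 1) n))) (*≡* (lem (+ suc n) refl))))
       where
       lem : ∀ x → x ≡ + suc n → (x Int.* + 1) Int.* + 1 ≡ + 1 Int.* + (1 Nat.* suc n)
       lem x refl = trans (Int.*-identityʳ _) (trans (Int.*-identityʳ _) (trans (cong +_ (sym (Nat.*-identityˡ (suc n)))) (sym (Int.*-identityˡ _))))

     fraction : ∀ a n → a ℚ./ suc n ≡ ⟦ a ⟧ ℚ.* recip (suc n)
     fraction a n = ℚₚ.toℚᵘ-injective (ℚᵘₚ.≃-trans (ℚₚ.toℚᵘ-fromℚᵘ (mkℚᵘ a n)) (ℚᵘₚ.≃-sym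
       (ℚᵘₚ.≃-trans (ℚₚ.toℚᵘ-homo-* ⟦ a ⟧ (recip (suc n))) (ℚᵘₚ.≃-trans (ℚᵘₚ.*-cong (emb a) (ℚₚ.toℚᵘ-fromℚᵘ (mkℚᵘ (+ 1) n)))
         (*≡* (cong₂ Int._*_ (Int.*-identityʳ a) (cong +_ (sym (Nat.*-identityˡ (suc n))))))))))

 infixl 6 _+_
 infixl 7 _*_
 infix  8 -_

 -- An opaque copy of ℚ: the arithmetic of the library's ℚ would otherwise be unfolded during unification.
 abstract
   F : Set
   F = ℚ

   _+_ _*_ : F → F → F
   _+_ = ℚ._+_
   _*_ = ℚ._*_

   -_ : F → F
   -_ = ℚ.-_

   0F 1F : F
   0F = ℚ.0ℚ
   1F = ℚ.1ℚ

   F-isCommutativeRing : IsCommutativeRing _≡_ _+_ _*_ -_ 0F 1F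
   F-isCommutativeRing = ℚₚ.+-*-isCommutativeRing

   fromℚ : ℚ → F
   fromℚ x = x

   ⟦_⟧ : ℤ → F
   ⟦_⟧ = Concrete.⟦_⟧

   ⟦⟧-* : ∀ a b → ⟦ a Int.* b ⟧ ≡ ⟦ a ⟧ * ⟦ b ⟧
   ⟦⟧-* = Concrete.⟦⟧-*

   ⟦⟧-+ : ∀ a b → ⟦ a Int.+ b ⟧ ≡ ⟦ a ⟧ + ⟦ b ⟧
   ⟦⟧-+ = Concrete.⟦⟧-+

   ⟦⟧-neg : ∀ a → ⟦ Int.- a ⟧ ≡ - ⟦ a ⟧
   ⟦⟧-neg = Concrete.⟦⟧-neg

   ⟦⟧-0 : ⟦ + 0 ⟧ ≡ 0F
   ⟦⟧-0 = refl

   ⟦⟧-1 : ⟦ + 1 ⟧ ≡ 1F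
   ⟦⟧-1 = refl

   ⟦⟧-injective : ∀ {a b} → ⟦ a ⟧ ≡ ⟦ b ⟧ → a ≡ b
   ⟦⟧-injective = Concrete.⟦⟧-injective

   recip : ℕ → F
   recip = Concrete.recip

   recip-inverse : ∀ n → .{{_ : NonZero n}} → ⟦ + n ⟧ * recip n ≡ 1F
   recip-inverse = Concrete.recip-inverse

   fraction : ∀ a n → fromℚ (a ℚ./ suc n) ≡ ⟦ a ⟧ * recip (suc n)
   fraction = Concrete.fraction

 fromℚ-normal : ∀ x → fromℚ x ≡ fromℚ (ℚ.↥ x ℚ./ suc (ℚ.denominator-1 x))
 fromℚ-normal x@record{} = cong fromℚ (sym (ℚₚ.↥p/↧p≡p x))

 F-ring : CommutativeRing 0ℓ 0ℓ
 F-ring = record { isCommutativeRing = F-isCommutativeRing }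

 module Fₚ = CommutativeRing F-ring
 open import Algebra.Properties.Ring Fₚ.ring using (-‿distribˡ-*; -‿distribʳ-*) public
 open NaturalSolver Fₚ.commutativeSemiring public using (solve; _:=_; _:+_; _:*_; con)

 # : ℕ → F
 # n = ⟦ + n ⟧

 #-+ : ∀ a b → # (a Nat.+ b) ≡ # a + # b
 #-+ a b = trans (cong ⟦_⟧ (Int.pos-+ a b)) (⟦⟧-+ (+ a) (+ b))

 #-* : ∀ a b → # (a Nat.* b) ≡ # a * # b
 #-* a b = trans (cong ⟦_⟧ (Int.pos-* a b)) (⟦⟧-* (+ a) (+ b))

 #-suc : ∀ a → # (suc a) ≡ 1F + # a
 #-suc a = trans (#-+ 1 a) (cong (_+ # a) ⟦⟧-1)

 cancel-# : ∀ n → .{{NonZero n}} → ∀ {x y} → # n * x ≡ # n * y → x ≡ y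
 cancel-# n {x} {y} h = trans (sym (lem x)) (trans (cong (recip n *_) h) (lem y))
   where
   lem : ∀ x → recip n * (# n * x) ≡ x
   lem x = trans (solve 3 (λ a b c → a :* (b :* c) := (b :* a) :* c) refl (recip n) (# n) x)
                 (trans (cong (_* x) (recip-inverse n)) (Fₚ.*-identityˡ x))

 recip-* : ∀ m n → .{{NonZero m}} → .{{NonZero n}} → recip (m Nat.* n) ≡ recip m * recip n
 recip-* m n = cancel-# (m Nat.* n) {{Nat.m*n≢0 m n}} (trans (recip-inverse (m Nat.* n) {{Nat.m*n≢0 m n}}) (sym
   (trans (cong (_* (recip m * recip n)) (#-* m n))
   (trans (solve 4 (λ a b c d → (a :* b) :* (c :* d) := (a :* c) :* (b :* d)) refl (# m) (# n) (recip m) (recip n))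
   (trans (cong₂ _*_ (recip-inverse m) (recip-inverse n)) (Fₚ.*-identityˡ 1F))))))

 module PIntegral {p : ℕ} (pr : Prime p) where
   private
     instance
       p≢0 : NonZero p
       p≢0 = prime⇒nonZero pr

   unit-* : ∀ {a b} → ¬ (p ∣ a) → ¬ (p ∣ b) → ¬ (p ∣ a Nat.* b)
   unit-* {a} {b} na nb h with euclidsLemma a b pr h
   ... | inj₁ x = na x
   ... | inj₂ x = nb x

   unit-1 : ¬ (p ∣ 1)
   unit-1 h = Nat.<⇒≱ (Nat.nonTrivial⇒n>1 p {{Data.Nat.Primality.prime⇒nonTrivial pr}}) (Data.Nat.Divisibility.∣⇒≤ h)
     where import Data.Nat.Primality
           import Data.Nat.Divisibility

   -- p^γ · x is p-integral.
   record Den (γ : ℕ) (x : F) : Set where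
     constructor mkDen
     field
       w     : ℕ
       u     : ℤ
       unit  : ¬ (p ∣ w)
       clear : x * # (w Nat.* p ^ γ) ≡ ⟦ u ⟧

   private
     P : ℕ → F
     P γ = # (p ^ γ)

     P-+ : ∀ a b → P (a Nat.+ b) ≡ P a * P b
     P-+ a b = trans (cong # (Nat.^-distribˡ-+-* p a b)) (#-* (p ^ a) (p ^ b))

   den-* : ∀ {γ δ x y} → Den γ x → Den δ y → Den (γ Nat.+ δ) (x * y)
   den-* {γ} {δ} {x} {y} (mkDen w u nw h) (mkDen w′ u′ nw′ h′) = mkDen (w Nat.* w′) (u Int.* u′) (unit-* nw nw′) (begin
     x * y * # (w Nat.* w′ Nat.* p ^ (γ Nat.+ δ))
       ≡⟨ cong (x * y *_) (trans (#-* (w Nat.* w′) (p ^ (γ Nat.+ δ))) (cong₂ _*_ (#-* w w′) (P-+ γ δ))) ⟩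
     x * y * (# w * # w′ * (P γ * P δ))
       ≡⟨ solve 6 (λ x y a b c d → (x :* y) :* ((a :* b) :* (c :* d)) := (x :* (a :* c)) :* (y :* (b :* d))) refl x y (# w) (# w′) (P γ) (P δ) ⟩
     x * (# w * P γ) * (y * (# w′ * P δ))
       ≡⟨ cong₂ (λ a b → x * a * (y * b)) (sym (#-* w _)) (sym (#-* w′ _)) ⟩
     x * # (w Nat.* p ^ γ) * (y * # (w′ Nat.* p ^ δ)) ≡⟨ cong₂ _*_ h h′ ⟩
     ⟦ u ⟧ * ⟦ u′ ⟧ ≡⟨ sym (⟦⟧-* u u′) ⟩
     ⟦ u Int.* u′ ⟧ ∎)
     where open ≡-Reasoning

   den-ℤ : ∀ z → Den 0 ⟦ z ⟧
   den-ℤ z = mkDen 1 z unit-1 (trans (cong (⟦ z ⟧ *_) ⟦⟧-1) (Fₚ.*-identityʳ ⟦ z ⟧))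

   den-mono : ∀ {γ δ x} → γ Nat.≤ δ → Den γ x → Den δ x
   den-mono {γ} {δ} {x} le (mkDen w u nw h) = mkDen w (u Int.* + (p ^ (δ Nat.∸ γ))) nw (begin
     x * # (w Nat.* p ^ δ) ≡⟨ cong (λ z → x * # (w Nat.* p ^ z)) (sym (Nat.m+[n∸m]≡n le)) ⟩
     x * # (w Nat.* p ^ (γ Nat.+ (δ Nat.∸ γ))) ≡⟨ cong (x *_) (trans (#-* w _) (cong (# w *_) (P-+ γ (δ Nat.∸ γ)))) ⟩
     x * (# w * (P γ * P (δ Nat.∸ γ))) ≡⟨ solve 4 (λ x a b c → x :* (a :* (b :* c)) := (x :* (a :* b)) :* c) refl x (# w) (P γ) (P (δ Nat.∸ γ)) ⟩
     x * (# w * P γ) * P (δ Nat.∸ γ) ≡⟨ cong (λ z → x * z * P (δ Nat.∸ γ)) (sym (#-* w _)) ⟩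
     x * # (w Nat.* p ^ γ) * P (δ Nat.∸ γ) ≡⟨ cong (_* P (δ Nat.∸ γ)) h ⟩
     ⟦ u ⟧ * P (δ Nat.∸ γ) ≡⟨ sym (⟦⟧-* u _) ⟩
     ⟦ u Int.* + (p ^ (δ Nat.∸ γ)) ⟧ ∎)
     where open ≡-Reasoning

   den-+ : ∀ {γ x y} → Den γ x → Den γ y → Den γ (x + y)
   den-+ {γ} {x} {y} (mkDen w u nw h) (mkDen w′ u′ nw′ h′) = mkDen (w Nat.* w′) (u Int.* + w′ Int.+ u′ Int.* + w) (unit-* nw nw′) (begin
     (x + y) * # (w Nat.* w′ Nat.* p ^ γ)
       ≡⟨ cong ((x + y) *_) (trans (#-* (w Nat.* w′) (p ^ γ)) (cong (_* P γ) (#-* w w′))) ⟩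
     (x + y) * (# w * # w′ * P γ)
       ≡⟨ solve 5 (λ x y a b c → (x :+ y) :* ((a :* b) :* c) := (x :* (a :* c)) :* b :+ (y :* (b :* c)) :* a) refl x y (# w) (# w′) (P γ) ⟩
     x * (# w * P γ) * # w′ + y * (# w′ * P γ) * # w
       ≡⟨ cong₂ (λ a b → x * a * # w′ + y * b * # w) (sym (#-* w _)) (sym (#-* w′ _)) ⟩
     x * # (w Nat.* p ^ γ) * # w′ + y * # (w′ Nat.* p ^ γ) * # w
       ≡⟨ cong₂ (λ a b → a * # w′ + b * # w) h h′ ⟩
     ⟦ u ⟧ * # w′ + ⟦ u′ ⟧ * # w ≡⟨ sym (trans (⟦⟧-+ (u Int.* + w′) (u′ Int.* + w)) (cong₂ _+_ (⟦⟧-* u (+ w′)) (⟦⟧-* u′ (+ w)))) ⟩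
     ⟦ u Int.* + w′ Int.+ u′ Int.* + w ⟧ ∎)
     where open ≡-Reasoning

   den-neg : ∀ {γ x} → Den γ x → Den γ (- x)
   den-neg {γ} {x} (mkDen w u nw h) = mkDen w (Int.- u) nw (trans (sym (-‿distribˡ-* x (# (w Nat.* p ^ γ)))) (trans (cong -_ h) (sym (⟦⟧-neg u))))

   den-0 : ∀ {γ} → Den γ 0F
   den-0 {γ} = mkDen 1 (+ 0) unit-1 (trans (Fₚ.zeroˡ (# (1 Nat.* p ^ γ))) (sym ⟦⟧-0))

   den-1 : Den 0 1F
   den-1 = subst (Den 0) ⟦⟧-1 (den-ℤ (+ 1))

   den-cancel-unit : ∀ {γ} d {x} → ¬ (p ∣ d) → Den γ (# d * x) → Den γ x
   den-cancel-unit {γ} d {x} nd (mkDen w u nw h) = mkDen (d Nat.* w) u (unit-* nd nw) (trans (cong (x *_) (trans (cong # (Nat.*-assoc d w _)) (#-* d (w Nat.* p ^ γ))))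
     (trans (solve 3 (λ x a b → x :* (a :* b) := (a :* x) :* b) refl x (# d) (# (w Nat.* p ^ γ))) h))

   den-recip-p : ∀ γ → Den γ (recip (p ^ γ))
   den-recip-p γ = mkDen 1 (+ 1) unit-1 (trans (Fₚ.*-comm (recip (p ^ γ)) _) (trans (cong (λ z → # z * recip (p ^ γ)) (Nat.*-identityˡ _))
     (trans (recip-inverse (p ^ γ) {{Nat.m^n≢0 p γ}}) (sym ⟦⟧-1))))

-- Power series and logarithmic derivatives

module Series where
 open Rat

 Series : Set
 Series = ℕ → F

 infixl 7 _⋆_
 infixl 6 _⊞_

 _⋆_ : Series → Series → Series
 (f ⋆ g) zero    = f 0 * g 0
 (f ⋆ g) (suc n) = f 0 * g (suc n) + ((f ∘ suc) ⋆ g) n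

 _⊞_ : Series → Series → Series
 (f ⊞ g) n = f n + g n

 infixr 8 _⊡_
 _⊡_ : F → Series → Series
 (c ⊡ f) n = c * f n

 one : Series
 one zero    = 1F
 one (suc n) = 0F

 -- θ = z d/dz
 θ : Series → Series
 θ f n = # n * f n

 ⋆-cong≤ : ∀ n {f f′ g g′ : Series} → (∀ i → i ≤ n → f i ≡ f′ i) → (∀ i → i ≤ n → g i ≡ g′ i) → (f ⋆ g) n ≡ (f′ ⋆ g′) n
 ⋆-cong≤ zero    h k = cong₂ _*_ (h 0 z≤n) (k 0 z≤n)
 ⋆-cong≤ (suc n) h k = cong₂ _+_ (cong₂ _*_ (h 0 z≤n) (k (suc n) Nat.≤-refl))
   (⋆-cong≤ n (λ i le → h (suc i) (s≤s le)) (λ i le → k i (Nat.m≤n⇒m≤1+n le)))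

 ⋆-cong : ∀ {f f′ g g′ : Series} → (∀ i → f i ≡ f′ i) → (∀ i → g i ≡ g′ i) → ∀ n → (f ⋆ g) n ≡ (f′ ⋆ g′) n
 ⋆-cong h k n = ⋆-cong≤ n (λ i _ → h i) (λ i _ → k i)

 ⋆-distribʳ : ∀ (f g h : Series) n → ((f ⊞ g) ⋆ h) n ≡ (f ⋆ h) n + (g ⋆ h) n
 ⋆-distribʳ f g h zero    = Fₚ.distribʳ (h 0) (f 0) (g 0)
 ⋆-distribʳ f g h (suc n) = trans (cong₂ _+_ (Fₚ.distribʳ (h (suc n)) (f 0) (g 0)) (⋆-distribʳ (f ∘ suc) (g ∘ suc) h n))
   (solve 4 (λ a b c d → (a :+ b) :+ (c :+ d) := (a :+ c) :+ (b :+ d)) refl (f 0 * h (suc n)) (g 0 * h (suc n)) _ _)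

 ⋆-scaleˡ : ∀ c (f g : Series) n → ((c ⊡ f) ⋆ g) n ≡ c * (f ⋆ g) n
 ⋆-scaleˡ c f g zero    = Fₚ.*-assoc c (f 0) (g 0)
 ⋆-scaleˡ c f g (suc n) = trans (cong₂ _+_ (Fₚ.*-assoc c (f 0) (g (suc n))) (⋆-scaleˡ c (f ∘ suc) g n)) (sym (Fₚ.distribˡ c _ _))

 ⋆-snoc : ∀ (f g : Series) n → (f ⋆ g) (suc n) ≡ (f ⋆ (g ∘ suc)) n + f (suc n) * g 0
 ⋆-snoc f g zero    = refl
 ⋆-snoc f g (suc n) = trans (cong (f 0 * g (suc (suc n)) +_) (⋆-snoc (f ∘ suc) g n)) (sym (Fₚ.+-assoc _ _ _))

 ⋆-comm : ∀ (f g : Series) n → (f ⋆ g) n ≡ (g ⋆ f) n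
 ⋆-comm f g zero    = Fₚ.*-comm (f 0) (g 0)
 ⋆-comm f g (suc n) = trans (cong₂ _+_ (Fₚ.*-comm (f 0) (g (suc n))) (⋆-comm (f ∘ suc) g n)) (trans (Fₚ.+-comm _ _) (sym (⋆-snoc g f n)))

 ⋆-assoc : ∀ (f g h : Series) n → ((f ⋆ g) ⋆ h) n ≡ (f ⋆ (g ⋆ h)) n
 ⋆-assoc f g h zero    = Fₚ.*-assoc (f 0) (g 0) (h 0)
 ⋆-assoc f g h (suc n) = begin
   f 0 * g 0 * h (suc n) + (((f 0 ⊡ (g ∘ suc)) ⊞ ((f ∘ suc) ⋆ g)) ⋆ h) n
     ≡⟨ cong (f 0 * g 0 * h (suc n) +_) (trans (⋆-distribʳ (f 0 ⊡ (g ∘ suc)) ((f ∘ suc) ⋆ g) h n)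
          (cong₂ _+_ (⋆-scaleˡ (f 0) (g ∘ suc) h n) (⋆-assoc (f ∘ suc) g h n))) ⟩
   f 0 * g 0 * h (suc n) + (f 0 * ((g ∘ suc) ⋆ h) n + ((f ∘ suc) ⋆ (g ⋆ h)) n)
     ≡⟨ solve 5 (λ a b c d e → a :* b :* c :+ (a :* d :+ e) := a :* (b :* c :+ d) :+ e) refl (f 0) (g 0) (h (suc n)) _ _ ⟩
   f 0 * (g ⋆ h) (suc n) + ((f ∘ suc) ⋆ (g ⋆ h)) n ∎
   where open ≡-Reasoning

 ⋆-zeroˡ : ∀ (g : Series) n → ((λ _ → 0F) ⋆ g) n ≡ 0F
 ⋆-zeroˡ g zero    = Fₚ.zeroˡ (g 0)
 ⋆-zeroˡ g (suc n) = trans (cong₂ _+_ (Fₚ.zeroˡ (g (suc n))) (⋆-zeroˡ g n)) (Fₚ.+-identityˡ 0F)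

 ⋆-identityˡ : ∀ (g : Series) n → (one ⋆ g) n ≡ g n
 ⋆-identityˡ g zero    = Fₚ.*-identityˡ (g 0)
 ⋆-identityˡ g (suc n) = trans (cong₂ _+_ (Fₚ.*-identityˡ (g (suc n))) (⋆-zeroˡ g n)) (Fₚ.+-identityʳ (g (suc n)))

 leibniz : ∀ (f g : Series) n → θ (f ⋆ g) n ≡ (θ f ⋆ g) n + (f ⋆ θ g) n
 leibniz f g zero    = trans (cong (_* (f 0 * g 0)) ⟦⟧-0) (sym (trans (cong₂ (λ a b → a * f 0 * g 0 + f 0 * (b * g 0)) ⟦⟧-0 ⟦⟧-0)
   (solve 2 (λ a b → con 0 :* a :* b :+ a :* (con 0 :* b) := con 0 :* (a :* b)) refl (f 0) (g 0))))
 leibniz f g (suc n) = begin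
   # (suc n) * (f 0 * g (suc n) + c)
     ≡⟨ cong (_* (f 0 * g (suc n) + c)) (#-suc n) ⟩
   (1F + # n) * (f 0 * g (suc n) + c)
     ≡⟨ solve 4 (λ a b n c → (con 1 :+ n) :* (a :* b :+ c) := a :* ((con 1 :+ n) :* b) :+ (n :* c :+ c)) refl (f 0) (g (suc n)) (# n) c ⟩
   f 0 * ((1F + # n) * g (suc n)) + (# n * c + c)
     ≡⟨ cong₂ (λ a b → f 0 * (a * g (suc n)) + (b + c)) (sym (#-suc n)) (leibniz (f ∘ suc) g n) ⟩
   f 0 * θ g (suc n) + ((θ (f ∘ suc) ⋆ g) n + ((f ∘ suc) ⋆ θ g) n + c)
     ≡⟨ solve 4 (λ a b c d → a :+ (b :+ c :+ d) := (b :+ d) :+ (a :+ c)) refl (f 0 * θ g (suc n)) _ _ c ⟩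
   ((θ (f ∘ suc) ⋆ g) n + c) + (f 0 * θ g (suc n) + ((f ∘ suc) ⋆ θ g) n)
     ≡⟨ cong (_+ (f 0 * θ g (suc n) + ((f ∘ suc) ⋆ θ g) n)) (trans (sym (⋆-distribʳ (θ (f ∘ suc)) (f ∘ suc) g n))
          (trans (⋆-cong tail-θ (λ _ → refl) n) (sym (trans (cong (λ z → z * f 0 * g (suc n) + ((θ f ∘ suc) ⋆ g) n) ⟦⟧-0)
            (trans (cong (_+ ((θ f ∘ suc) ⋆ g) n) (trans (cong (_* g (suc n)) (Fₚ.zeroˡ (f 0))) (Fₚ.zeroˡ (g (suc n))))) (Fₚ.+-identityˡ _)))))) ⟩
   (θ f ⋆ g) (suc n) + (f ⋆ θ g) (suc n) ∎
   where
   open ≡-Reasoning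
   c = ((f ∘ suc) ⋆ g) n
   tail-θ : ∀ i → (θ (f ∘ suc) ⊞ (f ∘ suc)) i ≡ θ f (suc i)
   tail-θ i = sym (trans (cong (_* f (suc i)) (#-suc i)) (solve 2 (λ n a → (con 1 :+ n) :* a := n :* a :+ a) refl (# i) (f (suc i))))

 -- ℓ is the logarithmic derivative z f′/f up to degree N.
 LDer : ℕ → Series → Series → Set
 LDer N f ℓ = ∀ n → n ≤ N → θ f n ≡ (ℓ ⋆ f) n

 lder-cong : ∀ {N f ℓ ℓ′} → (∀ n → n ≤ N → ℓ n ≡ ℓ′ n) → LDer N f ℓ → LDer N f ℓ′
 lder-cong h d n le = trans (d n le) (⋆-cong≤ n (λ i il → h i (Nat.≤-trans il le)) (λ _ _ → refl))

 lder-⋆ : ∀ {N f g ℓ m} → LDer N f ℓ → LDer N g m → LDer N (f ⋆ g) (ℓ ⊞ m)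
 lder-⋆ {N} {f} {g} {ℓ} {m} hf hg n le = begin
   θ (f ⋆ g) n ≡⟨ leibniz f g n ⟩
   (θ f ⋆ g) n + (f ⋆ θ g) n
     ≡⟨ cong₂ _+_ (⋆-cong≤ n (λ i il → hf i (Nat.≤-trans il le)) (λ _ _ → refl)) (⋆-cong≤ n (λ _ _ → refl) (λ i il → hg i (Nat.≤-trans il le))) ⟩
   ((ℓ ⋆ f) ⋆ g) n + (f ⋆ (m ⋆ g)) n
     ≡⟨ cong₂ _+_ (⋆-assoc ℓ f g n) (trans (sym (⋆-assoc f m g n)) (trans (⋆-cong (⋆-comm f m) (λ _ → refl) n) (⋆-assoc m f g n))) ⟩
   (ℓ ⋆ (f ⋆ g)) n + (m ⋆ (f ⋆ g)) n ≡⟨ sym (⋆-distribʳ ℓ m (f ⋆ g) n) ⟩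
   ((ℓ ⊞ m) ⋆ (f ⋆ g)) n ∎
   where open ≡-Reasoning

 lder-one : ∀ {N} → LDer N one (λ _ → 0F)
 lder-one zero    _ = trans (cong (_* 1F) ⟦⟧-0) (trans (Fₚ.zeroˡ 1F) (sym (Fₚ.zeroˡ 1F)))
 lder-one (suc n) _ = trans (Fₚ.zeroʳ (# (suc n))) (sym (⋆-zeroˡ one (suc n)))

 -- As `ℓ` has no constant term, the equation determines `n` times the coefficient of degree `n`
 -- from the lower coefficients.
 lder-unique : ∀ {N f g ℓ} → f 0 ≡ g 0 → ℓ 0 ≡ 0F → LDer N f ℓ → LDer N g ℓ → ∀ n → n ≤ N → f n ≡ g n
 lder-unique {N} {f} {g} {ℓ} h0 ℓ0 hf hg n le = go n n Nat.≤-refl le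
   where
   step : ∀ {f} → LDer N f ℓ → ∀ n → suc n ≤ N → # (suc n) * f (suc n) ≡ ((ℓ ∘ suc) ⋆ f) n
   step {f} hf n le = trans (hf (suc n) le) (trans (cong (λ z → z * f (suc n) + ((ℓ ∘ suc) ⋆ f) n) ℓ0)
     (trans (cong (_+ ((ℓ ∘ suc) ⋆ f) n) (Fₚ.zeroˡ (f (suc n)))) (Fₚ.+-identityˡ _)))
   go : ∀ b n → n ≤ b → n ≤ N → f n ≡ g n
   go b       zero    _         _  = h0
   go (suc b) (suc n) (s≤s n≤b) le = cancel-# (suc n) (trans (step hf n le) (trans
     (⋆-cong≤ n (λ _ _ → refl) (λ i il → go b i (Nat.≤-trans il n≤b) (Nat.≤-trans il (Nat.≤-trans (Nat.n≤1+n n) le)))) (sym (step hg n le))))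

 private
   -- A coefficient of the inverse depends on all lower ones. `N` is the depth to which this
   -- recursion is unfolded; by `invApprox-stable` any depth above the degree gives the same value.
   invApprox : Series → ℕ → Series
   invApprox f zero    _       = 0F
   invApprox f (suc N) zero    = 1F
   invApprox f (suc N) (suc m) = - ((f ∘ suc) ⋆ invApprox f N) m

   invApprox-stable : ∀ f N N′ m → m < N → m < N′ → invApprox f N m ≡ invApprox f N′ m
   invApprox-stable f (suc N) (suc N′) zero    _ _ = refl
   invApprox-stable f (suc N) (suc N′) (suc m) (s≤s a) (s≤s b) = cong -_ (⋆-cong≤ m (λ _ _ → refl)
     (λ i il → invApprox-stable f N N′ i (Nat.≤-<-trans il a) (Nat.≤-<-trans il b)))

 inv : Series → Series
 inv f m = invApprox f (suc m) m

 inv-⋆ : ∀ f → f 0 ≡ 1F → ∀ n → (f ⋆ inv f) n ≡ one n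
 inv-⋆ f h zero    = trans (cong (_* 1F) h) (Fₚ.*-identityˡ 1F)
 inv-⋆ f h (suc n) = trans (cong₂ _+_ (trans (cong (_* inv f (suc n)) h) (trans (Fₚ.*-identityˡ _)
     (cong -_ (⋆-cong≤ n {f ∘ suc} (λ _ _ → refl) (λ i il → invApprox-stable f (suc n) (suc i) i (s≤s il) (Nat.n<1+n i))))))
     refl) (Fₚ.-‿inverseˡ (((f ∘ suc) ⋆ inv f) n))

 logD : Series → Series
 logD f = θ f ⋆ inv f

 lder-logD : ∀ {N} f → f 0 ≡ 1F → LDer N f (logD f)
 lder-logD f h n _ = sym (trans (⋆-assoc (θ f) (inv f) f n) (trans (⋆-cong {θ f} (λ _ → refl) (λ i → trans (⋆-comm (inv f) f i) (inv-⋆ f h i)) n)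
   (trans (⋆-comm (θ f) one n) (⋆-identityˡ (θ f) n))))

 lder⇒logD : ∀ {N f ℓ} → f 0 ≡ 1F → LDer N f ℓ → ∀ n → n ≤ N → ℓ n ≡ logD f n
 lder⇒logD {N} {f} {ℓ} h d n le = trans (sym (trans (⋆-comm ℓ one n) (⋆-identityˡ ℓ n)))
   (trans (⋆-cong {ℓ} (λ _ → refl) (λ i → sym (inv-⋆ f h i)) n) (trans (sym (⋆-assoc ℓ f (inv f) n))
   (⋆-cong≤ n (λ i il → sym (d i (Nat.≤-trans il le))) (λ _ _ → refl))))

 pow : Series → ℕ → Series
 pow f zero    = one
 pow f (suc k) = f ⋆ pow f k

 pow-0 : ∀ f k → f 0 ≡ 1F → pow f k 0 ≡ 1F
 pow-0 f zero    h = refl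
 pow-0 f (suc k) h = trans (cong₂ _*_ h (pow-0 f k h)) (Fₚ.*-identityˡ 1F)

 lder-pow : ∀ {N f ℓ} → LDer N f ℓ → ∀ k → LDer N (pow f k) (# k ⊡ ℓ)
 lder-pow {N} {f} {ℓ} h zero    = lder-cong (λ n _ → sym (trans (cong (_* ℓ n) ⟦⟧-0) (Fₚ.zeroˡ (ℓ n)))) lder-one
 lder-pow {N} {f} {ℓ} h (suc k) = lder-cong (λ n _ → sym (trans (cong (_* ℓ n) (#-suc k)) (solve 2 (λ k a → (con 1 :+ k) :* a := a :+ k :* a) refl (# k) (ℓ n))))
   (lder-⋆ h (lder-pow h k))

-- Substitution, binomial roots and denominator bounds

module SeriesBounds where
 open Rat
 open Series
 open Nat using (_^_; _!)

 -- cnt m c f has the coefficients of f at the degrees c, c + (m+1), c + 2(m+1), …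
 cnt : ℕ → ℕ → Series → Series
 cnt m zero    f zero    = f 0
 cnt m zero    f (suc n) = cnt m m (f ∘ suc) n
 cnt m (suc c) f zero    = 0F
 cnt m (suc c) f (suc n) = cnt m c f n

 -- f(z^(m+1))
 spread : ℕ → Series → Series
 spread m = cnt m 0

 module _ (m : ℕ) where

   cnt-cong≤ : ∀ c n {f g : Series} → (∀ k → k ≤ n → f k ≡ g k) → cnt m c f n ≡ cnt m c g n
   cnt-cong≤ zero    zero    h = h 0 z≤n
   cnt-cong≤ zero    (suc n) h = cnt-cong≤ m n (λ k le → h (suc k) (s≤s le))
   cnt-cong≤ (suc c) zero    h = refl
   cnt-cong≤ (suc c) (suc n) h = cnt-cong≤ c n (λ k le → h k (Nat.m≤n⇒m≤1+n le))

   cnt-⊞ : ∀ c n (f g : Series) → cnt m c (f ⊞ g) n ≡ cnt m c f n + cnt m c g n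
   cnt-⊞ zero    zero    f g = refl
   cnt-⊞ zero    (suc n) f g = cnt-⊞ m n (f ∘ suc) (g ∘ suc)
   cnt-⊞ (suc c) zero    f g = sym (Fₚ.+-identityˡ 0F)
   cnt-⊞ (suc c) (suc n) f g = cnt-⊞ c n f g

   cnt-⊡ : ∀ c n x (f : Series) → cnt m c (x ⊡ f) n ≡ x * cnt m c f n
   cnt-⊡ zero    zero    x f = refl
   cnt-⊡ zero    (suc n) x f = cnt-⊡ m n x (f ∘ suc)
   cnt-⊡ (suc c) zero    x f = sym (Fₚ.zeroʳ x)
   cnt-⊡ (suc c) (suc n) x f = cnt-⊡ c n x f

   cnt-⋆ : ∀ c n (f g : Series) → (cnt m c f ⋆ spread m g) n ≡ cnt m c (f ⋆ g) n
   cnt-⋆ zero    zero    f g = refl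
   cnt-⋆ zero    (suc n) f g = trans (cong₂ _+_ (sym (cnt-⊡ m n (f 0) (g ∘ suc))) (cnt-⋆ m n (f ∘ suc) g))
                                     (sym (cnt-⊞ m n (f 0 ⊡ (g ∘ suc)) ((f ∘ suc) ⋆ g)))
   cnt-⋆ (suc c) zero    f g = Fₚ.zeroˡ (g 0)
   cnt-⋆ (suc c) (suc n) f g = trans (cong (_+ (cnt m c f ⋆ spread m g) n) (Fₚ.zeroˡ (spread m g (suc n))))
                                     (trans (Fₚ.+-identityˡ _) (cnt-⋆ c n f g))

   cnt-θ : ∀ c n f → θ (cnt m c f) n ≡ cnt m c (λ k → # (c Nat.+ suc m Nat.* k) * f k) n
   cnt-θ zero    zero    f = cong (λ z → # z * f 0) (sym (Nat.*-zeroʳ (suc m)))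
   cnt-θ zero    (suc n) f = trans (cong (_* cnt m m (f ∘ suc) n) (#-suc n))
     (trans (solve 2 (λ a b → (con 1 :+ a) :* b := b :+ a :* b) refl (# n) (cnt m m (f ∘ suc) n))
     (trans (cong₂ _+_ refl (cnt-θ m n (f ∘ suc))) (trans (sym (cnt-⊞ m n (f ∘ suc) (λ k → # (m Nat.+ suc m Nat.* k) * f (suc k))))
     (cnt-cong≤ m n (λ k _ → trans (solve 2 (λ a b → b :+ a :* b := (con 1 :+ a) :* b) refl (# (m Nat.+ suc m Nat.* k)) (f (suc k)))
       (cong (_* f (suc k)) (trans (sym (#-suc _)) (cong # (sym (Nat.*-suc (suc m) k))))))))))
   cnt-θ (suc c) zero    f = Fₚ.zeroʳ (# 0)
   cnt-θ (suc c) (suc n) f = trans (cong (_* cnt m c f n) (#-suc n))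
     (trans (solve 2 (λ a b → (con 1 :+ a) :* b := b :+ a :* b) refl (# n) (cnt m c f n))
     (trans (cong₂ _+_ refl (cnt-θ c n f)) (trans (sym (cnt-⊞ c n f (λ k → # (c Nat.+ suc m Nat.* k) * f k)))
     (cnt-cong≤ c n (λ k _ → trans (solve 2 (λ a b → b :+ a :* b := (con 1 :+ a) :* b) refl (# (c Nat.+ suc m Nat.* k)) (f k))
       (cong (_* f k) (sym (#-suc _))))))))

   cnt-at : ∀ c k f → cnt m c f (c Nat.+ suc m Nat.* k) ≡ f k
   cnt-at zero    zero    f = cong (cnt m 0 f) (Nat.*-zeroʳ (suc m))
   cnt-at zero    (suc k) f = trans (cong (cnt m 0 f) (Nat.*-suc (suc m) k)) (cnt-at m k (f ∘ suc))
   cnt-at (suc c) k       f = cnt-at c k f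

   cnt-cases : ∀ c n f → (cnt m c f n ≡ 0F) ⊎ (∃ λ k → n ≡ c Nat.+ suc m Nat.* k × cnt m c f n ≡ f k)
   cnt-cases zero    zero    f = inj₂ (0 , sym (Nat.*-zeroʳ (suc m)) , refl)
   cnt-cases zero    (suc n) f with cnt-cases m n (f ∘ suc)
   ... | inj₁ z = inj₁ z
   ... | inj₂ (k , e , h) = inj₂ (suc k , trans (cong suc e) (sym (Nat.*-suc (suc m) k)) , h)
   cnt-cases (suc c) zero    f = inj₁ refl
   cnt-cases (suc c) (suc n) f with cnt-cases c n f
   ... | inj₁ z = inj₁ z
   ... | inj₂ (k , e , h) = inj₂ (k , cong suc e , h)

   -- The chain rule for `z^(m+1)` contributes the factor `m + 1`.
   lder-spread : ∀ {N f ℓ} → LDer N f ℓ → LDer N (spread m f) (# (suc m) ⊡ spread m ℓ)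
   lder-spread {N} {f} {ℓ} h n le = begin
     θ (spread m f) n ≡⟨ cnt-θ 0 n f ⟩
     spread m (λ k → # (suc m Nat.* k) * f k) n
       ≡⟨ cnt-cong≤ 0 n (λ k kl → trans (cong (_* f k) (#-* (suc m) k)) (trans (Fₚ.*-assoc (# (suc m)) (# k) (f k)) (cong (# (suc m) *_) (h k (Nat.≤-trans kl le))))) ⟩
     spread m (# (suc m) ⊡ (ℓ ⋆ f)) n ≡⟨ cnt-⊡ 0 n (# (suc m)) (ℓ ⋆ f) ⟩
     # (suc m) * spread m (ℓ ⋆ f) n ≡⟨ cong (# (suc m) *_) (sym (cnt-⋆ 0 n ℓ f)) ⟩
     # (suc m) * (spread m ℓ ⋆ spread m f) n ≡⟨ sym (⋆-scaleˡ (# (suc m)) (spread m ℓ) (spread m f) n) ⟩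
     ((# (suc m) ⊡ spread m ℓ) ⋆ spread m f) n ∎
     where open ≡-Reasoning

 cnt-identity : ∀ f n → spread 0 f n ≡ f n
 cnt-identity f zero    = refl
 cnt-identity f (suc n) = cnt-identity (f ∘ suc) n

 -- (1 + u)^x = Σ_k b_k u^k where b_k = binom(x, k), truncated at k = K.
 binom : F → ℕ → F
 binom x zero    = 1F
 binom x (suc k) = recip (suc k) * ((x + - (# k)) * binom x k)

 binom-rec : ∀ x k → # (suc k) * binom x (suc k) + # k * binom x k ≡ x * binom x k
 binom-rec x k = begin
   # (suc k) * (recip (suc k) * ((x + - (# k)) * binom x k)) + # k * binom x k
     ≡⟨ cong (_+ # k * binom x k) (trans (sym (Fₚ.*-assoc (# (suc k)) (recip (suc k)) _)) (trans (cong₂ _*_ (recip-inverse (suc k)) refl) (Fₚ.*-identityˡ _))) ⟩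
   (x + - (# k)) * binom x k + # k * binom x k
     ≡⟨ solve 4 (λ x a b c → (x :+ a) :* b :+ c :* b := x :* b :+ (a :+ c) :* b) refl x (- (# k)) (binom x k) (# k) ⟩
   x * binom x k + (- (# k) + # k) * binom x k
     ≡⟨ trans (cong (λ z → x * binom x k + z * binom x k) (Fₚ.-‿inverseˡ (# k))) (trans (cong (x * binom x k +_) (Fₚ.zeroˡ (binom x k))) (Fₚ.+-identityʳ _)) ⟩
   x * binom x k ∎
   where open ≡-Reasoning

 partialRoot : F → Series → ℕ → Series
 partialRoot x u zero    = binom x 0 ⊡ one
 partialRoot x u (suc K) = partialRoot x u K ⊞ (binom x (suc K) ⊡ pow u (suc K))

 pow-order : ∀ u → u 0 ≡ 0F → ∀ k n → n < k → pow u k n ≡ 0F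
 pow-order u u0 (suc k) zero    _       = trans (cong (_* pow u k 0) u0) (Fₚ.zeroˡ (pow u k 0))
 pow-order u u0 (suc k) (suc n) (s≤s lt) = trans (cong₂ _+_ (trans (cong (_* pow u k (suc n)) u0) (Fₚ.zeroˡ _))
     (trans (⋆-cong≤ n {u ∘ suc} (λ _ _ → refl) (λ i il → pow-order u u0 k i (Nat.≤-<-trans il lt))) (trans (⋆-comm (u ∘ suc) (λ _ → 0F) n) (⋆-zeroˡ (u ∘ suc) n))))
   (Fₚ.+-identityˡ 0F)

 module Root (x : F) (f : Series) (f0 : f 0 ≡ 1F) where

   u : Series
   u zero    = 0F
   u (suc n) = f (suc n)

   f≡1+u : ∀ n → f n ≡ (one ⊞ u) n
   f≡1+u zero    = trans f0 (sym (Fₚ.+-identityʳ 1F))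
   f≡1+u (suc n) = sym (Fₚ.+-identityˡ (f (suc n)))

   private
     θpow : ∀ k n → θ (pow u (suc k)) n ≡ # (suc k) * (pow u k ⋆ θ u) n
     θpow zero    n = trans (cong (# n *_) (trans (⋆-comm u one n) (⋆-identityˡ u n))) (sym (trans (cong₂ _*_ ⟦⟧-1 (⋆-identityˡ (θ u) n)) (Fₚ.*-identityˡ _)))
     θpow (suc k) n = begin
       θ (u ⋆ pow u (suc k)) n ≡⟨ leibniz u (pow u (suc k)) n ⟩
       (θ u ⋆ pow u (suc k)) n + (u ⋆ θ (pow u (suc k))) n
         ≡⟨ cong₂ _+_ (⋆-comm (θ u) (pow u (suc k)) n) (trans (⋆-cong {u} (λ _ → refl) (θpow k) n) (trans (⋆-comm u (# (suc k) ⊡ (pow u k ⋆ θ u)) n)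
              (trans (⋆-scaleˡ (# (suc k)) (pow u k ⋆ θ u) u n) (cong (# (suc k) *_) (trans (⋆-comm (pow u k ⋆ θ u) u n) (sym (⋆-assoc u (pow u k) (θ u) n))))))) ⟩
       X + # (suc k) * X ≡⟨ solve 2 (λ a b → b :+ a :* b := (con 1 :+ a) :* b) refl (# (suc k)) X ⟩
       (1F + # (suc k)) * X ≡⟨ cong (_* X) (sym (#-suc (suc k))) ⟩
       # (suc (suc k)) * X ∎
       where
       open ≡-Reasoning
       X = (pow u (suc k) ⋆ θ u) n

     r : ℕ → Series
     r = partialRoot x u

     b : ℕ → F
     b = binom x

     -- The differential equation `f · θ r = x · r · θ u` of `r = (1 + u)^x`, with the error caused
     -- by truncating after `u^K`. The error is a multiple of `u^K · θ u`, which vanishes up to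
     -- degree `K`.
     ode : ∀ K n → (θ (r K) ⋆ f) n + # (suc K) * b (suc K) * (pow u K ⋆ θ u) n ≡ x * (r K ⋆ θ u) n
     ode zero n = begin
       (θ (r 0) ⋆ f) n + # 1 * b 1 * (one ⋆ θ u) n
         ≡⟨ cong₂ _+_ (trans (⋆-cong {θ (r 0)} {λ _ → 0F} {f} {f} θconst (λ _ → refl) n) (⋆-zeroˡ f n)) (cong (_* (one ⋆ θ u) n) b1) ⟩
       0F + x * b 0 * (one ⋆ θ u) n ≡⟨ trans (Fₚ.+-identityˡ _) (trans (Fₚ.*-assoc x (b 0) _) (cong (x *_) (sym (⋆-scaleˡ (b 0) one (θ u) n)))) ⟩
       x * (r 0 ⋆ θ u) n ∎
       where
       open ≡-Reasoning
       θconst : ∀ i → θ (r 0) i ≡ 0F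
       θconst zero    = trans (cong (_* (b 0 * 1F)) ⟦⟧-0) (Fₚ.zeroˡ _)
       θconst (suc i) = trans (cong (# (suc i) *_) (Fₚ.zeroʳ (b 0))) (Fₚ.zeroʳ _)
       b1 : # 1 * b 1 ≡ x * b 0
       b1 = trans (sym (Fₚ.+-identityʳ _)) (trans (cong (# 1 * b 1 +_) (sym (trans (cong (_* b 0) ⟦⟧-0) (Fₚ.zeroˡ (b 0))))) (binom-rec x 0))
     ode (suc K) n = begin
       (θ (r K ⊞ (c ⊡ pow u (suc K))) ⋆ f) n + B * Y
         ≡⟨ cong (_+ B * Y) (trans (⋆-cong {_} {θ (r K) ⊞ ((# (suc K) * c) ⊡ (pow u K ⋆ θ u))} {f} {f} expandθ (λ _ → refl) n)
              (trans (⋆-distribʳ (θ (r K)) ((# (suc K) * c) ⊡ (pow u K ⋆ θ u)) f n) (cong ((θ (r K) ⋆ f) n +_) (trans (⋆-scaleˡ (# (suc K) * c) (pow u K ⋆ θ u) f n) (cong (# (suc K) * c *_) mulf))))) ⟩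
       (θ (r K) ⋆ f) n + # (suc K) * c * (X + Y) + B * Y
         ≡⟨ solve 5 (λ t a X Y B → t :+ a :* (X :+ Y) :+ B :* Y := (t :+ a :* X) :+ (B :+ a) :* Y) refl ((θ (r K) ⋆ f) n) (# (suc K) * c) X Y B ⟩
       ((θ (r K) ⋆ f) n + # (suc K) * c * X) + (B + # (suc K) * c) * Y
         ≡⟨ cong₂ (λ s t → s + t * Y) (ode K n) (binom-rec x (suc K)) ⟩
       x * (r K ⋆ θ u) n + x * c * Y
         ≡⟨ trans (cong (x * (r K ⋆ θ u) n +_) (Fₚ.*-assoc x c Y)) (sym (Fₚ.distribˡ x _ _)) ⟩
       x * ((r K ⋆ θ u) n + c * Y)
         ≡⟨ cong (x *_) (sym (trans (⋆-distribʳ (r K) (c ⊡ pow u (suc K)) (θ u) n) (cong ((r K ⋆ θ u) n +_) (⋆-scaleˡ c (pow u (suc K)) (θ u) n)))) ⟩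
       x * ((r K ⊞ (c ⊡ pow u (suc K))) ⋆ θ u) n ∎
       where
       open ≡-Reasoning
       c = b (suc K)
       B = # (suc (suc K)) * b (suc (suc K))
       X = (pow u K ⋆ θ u) n
       Y = (pow u (suc K) ⋆ θ u) n
       expandθ : ∀ i → θ (r K ⊞ (c ⊡ pow u (suc K))) i ≡ (θ (r K) ⊞ ((# (suc K) * c) ⊡ (pow u K ⋆ θ u))) i
       expandθ i = trans (solve 4 (λ n a c w → n :* (a :+ c :* w) := n :* a :+ c :* (n :* w)) refl (# i) (r K i) c (pow u (suc K) i))
         (cong (θ (r K) i +_) (trans (cong (c *_) (θpow K i)) (solve 3 (λ c n w → c :* (n :* w) := n :* c :* w) refl c (# (suc K)) ((pow u K ⋆ θ u) i))))
       mulf : ((pow u K ⋆ θ u) ⋆ f) n ≡ X + Y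
       mulf = begin
         ((pow u K ⋆ θ u) ⋆ f) n ≡⟨ ⋆-comm (pow u K ⋆ θ u) f n ⟩
         (f ⋆ (pow u K ⋆ θ u)) n ≡⟨ ⋆-cong {f} {one ⊞ u} {pow u K ⋆ θ u} {pow u K ⋆ θ u} f≡1+u (λ _ → refl) n ⟩
         ((one ⊞ u) ⋆ (pow u K ⋆ θ u)) n ≡⟨ ⋆-distribʳ one u (pow u K ⋆ θ u) n ⟩
         (one ⋆ (pow u K ⋆ θ u)) n + (u ⋆ (pow u K ⋆ θ u)) n ≡⟨ cong₂ _+_ (⋆-identityˡ (pow u K ⋆ θ u) n) (sym (⋆-assoc u (pow u K) (θ u) n)) ⟩
         X + Y ∎

   root : ℕ → Series
   root = partialRoot x u

   root-0 : ∀ N → root N 0 ≡ 1F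
   root-0 zero    = Fₚ.*-identityˡ 1F
   root-0 (suc N) = trans (cong₂ _+_ (root-0 N) (trans (cong (b (suc N) *_) (pow-order u refl (suc N) 0 (s≤s z≤n))) (Fₚ.zeroʳ _))) (Fₚ.+-identityʳ 1F)

   lder-root : ∀ {N ℓ} → LDer N f ℓ → LDer N (root N) (x ⊡ ℓ)
   lder-root {N} {ℓ} h n le = begin
     θ R n ≡⟨ sym (cancel (θ R) n) ⟩
     ((θ R ⋆ f) ⋆ inv f) n ≡⟨ ⋆-cong≤ n {θ R ⋆ f} {x ⊡ (R ⋆ (ℓ ⋆ f))} {inv f} {inv f} (λ i il → odeN i (Nat.≤-trans il le)) (λ _ _ → refl) ⟩
     ((x ⊡ (R ⋆ (ℓ ⋆ f))) ⋆ inv f) n ≡⟨ ⋆-scaleˡ x (R ⋆ (ℓ ⋆ f)) (inv f) n ⟩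
     x * ((R ⋆ (ℓ ⋆ f)) ⋆ inv f) n
       ≡⟨ cong (x *_) (trans (⋆-cong {R ⋆ (ℓ ⋆ f)} {(R ⋆ ℓ) ⋆ f} {inv f} {inv f} (λ i → sym (⋆-assoc R ℓ f i)) (λ _ → refl) n) (trans (cancel (R ⋆ ℓ) n) (⋆-comm R ℓ n))) ⟩
     x * (ℓ ⋆ R) n ≡⟨ sym (⋆-scaleˡ x ℓ R n) ⟩
     ((x ⊡ ℓ) ⋆ R) n ∎
     where
     open ≡-Reasoning
     R = root N
     cancel : ∀ g n → ((g ⋆ f) ⋆ inv f) n ≡ g n
     cancel g n = trans (⋆-assoc g f (inv f) n) (trans (⋆-cong {g} (λ _ → refl) (inv-⋆ f f0) n) (trans (⋆-comm g one n) (⋆-identityˡ g n)))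
     θf≡θu : ∀ i → θ u i ≡ θ f i
     θf≡θu zero    = trans (cong (_* 0F) ⟦⟧-0) (trans (Fₚ.zeroˡ 0F) (sym (trans (cong (_* f 0) ⟦⟧-0) (Fₚ.zeroˡ (f 0)))))
     θf≡θu (suc i) = refl
     vanish : ∀ i → i ≤ N → (pow u N ⋆ θ u) i ≡ 0F
     vanish i il with Nat.m≤n⇒m<n∨m≡n il
     ... | inj₁ lt = trans (⋆-cong≤ i {pow u N} {λ _ → 0F} {θ u} {θ u} (λ j jl → pow-order u refl N j (Nat.≤-<-trans jl lt)) (λ _ _ → refl)) (⋆-zeroˡ (θ u) i)
     ... | inj₂ refl = top i
       where
       top : ∀ i → (pow u i ⋆ θ u) i ≡ 0F
       top zero    = trans (cong (1F *_) (θf≡0)) (Fₚ.zeroʳ 1F)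
         where
         θf≡0 : θ u 0 ≡ 0F
         θf≡0 = trans (cong (_* 0F) ⟦⟧-0) (Fₚ.zeroˡ 0F)
       top (suc i) = trans (⋆-snoc (pow u (suc i)) (θ u) i) (trans (cong₂ _+_
           (trans (⋆-cong≤ i {pow u (suc i)} {λ _ → 0F} {θ u ∘ suc} {θ u ∘ suc} (λ j jl → pow-order u refl (suc i) j (s≤s jl)) (λ _ _ → refl)) (⋆-zeroˡ (θ u ∘ suc) i))
           (trans (cong (pow u (suc i) (suc i) *_) (trans (cong (_* 0F) ⟦⟧-0) (Fₚ.zeroˡ 0F))) (Fₚ.zeroʳ _))) (Fₚ.+-identityˡ 0F))
     odeN : ∀ i → i ≤ N → (θ R ⋆ f) i ≡ x * (R ⋆ (ℓ ⋆ f)) i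
     odeN i il = trans (sym (Fₚ.+-identityʳ _)) (trans (cong ((θ R ⋆ f) i +_) (sym (trans (cong (# (suc N) * b (suc N) *_) (vanish i il)) (Fₚ.zeroʳ _))))
       (trans (ode N i) (cong (x *_) (⋆-cong≤ i {R} {R} {θ u} {ℓ ⋆ f} (λ _ _ → refl) (λ j jl → trans (θf≡θu j) (h j (Nat.≤-trans jl il)))))))

 module Bounds {p : ℕ} (pr : Prime p) (N : ℕ) where
   open PIntegral pr

   Bd : (ℕ → ℕ) → Series → Set
   Bd w f = ∀ n → n ≤ N → Den (w n) (f n)

   ⋆-den : ∀ {γ} n {f g : Series} → (∀ i j → i Nat.+ j ≡ n → Den γ (f i * g j)) → Den γ ((f ⋆ g) n)
   ⋆-den zero    h = h 0 0 refl
   ⋆-den (suc n) h = den-+ (h 0 (suc n) refl) (⋆-den n (λ i j e → h (suc i) j (cong suc e)))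

   bd-one : ∀ {w} → Bd w one
   bd-one zero    _ = den-mono z≤n den-1
   bd-one (suc n) _ = den-0

   module Superadditive (w : ℕ → ℕ) (super : ∀ i j → w i Nat.+ w j ≤ w (i Nat.+ j)) where

     private
       prodDen : ∀ {n} {f g : Series} → (∀ j → j ≤ n → Den (w j) (f j)) → (∀ j → j ≤ n → Den (w j) (g j)) → ∀ i j → i Nat.+ j ≡ n → Den (w n) (f i * g j)
       prodDen hf hg i j refl = den-mono (super i j) (den-* (hf i (Nat.m≤m+n i j)) (hg j (Nat.m≤n+m j i)))

     bd-⋆ : ∀ {f g} → Bd w f → Bd w g → Bd w (f ⋆ g)
     bd-⋆ {f} {g} hf hg n le = ⋆-den n {f} {g} (prodDen (λ j jl → hf j (Nat.≤-trans jl le)) (λ j jl → hg j (Nat.≤-trans jl le)))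

     bd-pow : ∀ {f} → Bd w f → ∀ k → Bd w (pow f k)
     bd-pow h zero    = bd-one
     bd-pow h (suc k) = bd-⋆ h (bd-pow h k)

     bd-quotient : ∀ {X Y Z} → X 0 ≡ 1F → (∀ n → n ≤ N → (X ⋆ Y) n ≡ Z n) → Bd w X → Bd w Z → Bd w Y
     bd-quotient {X} {Y} {Z} X0 eq hX hZ n le = go n n Nat.≤-refl le
       where
       cancel : ∀ a b c → a + b ≡ c → a ≡ c + - b
       cancel a b c refl = sym (trans (Fₚ.+-assoc a b (- b)) (trans (cong (a +_) (Fₚ.-‿inverseʳ b)) (Fₚ.+-identityʳ a)))
       go : ∀ b n → n ≤ b → n ≤ N → Den (w n) (Y n)
       go b zero _ le = subst (Den (w 0)) (sym (trans (sym (Fₚ.*-identityˡ (Y 0))) (trans (cong (_* Y 0) (sym X0)) (eq 0 le)))) (hZ 0 le)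
       go (suc b) (suc n) (s≤s nb) le = subst (Den (w (suc n))) (sym (cancel (Y (suc n)) _ (Z (suc n))
           (trans (cong (_+ ((X ∘ suc) ⋆ Y) n) (sym (trans (cong (_* Y (suc n)) X0) (Fₚ.*-identityˡ _)))) (eq (suc n) le))))
         (den-+ (hZ (suc n) le) (den-neg (⋆-den n {X ∘ suc} {Y} (λ i j e → den-mono (subst (λ z → w (suc i) Nat.+ w j ≤ w z) (cong suc e) (super (suc i) j))
           (den-* (hX (suc i) (Nat.≤-trans (s≤s (subst (i ≤_) e (Nat.m≤m+n i j))) le))
                  (go b j (Nat.≤-trans (subst (j ≤_) e (Nat.m≤n+m j i)) nb) (Nat.≤-trans (subst (j ≤_) e (Nat.m≤n+m j i)) (Nat.≤-trans (Nat.n≤1+n n) le))))))))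

     -- Compare the linear terms in the top coefficient of f^k.
     bd-root : ∀ {f} k → ¬ (p ∣ k) → f 0 ≡ 1F → Bd w (pow f k) → Bd w f
     bd-root {f} k nk f0 h n le = go n n Nat.≤-refl le
       where
       -- Apart from its two extreme terms the coefficient involves only lower coefficients, which
       -- are already bounded; superadditivity bounds their products.
       middle : ∀ n (g : Series) → g 0 ≡ 1F → (∀ j → j ≤ n → Den (w j) (f j)) → (∀ j → j ≤ n → Den (w j) (g j)) →
                ∃ λ e → Den (w (suc n)) e × (f ⋆ g) (suc n) ≡ (g (suc n) + f (suc n)) + e
       middle zero g g0 hf hg = 0F , den-0 , trans (cong₂ _+_ (trans (cong (_* g 1) f0) (Fₚ.*-identityˡ _)) (trans (cong (f 1 *_) g0) (Fₚ.*-identityʳ _))) (sym (Fₚ.+-identityʳ _))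
       middle (suc n) g g0 hf hg = ((f ∘ suc) ⋆ (g ∘ suc)) n , ⋆-den n {f ∘ suc} {g ∘ suc} (λ i j e →
             den-mono (subst (λ z → w (suc i) Nat.+ w (suc j) ≤ w z) (cong suc (trans (Nat.+-suc i j) (cong suc e))) (super (suc i) (suc j)))
               (den-* (hf (suc i) (s≤s (subst (i ≤_) e (Nat.m≤m+n i j)))) (hg (suc j) (s≤s (subst (j ≤_) e (Nat.m≤n+m j i)))))) ,
         trans (cong₂ _+_ (trans (cong (_* g (suc (suc n))) f0) (Fₚ.*-identityˡ _)) (trans (⋆-snoc (f ∘ suc) g n) (cong (((f ∘ suc) ⋆ (g ∘ suc)) n +_) (trans (cong (f (suc (suc n)) *_) g0) (Fₚ.*-identityʳ _)))))
           (solve 3 (λ a b c → a :+ (b :+ c) := (a :+ c) :+ b) refl (g (suc (suc n))) (((f ∘ suc) ⋆ (g ∘ suc)) n) (f (suc (suc n))))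
       top : ∀ n → (∀ j → j ≤ n → Den (w j) (f j)) → ∀ k → (∀ j → j ≤ n → Den (w j) (pow f k j)) × (∃ λ e → Den (w (suc n)) e × pow f k (suc n) ≡ # k * f (suc n) + e)
       top n hf zero = (λ j jl → one-den j) , 0F , den-0 , sym (trans (Fₚ.+-identityʳ _) (trans (cong (_* f (suc n)) ⟦⟧-0) (Fₚ.zeroˡ (f (suc n)))))
         where
         one-den : ∀ j → Den (w j) (one j)
         one-den zero    = den-mono z≤n den-1
         one-den (suc j) = den-0
       top n hf (suc k) with top n hf k
       ... | low , e , de , eq with middle n (pow f k) (pow-0 f k f0) hf low
       ... | e′ , de′ , eq′ = (λ j jl → ⋆-den j {f} {pow f k} (prodDen (λ i il → hf i (Nat.≤-trans il jl)) (λ i il → low i (Nat.≤-trans il jl)))) ,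
             e + e′ , den-+ de de′ , trans eq′ (trans (cong (λ z → z + f (suc n) + e′) eq) (trans
               (solve 4 (λ k f a b → k :* f :+ a :+ f :+ b := (con 1 :+ k) :* f :+ (a :+ b)) refl (# k) (f (suc n)) e e′)
               (cong (λ z → z * f (suc n) + (e + e′)) (sym (#-suc k)))))
       go : ∀ b n → n ≤ b → n ≤ N → Den (w n) (f n)
       go b zero _ le = subst (Den (w 0)) (sym f0) (den-mono z≤n den-1)
       go (suc b) (suc n) (s≤s nb) le with top n (λ j jl → go b j (Nat.≤-trans jl nb) (Nat.≤-trans jl (Nat.≤-trans (Nat.n≤1+n n) le))) k
       ... | _ , e , de , eq = den-cancel-unit k nk (subst (Den (w (suc n))) (sym (cancel _ _ _ (sym eq))) (den-+ (h (suc n) le) (den-neg de)))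
         where
         cancel : ∀ a b c → a + b ≡ c → a ≡ c + - b
         cancel a b c refl = sym (trans (Fₚ.+-assoc a b (- b)) (trans (cong (a +_) (Fₚ.-‿inverseʳ b)) (Fₚ.+-identityʳ a)))

   bd-spread : ∀ m {β w f} → Bd β f → (∀ k → suc m Nat.* k ≤ N → β k ≤ w (suc m Nat.* k)) → Bd w (spread m f)
   bd-spread m {β} {w} {f} h mono n le with cnt-cases m 0 n f
   ... | inj₁ z = subst (Den (w n)) (sym z) den-0
   ... | inj₂ (k , refl , e) = subst (Den (w (suc m Nat.* k))) (sym e) (den-mono (mono k le) (h k (Nat.≤-trans (Nat.m≤m+n k (m Nat.* k)) le)))

   module RootBound (β : ℕ → ℕ) (β-mono : ∀ {i j} → i ≤ j → β i ≤ β j) (x : F) (b-den : ∀ k → Den (β k) (binom x k))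
                    (f : Series) (f0 : f 0 ≡ 1F) (int : Bd (λ _ → 0) f) where
     open Root x f f0

     private
       open Superadditive (λ _ → 0) (λ _ _ → z≤n)

       u-int : Bd (λ _ → 0) u
       u-int zero    _  = den-0
       u-int (suc n) le = int (suc n) le

     -- The power `u^k` starts in degree `k`, so in degree `n` only the denominators `β k` with
     -- `k ≤ n` occur.
     bd-partial : ∀ K → Bd β (partialRoot x u K)
     bd-partial zero    zero    le = subst (Den (β 0)) (sym (Fₚ.*-identityˡ 1F)) (den-mono z≤n den-1)
     bd-partial zero    (suc n) le = subst (Den (β (suc n))) (sym (Fₚ.zeroʳ 1F)) den-0
     bd-partial (suc K) n       le = den-+ (bd-partial K n le) (term (n Nat.<? suc K))
       where
       term : Dec (n < suc K) → Den (β n) (binom x (suc K) * pow u (suc K) n)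
       term (yes lt) = subst (Den (β n)) (sym (trans (cong (binom x (suc K) *_) (pow-order u refl (suc K) n lt)) (Fₚ.zeroʳ _))) den-0
       term (no ge)  = den-mono (Nat.≤-trans (Nat.≤-reflexive (Nat.+-identityʳ _)) (β-mono (Nat.≮⇒≥ ge))) (den-* (b-den (suc K)) (bd-pow u-int (suc K) n le))

     bd-binomial : Bd β (root N)
     bd-binomial = bd-partial N

   module _ (v : ℕ → ℕ) (v-fact : ∀ k → ∃ λ m → ¬ (p ∣ m) × k ! ≡ p ^ v k Nat.* m) (a : ℕ) where
     private
       instance
         p≢0 : NonZero p
         p≢0 = prime⇒nonZero pr
         pa≢0 : NonZero (p ^ a)
         pa≢0 = Nat.m^n≢0 p a
       x = recip (p ^ a)

       -- `k! · binom(p^(−a), k)` is the product of `p^(−a) − j = p^(−a) (1 − j p^a)` over `j < k`.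
       numerator : ∀ k → ∃ λ s → # (k !) * binom x k ≡ ⟦ s ⟧ * recip (p ^ (a Nat.* k))
       numerator zero = Int.+ 1 , trans (cong₂ _*_ ⟦⟧-1 refl) (sym (trans (cong (λ z → ⟦ Int.+ 1 ⟧ * recip (p ^ z)) (Nat.*-zeroʳ a)) (trans (recip-inverse 1) (sym (Fₚ.*-identityˡ 1F)))))
       numerator (suc k) with numerator k
       ... | s , e = s Int.* (Int.+ 1 Int.- Int.+ (k Nat.* p ^ a)) , (begin
         # (suc k Nat.* k !) * (recip (suc k) * ((x + - (# k)) * binom x k))
           ≡⟨ cong₂ _*_ (#-* (suc k) (k !)) refl ⟩
         # (suc k) * # (k !) * (recip (suc k) * ((x + - (# k)) * binom x k))
           ≡⟨ solve 5 (λ a b c d e → a :* b :* (c :* (d :* e)) := (a :* c) :* (b :* e :* d)) refl (# (suc k)) (# (k !)) (recip (suc k)) (x + - (# k)) (binom x k) ⟩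
         # (suc k) * recip (suc k) * (# (k !) * binom x k * (x + - (# k)))
           ≡⟨ trans (cong₂ _*_ (recip-inverse (suc k)) refl) (trans (Fₚ.*-identityˡ _) (cong₂ _*_ e factor)) ⟩
         ⟦ s ⟧ * recip (p ^ (a Nat.* k)) * (⟦ Int.+ 1 Int.- Int.+ (k Nat.* p ^ a) ⟧ * x)
           ≡⟨ solve 4 (λ a b c d → a :* b :* (c :* d) := a :* c :* (b :* d)) refl ⟦ s ⟧ (recip (p ^ (a Nat.* k))) ⟦ Int.+ 1 Int.- Int.+ (k Nat.* p ^ a) ⟧ x ⟩
         ⟦ s ⟧ * ⟦ Int.+ 1 Int.- Int.+ (k Nat.* p ^ a) ⟧ * (recip (p ^ (a Nat.* k)) * x)
           ≡⟨ cong₂ _*_ (sym (⟦⟧-* s _)) (trans (sym (recip-* (p ^ (a Nat.* k)) (p ^ a) {{Nat.m^n≢0 p (a Nat.* k)}}))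
                (cong recip (trans (sym (Nat.^-distribˡ-+-* p (a Nat.* k) a)) (cong (p ^_) (trans (Nat.+-comm (a Nat.* k) a) (sym (Nat.*-suc a k))))))) ⟩
         ⟦ s Int.* (Int.+ 1 Int.- Int.+ (k Nat.* p ^ a)) ⟧ * recip (p ^ (a Nat.* suc k)) ∎)
         where
         open ≡-Reasoning
         factor : x + - (# k) ≡ ⟦ Int.+ 1 Int.- Int.+ (k Nat.* p ^ a) ⟧ * x
         factor = sym (trans (cong (_* x) (trans (⟦⟧-+ (Int.+ 1) (Int.- Int.+ (k Nat.* p ^ a))) (cong₂ _+_ ⟦⟧-1 (⟦⟧-neg _))))
           (trans (Fₚ.distribʳ x 1F (- # (k Nat.* p ^ a))) (cong₂ _+_ (Fₚ.*-identityˡ x) (trans (sym (-‿distribˡ-* _ x)) (cong -_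
             (trans (cong (_* x) (#-* k (p ^ a))) (trans (Fₚ.*-assoc (# k) (# (p ^ a)) x) (trans (cong (# k *_) (recip-inverse (p ^ a))) (Fₚ.*-identityʳ _)))))))))

     den-binom : ∀ k → Den (a Nat.* k Nat.+ v k) (binom x k)
     den-binom k with numerator k | v-fact k
     ... | s , e | m , nm , f = den-cancel-unit m nm (subst (Den (a Nat.* k Nat.+ v k)) eq
             (subst (λ z → Den z (⟦ s ⟧ * recip (p ^ (a Nat.* k)) * recip (p ^ v k))) refl
               (den-* {a Nat.* k} {v k} (den-* {0} {a Nat.* k} (den-ℤ s) (den-recip-p (a Nat.* k))) (den-recip-p (v k)))))
       where
       open ≡-Reasoning
       eq : ⟦ s ⟧ * recip (p ^ (a Nat.* k)) * recip (p ^ v k) ≡ # m * binom x k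
       eq = begin
         ⟦ s ⟧ * recip (p ^ (a Nat.* k)) * recip (p ^ v k) ≡⟨ cong (_* recip (p ^ v k)) (sym e) ⟩
         # (k !) * binom x k * recip (p ^ v k) ≡⟨ cong (λ z → z * binom x k * recip (p ^ v k)) (trans (cong # f) (#-* (p ^ v k) m)) ⟩
         # (p ^ v k) * # m * binom x k * recip (p ^ v k)
           ≡⟨ solve 4 (λ a b c d → a :* b :* c :* d := (a :* d) :* (b :* c)) refl (# (p ^ v k)) (# m) (binom x k) (recip (p ^ v k)) ⟩
         # (p ^ v k) * recip (p ^ v k) * (# m * binom x k) ≡⟨ trans (cong (_* (# m * binom x k)) (recip-inverse (p ^ v k) {{Nat.m^n≢0 p (v k)}})) (Fₚ.*-identityˡ _) ⟩
         # m * binom x k ∎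

-- The generating function as a product over the simple modules

module MainCount where
 open import Defs using (FiniteField; module HomCount; groupElems)
 open Counting
 open Rings
 open GL
 open Groups using (length-groupElems)
 open Reps
 open Types
 open Degrees
 open Rat
 open Series
 open SeriesBounds
 open Nat using (_^_)
 open import Data.Nat.Divisibility using (quotient)
 open import Data.Vec using (lookup)
 open import Algebra.Properties.CommutativeMonoid.Sum Nat.+-0-commutativeMonoid using (sum; sum-cong-≗)

 E : ℕ → Series
 E Q n = recip (gl Q n)

 prodSer : ∀ {k} → (Fin k → Series) → Series
 prodSer {zero}  f = one
 prodSer {suc k} f = f zero ⋆ prodSer (f ∘ suc)

 prodF : ∀ {k} → (Fin k → Series) → Vec ℕ k → F
 prodF f []      = 1F
 prodF f (u ∷ us) = f zero u * prodF (f ∘ suc) us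

 sumF : {X : Set} → (X → F) → List X → F
 sumF g []       = 0F
 sumF g (x ∷ xs) = g x + sumF g xs

 sumF-++ : {X : Set} (g : X → F) (xs ys : List X) → sumF g (xs ++ ys) ≡ sumF g xs + sumF g ys
 sumF-++ g []       ys = sym (Fₚ.+-identityˡ _)
 sumF-++ g (x ∷ xs) ys = trans (cong (g x +_) (sumF-++ g xs ys)) (sym (Fₚ.+-assoc _ _ _))

 heads : ∀ {k} → (ℕ → List (Vec ℕ k)) → ℕ → ℕ → List (Vec ℕ (suc k))
 heads rest a zero    = List.map (a ∷_) (rest 0)
 heads rest a (suc n) = List.map (a ∷_) (rest (suc n)) ++ heads rest (suc a) n

 -- The compositions of `n` into `k` parts, in the order in which `⋆` adds up its terms.
 comps : ∀ k → ℕ → List (Vec ℕ k)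
 comps zero    zero    = [] ∷ []
 comps zero    (suc n) = []
 comps (suc k) n       = heads (comps k) 0 n

 sum-comps : ∀ k (f : Fin k → Series) n → sumF (prodF f) (comps k n) ≡ prodSer f n
 sum-comps zero    f zero    = Fₚ.+-identityʳ 1F
 sum-comps zero    f (suc n) = refl
 sum-comps (suc k) f n       = go 0 n
   where
   row : ∀ a us → sumF (prodF f) (List.map (a ∷_) us) ≡ f zero a * sumF (prodF (f ∘ suc)) us
   row a []       = sym (Fₚ.zeroʳ (f zero a))
   row a (u ∷ us) = trans (cong (f zero a * prodF (f ∘ suc) u +_) (row a us)) (sym (Fₚ.distribˡ (f zero a) _ _))
   go : ∀ a n → sumF (prodF f) (heads (comps k) a n) ≡ ((λ i → f zero (a Nat.+ i)) ⋆ prodSer (f ∘ suc)) n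
   go a zero    = trans (row a (comps k 0)) (cong₂ _*_ (cong (f zero) (sym (Nat.+-identityʳ a))) (sum-comps k (f ∘ suc) 0))
   go a (suc n) = trans (sumF-++ (prodF f) (List.map (a ∷_) (comps k (suc n))) (heads (comps k) (suc a) n))
     (cong₂ _+_ (trans (row a (comps k (suc n))) (cong₂ _*_ (cong (f zero) (sym (Nat.+-identityʳ a))) (sum-comps k (f ∘ suc) (suc n))))
                (trans (go (suc a) n) (⋆-cong {g = prodSer (f ∘ suc)} (λ i → cong (f zero) (sym (Nat.+-suc a i))) (λ _ → refl) n)))

 comps-sum : ∀ k n {u} → u ∈ comps k n → Vec.sum u ≡ n
 comps-sum zero    zero    (here refl) = refl
 comps-sum (suc k) n       m = go 0 n m
   where
   go : ∀ a n {u} → u ∈ heads (comps k) a n → Vec.sum u ≡ a Nat.+ n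
   go a zero    m with ∈-map⁻ (a ∷_) m
   ... | v , v∈ , refl = cong (a Nat.+_) (comps-sum k 0 v∈)
   go a (suc n) m with ∈-++⁻ (List.map (a ∷_) (comps k (suc n))) m
   ... | inj₂ m′ = trans (go (suc a) n m′) (sym (Nat.+-suc a n))
   ... | inj₁ m′ with ∈-map⁻ (a ∷_) m′
   ... | v , v∈ , refl = cong (a Nat.+_) (comps-sum k (suc n) v∈)

 comps-complete : ∀ k (u : Vec ℕ k) n → Vec.sum u ≡ n → u ∈ comps k n
 comps-complete zero    []      zero    refl = here refl
 comps-complete (suc k) (x ∷ u) n       h    = go 0 x n h
   where
   go : ∀ a x n → x Nat.+ Vec.sum u ≡ n → (a Nat.+ x ∷ u) ∈ heads (comps k) a n
   go a zero    zero    h rewrite Nat.+-identityʳ a = ∈-map⁺ (a ∷_) (comps-complete k u 0 h)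
   go a zero    (suc n) h rewrite Nat.+-identityʳ a = ∈-++⁺ˡ (∈-map⁺ (a ∷_) (comps-complete k u (suc n) h))
   go a (suc x) (suc n) h = ∈-++⁺ʳ (List.map (a ∷_) (comps k (suc n))) (subst (λ z → (z ∷ u) ∈ heads (comps k) (suc a) n) (sym (Nat.+-suc a x)) (go (suc a) x n (Nat.suc-injective h)))

 comps-unique : ∀ k n → Unique (comps k n)
 comps-unique zero    zero    = [] ∷ []
 comps-unique zero    (suc n) = []
 comps-unique (suc k) n       = go 0 n
   where
   bigger : ∀ a n {u} → u ∈ heads (comps k) a n → a ≤ Vec.head u
   bigger a zero    m with ∈-map⁻ (a ∷_) m
   ... | v , _ , refl = Nat.≤-refl
   bigger a (suc n) m with ∈-++⁻ (List.map (a ∷_) (comps k (suc n))) m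
   ... | inj₂ m′ = Nat.≤-trans (Nat.n≤1+n a) (bigger (suc a) n m′)
   ... | inj₁ m′ with ∈-map⁻ (a ∷_) m′
   ... | v , _ , refl = Nat.≤-refl
   go : ∀ a n → Unique (heads (comps k) a n)
   go a zero    = Uniqueₚ.map⁺ (λ { refl → refl }) (comps-unique k 0)
   go a (suc n) = Uniqueₚ.++⁺ (Uniqueₚ.map⁺ (λ { refl → refl }) (comps-unique k (suc n))) (go (suc a) n) disjoint
     where
     disjoint : ∀ {u} → ¬ (u ∈ List.map (a ∷_) (comps k (suc n)) × u ∈ heads (comps k) (suc a) n)
     disjoint (m , m′) with ∈-map⁻ (a ∷_) m
     ... | v , _ , refl = Nat.<⇒≱ (bigger (suc a) n m′) Nat.≤-refl

 sumL : {X : Set} → (X → ℕ) → List X → ℕ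
 sumL g []       = 0
 sumL g (x ∷ xs) = g x Nat.+ sumL g xs

 card-fibres : {X Y : Set} (G : Finite X) (f : X → Y) (us : List Y) → Unique us → (∀ x → f x ∈ us) →
               (fib : ∀ u → Finite (Σ X (λ x → f x ≡ u))) → card G ≡ sumL (λ u → card (fib u)) us
 card-fibres {X} {Y} G f us uq mem fib = trans (card-cong G (finite-Σ (finite-Fin (length us)) (λ j → fib (List.lookup us j)))
     (mk↔ₛ′ to (λ (j , x , e) → x) to-from (λ _ → refl))) (go us (λ u → card (fib u)))
   where
   to : X → Σ (Fin (length us)) (λ j → Σ X (λ x → f x ≡ List.lookup us j))
   to x = index (mem x) , x , lookup-index (mem x)
   pairEq : ∀ {i j} x {p : f x ≡ List.lookup us i} {q : f x ≡ List.lookup us j} → i ≡ j → (i , x , p) ≡ (j , x , q)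
   pairEq {i} x {p} {q} refl = cong (λ z → i , x , z) (uip p q)
   to-from : ∀ s → to (proj₁ (proj₂ s)) ≡ s
   to-from (j , x , e) = pairEq x (lookup-unique uq (trans (sym (lookup-index (mem x))) e))
   go : ∀ us (g : Y → ℕ) → sum (λ j → g (List.lookup us j)) ≡ sumL g us
   go []       g = refl
   go (u ∷ us) g = cong (g u Nat.+_) (go us g)

 #-sumL : {X : Set} (g : X → ℕ) (xs : List X) (c : F) → # (sumL g xs) * c ≡ sumF (λ x → # (g x) * c) xs
 #-sumL g []       c = trans (cong (_* c) ⟦⟧-0) (Fₚ.zeroˡ c)
 #-sumL g (x ∷ xs) c = trans (cong (_* c) (#-+ (g x) (sumL g xs))) (trans (Fₚ.distribʳ c _ _) (cong (# (g x) * c +_) (#-sumL g xs c)))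

 sumF-cong : {X : Set} {g h : X → F} (xs : List X) → (∀ {x} → x ∈ xs → g x ≡ h x) → sumF g xs ≡ sumF h xs
 sumF-cong []       e = refl
 sumF-cong (x ∷ xs) e = cong₂ _+_ (e (here refl)) (sumF-cong xs (e ∘ there))

 glf-pos : ∀ q → 2 ≤ q → ∀ n m → m ≤ n → 0 < glf (q ^ n) q m
 glf-pos q q≥2 n zero    _  = s≤s z≤n
 glf-pos q q≥2 n (suc m) le = Nat.*-mono-< (glf-pos q q≥2 n m (Nat.≤-trans (Nat.n≤1+n m) le)) (Nat.m<n⇒0<n∸m (Nat.^-monoʳ-< q q≥2 le))

 gl-pos : ∀ q → 2 ≤ q → ∀ n → 0 < gl q n
 gl-pos q q≥2 n = glf-pos q q≥2 n n Nat.≤-refl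

 -- The number `c` is kept general so that the induction can absorb one factor of the product into
 -- it.
 prod-recip : ∀ {k} (f : Fin k → ℕ) → (∀ i → 0 < f i) → ∀ c N → 0 < N → c Nat.* prod f ≡ N → ∀ (g : Fin k → F) → (∀ i → g i ≡ recip (f i)) →
              # c * recip N ≡ Vec.foldr _ _*_ 1F (tabulate g)
 prod-recip {zero}  f pos c N N>0 h g gf = trans (cong (λ z → # z * recip N) (trans (sym (Nat.*-identityʳ c)) h)) (recip-inverse N {{Nat.>-nonZero N>0}})
 prod-recip {suc k} f pos c N N>0 h g gf = begin
   # c * recip N ≡⟨ cancel-# (f zero) {{nz}} (begin
       # (f zero) * (# c * recip N) ≡⟨ trans (sym (Fₚ.*-assoc (# (f zero)) (# c) (recip N))) (cong (_* recip N) (trans (sym (#-* (f zero) c)) (cong # (Nat.*-comm (f zero) c)))) ⟩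
       # (c Nat.* f zero) * recip N ≡⟨ prod-recip (f ∘ suc) (pos ∘ suc) (c Nat.* f zero) N N>0 (trans (Nat.*-assoc c (f zero) _) h) (g ∘ suc) (gf ∘ suc) ⟩
       T ≡⟨ sym (Fₚ.*-identityˡ T) ⟩
       1F * T ≡⟨ cong (_* T) (sym (recip-inverse (f zero) {{nz}})) ⟩
       # (f zero) * recip (f zero) * T ≡⟨ Fₚ.*-assoc _ _ T ⟩
       # (f zero) * (recip (f zero) * T) ∎) ⟩
   recip (f zero) * T ≡⟨ cong (_* T) (sym (gf zero)) ⟩
   g zero * T ∎
   where
   open ≡-Reasoning
   T = Vec.foldr _ _*_ 1F (tabulate (g ∘ suc))
   nz : NonZero (f zero)
   nz = Nat.>-nonZero (pos zero)

 prodF-tabulate : ∀ {k} (f : Fin k → Series) (u : Vec ℕ k) → prodF f u ≡ Vec.foldr _ _*_ 1F (tabulate (λ i → f i (lookup u i)))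
 prodF-tabulate f []      = refl
 prodF-tabulate f (x ∷ u) = cong (f zero x *_) (prodF-tabulate (f ∘ suc) u)

 prodF-zero : ∀ {k} (f : Fin k → Series) (u : Vec ℕ k) i → f i (lookup u i) ≡ 0F → prodF f u ≡ 0F
 prodF-zero f (x ∷ u) zero    h = trans (cong (_* prodF (f ∘ suc) u) h) (Fₚ.zeroˡ _)
 prodF-zero f (x ∷ u) (suc i) h = trans (cong (f zero x *_) (prodF-zero (f ∘ suc) u i h)) (Fₚ.zeroʳ (f zero x))

 vsum-tabulate : ∀ {k} (f : Fin k → ℕ) → Vec.sum (tabulate f) ≡ sum f
 vsum-tabulate {zero}  f = refl
 vsum-tabulate {suc k} f = cong (f zero Nat.+_) (vsum-tabulate (f ∘ suc))

 pick : {P : Set} → Dec P → ℕ → ℕ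
 pick (yes _) n = n
 pick (no  _) n = 0

 -- The simple modules of K[∏ C_{p^j}]: their degrees dᵢ over K, the exponents p^{aᵢ} of the image
 -- of the group, and their endomorphism fields.
 record CountingData (K : FiniteField) (p : ℕ) (js : List ℕ) (R : ℕ) : Set₁ where
   q : ℕ
   q = FiniteField.size K
   field
     k        : ℕ
     d a      : Fin k → ℕ
     field-of : Fin k → FiniteField
     size-of  : ∀ i → FiniteField.size (field-of i) ≡ q ^ d i
     d-pos    : ∀ i → 0 < d i
     bounded  : ∀ i → a i ≤ R
     divide   : ∀ i → p ^ a i ∣ q ^ d i ∸ 1
     minimal  : ∀ i m → 0 < m → p ^ a i ∣ q ^ m ∸ 1 → d i ≤ m
     degrees  : ∀ b → sum (λ i → pick (a i Nat.≤? b) (d i)) ≡ p ^ sumL (b ⊓_) js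
     count    : ∀ n → # (HomCount.numHom K (List.map (p ^_) js) n) * recip (gl q n) ≡ prodSer (λ i → spread (d i ∸ 1) (E (q ^ d i))) n

 module _ (K : FiniteField) {ℓ : ℕ} (ℓ-prime : Prime ℓ) (c : ℕ) (size≡ : FiniteField.size K ≡ ℓ ^ c)
   {p : ℕ} (p-prime : Prime p) (js : List ℕ) (R : ℕ) (js≤R : All (_≤ R) js)
   (M : ℕ) (M>0 : 0 < M) (p^R∣ : p ^ R ∣ FiniteField.size K ^ M ∸ 1) where

   private
     module D = Degree K ℓ-prime c size≡ p-prime js R js≤R M M>0 p^R∣
     open Frames using (Splitting; module SplittingP)
     open Splitting D.S using (k)
     open SplittingP D.S using (Q)
     open GLn K using (size≥2; finite-GL)
     instance
       p≢0 : NonZero p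
       p≢0 = prime⇒nonZero p-prime
     q = FiniteField.size K
     open Homs K D.ms D.nz using (Rep; finite-Rep; card-Rep)
     module T = RepTypes K D.ms D.nz D.S
     open T using (d; d>0; dims; OfType; finite-OfType; type-empty; mult; mult-total; Q≡; module TypeCount)

     terms : Fin k → Series
     terms i = spread (d i ∸ 1) (E (q ^ d i))

     d-suc : ∀ i → suc (d i ∸ 1) ≡ d i
     d-suc i = Nat.m+[n∸m]≡n (d>0 i)

     term-at : ∀ i m → terms i (d i Nat.* m) ≡ recip (gl (Q i) m)
     term-at i m = trans (cong (λ z → terms i (z Nat.* m)) (sym (d-suc i))) (trans (cnt-at (d i ∸ 1) 0 m (E (q ^ d i))) (cong (λ z → recip (gl z m)) (sym (Q≡ i))))

     term-off : ∀ i n → ¬ (d i ∣ n) → terms i n ≡ 0F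
     term-off i n nd = go (cnt-cases (d i ∸ 1) 0 n (E (q ^ d i)))
       where
       go : (terms i n ≡ 0F) ⊎ (∃ λ k → n ≡ 0 Nat.+ suc (d i ∸ 1) Nat.* k × terms i n ≡ E (q ^ d i) k) → terms i n ≡ 0F
       go (inj₁ z) = z
       go (inj₂ (k , e , _)) = ⊥-elim (nd (divides k (trans e (trans (cong (Nat._* k) (d-suc i)) (Nat.*-comm (d i) k)))))

     -- If some `d i` does not divide its entry of `u`, both sides vanish: there is no such
     -- representation, and the substituted series has no such coefficient. Otherwise `type-count`
     -- applies.
     type-term : ∀ n u → Vec.sum u ≡ n → # (card (finite-OfType n u)) * recip (gl q n) ≡ prodF terms u
     type-term n u tot = go (Finₚ.all? (λ i → d i ∣? lookup u i))
       where
       go : Dec (∀ i → d i ∣ lookup u i) → # (card (finite-OfType n u)) * recip (gl q n) ≡ prodF terms u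
       go (no nall) = bad (Finₚ.¬∀⟶∃¬ k _ (λ i → d i ∣? lookup u i) nall)
         where
         bad : (∃ λ i → ¬ (d i ∣ lookup u i)) → # (card (finite-OfType n u)) * recip (gl q n) ≡ prodF terms u
         bad (i , nd) = trans (cong (λ z → # z * recip (gl q n)) (type-empty n u i nd)) (trans (trans (cong (_* recip (gl q n)) ⟦⟧-0) (Fₚ.zeroˡ _))
           (sym (prodF-zero terms u i (term-off i (lookup u i) nd))))
       go (yes all) = trans (prod-recip (λ i → gl (Q i) (m i)) (λ i → gl-pos (Q i) (SplittingP.Q≥2 D.S i) (m i)) _ (gl q n) (gl-pos q size≥2 n) counted
             (λ i → terms i (lookup u i)) (λ i → trans (cong (terms i) (u-at i)) (term-at i (m i)))) (sym (prodF-tabulate terms u))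
         where
         m : Fin k → ℕ
         m i = quotient (all i)
         u-at : ∀ i → lookup u i ≡ d i Nat.* m i
         u-at i = trans (_∣_.equality (all i)) (Nat.*-comm (m i) (d i))
         u≡ : u ≡ tabulate (λ i → d i Nat.* m i)
         u≡ = trans (sym (Vecₚ.tabulate∘lookup u)) (Vecₚ.tabulate-cong u-at)
         counted : card (finite-OfType n u) Nat.* prod (λ i → gl (Q i) (m i)) ≡ gl q n
         counted = trans (cong (λ z → card (finite-OfType n z) Nat.* prod (λ i → gl (Q i) (m i))) u≡)
           (trans (TypeCount.type-count n m (trans (sym (vsum-tabulate (λ i → d i Nat.* m i))) (trans (cong Vec.sum (sym u≡)) tot))) (card-GL K n))

     dims∈ : ∀ n (ρ : Rep n) → dims ρ ∈ comps k n
     dims∈ n ρ = comps-complete k (dims ρ) n (trans (vsum-tabulate (λ i → d i Nat.* mult ρ i)) (mult-total ρ))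

     foldr-powers : ∀ b js → List.foldr Nat._*_ 1 (List.map (λ j → p ^ (b ⊓ j)) js) ≡ p ^ sumL (b ⊓_) js
     foldr-powers b []       = refl
     foldr-powers b (j ∷ js) = trans (cong (p ^ (b ⊓ j) Nat.*_) (foldr-powers b js)) (sym (Nat.^-distribˡ-+-* p (b ⊓ j) _))

     pick-same : ∀ b i (dec : Dec (D.level i ≤ b)) → D.Invariants.pick b dec (d i) ≡ pick dec (d i)
     pick-same b i (yes _) = refl
     pick-same b i (no  _) = refl

   countingData : CountingData K p js R
   countingData = record
     { k = k ; d = d ; a = D.level ; field-of = D.field′ ; size-of = D.size-field ; d-pos = d>0 ; bounded = D.level≤R
     ; divide = D.degree-divides ; minimal = D.degree-minimal
     ; degrees = λ b → trans (sum-cong-≗ (λ i → sym (pick-same b i (D.level i Nat.≤? b)))) (trans (D.Invariants.degree-sum b)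
         (trans (length-groupElems (List.map (λ j → p ^ (b ⊓ j)) js)) (foldr-powers b js)))
     ; count = λ n → trans (cong (λ z → # z * recip (gl q n)) (trans (card-Rep n) (card-fibres (finite-Rep n) dims (comps k n) (comps-unique k n) (dims∈ n) (finite-OfType n))))
         (trans (#-sumL (λ u → card (finite-OfType n u)) (comps k n) (recip (gl q n)))
         (trans (sumF-cong (comps k n) (λ {u} u∈ → type-term n u (comps-sum k n u∈))) (sum-comps k terms n))) }

-- Burnside's lemma and Frobenius' theorem

module Burnside where
 open import Defs using (groupElems; groupMul)
 open Counting
 open GroupAlg using (AbGroup)
 open Groups
 open Degrees using (least)
 open Valuation
 open Nat using (_+_; _*_; _^_; _%_)
 open import Data.Nat.Combinatorics using (_C_)
 open import Data.Vec using (lookup)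
 open Rings using (vec-ext)
 open import Algebra.Properties.CommutativeMonoid.Sum Nat.+-0-commutativeMonoid using (sum; sum-cong-≗; sum-permute)
 import Algebra.Properties.CommutativeMonoid.Sum Int.+-0-commutativeMonoid as ℤΣ

 record Group : Set₁ where
   infixl 7 _∙_
   field
     X    : Set
     _∙_  : X → X → X
     ε    : X
     _⁻¹  : X → X
     assoc     : ∀ a b c → (a ∙ b) ∙ c ≡ a ∙ (b ∙ c)
     identityˡ : ∀ a → ε ∙ a ≡ a
     identityʳ : ∀ a → a ∙ ε ≡ a
     inverseˡ  : ∀ a → (a ⁻¹) ∙ a ≡ ε
     inverseʳ  : ∀ a → a ∙ (a ⁻¹) ≡ ε
     finiteX   : Finite X

   order : ℕ
   order = card finiteX

   power : X → ℕ → X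
   power x zero    = ε
   power x (suc n) = x ∙ power x n

   power-+ : ∀ x m n → power x (m + n) ≡ power x m ∙ power x n
   power-+ x zero    n = sym (identityˡ _)
   power-+ x (suc m) n = trans (cong (x ∙_) (power-+ x m n)) (sym (assoc x _ _))

   power-* : ∀ x m n → power x m ≡ ε → power x (n * m) ≡ ε
   power-* x m zero    h = refl
   power-* x m (suc n) h = trans (power-+ x m (n * m)) (trans (cong₂ _∙_ h (power-* x m n h)) (identityˡ ε))

   cancelˡ : ∀ a {b c} → a ∙ b ≡ a ∙ c → b ≡ c
   cancelˡ a {b} {c} h = trans (sym (lem b)) (trans (cong ((a ⁻¹) ∙_) h) (lem c))
     where
     lem : ∀ b → (a ⁻¹) ∙ (a ∙ b) ≡ b
     lem b = trans (sym (assoc _ a b)) (trans (cong (_∙ b) (inverseˡ a)) (identityˡ b))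

   ⁻¹-∙ : ∀ a b → (a ∙ b) ⁻¹ ≡ (b ⁻¹) ∙ (a ⁻¹)
   ⁻¹-∙ a b = cancelˡ (a ∙ b) (trans (inverseʳ (a ∙ b)) (sym (trans (assoc a b _) (trans (cong (a ∙_) (trans (sym (assoc b (b ⁻¹) (a ⁻¹)))
     (trans (cong (_∙ (a ⁻¹)) (inverseʳ b)) (identityˡ _)))) (inverseʳ a)))))

   ε⁻¹ : ε ⁻¹ ≡ ε
   ε⁻¹ = trans (sym (identityˡ _)) (inverseʳ ε)

 record GSet (G : Group) : Set₁ where
   open Group G
   field
     Ω       : Set
     act     : X → Ω → Ω
     act-ε   : ∀ ω → act ε ω ≡ ω
     act-∙   : ∀ x y ω → act (x ∙ y) ω ≡ act x (act y ω)
     finiteΩ : Finite Ω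

   Fix : X → Set
   Fix x = Σ Ω (λ ω → act x ω ≡ ω)

   finite-Fix : ∀ x → Finite (Fix x)
   finite-Fix x = finite-sub finiteΩ (λ _ → uip) (λ ω → Finite._≟ᶠ_ finiteΩ (act x ω) ω)

   π : X → ℕ
   π x = card (finite-Fix x)

   act-inv : ∀ x ω → act (x ⁻¹) (act x ω) ≡ ω
   act-inv x ω = trans (sym (act-∙ (x ⁻¹) x ω)) (trans (cong (λ y → act y ω) (inverseˡ x)) (act-ε ω))

   inv-act : ∀ x ω → act x (act (x ⁻¹) ω) ≡ ω
   inv-act x ω = trans (sym (act-∙ x (x ⁻¹) ω)) (trans (cong (λ y → act y ω) (inverseʳ x)) (act-ε ω))

 firstFin : ∀ {n} {P : Fin n → Set} → (∀ i → Dec (P i)) → Σ (Fin n) P → Σ (Fin n) (λ i → P i × (∀ j → j Fin.< i → ¬ P j))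
 firstFin {suc n} {P} P? (i , p) = go (P? zero) i p
   where
   go : Dec (P zero) → ∀ i → P i → Σ (Fin (suc n)) (λ i → P i × (∀ j → j Fin.< i → ¬ P j))
   go (yes p₀) i       p = zero , p₀ , λ j ()
   go (no np)  zero    p = ⊥-elim (np p)
   go (no np)  (suc i) p = let (k , q , min) = firstFin (λ j → P? (suc j)) (i , p) in
     suc k , q , λ { zero _ → np ; (suc j) (s≤s lt) → min j lt }

 firstFin-unique : ∀ {n} {P Q : Fin n → Set} → (∀ i → P i → Q i) → (∀ i → Q i → P i) →
                   (s : Σ (Fin n) (λ i → P i × (∀ j → j Fin.< i → ¬ P j))) (t : Σ (Fin n) (λ i → Q i × (∀ j → j Fin.< i → ¬ Q j))) → proj₁ s ≡ proj₁ t
 firstFin-unique pq qp (i , p , min) (j , q , min′) with Finₚ.<-cmp i j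
 ... | tri< lt _ _ = ⊥-elim (min′ i lt (pq i p))
 ... | tri≈ _ e _  = e
 ... | tri> _ _ gt = ⊥-elim (min j gt (qp j q))

 module _ {G : Group} (S : GSet G) where
   open Group G
   open GSet S

   private
     Orbit : Ω → Fin (card finiteΩ) → Set
     Orbit ω i = Σ X (λ x → act x ω ≡ Finite.enum finiteΩ i)

     orbit? : ∀ ω i → Dec (Orbit ω i)
     orbit? ω i = Finite.any? finiteX (λ x → Finite._≟ᶠ_ finiteΩ (act x ω) (Finite.enum finiteΩ i))

     -- The least index in the orbit: a representative that depends on the orbit alone.
     firstOrbit : ∀ ω → Σ (Fin (card finiteΩ)) (λ i → Orbit ω i × (∀ j → j Fin.< i → ¬ Orbit ω j))
     firstOrbit ω = firstFin (orbit? ω) (Finite.idx finiteΩ ω , ε , trans (act-ε ω) (sym (Finite.enum-idx finiteΩ ω)))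

     rep : Ω → Ω
     rep ω = Finite.enum finiteΩ (proj₁ (firstOrbit ω))

     toRep : Ω → X
     toRep ω = proj₁ (proj₁ (proj₂ (firstOrbit ω)))

     toRep-act : ∀ ω → act (toRep ω) ω ≡ rep ω
     toRep-act ω = proj₂ (proj₁ (proj₂ (firstOrbit ω)))

     rep-act : ∀ x ω → rep (act x ω) ≡ rep ω
     rep-act x ω = cong (Finite.enum finiteΩ) (firstFin-unique
       (λ i (y , h) → y ∙ x , trans (act-∙ y x ω) h)
       (λ i (y , h) → y ∙ (x ⁻¹) , trans (act-∙ y (x ⁻¹) (act x ω)) (trans (cong (act y) (act-inv x ω)) h))
       (firstOrbit (act x ω)) (firstOrbit ω))

     Reps : Set
     Reps = Σ Ω (λ ω → rep ω ≡ ω)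

     finite-Reps : Finite Reps
     finite-Reps = finite-sub finiteΩ (λ _ → uip) (λ ω → Finite._≟ᶠ_ finiteΩ (rep ω) ω)

     -- A pair with `x ω = ω` goes to the representative of the orbit and to `y = toRep ω ∙ x`. As
     -- `x` fixes `ω`, `y` too carries `ω` to the representative, so `ω` and then `x` are recovered
     -- from `y`.
     orbits : Σ X Fix ↔ (Reps × X)
     orbits = mk↔ₛ′ to from to-from from-to
       where
       to : Σ X Fix → Reps × X
       to (x , ω , h) = (rep ω , trans (cong rep (sym (toRep-act ω))) (rep-act (toRep ω) ω)) , toRep ω ∙ x
       from : Reps × X → Σ X Fix
       from ((r , e) , y) = (toRep ω ⁻¹) ∙ y , ω , trans (act-∙ (toRep ω ⁻¹) y ω) (trans (cong (act (toRep ω ⁻¹)) (trans (inv-act y r) (trans (sym ω-rep) (sym (toRep-act ω))))) (act-inv (toRep ω) ω))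
         where
         ω = act (y ⁻¹) r
         ω-rep : rep ω ≡ r
         ω-rep = trans (rep-act (y ⁻¹) r) e
       to-from : ∀ s → to (from s) ≡ s
       to-from ((r , e) , y) = cong₂ _,_ (Σ-prop-≡ (λ _ → uip) (trans (rep-act (y ⁻¹) r) e))
         (trans (sym (assoc _ _ y)) (trans (cong (_∙ y) (inverseʳ _)) (identityˡ y)))
       pair : ∀ {x x′ ω ω′} {h : act x ω ≡ ω} {h′ : act x′ ω′ ≡ ω′} → x ≡ x′ → ω ≡ ω′ → _≡_ {A = Σ X Fix} (x , ω , h) (x′ , ω′ , h′)
       pair {x} {ω = ω} {h = h} {h′} refl refl = cong (λ z → x , ω , z) (uip h h′)
       from-to : ∀ s → from (to s) ≡ s
       from-to (x , ω , h) = pair (trans (cong (λ z → (toRep z ⁻¹) ∙ (toRep ω ∙ x)) back) (trans (sym (assoc _ _ x)) (trans (cong (_∙ x) (inverseˡ _)) (identityˡ x)))) back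
         where
         back : act ((toRep ω ∙ x) ⁻¹) (rep ω) ≡ ω
         back = trans (cong (act ((toRep ω ∙ x) ⁻¹)) (sym (trans (act-∙ (toRep ω) x ω) (trans (cong (act (toRep ω)) h) (toRep-act ω))))) (act-inv (toRep ω ∙ x) ω)

   burnside : order ∣ ∑ finiteX π
   burnside = divides (card finite-Reps) (card-cong (finite-Σ finiteX finite-Fix) (finite-× finite-Reps finiteX) orbits)

 head₀ : List ℕ → ℕ
 head₀ []      = 0
 head₀ (a ∷ _) = a

 valid-head : ∀ {o g} → Valid (o ∷ []) g → g ≡ head₀ g ∷ []
 valid-head (_ ∷ []) = refl

 valid-head< : ∀ {o g} → Valid (o ∷ []) g → head₀ g < o
 valid-head< (lt ∷ []) = lt

 -- The cyclic group of order o acting through the powers of τ.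
 module Cyclic {Y : Set} (finiteY : Finite Y) (τ : Y → Y) where

   iter : ℕ → Y → Y
   iter zero    y = y
   iter (suc n) y = τ (iter n y)

   iter-+ : ∀ m n y → iter (m + n) y ≡ iter m (iter n y)
   iter-+ zero    n y = refl
   iter-+ (suc m) n y = cong τ (iter-+ m n y)

   iter-* : ∀ o → (∀ y → iter o y ≡ y) → ∀ c y → iter (c * o) y ≡ y
   iter-* o h zero    y = refl
   iter-* o h (suc c) y = trans (iter-+ o (c * o) y) (trans (h _) (iter-* o h c y))

   module _ (o : ℕ) .{{_ : NonZero o}} (iter-o : ∀ y → iter o y ≡ y) (free : ∀ v → 0 < v → v < o → ∀ y → iter v y ≢ y) where
     private
       ms : List ℕ
       ms = o ∷ []

       nzs : (o′ : ℕ) → NonZero o′ → All NonZero (o′ ∷ [])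
       nzs o′ nz = nz ∷ []

       nzo : NonZero o
       nzo = Nat.≢-nonZero (Nat.≢-nonZero⁻¹ o)

       module L = FromList ms (nzs o nzo)

       value : Fin L.N → ℕ
       value i = head₀ (L.el i)

       el-value : ∀ i → L.el i ≡ value i ∷ []
       el-value i = valid-head (L.el-valid i)

       value< : ∀ i → value i < o
       value< i = valid-head< (L.el-valid i)

       value-∙ : ∀ i j → value (i L.∙ j) ≡ (value i + value j) % o
       value-∙ i j = head-inj (trans (sym (el-value (i L.∙ j))) (trans (L.el-∙ i j) (trans (cong₂ (groupMul ms) (el-value i) (el-value j)) (reduce o))))
         where
         head-inj : ∀ {a b : ℕ} → a ∷ [] ≡ b ∷ [] → a ≡ b
         head-inj refl = refl
         reduce : ∀ o .{{_ : NonZero o}} → groupMul (o ∷ []) (value i ∷ []) (value j ∷ []) ≡ ((value i + value j) % o) ∷ []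
         reduce (suc o) = refl

       value-ε : value L.ε ≡ 0
       value-ε = head-inj (trans (sym (el-value L.ε)) (L.el-ix (zeros-valid (nzs o nzo))))
         where
         head-inj : ∀ {a : ℕ} → a ∷ [] ≡ 0 ∷ [] → a ≡ 0
         head-inj refl = refl

       group : Group
       group = record
         { X = Fin L.N ; _∙_ = L._∙_ ; ε = L.ε ; _⁻¹ = L._⁻¹ ; assoc = L.assoc ; identityˡ = L.identityˡ
         ; identityʳ = λ a → trans (L.comm a L.ε) (L.identityˡ a) ; inverseˡ = L.inverseˡ
         ; inverseʳ = λ a → trans (L.comm a _) (L.inverseˡ a) ; finiteX = finite-Fin L.N }

       iter-% : ∀ n y → iter (n % o) y ≡ iter n y
       iter-% n y = sym (trans (cong (λ z → iter z y) (m≡m%n+[m/n]*n n o)) (trans (iter-+ (n % o) _ y) (cong (iter (n % o)) (iter-* o iter-o (n DivMod./ o) y))))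

       action : GSet group
       action = record
         { Ω = Y ; act = λ i → iter (value i)
         ; act-ε = λ y → cong (λ z → iter z y) value-ε
         ; act-∙ = λ i j y → trans (cong (λ z → iter z y) (value-∙ i j)) (trans (iter-% (value i + value j) y) (iter-+ (value i) (value j) y))
         ; finiteΩ = finiteY }

       fixed⇒ε : ∀ i y → iter (value i) y ≡ y → L.ε ≡ i
       fixed⇒ε i y h = L.el-injective (trans (el-value L.ε) (trans (cong (_∷ []) (trans value-ε (sym (zero-value (value i) refl)))) (sym (el-value i))))
         where
         zero-value : ∀ v → v ≡ value i → value i ≡ 0
         zero-value zero    e = sym e
         zero-value (suc v) e = ⊥-elim (free (value i) (subst (0 <_) e (s≤s z≤n)) (value< i) y h)

     -- In a free action only the identity has fixed points, so the sum in Burnside's lemma is the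
     -- number of points.
     free⇒∣ : o ∣ card finiteY
     free⇒∣ = subst₂ _∣_ (trans (length-groupElems ms) (Nat.*-identityʳ o)) (card-cong (finite-Σ (finite-Fin L.N) (GSet.finite-Fix action)) finiteY
       (mk↔ₛ′ (λ (i , y , h) → y) (λ y → L.ε , y , GSet.act-ε action y) (λ _ → refl) from-to)) (burnside action)
       where
       from-to : ∀ s → (L.ε , proj₁ (proj₂ s) , GSet.act-ε action (proj₁ (proj₂ s))) ≡ s
       from-to (i , y , h) = lem (fixed⇒ε i y h)
         where
         lem : ∀ {i} {h : iter (value i) y ≡ y} → L.ε ≡ i → (L.ε , y , GSet.act-ε action y) ≡ (i , y , h)
         lem {h = h} refl = cong (λ z → L.ε , y , z) (uip _ h)

 module _ {p : ℕ} (pr : Prime p) where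
   private
     instance
       p≢0 : NonZero p
       p≢0 = prime⇒nonZero pr

   module FixedPoints {Y : Set} (finiteY : Finite Y) (τ : Y → Y) (τ-p : ∀ y → Cyclic.iter finiteY τ p y ≡ y) where
     open Cyclic finiteY τ

     private
       open import Data.Nat.GCD using (gcd-GCD; module Bézout)
       open import Data.Nat.Coprimality using (prime⇒coprime; coprime-Bézout)

       power-fixed : ∀ v y → iter v y ≡ y → ∀ c → iter (c * v) y ≡ y
       power-fixed v y h zero    = refl
       power-fixed v y h (suc c) = trans (iter-+ v (c * v) y) (trans (cong (iter v) (power-fixed v y h c)) h)

       -- By Bézout `v` is invertible modulo `p`, so `τ` acts on `y` as an iterate of its `v`-th
       -- power.
       iter-fixed : ∀ v → 0 < v → v < p → ∀ y → iter v y ≡ y → τ y ≡ y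
       iter-fixed v v>0 v<p y h with coprime-Bézout (prime⇒coprime pr {{Nat.>-nonZero v>0}} v<p)
       ... | Bézout.+- a b e = trans (sym (cong τ (power-fixed v y h b))) (trans (cong (λ z → iter z y) e) (iter-* p τ-p a y))
       ... | Bézout.-+ a b e = trans (sym (cong τ (iter-* p τ-p a y))) (trans (cong (λ z → iter z y) e) (power-fixed v y h b))

       Moved : Set
       Moved = Σ Y (λ y → τ y ≢ y)

       moved? : ∀ y → Dec (τ y ≡ y)
       moved? y = Finite._≟ᶠ_ finiteY (τ y) y

       finite-Moved : Finite Moved
       finite-Moved = finite-sub finiteY (λ _ → ¬-prop) (λ y → neg (moved? y))
         where
         neg : ∀ {P : Set} → Dec P → Dec (¬ P)
         neg (yes q) = no (λ nq → nq q)
         neg (no nq) = yes nq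

       τ-injective : ∀ {y z} → τ y ≡ τ z → y ≡ z
       τ-injective {y} {z} e = trans (sym (τ-p y)) (trans (lem p) (τ-p z))
         where
         lem : ∀ n .{{_ : NonZero n}} → iter n y ≡ iter n z
         lem (suc n) = trans (back n y) (trans (cong (iter n) e) (sym (back n z)))
           where
           back : ∀ n y → iter (suc n) y ≡ iter n (τ y)
           back n y = trans (cong (λ k → iter k y) (Nat.+-comm 1 n)) (iter-+ n 1 y)

       τ′ : Moved → Moved
       τ′ (y , n) = τ y , (λ e → n (τ-injective e))

       iter′ : ∀ n s → proj₁ (Cyclic.iter finite-Moved τ′ n s) ≡ iter n (proj₁ s)
       iter′ zero    s = refl
       iter′ (suc n) s = cong τ (iter′ n s)

       p∣moved : p ∣ card finite-Moved
       p∣moved = Cyclic.free⇒∣ finite-Moved τ′ p (λ s → Σ-prop-≡ (λ _ → ¬-prop) (trans (iter′ p s) (τ-p (proj₁ s))))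
         (λ v v>0 v<p s h → proj₂ s (iter-fixed v v>0 v<p (proj₁ s) (trans (sym (iter′ v s)) (cong proj₁ h))))

     finite-Fixed : Finite (Σ Y (λ y → τ y ≡ y))
     finite-Fixed = finite-sub finiteY (λ _ → uip) moved?

     -- On the points that it moves, `τ` generates a free action of a group of order `p`.
     p∣fixed⇒p∣all : p ∣ card finite-Fixed → p ∣ card finiteY
     p∣fixed⇒p∣all h = subst (p ∣_) (sym (card-complement finiteY (λ _ → uip) moved? finite-Fixed finite-Moved)) (∣m∣n⇒∣m+n h p∣moved)

   module PGroup {G : Group} (S : GSet G) where
     open Group G
     open GSet S

     -- `x^(p^j)` acts with order dividing `p` on the fixed points of `x^(p^(j+1))`, and what it
     -- fixes there are its own fixed points. So divisibility by `p` climbs from `x` to the identity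
     -- `x^(p^N)`, which fixes everything.
     p-element : ∀ N x → power x (p ^ N) ≡ ε → p ∣ π x → p ∣ card finiteΩ
     p-element N x xN h = finish (climb N Nat.≤-refl)
       where
       y : ℕ → X
       y j = power x (p ^ j)
       act-power : ∀ z n ω → act (power z n) ω ≡ Cyclic.iter finiteΩ (act z) n ω
       act-power z zero    ω = act-ε ω
       act-power z (suc n) ω = trans (act-∙ z (power z n) ω) (cong (act z) (act-power z n ω))
       power-power : ∀ z m n → power z (m * n) ≡ power (power z n) m
       power-power z zero    n = refl
       power-power z (suc m) n = trans (power-+ z n (m * n)) (cong (power z n ∙_) (power-power z m n))
       y-suc : ∀ j → y (suc j) ≡ power (y j) p
       y-suc j = power-power x p (p ^ j)
       commute : ∀ j → y (suc j) ∙ y j ≡ y j ∙ y (suc j)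
       commute j = trans (sym (power-+ x (p ^ suc j) (p ^ j))) (trans (cong (power x) (Nat.+-comm (p ^ suc j) (p ^ j))) (power-+ x (p ^ j) (p ^ suc j)))
       step : ∀ j → p ∣ π (y j) → p ∣ π (y (suc j))
       step j d = FixedPoints.p∣fixed⇒p∣all (finite-Fix (y (suc j))) τ τ-p (subst (p ∣_) same d)
         where
         τ : Fix (y (suc j)) → Fix (y (suc j))
         τ (ω , e) = act (y j) ω , trans (sym (act-∙ (y (suc j)) (y j) ω)) (trans (cong (λ z → act z ω) (commute j)) (trans (act-∙ (y j) (y (suc j)) ω) (cong (act (y j)) e)))
         iter-τ : ∀ n s → proj₁ (Cyclic.iter (finite-Fix (y (suc j))) τ n s) ≡ act (power (y j) n) (proj₁ s)
         iter-τ zero    s = sym (act-ε (proj₁ s))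
         iter-τ (suc n) s = trans (cong (act (y j)) (iter-τ n s)) (sym (act-∙ (y j) (power (y j) n) (proj₁ s)))
         τ-p : ∀ s → Cyclic.iter (finite-Fix (y (suc j))) τ p s ≡ s
         τ-p (ω , e) = Σ-prop-≡ (λ _ → uip) (trans (iter-τ p (ω , e)) (trans (cong (λ z → act z ω) (sym (y-suc j))) e))
         same : π (y j) ≡ card (FixedPoints.finite-Fixed (finite-Fix (y (suc j))) τ τ-p)
         same = card-cong (finite-Fix (y j)) (FixedPoints.finite-Fixed (finite-Fix (y (suc j))) τ τ-p) (mk↔ₛ′
           (λ (ω , e) → (ω , trans (cong (λ z → act z ω) (y-suc j)) (trans (act-power (y j) p ω) (iterfix p ω e))) , Σ-prop-≡ (λ _ → uip) e)
           (λ ((ω , _) , e) → ω , cong proj₁ e)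
           (λ _ → Σ-prop-≡ (λ _ → uip) (Σ-prop-≡ (λ _ → uip) refl)) (λ _ → Σ-prop-≡ (λ _ → uip) refl))
           where
           iterfix : ∀ n ω → act (y j) ω ≡ ω → Cyclic.iter finiteΩ (act (y j)) n ω ≡ ω
           iterfix zero    ω e = refl
           iterfix (suc n) ω e = trans (cong (act (y j)) (iterfix n ω e)) e
       climb : ∀ j → j ≤ N → p ∣ π (y j)
       climb zero    _ = subst (λ z → p ∣ π z) (sym (identityʳ x)) h
       climb (suc j) le = step j (climb j (Nat.<⇒≤ le))
       finish : p ∣ π (y N) → p ∣ card finiteΩ
       finish d = subst (p ∣_) (card-cong (finite-Fix (y N)) finiteΩ (mk↔ₛ′ proj₁ (λ ω → ω , trans (cong (λ z → act z ω) xN) (act-ε ω)) (λ _ → refl) (λ _ → Σ-prop-≡ (λ _ → uip) refl))) d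

 bit : Bool → ℕ
 bit true  = 1
 bit false = 0

 size : ∀ {n} → Vec Bool n → ℕ
 size Y = sum (λ i → bit (lookup Y i))

 finite-Bool : Finite Bool
 finite-Bool = finite 2 (↔-sym Finₚ.2↔Bool)

 Subsets : ℕ → ℕ → Set
 Subsets n k = Σ (Vec Bool n) (λ Y → size Y ≡ k)

 finite-Subsets : ∀ n k → Finite (Subsets n k)
 finite-Subsets n k = finite-sub (finite-Vec finite-Bool n) (λ _ → uip) (λ Y → size Y Nat.≟ k)

 card-Subsets : ∀ n k → card (finite-Subsets n k) ≡ n C k
 card-Subsets zero    zero    = card-cong (finite-Subsets 0 0) (finite-Fin 1) (mk↔ₛ′ (λ _ → zero) (λ _ → [] , refl) (λ { zero → refl }) (λ { ([] , _) → Σ-prop-≡ (λ _ → uip) refl }))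
 card-Subsets zero    (suc k) = card-cong (finite-Subsets 0 (suc k)) (finite-Fin 0) (mk↔ₛ′ (λ { ([] , ()) }) (λ ()) (λ ()) (λ { ([] , ()) }))
 card-Subsets (suc n) zero    = trans (card-cong (finite-Subsets (suc n) 0) (finite-Subsets n 0) (mk↔ₛ′ to (λ (Y , e) → false ∷ Y , e) (λ _ → refl) from-to)) (card-Subsets n 0)
   where
   to : Subsets (suc n) 0 → Subsets n 0
   to (false ∷ Y , e) = Y , e
   from-to : ∀ s → (false ∷ proj₁ (to s) , proj₂ (to s)) ≡ s
   from-to (false ∷ Y , e) = refl
 card-Subsets (suc n) (suc k) = trans (card-cong (finite-Subsets (suc n) (suc k)) (finite-⊎ (finite-Subsets n k) (finite-Subsets n (suc k))) (mk↔ₛ′ to from to-from from-to))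
     (trans (cong₂ _+_ (card-Subsets n k) (card-Subsets n (suc k))) (nCk+nC[k+1]≡[n+1]C[k+1] n k))
   where
   to : Subsets (suc n) (suc k) → Subsets n k ⊎ Subsets n (suc k)
   to (true  ∷ Y , e) = inj₁ (Y , Nat.suc-injective e)
   to (false ∷ Y , e) = inj₂ (Y , e)
   from : Subsets n k ⊎ Subsets n (suc k) → Subsets (suc n) (suc k)
   from (inj₁ (Y , e)) = true ∷ Y , cong suc e
   from (inj₂ (Y , e)) = false ∷ Y , e
   to-from : ∀ s → to (from s) ≡ s
   to-from (inj₁ (Y , e)) = cong inj₁ (Σ-prop-≡ (λ _ → uip) refl)
   to-from (inj₂ (Y , e)) = refl
   from-to : ∀ s → from (to s) ≡ s
   from-to (true  ∷ Y , e) = Σ-prop-≡ (λ _ → uip) refl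
   from-to (false ∷ Y , e) = refl

 module Translates (G : Group) (k : ℕ) where
   open Group G
   private
     σ : X → Fin order → Fin order
     σ x i = Finite.idx finiteX (x ∙ Finite.enum finiteX i)

     σ-∙ : ∀ x y i → σ (x ∙ y) i ≡ σ x (σ y i)
     σ-∙ x y i = cong (Finite.idx finiteX) (trans (assoc x y _) (cong (x ∙_) (sym (Finite.enum-idx finiteX _))))

     σ-ε : ∀ i → σ ε i ≡ i
     σ-ε i = trans (cong (Finite.idx finiteX) (identityˡ _)) (Finite.idx-enum finiteX i)

     -- The characteristic function of the translate `x Y`.
     move : X → Vec Bool order → Vec Bool order
     move x Y = tabulate (λ i → lookup Y (σ (x ⁻¹) i))

     move-at : ∀ x Y i → lookup (move x Y) i ≡ lookup Y (σ (x ⁻¹) i)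
     move-at x Y i = Vecₚ.lookup∘tabulate _ i

     size-move : ∀ x Y → size (move x Y) ≡ size Y
     size-move x Y = trans (sum-cong-≗ (λ i → cong bit (move-at x Y i))) (sym (sum-permute (λ i → bit (lookup Y i))
       (mk↔ₛ′ (σ (x ⁻¹)) (σ x) (λ i → trans (sym (σ-∙ (x ⁻¹) x i)) (trans (cong (λ z → σ z i) (inverseˡ x)) (σ-ε i)))
                               (λ i → trans (sym (σ-∙ x (x ⁻¹) i)) (trans (cong (λ z → σ z i) (inverseʳ x)) (σ-ε i))))))

   subsets : GSet G
   subsets = record
     { Ω = Subsets order k
     ; act = λ x (Y , e) → move x Y , trans (size-move x Y) e
     ; act-ε = λ (Y , e) → Σ-prop-≡ (λ _ → uip) (vec-ext (λ i → trans (move-at ε Y i) (cong (lookup Y) (trans (cong (λ z → σ z i) ε⁻¹) (σ-ε i)))))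
     ; act-∙ = λ x y (Y , e) → Σ-prop-≡ (λ _ → uip) (vec-ext (λ i → trans (move-at (x ∙ y) Y i) (trans (cong (lookup Y) (trans (cong (λ z → σ z i) (⁻¹-∙ x y)) (σ-∙ (y ⁻¹) (x ⁻¹) i)))
         (sym (trans (move-at x (move y Y) i) (move-at y Y _))))))
     ; finiteΩ = finite-Subsets order k }

   private
     ^o : ∀ x → Σ ℕ (λ o → 0 < o × power x o ≡ ε)
     ^o x with Finₚ.pigeonhole (Nat.n<1+n order) (λ (i : Fin (suc order)) → Finite.idx finiteX (power x (toℕ i)))
     ... | i , j , i<j , h = toℕ j ∸ toℕ i , Nat.m<n⇒0<n∸m i<j , cancelˡ (power x (toℕ i)) (trans (sym (power-+ x (toℕ i) (toℕ j ∸ toℕ i)))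
           (trans (cong (power x) (Nat.m+[n∸m]≡n (Nat.<⇒≤ i<j))) (trans (sym (Finite.idx-injective finiteX h)) (sym (identityʳ _)))))

     Order : X → Set
     Order x = Σ ℕ (λ o → 0 < o × power x o ≡ ε × (∀ v → 0 < v → v < o → power x v ≢ ε))

     minimal-order : ∀ x → Order x
     minimal-order x = go (^o x)
       where
       shift : ∀ {o} → (∃ λ a → a ≤ o × (power x (suc a) ≡ ε) × (∀ b → b < a → power x (suc b) ≢ ε)) → Order x
       shift (a , _ , e , min) = suc a , s≤s z≤n , e , λ { (suc v) _ (s≤s lt) → min v lt }
       go : Σ ℕ (λ o → 0 < o × power x o ≡ ε) → Order x
       go (suc o , _ , h) = shift {o} (least (λ a → Finite._≟ᶠ_ finiteX (power x (suc a)) ε) o h)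

   -- Multiplication by x is free on a stable subset, so the order of x divides its size.
   stable⇒power : ∀ x → GSet.Fix subsets x → power x k ≡ ε
   stable⇒power x ((Y , sz) , fixed) = main (minimal-order x)
     where
     M : Set
     M = Σ (Fin order) (λ i → lookup Y i ≡ true)
     finite-M : Finite M
     finite-M = finite-sub (finite-Fin order) (λ _ → uip) (λ i → lookup Y i Boolₚ.≟ true)
     τ : M → M
     τ (i , t) = σ x i , trans (cong (λ Z → lookup Z (σ x i)) (sym (cong proj₁ fixed))) (trans (move-at x Y (σ x i))
       (trans (cong (lookup Y) (trans (sym (σ-∙ (x ⁻¹) x i)) (trans (cong (λ z → σ z i) (inverseˡ x)) (σ-ε i)))) t))
     iter-τ : ∀ n s → proj₁ (Cyclic.iter finite-M τ n s) ≡ σ (power x n) (proj₁ s)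
     iter-τ zero    s = sym (σ-ε (proj₁ s))
     iter-τ (suc n) s = trans (cong (σ x) (iter-τ n s)) (sym (σ-∙ x (power x n) (proj₁ s)))
     σ-free : ∀ z i → σ z i ≡ i → z ≡ ε
     σ-free z i h = trans (sym (identityʳ z)) (trans (cong (z ∙_) (sym (inverseʳ (Finite.enum finiteX i)))) (trans (sym (assoc z _ _))
       (trans (cong (_∙ (Finite.enum finiteX i ⁻¹)) (trans (sym (Finite.enum-idx finiteX _)) (cong (Finite.enum finiteX) h))) (inverseʳ _))))
     card-M : card finite-M ≡ k
     card-M = trans (sum-cong-≗ (λ i → step (lookup Y i) (lookup Y i Boolₚ.≟ true))) sz
       where
       step : ∀ b (d : Dec (b ≡ true)) → card (finite-Dec uip d) ≡ bit b
       step true  (yes _) = refl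
       step false (no _)  = refl
       step true  (no n)  = ⊥-elim (n refl)
     conclude : ∀ o → power x o ≡ ε → o ∣ k → power x k ≡ ε
     conclude o xo (divides c e) = trans (cong (power x) e) (power-* x o c xo)
     main : Order x → power x k ≡ ε
     main (o , o>0 , xo , min) = conclude o xo (subst (o ∣_) card-M (Cyclic.free⇒∣ finite-M τ o {{Nat.>-nonZero o>0}}
         (λ s → Σ-prop-≡ (λ _ → uip) (trans (iter-τ o s) (trans (cong (λ z → σ z (proj₁ s)) xo) (σ-ε (proj₁ s)))))
         (λ v v>0 v<o s h → min v v>0 v<o (σ-free (power x v) (proj₁ s) (trans (sym (iter-τ v s)) (cong proj₁ h))))))

 -- On the set of subsets of size p^s the permutation character π₀ vanishes off p-elements and is prime to p
 -- on p-elements, so Σ_x ∏_{x′ p-element} (π₀(x′) − π₀(x)) counts the non-p-elements up to a unit,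
 -- while Burnside's lemma makes it divisible by |G|.
 module Frobenius {p : ℕ} (pr : Prime p) (G : Group) (s m : ℕ) (p∤m : ¬ (p ∣ m)) (order≡ : Group.order G ≡ p ^ s * m)
                  (N : ℕ) (s≤N : s ≤ N) where
   open Group G
   private
     instance
       p≢0 : NonZero p
       p≢0 = prime⇒nonZero pr

     Ω₀ : GSet G
     Ω₀ = Translates.subsets G (p ^ s)

     π₀ : X → ℕ
     π₀ = GSet.π Ω₀

     PEl : X → Set
     PEl x = power x (p ^ N) ≡ ε

     pel? : ∀ x → Dec (PEl x)
     pel? x = Finite._≟ᶠ_ finiteX (power x (p ^ N)) ε

     -- If `p` divided the number of fixed points of the `p`-element, it would divide the number
     -- `binom(p^s m, p^s)` of all subsets of size `p^s`.
     π₀-unit : ∀ x → PEl x → ¬ (p ∣ π₀ x)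
     π₀-unit x h d = p∤binomial pr s m p∤m (subst (p ∣_) (trans (card-Subsets order (p ^ s)) (cong (_C (p ^ s)) order≡)) (PGroup.p-element pr Ω₀ N x h d))

     π₀-zero : ∀ x → ¬ PEl x → π₀ x ≡ 0
     π₀-zero x nh = Nat.n≤0⇒n≡0 (injective⇒card≤ (GSet.finite-Fix Ω₀ x) (finite-Fin 0) (λ f → ⊥-elim (absurd f)) (λ {f} _ → ⊥-elim (absurd f)))
       where
       absurd : GSet.Fix Ω₀ x → ⊥
       absurd f = nh (trans (cong (power x) (trans (cong (p ^_) (sym (Nat.m∸n+n≡m s≤N))) (Nat.^-distribˡ-+-* p (N ∸ s) s)))
         (power-* x (p ^ s) (p ^ (N ∸ s)) (Translates.stable⇒power G (p ^ s) x f)))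

     _×ᴳ_ : GSet G → GSet G → GSet G
     A ×ᴳ B = record
       { Ω = A.Ω × B.Ω ; act = λ x (a , b) → A.act x a , B.act x b
       ; act-ε = λ (a , b) → cong₂ _,_ (A.act-ε a) (B.act-ε b)
       ; act-∙ = λ x y (a , b) → cong₂ _,_ (A.act-∙ x y a) (B.act-∙ x y b)
       ; finiteΩ = finite-× A.finiteΩ B.finiteΩ }
       where module A = GSet A
             module B = GSet B

     π-× : ∀ A B x → GSet.π (A ×ᴳ B) x ≡ GSet.π A x * GSet.π B x
     π-× A B x = card-cong (GSet.finite-Fix (A ×ᴳ B) x) (finite-× (GSet.finite-Fix A x) (GSet.finite-Fix B x)) (mk↔ₛ′
       (λ ((a , b) , e) → (a , cong proj₁ e) , (b , cong proj₂ e)) (λ ((a , e) , (b , f)) → (a , b) , cong₂ _,_ e f)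
       (λ _ → cong₂ _,_ (Σ-prop-≡ (λ _ → uip) refl) (Σ-prop-≡ (λ _ → uip) refl)) (λ _ → Σ-prop-≡ (λ _ → uip) refl))

     point : GSet G
     point = record { Ω = ⊤ ; act = λ _ _ → tt ; act-ε = λ _ → refl ; act-∙ = λ _ _ _ → refl ; finiteΩ = finite-⊤ }

     Σℤ : (X → ℤ) → ℤ
     Σℤ f = ℤΣ.sum (λ i → f (Finite.enum finiteX i))

     Σℤ-cong : ∀ {f g : X → ℤ} → (∀ x → f x ≡ g x) → Σℤ f ≡ Σℤ g
     Σℤ-cong h = ℤΣ.sum-cong-≗ (λ i → h (Finite.enum finiteX i))

     Divisible : ℤ → Set
     Divisible z = ∃ λ c → z ≡ c Int.* Int.+ order

     Σℤ-pos : ∀ f → Σℤ (λ x → Int.+ f x) ≡ Int.+ ∑ finiteX f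
     Σℤ-pos f = go order (Finite.enum finiteX)
       where
       go : ∀ n (en : Fin n → X) → ℤΣ.sum (λ i → Int.+ f (en i)) ≡ Int.+ sum (λ i → f (en i))
       go zero    en = refl
       go (suc n) en = trans (cong₂ Int._+_ (refl {x = Int.+ f (en zero)}) (go n (en ∘ suc))) (sym (Int.pos-+ (f (en zero)) (sum (λ i → f (en (suc i))))))

     Σℤ-scale-minus : ∀ u (f g : X → ℤ) → Σℤ (λ x → u Int.* f x Int.- g x) ≡ u Int.* Σℤ f Int.- Σℤ g
     Σℤ-scale-minus u f g = go order (Finite.enum finiteX)
       where
       go : ∀ n (en : Fin n → X) → ℤΣ.sum (λ i → u Int.* f (en i) Int.- g (en i)) ≡ u Int.* ℤΣ.sum (λ i → f (en i)) Int.- ℤΣ.sum (λ i → g (en i))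
       go zero    en = sym (trans (cong (λ z → z Int.- Int.+ 0) (Int.*-zeroʳ u)) refl)
       go (suc n) en = trans (cong₂ Int._+_ (refl {x = u Int.* f (en zero) Int.- g (en zero)}) (go n (en ∘ suc))) (solve 5 (λ u a b c d → (u :* a :- b) :+ (u :* c :- d) := u :* (a :+ c) :- (b :+ d)) refl u a b c d)
         where
         open import Data.Integer.Solver using (module +-*-Solver)
         open +-*-Solver using (solve; _:=_; _:+_; _:*_; _:-_)
         a = f (en zero)
         b = g (en zero)
         c = ℤΣ.sum (λ i → f (en (suc i)))
         d = ℤΣ.sum (λ i → g (en (suc i)))

     factors : List ℕ → X → ℤ
     factors []       x = Int.+ 1
     factors (u ∷ us) x = (Int.+ u Int.- Int.+ π₀ x) Int.* factors us x

     -- Expanding one factor `u − π₀` gives `u` times the sum for `A` minus the sum for `Ω₀ ×ᴳ A`,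
     -- because permutation characters multiply. With no factor left, it is Burnside's lemma.
     mark : ∀ us (A : GSet G) → Divisible (Σℤ (λ x → Int.+ GSet.π A x Int.* factors us x))
     mark [] A = start (burnside A)
       where
       start : order ∣ ∑ finiteX (GSet.π A) → Divisible (Σℤ (λ x → Int.+ GSet.π A x Int.* factors [] x))
       start (divides c e) = Int.+ c , trans (Σℤ-cong {λ x → Int.+ GSet.π A x Int.* Int.+ 1} {λ x → Int.+ GSet.π A x} (λ x → Int.*-identityʳ (Int.+ GSet.π A x))) (trans (Σℤ-pos (GSet.π A)) (trans (cong Int.+_ e) (Int.pos-* c order)))
     mark (u ∷ us) A = combine (λ x → Int.+ GSet.π A x Int.* factors us x) (λ x → Int.+ GSet.π (Ω₀ ×ᴳ A) x Int.* factors us x) (mark us A) (mark us (Ω₀ ×ᴳ A))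
       (λ x → Int.+ GSet.π A x Int.* factors (u ∷ us) x) (λ x → rearrange (GSet.π A x) (π₀ x) (GSet.π (Ω₀ ×ᴳ A) x) (factors us x) (π-× Ω₀ A x))
       where
       open import Data.Integer.Solver using (module +-*-Solver)
       open +-*-Solver using (solve; _:=_; _:+_; _:*_; _:-_)
       combine : ∀ (f g : X → ℤ) → Divisible (Σℤ f) → Divisible (Σℤ g) → (h : X → ℤ) → (∀ x → h x ≡ Int.+ u Int.* f x Int.- g x) → Divisible (Σℤ h)
       combine f g (c , e) (c′ , e′) h eq = Int.+ u Int.* c Int.- c′ , trans (Σℤ-cong {h} {λ x → Int.+ u Int.* f x Int.- g x} eq) (trans (Σℤ-scale-minus (Int.+ u) f g) (trans (cong₂ (λ a b → Int.+ u Int.* a Int.- b) e e′)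
           (solve 4 (λ u c d g → u :* (c :* g) :- d :* g := (u :* c :- d) :* g) refl (Int.+ u) c c′ (Int.+ order))))
       rearrange : ∀ a b ba (t : ℤ) → ba ≡ b * a → Int.+ a Int.* ((Int.+ u Int.- Int.+ b) Int.* t) ≡ Int.+ u Int.* (Int.+ a Int.* t) Int.- Int.+ ba Int.* t
       rearrange a b ba t e = trans (solve 4 (λ a u b t → a :* ((u :- b) :* t) := u :* (a :* t) :- (b :* a) :* t) refl (Int.+ a) (Int.+ u) (Int.+ b) t)
         (cong (λ z → Int.+ u Int.* (Int.+ a Int.* t) Int.- z Int.* t) (trans (sym (Int.pos-* b a)) (cong Int.+_ (sym e))))

     -- the values of π₀ on the p-elements; other elements contribute a harmless factor 1
     valueAt : ∀ x → Dec (PEl x) → ℕ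
     valueAt x (yes _) = π₀ x
     valueAt x (no  _) = 1

     values : List ℕ
     values = List.tabulate (λ i → valueAt (Finite.enum finiteX i) (pel? (Finite.enum finiteX i)))

     product : List ℕ → ℕ
     product []       = 1
     product (u ∷ us) = u * product us

     product-unit : ∀ {n} (f : Fin n → ℕ) → (∀ i → ¬ (p ∣ f i)) → ¬ (p ∣ product (List.tabulate f))
     product-unit {zero}  f h = p∤1 pr
     product-unit {suc n} f h = p∤* pr (h zero) (product-unit (f ∘ suc) (h ∘ suc))

     U : ℕ
     U = product values

     U-unit : ¬ (p ∣ U)
     U-unit = product-unit _ (λ i → lem (Finite.enum finiteX i) (pel? (Finite.enum finiteX i)))
       where
       lem : ∀ x (d : Dec (PEl x)) → ¬ (p ∣ valueAt x d)
       lem x (yes h) = π₀-unit x h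
       lem x (no _)  = p∤1 pr

     factors-off : ∀ us x → π₀ x ≡ 0 → factors us x ≡ Int.+ product us
     factors-off []       x h = refl
     factors-off (u ∷ us) x h = trans (cong₂ (λ a b → (Int.+ u Int.- Int.+ a) Int.* b) h (factors-off us x h))
       (trans (cong (Int._* Int.+ product us) (Int.+-identityʳ (Int.+ u))) (sym (Int.pos-* u (product us))))

     factors-on : ∀ us x → π₀ x ∈ us → factors us x ≡ Int.+ 0
     factors-on (u ∷ us) x (here e)  = trans (cong (Int._* factors us x) (trans (cong (λ z → Int.+ u Int.- Int.+ z) e) (Int.+-inverseʳ (Int.+ u)))) (Int.*-zeroˡ (factors us x))
     factors-on (u ∷ us) x (there m) = trans (cong ((Int.+ u Int.- Int.+ π₀ x) Int.*_) (factors-on us x m)) (Int.*-zeroʳ (Int.+ u Int.- Int.+ π₀ x))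

     value∈ : ∀ x → PEl x → π₀ x ∈ values
     value∈ x h = subst (_∈ values) (trans (cong (λ z → valueAt z (pel? z)) (Finite.enum-idx finiteX x)) (lem (pel? x)))
       (∈-tabulate⁺ (Finite.idx finiteX x))
       where
       lem : (d : Dec (PEl x)) → valueAt x d ≡ π₀ x
       lem (yes _) = refl
       lem (no n)  = ⊥-elim (n h)

     not : ∀ {P : Set} → Dec P → Dec (¬ P)
     not (yes q) = no (λ nq → nq q)
     not (no nq) = yes nq

   PElements : Set
   PElements = Σ X (λ x → power x (p ^ N) ≡ ε)

   finite-PElements : Finite PElements
   finite-PElements = finite-sub finiteX (λ _ → uip) pel?

   private
     finite-Others : Finite (Σ X (λ x → ¬ PEl x))
     finite-Others = finite-sub finiteX (λ _ → ¬-prop) (λ x → not (pel? x))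

     total : Σℤ (λ x → Int.+ 1 Int.* factors values x) ≡ Int.+ (card finite-Others * U)
     total = trans (Σℤ-cong (λ x → trans (Int.*-identityˡ _) (each x (pel? x)))) (trans (Σℤ-pos (λ x → card (finite-Dec ¬-prop (not (pel? x))) * U))
       (cong Int.+_ (go order (λ i → card (finite-Dec ¬-prop (not (pel? (Finite.enum finiteX i))))))))
       where
       each : ∀ x (d : Dec (PEl x)) → factors values x ≡ Int.+ (card (finite-Dec ¬-prop (not d)) * U)
       each x (yes h) = factors-on values x (value∈ x h)
       each x (no nh) = trans (factors-off values x (π₀-zero x nh)) (cong Int.+_ (sym (Nat.+-identityʳ U)))
       go : ∀ n (f : Fin n → ℕ) → sum (λ i → f i * U) ≡ sum f * U
       go zero    f = refl
       go (suc n) f = trans (cong (f zero * U +_) (go n (f ∘ suc))) (sym (Nat.*-distribʳ-+ U (f zero) _))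

     order∣ : order ∣ card finite-Others * U
     order∣ = conclude (mark values point)
       where
       point-fixed : ∀ x → GSet.π point x ≡ 1
       point-fixed x = card-cong (GSet.finite-Fix point x) finite-⊤ (mk↔ₛ′ (λ _ → tt) (λ _ → tt , refl) (λ _ → refl) (λ { (tt , refl) → refl }))
       conclude : Divisible (Σℤ (λ x → Int.+ GSet.π point x Int.* factors values x)) → order ∣ card finite-Others * U
       conclude (c , e) = divides Int.∣ c ∣ (trans (cong Int.∣_∣ (trans (sym total) (trans (Σℤ-cong {λ x → Int.+ 1 Int.* factors values x} {λ x → Int.+ GSet.π point x Int.* factors values x}
         (λ x → cong (λ z → Int.+ z Int.* factors values x) (sym (point-fixed x)))) e))) (Int.abs-* c (Int.+ order)))

   -- The group order divides `U` times the number of the other elements, with `U` prime to `p`.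
   -- Hence `p^s` divides that number, and therefore also its complement.
   frobenius : p ^ s ∣ card finite-PElements
   frobenius = ∣m+n∣m⇒∣n (subst (p ^ s ∣_) (trans (card-complement finiteX (λ _ → uip) pel? finite-PElements finite-Others) (Nat.+-comm (card finite-PElements) _)) ps∣order)
     (pow∣-unit pr U-unit s (card finite-Others) (∣-trans ps∣order order∣))
     where
     ps∣order : p ^ s ∣ order
     ps∣order = subst (p ^ s ∣_) (sym order≡) (m∣m*n m)

-- Integrality for cyclic p-groups

module PElements where
 open import Defs using (FiniteField; module Matrices; module HomCount; groupElems; groupMul)
 open Counting
 open Rings
 open GroupAlg using (AbGroup)
 open GL
 open Groups
 open Reps
 open Types using (card-GL)
 open Degrees using (powers-nonZero)
 open Burnside
 open Rat
 open MainCount using (gl-pos)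
 open Valuation
 open Nat using (_^_; _%_)
 open import Data.Nat.DivMod using (_/_)

 module _ (G : Group) where
   open Group G

   power-% : ∀ x o .{{_ : NonZero o}} → power x o ≡ ε → ∀ k → power x (k % o) ≡ power x k
   power-% x o h k = sym (trans (cong (power x) (m≡m%n+[m/n]*n k o)) (trans (power-+ x (k % o) ((k / o) Nat.* o))
     (trans (cong (power x (k % o) ∙_) (power-* x o (k / o) h)) (identityʳ (power x (k % o))))))

   power-mod : ∀ x o .{{_ : NonZero o}} → power x o ≡ ε → ∀ a b → power x ((a Nat.+ b) % o) ≡ power x a ∙ power x b
   power-mod x o h a b = trans (power-% x o h (a Nat.+ b)) (power-+ x a b)

   power-1 : ∀ x o .{{_ : NonZero o}} → power x o ≡ ε → power x (1 % o) ≡ x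
   power-1 x o h = trans (power-% x o h 1) (identityʳ x)

 module _ (K : FiniteField) where
   open Matrices K
   open LinearMaps K
   open GLn K

   invertible : ∀ {n} (P : GL n) → IsInvertible (proj₁ P)
   invertible (A , t) = toWitness t

   sandwich : ∀ {n} (A B B′ A′ : Mat n) → B · B′ ≡ idM → A · A′ ≡ idM → (A · B) · (B′ · A′) ≡ idM
   sandwich A B B′ A′ b a = trans (·-assocM A B (B′ · A′)) (trans (cong (A ·_) (trans (sym (·-assocM B B′ A′)) (trans (cong (_· A′) b) (·-idˡ A′)))) a)

   abstract
     invGL′ : ∀ {n} → GL n → GL n
     invGL′ P = mkGL (invGL P) (proj₁ P) (invGLˡ P) (invGLʳ P)

     mulGL : ∀ {n} → GL n → GL n → GL n
     mulGL P Q = mkGL (proj₁ P · proj₁ Q) (invGL Q · invGL P) (sandwich (proj₁ P) (proj₁ Q) (invGL Q) (invGL P) (invGLʳ Q) (invGLʳ P))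
       (sandwich (invGL Q) (invGL P) (proj₁ P) (proj₁ Q) (invGLˡ P) (invGLˡ Q))

     idGL : ∀ {n} → GL n
     idGL = mkGL idM idM (·-idˡ idM) (·-idˡ idM)

     proj-mul : ∀ {n} (P Q : GL n) → proj₁ (mulGL P Q) ≡ proj₁ P · proj₁ Q
     proj-mul P Q = refl

     proj-id : ∀ {n} → proj₁ (idGL {n}) ≡ idM
     proj-id = refl

     assocGL : ∀ {n} (P Q R : GL n) → mulGL (mulGL P Q) R ≡ mulGL P (mulGL Q R)
     assocGL P Q R = GL-≡ (·-assocM (proj₁ P) (proj₁ Q) (proj₁ R))

     identityˡGL : ∀ {n} (P : GL n) → mulGL idGL P ≡ P
     identityˡGL P = GL-≡ (·-idˡ (proj₁ P))

     identityʳGL : ∀ {n} (P : GL n) → mulGL P idGL ≡ P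
     identityʳGL P = GL-≡ (·-idʳ (proj₁ P))

     inverseˡGL : ∀ {n} (P : GL n) → mulGL (invGL′ P) P ≡ idGL
     inverseˡGL P = GL-≡ (invGLˡ P)

     inverseʳGL : ∀ {n} (P : GL n) → mulGL P (invGL′ P) ≡ idGL
     inverseʳGL P = GL-≡ (invGLʳ P)

   generalLinear : ℕ → Group
   generalLinear n = record
     { X = GL n ; _∙_ = mulGL ; ε = idGL ; _⁻¹ = invGL′
     ; assoc = assocGL ; identityˡ = identityˡGL ; identityʳ = identityʳGL ; inverseˡ = inverseˡGL ; inverseʳ = inverseʳGL
     ; finiteX = finite-GL n }

   module _ {p : ℕ} (pr : Prime p) (N n : ℕ) where
     private
       instance
         p≢0 : NonZero p
         p≢0 = prime⇒nonZero pr
         o≢0 : NonZero (p ^ N)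
         o≢0 = Nat.m^n≢0 p N
       o = p ^ N
       ms = List.map (p ^_) (N ∷ [])
       nz = powers-nonZero p (N ∷ [])
       module L = FromList ms nz
       open Homs K ms nz
       open Group (generalLinear n)

       groupMul-% : ∀ o .{{_ : NonZero o}} a b → groupMul (o ∷ []) (a ∷ []) (b ∷ []) ≡ ((a Nat.+ b) % o) ∷ []
       groupMul-% (suc o) a b = refl

       nsmul-% : ∀ o .{{_ : NonZero o}} k a → nsmul (o ∷ []) k (a ∷ []) ≡ ((k Nat.* a) % o) ∷ []
       nsmul-% (suc o) k a = refl

       abstract
         value : Fin L.N → ℕ
         value i = head₀ (L.el i)

         el-value : ∀ i → L.el i ≡ value i ∷ []
         el-value i = valid-head (L.el-valid i)

         value-∙ : ∀ i j → value (i L.∙ j) ≡ (value i Nat.+ value j) % o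
         value-∙ i j = cong head₀ (trans (L.el-∙ i j) (trans (cong₂ (groupMul ms) (el-value i) (el-value j)) (groupMul-% o (value i) (value j))))

         -- `1 % o` rather than `1`: for `N = 0` the group is trivial and its only residue is `0`.
         generator-valid : Valid ms (1 % o ∷ [])
         generator-valid = m%n<n 1 o ∷ []

         generator : Fin L.N
         generator = L.ix generator-valid

         value-generator : value generator ≡ 1 % o
         value-generator = cong head₀ (L.el-ix generator-valid)

         generates : ∀ i → L.pow generator (value i) ≡ i
         generates i = L.el-injective (trans (L.el-pow generator (value i)) (trans (cong (nsmul ms (value i)) (L.el-ix generator-valid))
           (trans (nsmul-% o (value i) (1 % o)) (trans (cong (_∷ []) (trans (%-distribˡ-* (value i) (1 % o) o) (trans (cong (λ z → (value i % o Nat.* z) % o) (m%n%n≡m%n 1 o))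
             (trans (sym (%-distribˡ-* (value i) 1 o)) (trans (cong (_% o) (Nat.*-identityʳ (value i))) (m<n⇒m%n≡m (valid-head< (L.el-valid i)))))))) (sym (el-value i))))))

       rep-1 : ∀ (ρ : Rep n) → ρ ⟪ L.ε ⟫ ≡ idM
       rep-1 ρ = apply-injective (λ v → trans (rep-ε ρ v) (sym (apply-id v)))

       image : Rep n → GL n
       image ρ = ρ ⟪ generator ⟫ , fromWitness (rep-inv ρ generator)

       image-power : ∀ ρ k → proj₁ (power (image ρ) k) ≡ ρ ⟪ L.pow generator k ⟫
       image-power ρ zero    = trans proj-id (sym (rep-1 ρ))
       image-power ρ (suc k) = trans (proj-mul (image ρ) (power (image ρ) k)) (trans (cong (ρ ⟪ generator ⟫ ·_) (image-power ρ k)) (sym (rep-∙ ρ generator (L.pow generator k))))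

       image-torsion : ∀ ρ → power (image ρ) o ≡ ε
       image-torsion ρ = GL-≡ (trans (image-power ρ o) (trans (cong (ρ ⟪_⟫) (L.pow-ε o (∣-refl ∷ []) generator)) (trans (rep-1 ρ) (sym proj-id))))

       torsion-hom : (P : GL n) → power P o ≡ ε → ∀ i j → proj₁ (power P (value (i L.∙ j))) ≡ proj₁ (power P (value i)) · proj₁ (power P (value j))
       torsion-hom P h i j = trans (cong (λ k → proj₁ (power P k)) (value-∙ i j)) (trans (cong proj₁ (power-mod (generalLinear n) P o h (value i) (value j)))
         (proj-mul (power P (value i)) (power P (value j))))

       representation : (P : GL n) → power P o ≡ ε → Rep n
       representation P h = mkRep (λ i → proj₁ (power P (value i))) (λ i → invertible (power P (value i))) (torsion-hom P h)

       representation-at : ∀ P h i → representation P h ⟪ i ⟫ ≡ proj₁ (power P (value i))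
       representation-at P h i = mkRep-at (λ i → proj₁ (power P (value i))) (λ i → invertible (power P (value i))) (torsion-hom P h) i

       repPElements : Rep n ↔ Σ (GL n) (λ P → power P o ≡ ε)
       repPElements = mk↔ₛ′ (λ ρ → image ρ , image-torsion ρ)
         (λ (P , h) → representation P h)
         (λ (P , h) → Σ-prop-≡ (λ _ → uip) (GL-≡ (trans (representation-at P h generator)
           (cong proj₁ (trans (cong (power P) value-generator) (power-1 (generalLinear n) P o h))))))
         (λ ρ → rep-≡ (λ i → trans (representation-at (image ρ) (image-torsion ρ) i) (trans (image-power ρ (value i)) (cong (ρ ⟪_⟫) (generates i)))))

     pow∣numHom : ∀ s m → ¬ (p ∣ m) → gl (FiniteField.size K) n ≡ p ^ s Nat.* m → s ≤ N → p ^ s ∣ HomCount.numHom K ms n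
     pow∣numHom s m nm e s≤N = subst (p ^ s ∣_) (sym (trans (card-Rep n) (card-cong (finite-Rep n) F.finite-PElements repPElements))) F.frobenius
       where module F = Frobenius pr (generalLinear n) s m nm (trans (card-GL K n) e) N s≤N

     open PIntegral pr

     -- By Frobenius' theorem, the number of p^N-torsion elements is divisible by the p-part of the group order.
     cyclic-integral : (val : Val pr (gl (FiniteField.size K) n)) → Val.v val ≤ N →
                       Den 0 (# (HomCount.numHom K ms n) * recip (gl (FiniteField.size K) n))
     cyclic-integral (mkVal s m nm e) s≤N = go (pow∣numHom s m nm e s≤N)
       where
       q = FiniteField.size K
       instance
         g≢0 : NonZero (gl q n)
         g≢0 = Nat.>-nonZero (gl-pos q size≥2 n)
       go : p ^ s ∣ HomCount.numHom K ms n → Den 0 (# (HomCount.numHom K ms n) * recip (gl q n))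
       go (divides c h) = den-cancel-unit {0} m nm (subst (Den 0) (sym eq) (den-ℤ (Data.Integer.+ c)))
         where
         import Data.Integer
         open ≡-Reasoning
         eq : # m * (# (HomCount.numHom K ms n) * recip (gl q n)) ≡ # c
         eq = begin
           # m * (# (HomCount.numHom K ms n) * recip (gl q n)) ≡⟨ cong (λ z → # m * (z * recip (gl q n))) (trans (cong # h) (#-* c (p ^ s))) ⟩
           # m * (# c * # (p ^ s) * recip (gl q n)) ≡⟨ solve 4 (λ m c p g → m :* (c :* p :* g) := c :* (p :* m :* g)) refl (# m) (# c) (# (p ^ s)) (recip (gl q n)) ⟩
           # c * (# (p ^ s) * # m * recip (gl q n)) ≡⟨ cong (λ z → # c * (z * recip (gl q n))) (trans (sym (#-* (p ^ s) m)) (cong # (sym e))) ⟩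
           # c * (# (gl q n) * recip (gl q n)) ≡⟨ trans (cong (# c *_) (recip-inverse (gl q n))) (Fₚ.*-identityʳ (# c)) ⟩
           # c ∎

-- The tower of fields and Abel summation of logarithmic derivatives

module Levels where
 open import Defs using (FiniteField; module HomCount)
 open GL using (gl; module GLn)
 open Groups using (pow∣pow)
 open Degrees using (divisor-of-power; coprime∣pow; p∤⇒coprime)
 open Rat
 open Series
 open SeriesBounds
 open MainCount
 open Valuation
 open Nat using (_^_; _%_)
 open import Algebra.Properties.CommutativeMonoid.Sum Nat.+-0-commutativeMonoid using (sum; sum-cong-≗)

 pow-minus-one : ∀ Q → 0 < Q → ∀ a b → Q ^ (a Nat.+ b) ∸ 1 ≡ Q ^ a Nat.* (Q ^ b ∸ 1) Nat.+ (Q ^ a ∸ 1)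
 pow-minus-one Q Q>0 a b = trans (cong (_∸ 1) (Nat.^-distribˡ-+-* Q a b)) (go (Q ^ a) (Q ^ b) (pos a) (pos b))
   where
   pos : ∀ a → 0 < Q ^ a
   pos a = Nat.m^n>0 Q {{Nat.>-nonZero Q>0}} a
   go : ∀ x y → 0 < x → 0 < y → x Nat.* y ∸ 1 ≡ x Nat.* (y ∸ 1) Nat.+ (x ∸ 1)
   go (suc x) (suc y) _ _ = trans (Nat.+-comm y (x Nat.* suc y)) (trans (cong (Nat._+ y) (Nat.*-suc x y))
     (trans (Nat.+-assoc x (x Nat.* y) y) (trans (Nat.+-comm x _) (cong (Nat._+ x) (Nat.+-comm (x Nat.* y) y)))))

 ∣pow-multiple : ∀ {M} Q → 0 < Q → ∀ D → M ∣ Q ^ D ∸ 1 → ∀ c → M ∣ Q ^ (c Nat.* D) ∸ 1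
 ∣pow-multiple Q Q>0 D h zero    = _ ∣0
 ∣pow-multiple {M} Q Q>0 D h (suc c) = subst (M ∣_) (sym (pow-minus-one Q Q>0 D (c Nat.* D)))
   (Data.Nat.Divisibility.∣m∣n⇒∣m+n (∣n⇒∣m*n (Q ^ D) (∣pow-multiple Q Q>0 D h c)) h)
   where import Data.Nat.Divisibility

 -- A nonzero remainder of `x` modulo `D` would be a smaller admissible exponent.
 minimal⇒∣ : ∀ {M} Q → 0 < Q → ∀ D → 0 < D → M ∣ Q ^ D ∸ 1 → (∀ m → 0 < m → M ∣ Q ^ m ∸ 1 → D ≤ m) →
             ∀ x → M ∣ Q ^ x ∸ 1 → D ∣ x
 minimal⇒∣ {M} Q Q>0 D D>0 h min x hx = go (x % D) refl
   where
   instance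
     D≢0 : NonZero D
     D≢0 = Nat.>-nonZero D>0
   c = x DivMod./ D
   split : x ≡ x % D Nat.+ c Nat.* D
   split = m≡m%n+[m/n]*n x D
   go : ∀ r → x % D ≡ r → D ∣ x
   go zero    e = divides c (trans split (cong (Nat._+ c Nat.* D) e))
   go (suc r) e = ⊥-elim (Nat.<⇒≱ (subst (_< D) e (m%n<n x D)) (min (suc r) (s≤s z≤n)
     (∣m+n∣m⇒∣n (subst (M ∣_) (trans (cong (λ z → Q ^ z ∸ 1) (trans split (cong (Nat._+ c Nat.* D) e))) (pow-minus-one Q Q>0 (suc r) (c Nat.* D))) hx)
       (∣n⇒∣m*n (Q ^ suc r) (∣pow-multiple Q Q>0 D h c)))))

 divisors-of-power : ∀ {p} → Prime p → ∀ b g → g ∣ p ^ b → ∃ λ j → g ≡ p ^ j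
 divisors-of-power pr zero    g h = 0 , ∣1⇒≡1 h
 divisors-of-power pr (suc b) g h with divisor-of-power pr b g h
 ... | inj₁ e = suc b , e
 ... | inj₂ h′ = divisors-of-power pr b g h′

 sumTo : ℕ → (ℕ → F) → F
 sumTo zero    f = 0F
 sumTo (suc I) f = sumTo I f + f I

 sumFin : ∀ {k} → (Fin k → F) → F
 sumFin {zero}  f = 0F
 sumFin {suc k} f = f zero + sumFin (f ∘ suc)

 sumFin-cong : ∀ {k} {f g : Fin k → F} → (∀ i → f i ≡ g i) → sumFin f ≡ sumFin g
 sumFin-cong {zero}  h = refl
 sumFin-cong {suc k} h = cong₂ _+_ (h zero) (sumFin-cong (h ∘ suc))

 sumFin-scale : ∀ {k} c (f : Fin k → F) → sumFin (λ i → c * f i) ≡ c * sumFin f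
 sumFin-scale {zero}  c f = sym (Fₚ.zeroʳ c)
 sumFin-scale {suc k} c f = trans (cong₂ _+_ refl (sumFin-scale c (f ∘ suc))) (sym (Fₚ.distribˡ c (f zero) _))

 sumTo-cong : ∀ I {f g : ℕ → F} → (∀ b → b < I → f b ≡ g b) → sumTo I f ≡ sumTo I g
 sumTo-cong zero    h = refl
 sumTo-cong (suc I) h = cong₂ _+_ (sumTo-cong I (λ b lt → h b (Nat.m≤n⇒m≤1+n lt))) (h I Nat.≤-refl)

 module Abel (x : ℕ → F) where

   -- This is `∑_(b ≤ I) (P b − P (b − 1)) x b`, with `P (−1) = 0`, after summation by parts: a sum
   -- over levels expressed through the accumulated weights `P`.
   abelSum : ℕ → (ℕ → ℕ) → F
   abelSum I P = # (P I) * x I + sumTo I (λ b → # (P b) * (x b + - x (suc b)))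

   abel-cong : ∀ I {P P′ : ℕ → ℕ} → (∀ b → b ≤ I → P b ≡ P′ b) → abelSum I P ≡ abelSum I P′
   abel-cong I h = cong₂ _+_ (cong (λ z → # z * x I) (h I Nat.≤-refl)) (sumTo-cong I (λ b lt → cong (λ z → # z * (x b + - x (suc b))) (h b (Nat.<⇒≤ lt))))

   private
     #0* : ∀ y → # 0 * y ≡ 0F
     #0* y = trans (cong (_* y) ⟦⟧-0) (Fₚ.zeroˡ y)

   abel-+ : ∀ I P P′ → abelSum I (λ b → P b Nat.+ P′ b) ≡ abelSum I P + abelSum I P′
   abel-+ I P P′ = trans (cong₂ _+_ (cong (_* x I) (#-+ (P I) (P′ I))) (go I))
     (solve 5 (λ a b c d e → (a :+ b) :* c :+ (d :+ e) := a :* c :+ d :+ (b :* c :+ e)) refl (# (P I)) (# (P′ I)) (x I)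
       (sumTo I (λ b → # (P b) * (x b + - x (suc b)))) (sumTo I (λ b → # (P′ b) * (x b + - x (suc b)))))
     where
     go : ∀ I → sumTo I (λ b → # (P b Nat.+ P′ b) * (x b + - x (suc b))) ≡
                sumTo I (λ b → # (P b) * (x b + - x (suc b))) + sumTo I (λ b → # (P′ b) * (x b + - x (suc b)))
     go zero    = sym (Fₚ.+-identityˡ 0F)
     go (suc I) = trans (cong₂ _+_ (go I) (cong (_* (x I + - x (suc I))) (#-+ (P I) (P′ I))))
       (solve 5 (λ d e a b c → d :+ e :+ (a :+ b) :* c := (d :+ a :* c) :+ (e :+ b :* c)) refl
         (sumTo I (λ b → # (P b) * (x b + - x (suc b)))) (sumTo I (λ b → # (P′ b) * (x b + - x (suc b)))) (# (P I)) (# (P′ I)) (x I + - x (suc I)))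

   pick-yes : ∀ {A : Set} (dec : Dec A) D → A → pick dec D ≡ D
   pick-yes (yes _) D a = refl
   pick-yes (no n)  D a = ⊥-elim (n a)

   pick-no : ∀ {A : Set} (dec : Dec A) D → ¬ A → pick dec D ≡ 0
   pick-no (yes a) D n = ⊥-elim (n a)
   pick-no (no _)  D n = refl

   abel-below : ∀ e D I → I < e → abelSum I (λ b → pick (e Nat.≤? b) D) ≡ 0F
   abel-below e D I lt = trans (abel-cong I {λ b → pick (e Nat.≤? b) D} {λ _ → 0} (λ b le → pick-no (e Nat.≤? b) D (Nat.<⇒≱ (Nat.≤-<-trans le lt))))
     (trans (cong₂ _+_ (#0* (x I)) (go I)) (Fₚ.+-identityˡ 0F))
     where
     go : ∀ I → sumTo I (λ b → # 0 * (x b + - x (suc b))) ≡ 0F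
     go zero    = refl
     go (suc I) = trans (cong₂ _+_ (go I) (#0* _)) (Fₚ.+-identityˡ 0F)

   abel-single : ∀ e D I → e ≤ I → abelSum I (λ b → pick (e Nat.≤? b) D) ≡ # D * x e
   abel-single e D I le = step I (Nat.m≤n⇒m<n∨m≡n le)
     where
     P : ℕ → ℕ
     P b = pick (e Nat.≤? b) D
     S : ℕ → F
     S I = sumTo I (λ b → # (P b) * (x b + - x (suc b)))
     P-at : ∀ b → e ≤ b → P b ≡ D
     P-at b le = pick-yes (e Nat.≤? b) D le
     step : ∀ I → e < I ⊎ e ≡ I → abelSum I P ≡ # D * x e
     step zero    (inj₂ refl) = trans (Fₚ.+-identityʳ _) (cong (λ z → # z * x 0) (P-at 0 z≤n))
     step (suc I) (inj₂ refl) = trans (cong₂ _+_ (cong (λ z → # z * x (suc I)) (P-at (suc I) Nat.≤-refl)) tail) (Fₚ.+-identityʳ _)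
       where
       PI : P I ≡ 0
       PI = pick-no (suc I Nat.≤? I) D Nat.1+n≰n
       tail : S (suc I) ≡ 0F
       tail = trans (cong₂ _+_ (trans (sym (trans (cong (_+ S I) (trans (cong (λ z → # z * x I) PI) (#0* (x I)))) (Fₚ.+-identityˡ (S I)))) (abel-below (suc I) D I Nat.≤-refl))
         (trans (cong (λ z → # z * (x I + - x (suc I))) PI) (#0* _))) (Fₚ.+-identityˡ 0F)
     step (suc I) (inj₁ (s≤s lt)) = trans (cong₂ (λ a b → # a * x (suc I) + (S I + # b * (x I + - x (suc I)))) (P-at (suc I) (Nat.m≤n⇒m≤1+n lt)) (P-at I lt))
       (trans (collapse (# D) (x (suc I)) (S I) (x I)) (trans (cong (λ z → # z * x I + S I) (sym (P-at I lt))) (step I (Nat.m≤n⇒m<n∨m≡n lt))))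
       where
       collapse : ∀ d y s z → d * y + (s + d * (z + - y)) ≡ d * z + s
       collapse d y s z = trans (solve 5 (λ d y s z w → d :* y :+ (s :+ d :* (z :+ w)) := d :* z :+ s :+ d :* (y :+ w)) refl d y s z (- y))
         (trans (cong (λ t → d * z + s + d * t) (Fₚ.-‿inverseʳ y)) (trans (cong (d * z + s +_) (Fₚ.zeroʳ d)) (Fₚ.+-identityʳ _)))

   -- Each index contributes to the accumulated weights a step of height `D i` at `e i`, on which
   -- `abelSum` is evaluated by `abel-single`.
   abel : ∀ I {k} (e : Fin k → ℕ) (D : Fin k → ℕ) → (∀ i → e i ≤ I) →
          sumFin (λ i → # (D i) * x (e i)) ≡ abelSum I (λ b → sum (λ i → pick (e i Nat.≤? b) (D i)))
   abel I {zero}  e D h = sym (trans (abel-cong I {λ _ → 0} {λ b → pick (suc I Nat.≤? b) 0} (λ b le → sym (pick-no (suc I Nat.≤? b) 0 (Nat.<⇒≱ (s≤s le))))) (abel-below (suc I) 0 I Nat.≤-refl))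
   abel I {suc k} e D h = trans (cong₂ _+_ (sym (abel-single (e zero) (D zero) I (h zero))) (abel I (e ∘ suc) (D ∘ suc) (h ∘ suc)))
     (sym (abel-+ I (λ b → pick (e zero Nat.≤? b) (D zero)) (λ b → sum (λ i → pick (e (suc i) Nat.≤? b) (D (suc i))))))

 spread-spread : ∀ {m m′ m″} → suc m″ ≡ suc m Nat.* suc m′ → ∀ f n → spread m (spread m′ f) n ≡ spread m″ f n
 spread-spread {m} {m′} {m″} h f n = go (cnt-cases m″ 0 n f)
   where
   assoc : ∀ k → suc m″ Nat.* k ≡ suc m Nat.* (suc m′ Nat.* k)
   assoc k = trans (cong (Nat._* k) h) (Nat.*-assoc (suc m) (suc m′) k)
   at : ∀ k → n ≡ suc m″ Nat.* k → spread m (spread m′ f) n ≡ f k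
   at k e = trans (cong (spread m (spread m′ f)) (trans e (assoc k))) (trans (cnt-at m 0 (suc m′ Nat.* k) (spread m′ f)) (cnt-at m′ 0 k f))
   inner : spread m″ f n ≡ 0F → ∀ k → n ≡ suc m Nat.* k → spread m′ f k ≡ 0F ⊎ (∃ λ k′ → k ≡ suc m′ Nat.* k′ × spread m′ f k ≡ f k′) → spread m′ f k ≡ 0F
   inner z k e (inj₁ z′) = z′
   inner z k e (inj₂ (k′ , e′ , h′)) = trans h′ (trans (sym (trans (cong (spread m″ f) (trans e (trans (cong (suc m Nat.*_) e′) (sym (assoc k′))))) (cnt-at m″ 0 k′ f))) z)
   outer : spread m″ f n ≡ 0F → spread m (spread m′ f) n ≡ 0F ⊎ (∃ λ k → n ≡ suc m Nat.* k × spread m (spread m′ f) n ≡ spread m′ f k) → spread m (spread m′ f) n ≡ 0F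
   outer z (inj₁ z′) = z′
   outer z (inj₂ (k , e , h′)) = trans h′ (inner z k e (cnt-cases m′ 0 k f))
   go : spread m″ f n ≡ 0F ⊎ (∃ λ k → n ≡ suc m″ Nat.* k × spread m″ f n ≡ f k) → spread m (spread m′ f) n ≡ spread m″ f n
   go (inj₁ z) = trans (outer z (cnt-cases m 0 n (spread m′ f))) (sym z)
   go (inj₂ (k , e , h′)) = trans (at k e) (sym h′)

 lder-≗ : ∀ {N f g ℓ} → (∀ n → f n ≡ g n) → LDer N f ℓ → LDer N g ℓ
 lder-≗ {N} {f} {g} {ℓ} h d n le = trans (cong (# n *_) (sym (h n))) (trans (d n le) (⋆-cong {ℓ} {ℓ} (λ _ → refl) h n))

 lder-prodSer : ∀ {N k} (f ℓ : Fin k → Series) → (∀ i → LDer N (f i) (ℓ i)) → LDer N (prodSer f) (λ n → sumFin (λ i → ℓ i n))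
 lder-prodSer {k = zero}  f ℓ h = lder-one
 lder-prodSer {k = suc k} f ℓ h = lder-⋆ (h zero) (lder-prodSer (f ∘ suc) (ℓ ∘ suc) (h ∘ suc))

 prodSer-0 : ∀ {k} (f : Fin k → Series) → (∀ i → f i 0 ≡ 1F) → prodSer f 0 ≡ 1F
 prodSer-0 {zero}  f h = refl
 prodSer-0 {suc k} f h = trans (cong₂ _*_ (h zero) (prodSer-0 (f ∘ suc) (h ∘ suc))) (Fₚ.*-identityˡ 1F)

 spread-sumFin : ∀ m {k} (ℓ : Fin k → Series) n → spread m (λ n → sumFin (λ i → ℓ i n)) n ≡ sumFin (λ i → spread m (ℓ i) n)
 spread-sumFin m {zero}  ℓ n = go (cnt-cases m 0 n (λ _ → 0F))
   where
   go : spread m (λ _ → 0F) n ≡ 0F ⊎ (∃ λ k → n ≡ suc m Nat.* k × spread m (λ _ → 0F) n ≡ 0F) → spread m (λ _ → 0F) n ≡ 0F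
   go (inj₁ z) = z
   go (inj₂ (_ , _ , z)) = z
 spread-sumFin m {suc k} ℓ n = trans (cnt-⊞ m 0 n (ℓ zero) (λ n → sumFin (λ i → ℓ (suc i) n))) (cong₂ _+_ refl (spread-sumFin m (ℓ ∘ suc) n))

 E-0 : ∀ Q → E Q 0 ≡ 1F
 E-0 Q = trans (sym (trans (cong (_* recip 1) ⟦⟧-1) (Fₚ.*-identityˡ _))) (recip-inverse 1)

 module Level {p : ℕ} (pr : Prime p) (q : ℕ) (q≥2 : 2 ≤ q) (d : ℕ) (d>0 : 0 < d)
   (order∣ : p ∣ q ^ d ∸ 1) (order-min : ∀ m → 0 < m → p ∣ q ^ m ∸ 1 → d ≤ m)
   (lam : ℕ → ℕ) (lam∣ : ∀ i → p ^ lam i ∣ q ^ (d Nat.* p ^ i) ∸ 1) (lam-max : ∀ i a → p ^ a ∣ q ^ (d Nat.* p ^ i) ∸ 1 → a ≤ lam i) where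

   private
     instance
       p≢0 : NonZero p
       p≢0 = prime⇒nonZero pr
       d≢0 : NonZero d
       d≢0 = Nat.>-nonZero d>0

     q>0 : 0 < q
     q>0 = Nat.≤-trans (s≤s z≤n) q≥2

   -- Level 0 is the base field (index −1 in the limit formula), level i + 1 the degree d p^i.
   m : ℕ → ℕ
   m zero    = 1
   m (suc i) = d Nat.* p ^ i

   Λ : ℕ → ℕ
   Λ zero    = 0
   Λ (suc i) = lam i

   m>0 : ∀ e → 0 < m e
   m>0 zero    = s≤s z≤n
   m>0 (suc i) = Nat.*-mono-≤ d>0 (Nat.m^n>0 p i)

   -- The relative degree `m b / m e` of the fields of levels `e ≤ b`.
   ratio : ℕ → ℕ → ℕ
   ratio zero    b       = m b
   ratio (suc i) zero    = 0
   ratio (suc i) (suc j) = p ^ (j ∸ i)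

   ratio-m : ∀ e b → e ≤ b → m e Nat.* ratio e b ≡ m b
   ratio-m zero    b       _        = Nat.+-identityʳ (m b)
   ratio-m (suc i) (suc j) (s≤s le) = trans (Nat.*-assoc d (p ^ i) (p ^ (j ∸ i))) (cong (d Nat.*_) (trans (sym (Nat.^-distribˡ-+-* p i (j ∸ i))) (cong (p ^_) (Nat.m+[n∸m]≡n le))))

   ratio>0 : ∀ e b → e ≤ b → 0 < ratio e b
   ratio>0 zero    b       _ = m>0 b
   ratio>0 (suc i) (suc j) _ = Nat.m^n>0 p (j ∸ i)

   Λ∣ : ∀ e b → e ≤ b → p ^ Λ b ∣ (q ^ m e) ^ ratio e b ∸ 1
   Λ∣ e b le = subst (λ z → p ^ Λ b ∣ z ∸ 1) (sym (trans (Nat.^-*-assoc q (m e) (ratio e b)) (cong (q ^_) (ratio-m e b le)))) (go b)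
     where
     go : ∀ b → p ^ Λ b ∣ q ^ m b ∸ 1
     go zero    = 1∣ _
     go (suc i) = lam∣ i

   pow∣pow⇒≤ : ∀ {i j} → p ^ i ∣ p ^ j → i ≤ j
   pow∣pow⇒≤ {i} {j} h = pow∣⇒≤ pr {i} {j} {1} (p∤1 pr) (subst (p ^ i ∣_) (sym (Nat.*-identityʳ (p ^ j))) h)

   -- For a simple module of degree `D` over the field of level `e` on which the group acts with
   -- exponent `p^a`: its field sits at `level`, the least `b ≥ e` with `a ≤ Λ b`.
   record AtLevel (e a D : ℕ) : Set where
     field
       level : ℕ
       above : e ≤ level
       degree : m e Nat.* D ≡ m level
       low⇒  : ∀ b → e ≤ b → a ≤ Λ b → level ≤ b
       low⇐  : ∀ b → level ≤ b → a ≤ Λ b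

   -- `D` is the order of `q ^ m e` modulo `p^a` and so divides every sufficient relative degree.
   -- This leaves 1, or `d p^j` over the base field, or `p^j` over the others, which are relative
   -- degrees of the tower.
   atLevel : ∀ e I a D → e ≤ I → a ≤ Λ I → 0 < D → p ^ a ∣ (q ^ m e) ^ D ∸ 1 →
             (∀ x → 0 < x → p ^ a ∣ (q ^ m e) ^ x ∸ 1 → D ≤ x) → AtLevel e a D
   atLevel e I a D e≤I aI D>0 h min = go e refl a refl e≤I aI
     where
     Q = q ^ m e
     D∣ : ∀ x → p ^ a ∣ Q ^ x ∸ 1 → D ∣ x
     D∣ = minimal⇒∣ Q (Nat.m^n>0 q {{Nat.>-nonZero q>0}} (m e)) D D>0 h min
     D∣ratio : ∀ b → e ≤ b → a ≤ Λ b → D ∣ ratio e b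
     D∣ratio b le al = D∣ (ratio e b) (∣-trans (pow∣pow p al) (Λ∣ e b le))
     back : ∀ b c → D Nat.* m e Nat.* c ≡ d Nat.* p ^ b → a ≤ lam b
     back b c e₁ = lam-max b a (subst (λ z → p ^ a ∣ z ∸ 1) (trans (Nat.^-*-assoc q (m e) (c Nat.* D)) (cong (q ^_)
       (trans (Nat.*-comm (m e) (c Nat.* D)) (trans (Nat.*-assoc c D (m e)) (trans (Nat.*-comm c (D Nat.* m e)) e₁))))) (∣pow-multiple Q (Nat.m^n>0 q {{Nat.>-nonZero q>0}} (m e)) D h c))
     back-le : ∀ t j → m e Nat.* D ≡ d Nat.* p ^ t → t ≤ j → a ≤ lam j
     back-le t j eq le = back j (p ^ (j ∸ t)) (trans (cong (Nat._* p ^ (j ∸ t)) (trans (Nat.*-comm D (m e)) eq))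
       (trans (Nat.*-assoc d (p ^ t) _) (cong (d Nat.*_) (trans (sym (Nat.^-distribˡ-+-* p t (j ∸ t))) (cong (p ^_) (Nat.m+[n∸m]≡n le))))))
     go : ∀ e′ → e ≡ e′ → ∀ a′ → a ≡ a′ → e′ ≤ I → a′ ≤ Λ I → AtLevel e′ a′ D
     go zero refl zero refl _ _ = record
       { level = 0 ; above = z≤n ; degree = trans (Nat.+-identityʳ D) (Nat.≤-antisym (min 1 (s≤s z≤n) (1∣ _)) D>0)
       ; low⇒ = λ _ _ _ → z≤n ; low⇐ = λ _ _ → z≤n }
     -- As `p` divides `p^a`, the order `d` of `q` modulo `p` divides `D`; the cofactor then divides
     -- a power of `p`.
     go zero refl (suc a′) refl le al = base I al (D∣ratio I z≤n al)
       where
       d∣D : d ∣ D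
       d∣D = minimal⇒∣ q q>0 d d>0 order∣ order-min D (∣-trans (m∣m*n (p ^ a′)) (subst (λ z → p ^ suc a′ ∣ z ^ D ∸ 1) (Nat.*-identityʳ q) h))
       base : ∀ I → suc a′ ≤ Λ I → D ∣ m I → AtLevel 0 (suc a′) D
       base (suc i) al D∣m = cases d∣D
         where
         cases : d ∣ D → AtLevel 0 (suc a′) D
         cases (divides c refl) = final (divisors-of-power pr i c (*-cancelˡ-∣ d (subst (_∣ m (suc i)) (Nat.*-comm c d) D∣m)))
           where
           final : (∃ λ j → c ≡ p ^ j) → AtLevel 0 (suc a′) D
           final (j , refl) = record
             { level = suc j ; above = z≤n ; degree = deg
             ; low⇒ = λ { (suc b) _ al → s≤s (pow∣pow⇒≤ (*-cancelˡ-∣ d (subst (_∣ m (suc b)) (Nat.*-comm c d) (D∣ratio (suc b) z≤n al)))) }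
             ; low⇐ = λ { (suc b) (s≤s le) → back-le j b deg le } }
             where
             deg : 1 Nat.* D ≡ d Nat.* p ^ j
             deg = trans (Nat.+-identityʳ D) (Nat.*-comm c d)
     go (suc i) refl a′ refl le al = final I le (D∣ratio I le al)
       where
       final : ∀ I → suc i ≤ I → D ∣ ratio (suc i) I → AtLevel (suc i) a′ D
       final (suc I) _ D∣r = close (divisors-of-power pr (I ∸ i) D D∣r)
         where
         close : (∃ λ j → D ≡ p ^ j) → AtLevel (suc i) a′ D
         close (j , D≡) = record
           { level = suc (i Nat.+ j) ; above = s≤s (Nat.m≤m+n i j) ; degree = deg
           ; low⇒ = λ { (suc b) (s≤s le) al → s≤s (Nat.≤-trans (Nat.+-monoʳ-≤ i (pow∣pow⇒≤ (subst (_∣ p ^ (b ∸ i)) D≡ (D∣ratio (suc b) (s≤s le) al)))) (Nat.≤-reflexive (Nat.m+[n∸m]≡n le))) }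
           ; low⇐ = λ { (suc b) (s≤s le) → back-le (i Nat.+ j) b deg le } }
           where
           deg : m (suc i) Nat.* D ≡ d Nat.* p ^ (i Nat.+ j)
           deg = trans (Nat.*-assoc d (p ^ i) D) (cong (d Nat.*_) (trans (cong (p ^ i Nat.*_) D≡) (sym (Nat.^-distribˡ-+-* p i j))))

   baseSeries : ℕ → Series
   baseSeries b = spread (m b ∸ 1) (E (q ^ m b))

   -- Normalised by the degree of the level, so that a simple module of degree `D` and level `b`
   -- over the field of level `e` contributes `m e · D · ε b` after the substitution `z^(m e)`.
   ε : ℕ → Series
   ε b n = recip (m b) * logD (baseSeries b) n

   homSeries : (L : FiniteField) → List ℕ → Series
   homSeries L js n = # (HomCount.numHom L (List.map (p ^_) js) n) * recip (gl (FiniteField.size L) n)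

   -- The total degree, over the field of level `e`, of the simple modules of level at most `b`.
   weights : ℕ → List ℕ → ℕ → ℕ
   weights e js b = pick (e Nat.≤? b) (p ^ sumL (Λ b ⊓_) js)

   m-suc : ∀ b → suc (m b ∸ 1) ≡ m b
   m-suc b = Nat.m+[n∸m]≡n (m>0 b)

   module _ {N I : ℕ} (e : ℕ) (e≤I : e ≤ I) (L : FiniteField) (size-L : FiniteField.size L ≡ q ^ m e) (js : List ℕ)
            (C : CountingData L p js (Λ I)) where
     open CountingData C using (k; divide; minimal; degrees; count; d-pos; bounded) renaming (d to D; a to a)

     private
       Q = FiniteField.size L

       at : ∀ i → AtLevel e (a i) (D i)
       at i = atLevel e I (a i) (D i) e≤I (bounded i) (d-pos i) (subst (λ z → p ^ a i ∣ z ^ D i ∸ 1) size-L (divide i))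
         (λ x x>0 h → minimal i x x>0 (subst (λ z → p ^ a i ∣ z ^ x ∸ 1) (sym size-L) h))

       lvl : Fin k → ℕ
       lvl i = AtLevel.level (at i)

       f : Fin k → Series
       f i = spread (D i ∸ 1) (E (Q ^ D i))

       f-0 : ∀ i → f i 0 ≡ 1F
       f-0 i = E-0 (Q ^ D i)

       base : ∀ i n → spread (m e ∸ 1) (f i) n ≡ baseSeries (lvl i) n
       base i n = trans (spread-spread {m e ∸ 1} {D i ∸ 1} {m (lvl i) ∸ 1} (trans (m-suc (lvl i)) (trans (sym (AtLevel.degree (at i))) (cong₂ Nat._*_ (sym (m-suc e)) (sym (Nat.m+[n∸m]≡n (d-pos i)))))) (E (Q ^ D i)) n)
         (cong (λ z → spread (m (lvl i) ∸ 1) (E z) n) (trans (cong (Nat._^ D i) size-L) (trans (Nat.^-*-assoc q (m e) (D i)) (cong (q ^_) (AtLevel.degree (at i))))))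

       scaled : ∀ i n → n ≤ N → # (m e) * spread (m e ∸ 1) (logD (f i)) n ≡ # (m e) * (# (D i) * ε (lvl i) n)
       scaled i n le = trans (lder⇒logD {N} {baseSeries (lvl i)} {λ n → # (m e) * spread (m e ∸ 1) (logD (f i)) n} (E-0 (q ^ m (lvl i)))
           (lder-≗ (base i) (subst (λ z → LDer N (spread (m e ∸ 1) (f i)) (# z ⊡ spread (m e ∸ 1) (logD (f i)))) (m-suc e) (lder-spread (m e ∸ 1) (lder-logD (f i) (f-0 i))))) n le)
         (sym (trans (sym (Fₚ.*-assoc (# (m e)) (# (D i)) _)) (trans (cong (_* ε (lvl i) n) (trans (sym (#-* (m e) (D i))) (cong # (AtLevel.degree (at i)))))
           (trans (sym (Fₚ.*-assoc (# (m (lvl i))) (recip (m (lvl i))) _)) (trans (cong (_* logD (baseSeries (lvl i)) n) (recip-inverse (m (lvl i)) {{Nat.>-nonZero (m>0 (lvl i))}})) (Fₚ.*-identityˡ _))))))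

       -- For `e ≤ b` a module has level at most `b` exactly when its exponent is at most `Λ b`, so
       -- the degree formula is applied at `Λ b`. For `b < e` there are no such modules.
       degree-sum : ∀ b → b ≤ I → sum (λ i → pick (lvl i Nat.≤? b) (D i)) ≡ weights e js b
       degree-sum b b≤I = go (e Nat.≤? b)
         where
         same : e ≤ b → ∀ i (x : Dec (lvl i ≤ b)) (y : Dec (a i ≤ Λ b)) → pick x (D i) ≡ pick y (D i)
         same le i (yes _) (yes _) = refl
         same le i (yes x) (no y)  = ⊥-elim (y (AtLevel.low⇐ (at i) b x))
         same le i (no x)  (yes y) = ⊥-elim (x (AtLevel.low⇒ (at i) b le y))
         same le i (no _)  (no _)  = refl
         zeros : ∀ n (g : Fin n → ℕ) → (∀ i → g i ≡ 0) → sum g ≡ 0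
         zeros zero    g h = refl
         zeros (suc n) g h = cong₂ Nat._+_ (h zero) (zeros n (g ∘ suc) (h ∘ suc))
         go : (x : Dec (e ≤ b)) → sum (λ i → pick (lvl i Nat.≤? b) (D i)) ≡ pick x (p ^ sumL (Λ b ⊓_) js)
         go (yes le) = trans (sum-cong-≗ (λ i → same le i (lvl i Nat.≤? b) (a i Nat.≤? Λ b))) (degrees (Λ b))
         go (no lt)  = zeros k _ (λ i → Abel.pick-no (λ _ → 0F) (lvl i Nat.≤? b) (D i) (λ le → lt (Nat.≤-trans (AtLevel.above (at i)) le)))

     homSeries-0 : homSeries L js 0 ≡ 1F
     homSeries-0 = trans (count 0) (prodSer-0 f f-0)

     -- The product over the simple modules turns into the sum of their `D · ε`, which `abel`
     -- expresses through the degree sums.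
     lder-homSeries : LDer N (spread (m e ∸ 1) (homSeries L js)) (λ n → # (m e) * Abel.abelSum (λ b → ε b n) I (weights e js))
     lder-homSeries = lder-cong eq (lder-≗ {g = spread (m e ∸ 1) (homSeries L js)} (λ n → cnt-cong≤ (m e ∸ 1) 0 n (λ j _ → sym (count j)))
         (lder-spread (m e ∸ 1) (lder-prodSer f (λ i → logD (f i)) (λ i → lder-logD (f i) (f-0 i)))))
       where
       eq : ∀ n → n ≤ N → (# (suc (m e ∸ 1)) ⊡ spread (m e ∸ 1) (λ n → sumFin (λ i → logD (f i) n))) n ≡ # (m e) * Abel.abelSum (λ b → ε b n) I (weights e js)
       eq n le = begin
         # (suc (m e ∸ 1)) * spread (m e ∸ 1) (λ n → sumFin (λ i → logD (f i) n)) n ≡⟨ cong₂ (λ a b → # a * b) (m-suc e) (spread-sumFin (m e ∸ 1) (λ i → logD (f i)) n) ⟩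
         # (m e) * sumFin (λ i → spread (m e ∸ 1) (logD (f i)) n) ≡⟨ sym (sumFin-scale (# (m e)) (λ i → spread (m e ∸ 1) (logD (f i)) n)) ⟩
         sumFin (λ i → # (m e) * spread (m e ∸ 1) (logD (f i)) n) ≡⟨ sumFin-cong (λ i → scaled i n le) ⟩
         sumFin (λ i → # (m e) * (# (D i) * ε (lvl i) n)) ≡⟨ sumFin-scale (# (m e)) (λ i → # (D i) * ε (lvl i) n) ⟩
         # (m e) * sumFin (λ i → # (D i) * ε (lvl i) n) ≡⟨ cong (# (m e) *_) (Abel.abel (λ b → ε b n) I lvl D (λ i → AtLevel.low⇒ (at i) I e≤I (bounded i))) ⟩
         # (m e) * Abel.abelSum (λ b → ε b n) I (λ b → sum (λ i → pick (lvl i Nat.≤? b) (D i))) ≡⟨ cong (# (m e) *_) (Abel.abel-cong (λ b → ε b n) I degree-sum) ⟩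
         # (m e) * Abel.abelSum (λ b → ε b n) I (weights e js) ∎
         where open ≡-Reasoning

-- Legendre's formula and lifting the exponent

module Numeric where
 open import Defs using (vpAux; vpℕ)
 open Valuation
 open Levels using (pow-minus-one)
 open Nat using (_+_; _*_; _^_; _!; _%_; _/_)

 -- `(p^t − 1)/(p − 1)`, which is also the valuation of `(p^t)!`.
 repunit : ℕ → ℕ → ℕ
 repunit p zero    = 0
 repunit p (suc t) = p ^ t + repunit p t

 repunit-geometric : ∀ P t → repunit (suc P) t * P + 1 ≡ suc P ^ t
 repunit-geometric P zero    = refl
 repunit-geometric P (suc t) = trans (arith (suc P ^ t) (repunit (suc P) t) P) (trans (cong (suc P ^ t * P +_) (repunit-geometric P t)) (arith′ (suc P ^ t) P))
   where
   arith : ∀ x r P → (x + r) * P + 1 ≡ x * P + (r * P + 1)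
   arith = solve-∀
   arith′ : ∀ x P → x * P + x ≡ (1 + P) * x
   arith′ = solve-∀

 triangle : ℕ → ℕ
 triangle zero    = 0
 triangle (suc n) = triangle n + n

 2*triangle : ∀ n → 2 * triangle n + n ≡ n * n
 2*triangle zero    = refl
 2*triangle (suc n) = trans (arith (triangle n) n) (trans (cong (λ z → z + (n + n) + 1) (2*triangle n)) (arith′ n))
   where
   arith : ∀ t n → 2 * (t + n) + (1 + n) ≡ (2 * t + n) + (n + n) + 1
   arith = solve-∀
   arith′ : ∀ n → n * n + (n + n) + 1 ≡ (1 + n) * (1 + n)
   arith′ = solve-∀

 -- For `y = p^(l+1) u` the cubic part is always divisible by `p^(l+3)`; only the quadratic term
 -- needs a case distinction when the exponent is lifted.
 binomial-third-order : ∀ y n → ∃ λ R → suc y ^ n ≡ 1 + (n * y + (triangle n * (y * y) + R * (y * y * y)))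
 binomial-third-order y zero    = 0 , refl
 binomial-third-order y (suc n) with binomial-third-order y n
 ... | R , e = R + triangle n + R * y , trans (cong (suc y *_) e) (arith y n (triangle n) R)
   where
   arith : ∀ y n T R → (1 + y) * (1 + (n * y + (T * (y * y) + R * (y * y * y)))) ≡ 1 + ((1 + n) * y + ((T + n) * (y * y) + (R + T + R * y) * (y * y * y)))
   arith = solve-∀

 module _ {p : ℕ} (pr : Prime p) where
   private
     instance
       p≢0 : NonZero p
       p≢0 = prime⇒nonZero pr

   record Valued (n v : ℕ) : Set where
     constructor mkValued
     field
       u    : ℕ
       unit : ¬ (p ∣ u)
       eq   : n ≡ p ^ v * u

   valued-unique : ∀ {n v w} → Valued n v → Valued n w → v ≡ w
   valued-unique {n} {v} {w} (mkValued u nu e) (mkValued u′ nu′ e′) = Nat.≤-antisym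
     (pow∣⇒≤ pr {v} {w} {u′} nu′ (subst (p ^ v ∣_) (trans (sym e) e′) (m∣m*n u)))
     (pow∣⇒≤ pr {w} {v} {u} nu (subst (p ^ w ∣_) (trans (sym e′) e) (m∣m*n u′)))

   valued-* : ∀ {m n v w} → Valued m v → Valued n w → Valued (m * n) (v + w)
   valued-* {v = v} {w} (mkValued u nu e) (mkValued u′ nu′ e′) = mkValued (u * u′) (p∤* pr nu nu′)
     (trans (cong₂ _*_ e e′) (trans (arith (p ^ v) u (p ^ w) u′) (cong (_* (u * u′)) (sym (Nat.^-distribˡ-+-* p v w)))))
     where
     arith : ∀ a b c d → (a * b) * (c * d) ≡ (a * c) * (b * d)
     arith = solve-∀

   valued-unit : ∀ {u} → ¬ (p ∣ u) → Valued u 0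
   valued-unit {u} nu = mkValued u nu (sym (Nat.+-identityʳ u))

   valued-p : Valued p 1
   valued-p = mkValued 1 (p∤1 pr) (sym (trans (Nat.*-identityʳ (p ^ 1)) (Nat.*-identityʳ p)))

   ∣⇒≤valued : ∀ {n v a} → Valued n v → p ^ a ∣ n → a ≤ v
   ∣⇒≤valued {v = v} {a} (mkValued u nu e) h = pow∣⇒≤ pr {a} {v} {u} nu (subst (p ^ a ∣_) e h)

   vpℕ-valued : ∀ n → 0 < n → Valued n (vpℕ p n)
   vpℕ-valued n n>0 = go p refl n n n>0 Nat.≤-refl
     where
     go : ∀ p′ → p ≡ p′ → ∀ f m → 0 < m → m ≤ f → Valued m (vpAux f p′ m)
     go zero          e f       m       m>0 le = ⊥-elim (Nat.<⇒≱ (p>1 pr) (subst (_≤ 1) (sym e) z≤n))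
     go (suc zero)    e f       m       m>0 le = ⊥-elim (Nat.<⇒≱ (p>1 pr) (Nat.≤-reflexive e))
     go (suc (suc k)) e (suc f) (suc m) m>0 le with (suc m) % suc (suc k) Nat.≟ 0
     ... | no ne = valued-unit (λ h → ne (n∣m⇒m%n≡0 (suc m) (suc (suc k)) (subst (_∣ suc m) e h)))
     ... | yes z = subst (λ x → Valued x (suc (vpAux f (suc (suc k)) c))) (sym split)
                     (valued-* valued-p (go (suc (suc k)) e f c c>0 (Nat.≤-pred (Nat.≤-trans (m/n<m (suc m) (suc (suc k)) (s≤s (s≤s z≤n))) le))))
       where
       c = suc m / suc (suc k)
       split : suc m ≡ p * c
       split = trans (m≡m%n+[m/n]*n (suc m) (suc (suc k))) (trans (cong (_+ c * suc (suc k)) z) (trans (Nat.*-comm c (suc (suc k))) (cong (_* c) (sym e))))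
       c>0 : 0 < c
       c>0 = Nat.n≢0⇒n>0 (λ c≡0 → Nat.1+n≢0 (trans split (trans (cong (p *_) c≡0) (Nat.*-zeroʳ p))))

   -- Legendre

   vf : ℕ → ℕ
   vf k = vpℕ p (k !)

   vf-valued : ∀ k → Valued (k !) (vf k)
   vf-valued k = vpℕ-valued (k !) (fact>0 k)
     where
     fact>0 : ∀ k → 0 < k !
     fact>0 zero    = s≤s z≤n
     fact>0 (suc k) = Nat.*-mono-≤ {1} {suc k} (s≤s z≤n) (fact>0 k)

   private
     -- None of the factors `i + p k` with `0 < i < p` is divisible by `p`.
     block : ∀ k j → j < p → ∀ {v} → Valued ((p * k) !) v → Valued ((j + p * k) !) v
     block k zero    j<p h = h
     block k (suc j) j<p h = valued-* (valued-unit (λ d → Nat.<⇒≱ j<p (∣⇒≤ (∣m+n∣m⇒∣n (subst (p ∣_) (Nat.+-comm (suc j) (p * k)) d) (m∣m*n k))))) (block k j (Nat.<-trans (Nat.n<1+n j) j<p) h)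

     P : ℕ
     P = p ∸ 1

     p≡ : p ≡ suc P
     p≡ = sym (Nat.m+[n∸m]≡n (Nat.<⇒≤ (p>1 pr)))

     multiple : ∀ k → Valued ((p * k) !) (k + vf k)
     multiple zero    = subst (λ z → Valued (z !) (vf 0)) (sym (Nat.*-zeroʳ p)) (vf-valued 0)
     multiple (suc k) = subst₂ Valued (cong _! (sym (trans (Nat.*-suc p k) (cong (_+ p * k) p≡)))) exponent
       (subst (λ z → Valued (z * (P + p * k) !) (1 + vpℕ p (suc k) + (k + vf k))) (trans (Nat.*-suc p k) (cong (_+ p * k) p≡))
         (valued-* (valued-* valued-p (vpℕ-valued (suc k) (s≤s z≤n))) (block k P (subst (P <_) (sym p≡) Nat.≤-refl) (multiple k))))
       where
       exponent : 1 + vpℕ p (suc k) + (k + vf k) ≡ suc k + vf (suc k)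
       exponent = trans (arith (vpℕ p (suc k)) k (vf k)) (cong (suc k +_) (valued-unique (valued-* (vpℕ-valued (suc k) (s≤s z≤n)) (vf-valued k)) (vf-valued (suc k))))
         where
         arith : ∀ a k b → 1 + a + (k + b) ≡ 1 + k + (a + b)
         arith = solve-∀

   vf-multiple : ∀ k → vf (p * k) ≡ k + vf k
   vf-multiple k = valued-unique (vf-valued (p * k)) (multiple k)

   vf-legendre : ∀ k → vf k ≡ k / p + vf (k / p)
   vf-legendre k = valued-unique (vf-valued k) (subst (λ z → Valued (z !) (k / p + vf (k / p))) (sym (trans (m≡m%n+[m/n]*n k p) (cong (k % p +_) (Nat.*-comm (k / p) p))))
     (block (k / p) (k % p) (m%n<n k p) (multiple (k / p))))

   vf-power : ∀ t k → vf (p ^ t * k) ≡ k * repunit p t + vf k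
   vf-power zero    k = trans (cong vf (Nat.+-identityʳ k)) (cong (_+ vf k) (sym (Nat.*-zeroʳ k)))
   vf-power (suc t) k = trans (cong vf (Nat.*-assoc p (p ^ t) k)) (trans (vf-multiple (p ^ t * k)) (trans (cong (p ^ t * k +_) (vf-power t k)) (arith (p ^ t) k (repunit p t) (vf k))))
     where
     arith : ∀ x k r v → x * k + (k * r + v) ≡ k * (x + r) + v
     arith = solve-∀

   -- Binomial coefficients are integers: `i! j!` divides `(i + j)!`.
   vf-super : ∀ i j → vf i + vf j ≤ vf (i + j)
   vf-super i j = ∣⇒≤valued (vf-valued (i + j)) (∣-trans (pow∣ (valued-* (vf-valued i) (vf-valued j)))
     (subst (λ z → i ! * z ! ∣ (i + j) !) (Nat.m+n∸m≡n i j) (k![n∸k]!∣n! {i + j} {i} (Nat.m≤m+n i j))))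
     where
     pow∣ : ∀ {n v} → Valued n v → p ^ v ∣ n
     pow∣ {v = v} (mkValued u _ e) = subst (p ^ v ∣_) (sym e) (m∣m*n u)

   vf-mono : ∀ {i j} → i ≤ j → vf i ≤ vf j
   vf-mono {i} {j} le = Nat.≤-trans (Nat.m≤m+n (vf i) (vf (j ∸ i))) (subst (λ z → vf i + vf (j ∸ i) ≤ vf z) (Nat.m+[n∸m]≡n le) (vf-super i (j ∸ i)))

   -- With `B = −b_l` and `T = ⌊n/(d p^l)⌋` this is minus the lower bound of the theorem.
   γ : ℕ → ℕ → ℕ
   γ B T = B * T + vf T

   γ-mono : ∀ B {i j} → i ≤ j → γ B i ≤ γ B j
   γ-mono B le = Nat.+-mono-≤ (Nat.*-monoʳ-≤ B le) (vf-mono le)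

   γ-super : ∀ B i j → γ B i + γ B j ≤ γ B (i + j)
   γ-super B i j = Nat.≤-trans (Nat.≤-reflexive (arith B i j (vf i) (vf j))) (Nat.+-monoʳ-≤ (B * (i + j)) (vf-super i j))
     where
     arith : ∀ B i j a b → B * i + a + (B * j + b) ≡ B * (i + j) + (a + b)
     arith = solve-∀

   γ-floor-super : ∀ B M .{{_ : NonZero M}} i j → γ B (i / M) + γ B (j / M) ≤ γ B ((i + j) / M)
   γ-floor-super B M i j = Nat.≤-trans (γ-super B (i / M) (j / M)) (γ-mono B (subst (_≤ (i + j) / M) (m*n/n≡m (i / M + j / M) M)
     (/-monoˡ-≤ M (subst (_≤ i + j) (sym (Nat.*-distribʳ-+ M (i / M) (j / M))) (Nat.+-mono-≤ (m/n*n≤m i M) (m/n*n≤m j M))))))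

   -- The hypothesis is the minimality at `l` without denominators; it says
   -- `a ≤ B p^t + (p^t − 1)/(p − 1)`. By `vf-power` the last summand, times `k`, is exactly what
   -- the valuation of `(p^t k)!` has beyond that of `k!`.
   bound-up : ∀ a B t → a * (p ∸ 1) + 1 ≤ p ^ t * (B * (p ∸ 1) + 1) → ∀ k → a * k + vf k ≤ γ B (p ^ t * k)
   bound-up a B t h k = Nat.≤-trans (Nat.+-monoˡ-≤ (vf k) (Nat.*-monoˡ-≤ k a≤)) (Nat.≤-reflexive
     (trans (arith B (p ^ t) k (repunit p t) (vf k)) (cong (B * (p ^ t * k) +_) (sym (vf-power t k)))))
     where
     arith : ∀ B x k r v → (B * x + r) * k + v ≡ B * (x * k) + (k * r + v)
     arith = solve-∀
     geometric : repunit p t * P + 1 ≡ p ^ t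
     geometric = subst (λ z → repunit z t * P + 1 ≡ z ^ t) (sym p≡) (repunit-geometric P t)
     expand : p ^ t * (B * P + 1) ≡ (B * p ^ t + repunit p t) * P + 1
     expand = trans (arith₁ (p ^ t) B P) (trans (cong (B * p ^ t * P +_) (sym geometric)) (arith₂ (B * p ^ t) (repunit p t) P))
       where
       arith₁ : ∀ x B P → x * (B * P + 1) ≡ B * x * P + x
       arith₁ = solve-∀
       arith₂ : ∀ y r P → y * P + (r * P + 1) ≡ (y + r) * P + 1
       arith₂ = solve-∀
     a≤ : a ≤ B * p ^ t + repunit p t
     a≤ = Nat.*-cancelʳ-≤ a (B * p ^ t + repunit p t) P {{Nat.>-nonZero (Nat.≤-pred (subst (2 ≤_) p≡ (p>1 pr)))}}
       (Nat.+-cancelʳ-≤ 1 (a * P) _ (Nat.≤-trans h (Nat.≤-reflexive expand)))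

   -- By Legendre `vf k` is `k / p + vf (k / p)`, and `B ≥ 1` pays for the first summand.
   bound-down : ∀ B → 1 ≤ B → ∀ k → vf k ≤ γ B (k / p)
   bound-down B B≥1 k = Nat.≤-trans (Nat.≤-reflexive (vf-legendre k)) (Nat.+-monoˡ-≤ (vf (k / p)) (Nat.m≤n*m (k / p) B {{Nat.>-nonZero B≥1}}))

   -- Lifting the exponent

   private
     module Lift (l u : ℕ) where
       y = p ^ suc l * u
       R = proj₁ (binomial-third-order y p)

       lifted : suc y ^ p ∸ 1 ≡ p * y + (triangle p * (y * y) + R * (y * y * y))
       lifted = cong (_∸ 1) (proj₂ (binomial-third-order y p))

       cube : y * y * y ≡ p ^ (2 + suc l) * (p ^ (l + l) * (u * u * u))
       cube = trans (arith p (p ^ l) u) (cong (λ b → p ^ (2 + suc l) * (b * (u * u * u))) (sym (Nat.^-distribˡ-+-* p l l)))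
         where
         arith : ∀ p x u → (p * x * u) * (p * x * u) * (p * x * u) ≡ (p * (p * (p * x))) * ((x * x) * (u * u * u))
         arith = solve-∀

       lower : p ^ suc (suc l) ∣ suc y ^ p ∸ 1
       lower = subst (p ^ suc (suc l) ∣_) (sym lifted) (∣m∣n⇒∣m+n (subst (p ^ suc (suc l) ∣_) (Nat.*-assoc p (p ^ suc l) u) (m∣m*n u))
         (∣m∣n⇒∣m+n (∣n⇒∣m*n (triangle p) square) (∣n⇒∣m*n R (∣m⇒∣m*n y square))))
         where
         square : p ^ suc (suc l) ∣ y * y
         square = subst (p ^ suc (suc l) ∣_) (arith p (p ^ l) u) (m∣m*n (p ^ l * u * u))
           where
           arith : ∀ p x u → (p * (p * x)) * (x * u * u) ≡ (p * x * u) * (p * x * u)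
           arith = solve-∀

       exact : ¬ (p ∣ u) → (∃ λ Z → triangle p * (y * y) ≡ p ^ (2 + suc l) * Z) → Valued (suc y ^ p ∸ 1) (suc (suc l))
       exact nu (Z , e) = mkValued (u + p * W) (λ d → nu (∣m+n∣m⇒∣n (subst (p ∣_) (Nat.+-comm u (p * W)) d) (m∣m*n W)))
         (trans lifted (trans (cong₂ (λ a b → p * y + (a + R * b)) e cube) (arith p (p ^ suc l) u Z R (p ^ (l + l) * (u * u * u)))))
         where
         W = Z + R * (p ^ (l + l) * (u * u * u))
         arith : ∀ p x u Z R C → p * (x * u) + ((p * (p * x)) * Z + R * ((p * (p * x)) * C)) ≡ (p * x) * (u + p * (Z + R * C))
         arith = solve-∀

       -- An odd prime divides `binom(p, 2)`, which supplies the missing factor `p`.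
       odd : p ≢ 2 → ∃ λ Z → triangle p * (y * y) ≡ p ^ (2 + suc l) * Z
       odd p≢2 with euclidsLemma 2 (triangle p) pr (∣m+n∣m⇒∣n (subst (p ∣_) (trans (sym (2*triangle p)) (Nat.+-comm (2 * triangle p) p)) (m∣m*n p)) ∣-refl)
       ... | inj₁ p∣2 = ⊥-elim (p≢2 (Nat.≤-antisym (∣⇒≤ p∣2) (p>1 pr)))
       ... | inj₂ (divides c e) = c * (p ^ l * (u * u)) , trans (cong (_* (y * y)) e) (arith c p (p ^ l) u)
         where
         arith : ∀ c p x u → (c * p) * ((p * x * u) * (p * x * u)) ≡ (p * (p * (p * x))) * (c * (x * (u * u)))
         arith = solve-∀

       -- Here `y²` alone is divisible by `p^(2l+2)`, and `2l + 2 ≥ l + 3`.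
       large : 1 ≤ l → ∃ λ Z → triangle p * (y * y) ≡ p ^ (2 + suc l) * Z
       large (s≤s {n = l′} z≤n) = triangle p * (p ^ l′ * (u * u)) , arith (triangle p) p (p ^ l′) u
         where
         arith : ∀ T p x u → T * ((p * (p * x) * u) * (p * (p * x) * u)) ≡ (p * (p * (p * (p * x)))) * (T * (x * (u * u)))
         arith = solve-∀

   module _ (q : ℕ) (q≥2 : 2 ≤ q) where

     q^>1 : ∀ m → 0 < m → 2 ≤ q ^ m
     q^>1 (suc m) _ = Nat.≤-trans q≥2 (Nat.m≤m*n q (q ^ m) {{Nat.>-nonZero (Nat.m^n>0 q {{Nat.>-nonZero (Nat.<⇒≤ q≥2)}} m)}})

     private
       successor : ∀ m → 0 < m → ∀ {v u} → q ^ m ∸ 1 ≡ p ^ v * u → q ^ (m * p) ∸ 1 ≡ suc (p ^ v * u) ^ p ∸ 1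
       successor m m>0 e = cong (_∸ 1) (trans (sym (Nat.^-*-assoc q m p)) (cong (_^ p) (trans (sym (Nat.m+[n∸m]≡n (Nat.<⇒≤ (q^>1 m m>0)))) (cong suc e))))

     lift-≥ : ∀ m → 0 < m → ∀ {v w} → 1 ≤ v → Valued (q ^ m ∸ 1) v → Valued (q ^ (m * p) ∸ 1) w → suc v ≤ w
     lift-≥ m m>0 (s≤s {n = l} z≤n) (mkValued u nu e) h = ∣⇒≤valued h (subst (p ^ suc (suc l) ∣_) (sym (successor m m>0 {suc l} {u} e)) (Lift.lower l u))

     -- The excluded case `p = 2`, `v = 1` is a genuine exception: from `3 − 1` to `3² − 1` the
     -- valuation rises from 1 to 3.
     lift-≡ : ∀ m → 0 < m → ∀ {v w} → 1 ≤ v → p ≢ 2 ⊎ 2 ≤ v → Valued (q ^ m ∸ 1) v → Valued (q ^ (m * p) ∸ 1) w → w ≡ suc v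
     lift-≡ m m>0 (s≤s {n = l} z≤n) c (mkValued u nu e) h = valued-unique h (subst (λ z → Valued z (suc (suc l))) (sym (successor m m>0 {suc l} {u} e)) (Lift.exact l u nu (cases c)))
       where
       cases : p ≢ 2 ⊎ 2 ≤ suc l → _
       cases (inj₁ ne) = Lift.odd l u ne
       cases (inj₂ (s≤s le)) = Lift.large l u le

     -- The powers of q modulo p take at most p − 1 values.
     order<p : ¬ (p ∣ q) → ∀ d → (∀ e → 0 < e → p ∣ q ^ e ∸ 1 → d ≤ e) → d < p
     order<p nq d min = go (Finₚ.pigeonhole (subst (P <_) (sym p≡) Nat.≤-refl) residue)
       where
       instance
         q≢0 : NonZero q
         q≢0 = Nat.>-nonZero (Nat.<⇒≤ q≥2)
       unit-pow : ∀ i → ¬ (p ∣ q ^ i)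
       unit-pow zero    = p∤1 pr
       unit-pow (suc i) = p∤* pr nq (unit-pow i)
       rem>0 : ∀ i → 0 < q ^ i % p
       rem>0 i = Nat.n≢0⇒n>0 (λ z → unit-pow i (m%n≡0⇒n∣m (q ^ i) p z))
       small : ∀ i → q ^ i % p ∸ 1 < P
       small i = Nat.∸-monoˡ-< (m%n<n (q ^ i) p) (rem>0 i)
       residue : Fin p → Fin P
       residue i = fromℕ< (small (toℕ i))
       equal : ∀ {i j} → residue i ≡ residue j → q ^ toℕ i % p ≡ q ^ toℕ j % p
       equal {i} {j} h = trans (sym (Nat.m+[n∸m]≡n (rem>0 (toℕ i)))) (trans (cong suc (trans (sym (Finₚ.toℕ-fromℕ< (small (toℕ i)))) (trans (cong toℕ h) (Finₚ.toℕ-fromℕ< (small (toℕ j)))))) (Nat.m+[n∸m]≡n (rem>0 (toℕ j))))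
       same-remainder : ∀ a b → a % p ≡ b % p → p ∣ a ∸ b
       same-remainder a b h = divides (a / p ∸ b / p) (trans (cong₂ _∸_ (m≡m%n+[m/n]*n a p) (trans (m≡m%n+[m/n]*n b p) (cong (_+ b / p * p) (sym h))))
         (trans (Nat.[m+n]∸[m+o]≡n∸o (a % p) (a / p * p) (b / p * p)) (sym (Nat.*-distribʳ-∸ p (a / p) (b / p)))))
       go : (∃ λ i → ∃ λ j → i Fin.< j × residue i ≡ residue j) → d < p
       go (i , j , i<j , h) = Nat.≤-<-trans (min k (Nat.m<n⇒0<n∸m i<j) divisible) (Nat.≤-<-trans (Nat.m∸n≤m (toℕ j) (toℕ i)) (Finₚ.toℕ<n j))
         where
         k = toℕ j ∸ toℕ i
         factor : q ^ toℕ j ∸ q ^ toℕ i ≡ q ^ toℕ i * (q ^ k ∸ 1)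
         factor = trans (cong (λ z → q ^ z ∸ q ^ toℕ i) (sym (Nat.m+[n∸m]≡n (Nat.<⇒≤ i<j)))) (trans (cong₂ _∸_ (Nat.^-distribˡ-+-* q (toℕ i) k) (sym (Nat.*-identityʳ (q ^ toℕ i)))) (sym (Nat.*-distribˡ-∸ (q ^ toℕ i) (q ^ k) 1)))
         divisible : p ∣ q ^ k ∸ 1
         divisible with euclidsLemma (q ^ toℕ i) (q ^ k ∸ 1) pr (subst (p ∣_) factor (same-remainder (q ^ toℕ j) (q ^ toℕ i) (sym (equal {i} {j} h))))
         ... | inj₁ bad  = ⊥-elim (unit-pow (toℕ i) bad)
         ... | inj₂ good = good

-- The minimiser l and the local bounds

module Objective where
 open import Defs using (divℤ; lam; cc; bb; sum1; objective; IsLeastMinimizer)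
 open Numeric
 open Valuation
 open Nat using (_+_; _*_; _^_; _/_)
 open Int using (+_)

 -- The objective p^(−i)(b − 1/D) with D = p − 1, and P = p^i.
 scaled : ℤ → ℕ → ℕ → ℚ
 scaled b D P = (divℤ b (+ 1) ℚ.- divℤ (+ 1) (+ D)) ℚ.* divℤ (+ 1) (+ P)

 private
   unnormalised : ℤ → ℕ → ℕ → ℚᵘ
   unnormalised b D P = (mkℚᵘ b 0 ℚᵘ.- mkℚᵘ (+ 1) D) ℚᵘ.* mkℚᵘ (+ 1) P

   scaled-unnormalised : ∀ b D P → toℚᵘ (scaled b (suc D) (suc P)) ℚᵘ.≃ unnormalised b D P
   scaled-unnormalised b D P = ℚᵘₚ.≃-trans (ℚₚ.toℚᵘ-homo-* (divℤ b (+ 1) ℚ.- divℤ (+ 1) (+ suc D)) (divℤ (+ 1) (+ suc P)))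
     (ℚᵘₚ.*-cong (ℚᵘₚ.≃-trans (ℚₚ.toℚᵘ-homo-+ (divℤ b (+ 1)) (ℚ.- divℤ (+ 1) (+ suc D)))
         (ℚᵘₚ.+-cong (ℚₚ.toℚᵘ-fromℚᵘ (mkℚᵘ b 0)) (ℚᵘₚ.≃-trans (ℚₚ.toℚᵘ-homo‿- (divℤ (+ 1) (+ suc D))) (ℚᵘₚ.-‿cong (ℚₚ.toℚᵘ-fromℚᵘ (mkℚᵘ (+ 1) D))))))
       (ℚₚ.toℚᵘ-fromℚᵘ (mkℚᵘ (+ 1) P)))

   cross : ∀ b D P P′ → ℚᵘ.↥ unnormalised b D P Int.* ℚᵘ.↧ unnormalised b D P′ ≡ (b Int.* + suc D Int.- + 1) Int.* + suc P′ Int.* + suc D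
   cross b D P P′ = trans (cong (ℚᵘ.↥ unnormalised b D P Int.*_) (trans (cong +_ (cong (_* suc P′) (Nat.+-identityʳ (suc D)))) (Int.pos-* (suc D) (suc P′)))) (arith b (+ suc D) (+ suc P′))
     where
     arith : ∀ b d p′ → ((b Int.* d Int.+ Int.- + 1 Int.* + 1) Int.* + 1) Int.* (d Int.* p′) ≡ (b Int.* d Int.- + 1) Int.* p′ Int.* d
     arith = ℤSolver.solve-∀

 scaled-≤ : ∀ {b b′} D P P′ → 0 < D → 0 < P → 0 < P′ → scaled b D P ℚ.≤ scaled b′ D P′ →
            (b Int.* + D Int.- + 1) Int.* + P′ Int.≤ (b′ Int.* + D Int.- + 1) Int.* + P
 scaled-≤ {b} {b′} (suc D) (suc P) (suc P′) _ _ _ h = go (ℚᵘₚ.≤-respˡ-≃ (scaled-unnormalised b D P) (ℚᵘₚ.≤-respʳ-≃ (scaled-unnormalised b′ D P′) (ℚₚ.toℚᵘ-mono-≤ h)))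
   where
   go : unnormalised b D P ℚᵘ.≤ unnormalised b′ D P′ → _
   go (*≤* le) = Int.*-cancelʳ-≤-pos _ _ (+ suc D) (subst₂ Int._≤_ (cross b D P P′) (cross b′ D P′ P) le)

 scaled-< : ∀ {b b′} D P P′ → 0 < D → 0 < P → 0 < P′ → scaled b D P ℚ.< scaled b′ D P′ →
            (b Int.* + D Int.- + 1) Int.* + P′ Int.< (b′ Int.* + D Int.- + 1) Int.* + P
 scaled-< {b} {b′} (suc D) (suc P) (suc P′) _ _ _ h = go (ℚᵘₚ.<-respˡ-≃ (scaled-unnormalised b D P) (ℚᵘₚ.<-respʳ-≃ (scaled-unnormalised b′ D P′) (ℚₚ.toℚᵘ-mono-< h)))
   where
   go : unnormalised b D P ℚᵘ.< unnormalised b′ D P′ → _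
   go (*<* lt) = Int.*-cancelʳ-<-nonNeg (+ suc D) (subst₂ Int._<_ (cross b D P P′) (cross b′ D P′ P) lt)

 sum1-mono : ∀ r {f g : ℕ → ℕ} → (∀ j → f j ≤ g j) → sum1 r f ≤ sum1 r g
 sum1-mono zero    h = z≤n
 sum1-mono (suc r) h = Nat.+-mono-≤ (sum1-mono r h) (h (suc r))

 module _ {p : ℕ} (pr : Prime p) (q : ℕ) (q≥2 : 2 ≤ q) (d : ℕ) (d>0 : 0 < d) (order∣ : p ∣ q ^ d ∸ 1)
          (r : ℕ) (k : ℕ → ℕ) (r≥1 : 1 ≤ r) (kr>0 : 0 < k r) where
   private
     instance
       p≢0 : NonZero p
       p≢0 = prime⇒nonZero pr
       d≢0 : NonZero d
       d≢0 = Nat.>-nonZero d>0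

     λ′ : ℕ → ℕ
     λ′ = lam p q d

     c : ℕ → ℕ
     c i = cc r k (λ′ i)

     D : ℕ
     D = p ∸ 1

     p≡ : p ≡ suc D
     p≡ = sym (Nat.m+[n∸m]≡n (Nat.<⇒≤ (p>1 pr)))

     D>0 : 0 < D
     D>0 = Nat.≤-pred (subst (2 ≤_) p≡ (p>1 pr))

   exponent>0 : ∀ i → 0 < d * p ^ i
   exponent>0 i = Nat.*-mono-≤ d>0 (Nat.m^n>0 p i)

   lam-valued : ∀ i → Valued pr (q ^ (d * p ^ i) ∸ 1) (lam p q d i)
   lam-valued i = vpℕ-valued pr _ (Nat.m<n⇒0<n∸m (q^>1 pr q q≥2 (d * p ^ i) (exponent>0 i)))

   private
     next : ∀ i → Valued pr (q ^ (d * p ^ i * p) ∸ 1) (λ′ (suc i))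
     next i = subst (λ z → Valued pr (q ^ z ∸ 1) (λ′ (suc i))) (trans (cong (d *_) (Nat.*-comm p (p ^ i))) (sym (Nat.*-assoc d (p ^ i) p))) (lam-valued (suc i))

   i<lam : ∀ i → i < lam p q d i
   i<lam zero    = ∣⇒≤valued pr {a = 1} (lam-valued 0) (subst₂ (λ a b → a ∣ q ^ b ∸ 1) (sym (Nat.*-identityʳ p)) (sym (Nat.*-identityʳ d)) order∣)
   i<lam (suc i) = Nat.≤-trans (s≤s (i<lam i)) (lift-≥ pr q q≥2 (d * p ^ i) (exponent>0 i) (Nat.≤-trans (s≤s z≤n) (i<lam i)) (lam-valued i) (next i))

   lam-mono : ∀ i → lam p q d i < lam p q d (suc i)
   lam-mono i = lift-≥ pr q q≥2 (d * p ^ i) (exponent>0 i) (Nat.≤-trans (s≤s z≤n) (i<lam i)) (lam-valued i) (next i)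

   private
     lam-step : ∀ i → p ≢ 2 ⊎ 2 ≤ λ′ i → λ′ (suc i) ≡ suc (λ′ i)
     lam-step i h = lift-≡ pr q q≥2 (d * p ^ i) (exponent>0 i) (Nat.≤-trans (s≤s z≤n) (i<lam i)) h (lam-valued i) (next i)

     c-mono : ∀ {i j} → i ≤ j → cc r k i ≤ cc r k j
     c-mono le = sum1-mono r (λ j → Nat.*-monoˡ-≤ (k j) (Nat.⊓-monoˡ-≤ j le))

     c-1 : 1 ≤ cc r k 1
     c-1 = go r r≥1 kr>0
       where
       go : ∀ r → 1 ≤ r → 0 < k r → 1 ≤ cc r k 1
       go (suc r) _ h = Nat.≤-trans (Nat.≤-trans h (Nat.≤-reflexive (sym (Nat.+-identityʳ (k (suc r)))))) (Nat.m≤n+m (1 * k (suc r)) (sum1 r (λ j → Nat._⊓_ 1 j * k j)))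

     ℤ→ℕ : ∀ i a → bb p q d r k i ≡ Int.- + a → c i + a ≡ λ′ i + i
     ℤ→ℕ i a h = Int.+-injective (trans (Int.pos-+ (c i) a) (trans (arith (+ c i) (+ λ′ i) (+ i) (+ a)) (trans (cong (λ z → z Int.+ + a Int.+ (+ λ′ i Int.+ + i)) h)
         (trans (cong (Int._+ (+ λ′ i Int.+ + i)) (Int.+-inverseˡ (+ a))) (trans (Int.+-identityˡ _) (sym (Int.pos-+ (λ′ i) i)))))))
       where
       arith : ∀ x y z w → x Int.+ w ≡ x Int.- y Int.- z Int.+ w Int.+ (y Int.+ z)
       arith = ℤSolver.solve-∀

     negated : ∀ a D P → ((Int.- + a) Int.* + D Int.- + 1) Int.* + P ≡ Int.- + ((a * D + 1) * P)
     negated a D P = trans (arith (+ a) (+ D) (+ P)) (cong Int.-_ (sym (trans (Int.pos-* (a * D + 1) P) (cong (Int._* + P) (trans (Int.pos-+ (a * D) 1) (cong (Int._+ + 1) (Int.pos-* a D)))))))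
       where
       arith : ∀ a d x → ((Int.- a) Int.* d Int.- + 1) Int.* x ≡ Int.- ((a Int.* d Int.+ + 1) Int.* x)
       arith = ℤSolver.solve-∀

     pow>0 : ∀ i → 0 < p ^ i
     pow>0 = Nat.m^n>0 p

   ℕ→ℤ : ∀ i a → cc r k (lam p q d i) + a ≡ lam p q d i + i → bb p q d r k i ≡ Int.- + a
   ℕ→ℤ i a h = trans (arith (+ cc r k (lam p q d i)) (+ lam p q d i) (+ i) (+ a)) (trans (cong (λ z → z Int.- (+ lam p q d i Int.+ + i) Int.- + a) (trans (sym (Int.pos-+ (cc r k (lam p q d i)) a)) (trans (cong +_ h) (Int.pos-+ (lam p q d i) i))))
       (trans (cong (Int._- + a) (Int.+-inverseʳ (+ lam p q d i Int.+ + i))) (Int.+-identityˡ _)))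
     where
     arith : ∀ x y z w → x Int.- y Int.- z ≡ x Int.+ w Int.- (y Int.+ z) Int.- w
     arith = ℤSolver.solve-∀

   module _ (l : ℕ) (least : IsLeastMinimizer (objective p q d r k) l) where
     private
       -- Since `c` never exceeds `∑ j k_j`, the number `b` is negative at this index.
       far : ℕ
       far = suc (sum1 r (λ j → j * k j))

       b-far : ∃ λ a → c far + suc a ≡ λ′ far + far
       b-far = λ′ far + far ∸ suc (c far) , trans (Nat.+-suc (c far) _) (Nat.m+[n∸m]≡n {suc (c far)} (Nat.≤-trans (s≤s (sum1-mono r (λ j → Nat.*-monoˡ-≤ (k j) (Nat.m⊓n≤n (λ′ far) j)))) (Nat.m≤n+m far (λ′ far))))

     -- The objective is eventually negative, so its minimum is.
     minimum≤0 : ∃ λ B → bb p q d r k l ≡ Int.- + B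
     minimum≤0 = go (bb p q d r k l) refl
       where
       go : ∀ b → bb p q d r k l ≡ b → ∃ λ B → bb p q d r k l ≡ Int.- + B
       go (+ zero)    e = 0 , e
       go -[1+ B ]    e = suc B , e
       go +[1+ B ]    e = ⊥-elim (contradiction (subst₂ Int._≤_ (cong (λ z → (z Int.* + D Int.- + 1) Int.* + (p ^ far)) e)
             (trans (cong (λ z → (z Int.* + D Int.- + 1) Int.* + (p ^ l)) (ℕ→ℤ far (suc (proj₁ b-far)) (proj₂ b-far))) (negated (suc (proj₁ b-far)) D (p ^ l)))
             (scaled-≤ {bb p q d r k l} {bb p q d r k far} D (p ^ l) (p ^ far) D>0 (pow>0 l) (pow>0 far) (proj₁ least far))))
         where
         nonneg : ∀ B D P → 0 < D → ∃ λ n → (+[1+ B ] Int.* + D Int.- + 1) Int.* + P ≡ + n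
         nonneg B (suc D) P _ = (D + B * suc D) * P , sym (Int.pos-* (D + B * suc D) P)
         negative : ∀ {m n} → 0 < n → ¬ (+ m Int.≤ Int.- + n)
         negative {n = suc n} _ ()
         contradiction : ¬ ((+[1+ B ] Int.* + D Int.- + 1) Int.* + (p ^ far) Int.≤ Int.- + ((suc (proj₁ b-far) * D + 1) * p ^ l))
         contradiction h = negative {proj₁ (nonneg B D (p ^ far) D>0)} (Nat.*-mono-≤ {1} {suc (proj₁ b-far) * D + 1} (Nat.m≤n+m 1 _) (pow>0 l))
           (subst (Int._≤ _) (proj₂ (nonneg B D (p ^ far) D>0)) h)

     module _ (B : ℕ) (b-l : bb p q d r k l ≡ Int.- + B) where
       private
         -- The inequality of objectives after clearing denominators and changing signs.
         minimal : ∀ i a → bb p q d r k i ≡ Int.- + a → (a * D + 1) * p ^ l ≤ (B * D + 1) * p ^ i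
         minimal i a e = Int.drop‿+≤+ (Int.neg-cancel-≤ (subst₂ Int._≤_
           (trans (cong (λ z → (z Int.* + D Int.- + 1) Int.* + (p ^ i)) b-l) (negated B D (p ^ i)))
           (trans (cong (λ z → (z Int.* + D Int.- + 1) Int.* + (p ^ l)) e) (negated a D (p ^ l)))
           (scaled-≤ {bb p q d r k l} {bb p q d r k i} D (p ^ l) (p ^ i) D>0 (pow>0 l) (pow>0 i) (proj₁ least i))))

         strict : ∀ i a → i < l → bb p q d r k i ≡ Int.- + a → (a * D + 1) * p ^ l < (B * D + 1) * p ^ i
         strict i a lt e = Int.drop‿+<+ (Int.neg-cancel-< (subst₂ Int._<_
           (trans (cong (λ z → (z Int.* + D Int.- + 1) Int.* + (p ^ i)) b-l) (negated B D (p ^ i)))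
           (trans (cong (λ z → (z Int.* + D Int.- + 1) Int.* + (p ^ l)) e) (negated a D (p ^ l)))
           (scaled-< {bb p q d r k l} {bb p q d r k i} D (p ^ l) (p ^ i) D>0 (pow>0 l) (pow>0 i) (proj₂ least i lt))))

         reduced : ∀ i t a → i + t ≡ l → 0 < t → bb p q d r k i ≡ Int.- + a → (a * D + 1) * p ^ t < B * D + 1
         reduced i t a e t>0 h = Nat.*-cancelʳ-< (p ^ i) ((a * D + 1) * p ^ t) (B * D + 1) (subst (_< (B * D + 1) * p ^ i)
           (trans (cong (λ z → (a * D + 1) * p ^ z) (sym e)) (trans (cong ((a * D + 1) *_) (Nat.^-distribˡ-+-* p i t)) (arith (a * D + 1) (p ^ i) (p ^ t))))
           (strict i a (subst (i <_) e (subst (_≤ i + t) (Nat.+-comm i 1) (Nat.+-monoʳ-≤ i t>0))) h))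
           where
           arith : ∀ x y z → x * (y * z) ≡ x * z * y
           arith = solve-∀

       private
         -- When `λ` rises by exactly 1 from `l − 1` to `l`, `b` falls by at most 2. So `B ≤ 2` if
         -- `b` is nonnegative at `l − 1`; if it is `−a` with `a ≥ 1` there, then `B ≤ a + 2`
         -- contradicts the strict inequality `(a D + 1) p < B D + 1`.
         minimum≤2 : ∀ l′ → l ≡ suc l′ → p ≢ 2 ⊎ 2 ≤ λ′ l′ → B ≤ 2
         minimum≤2 l′ refl nojump = go (Nat.<-≤-connex (λ′ l′ + l′) (c l′))
           where
           total : c l + B ≡ 2 + (λ′ l′ + l′)
           total = trans (ℤ→ℕ l B b-l) (trans (cong (_+ suc l′) (lam-step l′ nojump)) (arith (λ′ l′) l′))
             where
             arith : ∀ x y → 1 + x + (1 + y) ≡ 2 + (x + y)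
             arith = solve-∀
           monotone : c l′ ≤ c l
           monotone = c-mono (Nat.<⇒≤ (lam-mono l′))
           go : λ′ l′ + l′ < c l′ ⊎ c l′ ≤ λ′ l′ + l′ → B ≤ 2
           go (inj₁ lt) = Nat.+-cancelˡ-≤ (c l) B 2 (Nat.≤-trans (Nat.≤-reflexive total) (Nat.≤-trans (Nat.+-monoʳ-≤ 2 (Nat.≤-trans (Nat.<⇒≤ lt) monotone)) (Nat.≤-reflexive (Nat.+-comm 2 (c l)))))
           go (inj₂ le) = conclude a refl
             where
             a = λ′ l′ + l′ ∸ c l′
             a-eq : c l′ + a ≡ λ′ l′ + l′
             a-eq = Nat.m+[n∸m]≡n le
             B≤ : B ≤ a + 2
             B≤ = Nat.+-cancelˡ-≤ (c l) B (a + 2) (Nat.≤-trans (Nat.≤-reflexive (trans total (trans (cong (λ z → 2 + z) (sym a-eq)) (arith (c l′) a)))) (Nat.+-monoˡ-≤ (a + 2) monotone))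
               where
               arith : ∀ x y → 2 + (x + y) ≡ x + (y + 2)
               arith = solve-∀
             conclude : ∀ a′ → a ≡ a′ → B ≤ 2
             conclude zero     e = subst (λ z → B ≤ z + 2) e B≤
             conclude (suc a′) e = ⊥-elim (Nat.<⇒≱ (reduced l′ 1 a (Nat.+-comm l′ 1) (s≤s z≤n) (ℕ→ℤ l′ a a-eq))
               (Nat.≤-trans (Nat.+-monoˡ-≤ 1 (Nat.*-monoˡ-≤ D B≤)) (subst₂ (λ x y → (x + 2) * D + 1 ≤ (x * D + 1) * y) (sym e) (sym (trans (Nat.*-identityʳ p) p≡)) (ineq a′ D D>0))))
               where
               ineq : ∀ a D → 0 < D → (suc a + 2) * D + 1 ≤ (suc a * D + 1) * suc D
               ineq a (suc D) _ = Nat.≤-trans (Nat.m≤m+n _ (a * suc D * suc D + suc D * D)) (Nat.≤-reflexive (arith a D))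
                 where
                 arith : ∀ a D → (1 + a + 2) * (1 + D) + 1 + (a * (1 + D) * (1 + D) + (1 + D) * D) ≡ ((1 + a) * (1 + D) + 1) * (1 + (1 + D))
                 arith = solve-∀

       -- With `B ≤ 2`, the strict inequality `(a D + 1) p^t < B D + 1` for `t = l − j` leaves only
       -- `a = 0` and `t = 1`, since `p² ≥ 2 D + 1`. If instead the step of `λ` before `l` may be
       -- irregular, then `λ ≤ 1` there, which happens only at index 0; and `c ≥ 1` forces `a = 0`.
       below : ∀ j a → j < l → bb p q d r k j ≡ Int.- + a → a ≡ 0 × l ≡ suc j × 1 ≤ B
       below j a lt e = main (l ∸ suc j) (trans (Nat.+-suc j (l ∸ suc j)) (Nat.m+[n∸m]≡n lt))
         where
         B≥1 : ∀ t a → j + t ≡ l → 0 < t → bb p q d r k j ≡ Int.- + a → 1 ≤ B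
         B≥1 t a e t>0 h = go B refl
           where
           go : ∀ B′ → B ≡ B′ → 1 ≤ B′
           go (suc _) _ = s≤s z≤n
           go zero B≡ = ⊥-elim (Nat.<⇒≱ (subst (λ z → (a * D + 1) * p ^ t < z * D + 1) B≡ (reduced j t a e t>0 h)) (Nat.*-mono-≤ {1} {a * D + 1} (Nat.m≤n+m 1 (a * D)) (pow>0 t)))
         main : ∀ t → j + suc t ≡ l → a ≡ 0 × l ≡ suc j × 1 ≤ B
         main t eq = split (jump? (j + t))
           where
           l≡ : l ≡ suc (j + t)
           l≡ = trans (sym eq) (Nat.+-suc j t)
           jump? : ∀ i → (p ≢ 2 ⊎ 2 ≤ λ′ i) ⊎ (λ′ i ≤ 1)
           jump? i with 2 Nat.≤? λ′ i
           ... | yes h = inj₁ (inj₂ h)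
           ... | no h  = inj₂ (Nat.≤-pred (Nat.≰⇒> h))
           split : (p ≢ 2 ⊎ 2 ≤ λ′ (j + t)) ⊎ (λ′ (j + t) ≤ 1) → a ≡ 0 × l ≡ suc j × 1 ≤ B
           split (inj₂ h) = a≡0 , trans l≡ (cong suc j+t≡j) , B≥1 (suc t) a eq (s≤s z≤n) e
             where
             j+t≡0 : j + t ≡ 0
             j+t≡0 = Nat.n≤0⇒n≡0 (Nat.≤-pred (Nat.≤-trans (i<lam (j + t)) h))
             j≡0 : j ≡ 0
             j≡0 = Nat.m+n≡0⇒m≡0 j j+t≡0
             j+t≡j : j + t ≡ j
             j+t≡j = trans j+t≡0 (sym j≡0)
             λ≡1 : λ′ j ≡ 1
             λ≡1 = Nat.≤-antisym (subst (λ z → λ′ z ≤ 1) j+t≡j h) (Nat.≤-trans (s≤s z≤n) (i<lam j))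
             a≡0 : a ≡ 0
             a≡0 = Nat.n≤0⇒n≡0 (Nat.+-cancelˡ-≤ 1 a 0 (Nat.≤-trans (Nat.+-monoˡ-≤ a c-1) (Nat.≤-reflexive (trans (cong (λ z → cc r k z + a) (sym λ≡1)) (trans (ℤ→ℕ j a e) (cong₂ _+_ λ≡1 j≡0))))))
           split (inj₁ nojump) = finish a t refl refl
             where
             B≤2 : B ≤ 2
             B≤2 = minimum≤2 (j + t) l≡ nojump
             bound : (a * D + 1) * p ^ suc t < 2 * D + 1
             bound = Nat.<-≤-trans (reduced j (suc t) a eq (s≤s z≤n) e) (Nat.+-monoˡ-≤ 1 (Nat.*-monoˡ-≤ D B≤2))
             finish : ∀ a′ t′ → a ≡ a′ → t ≡ t′ → a ≡ 0 × l ≡ suc j × 1 ≤ B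
             finish zero    zero    ea et = ea , trans l≡ (cong suc (trans (cong (λ z → j + z) et) (Nat.+-identityʳ j))) , B≥1 (suc t) a eq (s≤s z≤n) e
             finish (suc a′) t′     ea et = ⊥-elim (Nat.<⇒≱ bound (Nat.≤-trans (ineq D) (subst₂ (λ x y → suc D * suc D ≤ (x * D + 1) * y) (sym ea) refl
                 (Nat.*-mono-≤ {suc D} {suc a′ * D + 1} (Nat.≤-trans (Nat.≤-reflexive (Nat.+-comm 1 D)) (Nat.+-monoˡ-≤ 1 (Nat.m≤m+n D (a′ * D))))
                   (subst (_≤ p ^ suc t) p≡ (Nat.m≤m*n p (p ^ t) {{Nat.m^n≢0 p t}}))))))
               where
               ineq : ∀ D → 2 * D + 1 ≤ suc D * suc D
               ineq D = Nat.≤-trans (Nat.m≤m+n _ (D * D)) (Nat.≤-reflexive (arith D))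
                 where
                 arith : ∀ D → 2 * D + 1 + D * D ≡ (1 + D) * (1 + D)
                 arith = solve-∀
             finish zero (suc t′)   ea et = ⊥-elim (Nat.<⇒≱ bound (Nat.≤-trans (ineq D) (Nat.≤-trans (subst (λ z → suc D * suc D ≤ p ^ suc z) (sym et)
                 (subst (λ z → z * z ≤ p ^ suc (suc t′)) p≡ (subst (_≤ p ^ suc (suc t′)) refl (Nat.*-monoʳ-≤ p (Nat.m≤m*n p (p ^ t′) {{Nat.m^n≢0 p t′}})))))
                 (Nat.m≤n*m (p ^ suc t) (a * D + 1) {{Nat.>-nonZero (Nat.m≤n+m 1 (a * D))}}))))
               where
               ineq : ∀ D → 2 * D + 1 ≤ suc D * suc D
               ineq D = Nat.≤-trans (Nat.m≤m+n _ (D * D)) (Nat.≤-reflexive (arith D))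
                 where
                 arith : ∀ D → 2 * D + 1 + D * D ≡ (1 + D) * (1 + D)
                 arith = solve-∀

       -- Bounds the denominators of a `p^a`-th root of a series in `z^(d p^j)`. For `j ≥ l`
       -- minimality feeds `bound-up`; for `j < l` the lemma `below` leaves a case covered by
       -- `bound-down`.
       local-bound : .{{_ : NonZero (d * p ^ l)}} → ∀ j a → bb p q d r k j ≡ Int.- + a → ∀ n → a * n + vf pr n ≤ γ pr B (d * p ^ j * n / (d * p ^ l))
       local-bound j a e n = go (Nat.<-≤-connex j l)
         where
         go : j < l ⊎ l ≤ j → a * n + vf pr n ≤ γ pr B (d * p ^ j * n / (d * p ^ l))
         go (inj₂ le) = Nat.≤-trans (bound-up pr a B t (Nat.*-cancelʳ-≤ (a * D + 1) (p ^ t * (B * D + 1)) (p ^ l) {{Nat.m^n≢0 p l}} (Nat.≤-trans (minimal j a e) (Nat.≤-reflexive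
               (trans (cong (λ z → (B * D + 1) * z) split) (arith (B * D + 1) (p ^ l) (p ^ t)))))) n)
             (Nat.≤-reflexive (cong (γ pr B) (sym (trans (cong (_/ (d * p ^ l)) (trans (cong (λ z → d * z * n) split) (arith′ d (p ^ l) (p ^ t) n))) (m*n/n≡m (p ^ t * n) (d * p ^ l))))))
           where
           t = j ∸ l
           split : p ^ j ≡ p ^ l * p ^ t
           split = trans (cong (p ^_) (sym (Nat.m+[n∸m]≡n le))) (Nat.^-distribˡ-+-* p l t)
           arith : ∀ x y z → x * (y * z) ≡ z * x * y
           arith = solve-∀
           arith′ : ∀ d y z n → d * (y * z) * n ≡ z * n * (d * y)
           arith′ = solve-∀
         go (inj₁ lt) = conclude (below j a lt e)
           where
           conclude : a ≡ 0 × l ≡ suc j × 1 ≤ B → a * n + vf pr n ≤ γ pr B (d * p ^ j * n / (d * p ^ l))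
           conclude (a≡0 , l≡ , B≥1) = subst (λ z → z * n + vf pr n ≤ γ pr B (d * p ^ j * n / (d * p ^ l))) (sym a≡0) (Nat.≤-trans (bound-down pr B B≥1 n) (Nat.≤-reflexive (cong (γ pr B) (sym quotient))))
             where
             quotient : d * p ^ j * n / (d * p ^ l) ≡ n / p
             quotient = trans (same (d * p ^ l) (d * p ^ j * p) {{it}} {{nz}} (trans (cong (λ z → d * p ^ z) l≡) (arith d p (p ^ j)))) (m*n/m*o≡n/o (d * p ^ j) n p {{p≢0}} {{nz}})
               where
               arith : ∀ d p x → d * (p * x) ≡ d * x * p
               arith = solve-∀
               it : NonZero (d * p ^ l)
               it = Nat.>-nonZero (exponent>0 l)
               nz : NonZero (d * p ^ j * p)
               nz = Nat.>-nonZero (Nat.*-mono-≤ (exponent>0 j) (Nat.<⇒≤ (p>1 pr)))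
               same : ∀ x y .{{_ : NonZero x}} .{{_ : NonZero y}} → x ≡ y → d * p ^ j * n / x ≡ d * p ^ j * n / y
               same x .x refl = refl

-- Assembling bounded series

module Assembly where
 open Rat
 open Series
 open SeriesBounds
 open MainCount using (pick; E)
 open Levels using (sumTo; sumTo-cong; module Abel; lder-≗)
 open Valuation
 open Nat using (_^_; _!)

 -- Integrality of `J` is only known in those degrees that stay within `N` after the substitution;
 -- the others are cut off before a root is taken.
 truncate : ℕ → Series → Series
 truncate N f k with k Nat.≤? N
 ... | yes _ = f k
 ... | no  _ = 0F

 truncate-≤ : ∀ {N} f {k} → k ≤ N → truncate N f k ≡ f k
 truncate-≤ {N} f {k} le with k Nat.≤? N
 ... | yes _ = refl
 ... | no n  = ⊥-elim (n le)

 lder-cong≤ : ∀ {N f g ℓ} → (∀ n → n ≤ N → f n ≡ g n) → LDer N f ℓ → LDer N g ℓ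
 lder-cong≤ {N} {f} {g} {ℓ} h d n le = trans (cong (# n *_) (sym (h n le))) (trans (d n le) (⋆-cong≤ n {ℓ} {ℓ} (λ _ _ → refl) (λ i il → h i (Nat.≤-trans il le))))

 lder-0 : ∀ {N f ℓ} → f 0 ≡ 1F → LDer N f ℓ → ℓ 0 ≡ 0F
 lder-0 {N} {f} {ℓ} f0 h = trans (sym (trans (cong (ℓ 0 *_) f0) (Fₚ.*-identityʳ (ℓ 0)))) (trans (sym (h 0 z≤n)) (trans (cong (_* f 0) ⟦⟧-0) (Fₚ.zeroˡ (f 0))))

 module Pieces {p : ℕ} (pr : Prime p) (N : ℕ) (v : ℕ → ℕ) (v-fact : ∀ k → ∃ λ m → ¬ (p ∣ m) × k ! ≡ p ^ v k Nat.* m)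
               (v-mono : ∀ {i j} → i ≤ j → v i ≤ v j) (w : ℕ → ℕ) (w-super : ∀ i j → w i Nat.+ w j ≤ w (i Nat.+ j)) where
   open PIntegral pr
   open Bounds pr N
   open Superadditive w w-super
   private
     instance
       p≢0 : NonZero p
       p≢0 = prime⇒nonZero pr

   -- A bounded series with constant term 1 and logarithmic derivative ℓ.
   record Piece (ℓ : Series) : Set where
     constructor mkPiece
     field
       T     : Series
       T-0   : T 0 ≡ 1F
       bound : Bd w T
       lder  : LDer N T ℓ

   piece-cong : ∀ {ℓ ℓ′} → (∀ n → n ≤ N → ℓ n ≡ ℓ′ n) → Piece ℓ → Piece ℓ′
   piece-cong h (mkPiece T T0 b d) = mkPiece T T0 b (lder-cong h d)

   piece-⋆ : ∀ {ℓ m} → Piece ℓ → Piece m → Piece (ℓ ⊞ m)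
   piece-⋆ {ℓ} {m} (mkPiece T T0 b d) (mkPiece U U0 c e) = mkPiece (T ⋆ U) (trans (cong₂ _*_ T0 U0) (Fₚ.*-identityˡ 1F)) (bd-⋆ {T} {U} b c) (lder-⋆ {N} {T} {U} {ℓ} {m} d e)

   piece-sum : ∀ I (ℓ : ℕ → Series) → (∀ b → b < I → Piece (ℓ b)) → Piece (λ n → sumTo I (λ b → ℓ b n))
   piece-sum zero    ℓ h = mkPiece one refl bd-one lder-one
   piece-sum (suc I) ℓ h = piece-⋆ (piece-sum I ℓ (λ b lt → h b (Nat.m≤n⇒m≤1+n lt))) (h I Nat.≤-refl)

   -- If LD f = (LD Z − LD X)/d with p ∤ d and X, Z bounded, then f is bounded.
   conclude : ∀ {f ℓ x z} d → ¬ (p ∣ d) → f 0 ≡ 1F → LDer N f ℓ → Piece x → Piece z →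
              (∀ n → n ≤ N → x n + # d * ℓ n ≡ z n) → Bd w f
   conclude {f} {ℓ} {x} {z} d nd f0 hf (mkPiece X X0 bX dX) (mkPiece Z Z0 bZ dZ) eq = bd-root d nd f0
     (bd-quotient {X} {pow f d} {Z} X0 (lder-unique {N} {X ⋆ pow f d} {Z} {x ⊞ (# d ⊡ ℓ)}
       (trans (cong₂ _*_ X0 (pow-0 f d f0)) (trans (Fₚ.*-identityˡ 1F) (sym Z0)))
       (trans (cong₂ (λ a b → a + # d * b) (lder-0 X0 dX) (lder-0 f0 hf)) (trans (Fₚ.+-identityˡ _) (Fₚ.zeroʳ (# d))))
       (lder-⋆ dX (lder-pow hf d)) (lder-cong (λ n le → sym (eq n le)) dZ)) bX bZ)

   module _ (m : ℕ) (J : Series) (J-0 : J 0 ≡ 1F) (J-int : ∀ k → suc m Nat.* k ≤ N → Den 0 (J k)) (ℓ : Series) (J-lder : LDer N (spread m J) ℓ) where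

     spread-bd : Bd w (spread m J)
     spread-bd n le with cnt-cases m 0 n J
     ... | inj₁ z = subst (Den (w n)) (sym z) den-0
     ... | inj₂ (k , e , h) = subst (Den (w n)) (sym h) (den-mono z≤n (J-int k (subst (_≤ N) e le)))

     power-piece : ∀ c → Piece (# c ⊡ ℓ)
     power-piece c = mkPiece (pow (spread m J) c) (pow-0 (spread m J) c J-0) (bd-pow spread-bd c) (lder-pow J-lder c)

     -- The root is taken before the substitution `z^(m+1)`, so the coefficient of degree
     -- `(m + 1) k` costs only the denominator that belongs to `k`.
     root-piece : ∀ a → (∀ k → a Nat.* k Nat.+ v k ≤ w (suc m Nat.* k)) → Piece (recip (p ^ a) ⊡ ℓ)
     root-piece a bnd = mkPiece (spread m (R.root N)) (R.root-0 N)
         (bd-spread m (RootBound.bd-binomial (λ k → a Nat.* k Nat.+ v k) (λ le → Nat.+-mono-≤ (Nat.*-monoʳ-≤ a le) (v-mono le)) x (den-binom v v-fact a) J′ J′-0 J′-int) (λ k _ → bnd k))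
         (lder-cong same (lder-spread m (R.lder-root {N} (lder-logD J′ J′-0))))
       where
       x = recip (p ^ a)
       M = N Nat./ suc m
         where open import Data.Nat.DivMod
       open import Data.Nat.DivMod using (m*n/n≡m; /-monoˡ-≤; m/n*n≤m)
       J′ : Series
       J′ = truncate M J
       within : ∀ k → suc m Nat.* k ≤ N → k ≤ M
       within k le = subst (_≤ M) (m*n/n≡m k (suc m)) (/-monoˡ-≤ (suc m) (subst (_≤ N) (Nat.*-comm (suc m) k) le))
       J′-0 : J′ 0 ≡ 1F
       J′-0 = trans (truncate-≤ {M} J z≤n) J-0
       J′-int : Bd (λ _ → 0) J′
       J′-int k _ with k Nat.≤? M
       ... | yes le = J-int k (Nat.≤-trans (Nat.*-monoʳ-≤ (suc m) le) (subst (_≤ N) (Nat.*-comm M (suc m)) (m/n*n≤m N (suc m))))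
       ... | no _   = den-0
       module R = Root x J′ J′-0
       agree : ∀ n → n ≤ N → spread m J n ≡ spread m J′ n
       agree n le = go (cnt-cases m 0 n J) (cnt-cases m 0 n J′)
         where
         go : spread m J n ≡ 0F ⊎ (∃ λ k → n ≡ suc m Nat.* k × spread m J n ≡ J k) → spread m J′ n ≡ 0F ⊎ (∃ λ k → n ≡ suc m Nat.* k × spread m J′ n ≡ J′ k) → spread m J n ≡ spread m J′ n
         at : ∀ k → n ≡ suc m Nat.* k → spread m J n ≡ spread m J′ n
         at k e = trans (trans (cong (spread m J) e) (cnt-at m 0 k J)) (trans (sym (truncate-≤ {M} J (within k (subst (_≤ N) e le)))) (sym (trans (cong (spread m J′) e) (cnt-at m 0 k J′))))
         go (inj₁ z) (inj₁ z′) = trans z (sym z′)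
         go (inj₂ (k , e , _)) _ = at k e
         go _ (inj₂ (k , e , _)) = at k e
       same : ∀ n → n ≤ N → (# (suc m) ⊡ spread m (x ⊡ logD J′)) n ≡ (x ⊡ ℓ) n
       same n le = trans (cong (# (suc m) *_) (cnt-⊡ m 0 n x (logD J′))) (trans (solve 3 (λ a b c → a :* (b :* c) := b :* (a :* c)) refl (# (suc m)) x (spread m (logD J′) n))
         (cong (x *_) (trans (lder⇒logD {N} {spread m J′} {# (suc m) ⊡ spread m (logD J′)} J′-0 (lder-spread m (lder-logD J′ J′-0)) n le)
           (sym (lder⇒logD {N} {spread m J′} {ℓ} J′-0 (lder-cong≤ {N} {spread m J} agree J-lder) n le)))))

     -- The factor of exponent p^(C − Λ) · d/(m + 1), an integral or fractional power of p.
     piece : ∀ d s C Λ (η : Series) → (∀ n → n ≤ N → ℓ n ≡ # (d Nat.* p ^ s) * η n) →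
             (∀ a → C Nat.+ suc a ≡ Λ Nat.+ s → ∀ k → suc a Nat.* k Nat.+ v k ≤ w (suc m Nat.* k)) →
             Piece (λ n → # d * (# (p ^ C) * recip (p ^ Λ) * η n))
     piece d s C Λ η ℓ≡ bnd = go (Nat.<-≤-connex C (Λ Nat.+ s))
       where
       P : ℕ → F
       P a = # (p ^ a)
       P⁻¹ : ℕ → F
       P⁻¹ a = recip (p ^ a)
       inverse : ∀ a → P a * P⁻¹ a ≡ 1F
       inverse a = recip-inverse (p ^ a) {{Nat.m^n≢0 p a}}
       P-+ : ∀ a b → P (a Nat.+ b) ≡ P a * P b
       P-+ a b = trans (cong # (Nat.^-distribˡ-+-* p a b)) (#-* (p ^ a) (p ^ b))
       factor : ∀ t → t * P s ≡ P C * P⁻¹ Λ → ∀ n → n ≤ N → (t ⊡ ℓ) n ≡ # d * (P C * P⁻¹ Λ * η n)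
       factor t h n le = trans (cong (t *_) (trans (ℓ≡ n le) (cong (_* η n) (#-* d (p ^ s))))) (trans (solve 4 (λ t d s e → t :* ((d :* s) :* e) := d :* ((t :* s) :* e)) refl t (# d) (P s) (η n))
         (cong (λ z → # d * (z * η n)) h))
       go : C < Λ Nat.+ s ⊎ Λ Nat.+ s ≤ C → Piece (λ n → # d * (P C * P⁻¹ Λ * η n))
       go (inj₂ le) = piece-cong (factor (P b) h) (power-piece (p ^ b))
         where
         b = C ∸ (Λ Nat.+ s)
         h : P b * P s ≡ P C * P⁻¹ Λ
         h = sym (trans (cong (λ z → P z * P⁻¹ Λ) (sym (Nat.m+[n∸m]≡n le))) (trans (cong (_* P⁻¹ Λ) (trans (P-+ (Λ Nat.+ s) b) (cong (_* P b) (P-+ Λ s))))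
           (trans (solve 4 (λ l s b i → ((l :* s) :* b) :* i := (l :* i) :* (b :* s)) refl (P Λ) (P s) (P b) (P⁻¹ Λ)) (trans (cong (_* (P b * P s)) (inverse Λ)) (Fₚ.*-identityˡ _)))))
       go (inj₁ lt) = piece-cong (factor (P⁻¹ (suc a)) h) (root-piece (suc a) (bnd a total))
         where
         a = Λ Nat.+ s ∸ suc C
         total : C Nat.+ suc a ≡ Λ Nat.+ s
         total = trans (Nat.+-suc C a) (Nat.m+[n∸m]≡n lt)
         h : P⁻¹ (suc a) * P s ≡ P C * P⁻¹ Λ
         h = trans (sym (trans (cong₂ _*_ (inverse Λ) refl) (Fₚ.*-identityˡ _))) (trans (solve 4 (λ l i b s → (l :* i) :* (b :* s) := ((l :* s) :* b) :* i) refl (P Λ) (P⁻¹ Λ) (P⁻¹ (suc a)) (P s))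
           (cong (_* P⁻¹ Λ) (trans (cong (_* P⁻¹ (suc a)) (trans (sym (P-+ Λ s)) (trans (cong P (sym total)) (P-+ C (suc a)))))
             (trans (Fₚ.*-assoc (P C) (P (suc a)) (P⁻¹ (suc a))) (trans (cong (P C *_) (inverse (suc a))) (Fₚ.*-identityʳ (P C)))))))

 -- Summation by parts: Σ p^(C_b) (x_b − x_(b+1)) in terms of η_e = Σ_(b ≥ e) p^(Λ_b) (x_b − x_(b+1)).
 module ByParts (p : ℕ) .{{_ : NonZero p}} (x : ℕ → F) (I : ℕ) (C Λ : ℕ → ℕ) where
   open Abel x

   η : ℕ → F
   η e = abelSum I (λ b → pick (e Nat.≤? b) (p ^ Λ b))

   ρ : ℕ → F
   ρ b = # (p ^ C b) * recip (p ^ Λ b)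

   private
     P : ℕ → F
     P a = # (p ^ a)

     ρ-cancel : ∀ b → ρ b * P (Λ b) ≡ P (C b)
     ρ-cancel b = trans (Fₚ.*-assoc (P (C b)) _ _) (trans (cong (P (C b) *_) (trans (Fₚ.*-comm _ _) (recip-inverse (p ^ Λ b) {{Nat.m^n≢0 p (Λ b)}}))) (Fₚ.*-identityʳ _))

     top : η I ≡ P (Λ I) * x I
     top = trans (abel-cong I {λ b → pick (I Nat.≤? b) (p ^ Λ b)} {λ b → pick (I Nat.≤? b) (p ^ Λ I)} (λ b le → go b le (I Nat.≤? b))) (abel-single I (p ^ Λ I) I Nat.≤-refl)
       where
       go : ∀ b → b ≤ I → (dec : Dec (I ≤ b)) → pick dec (p ^ Λ b) ≡ pick dec (p ^ Λ I)
       go b le (yes ge) = cong (λ z → p ^ Λ z) (Nat.≤-antisym le ge)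
       go b le (no _)   = refl

     -- That is, `η e − η (e + 1) = p^(Λ e) (x e − x (e + 1))`; in this form both sides are Abel
     -- sums with natural weights, which agree level by level.
     step : ∀ e → e < I → η e + P (Λ e) * x (suc e) ≡ P (Λ e) * x e + η (suc e)
     step e lt = trans (cong (η e +_) (sym (abel-single (suc e) D I lt))) (trans (sym (abel-+ I (λ b → pick (e Nat.≤? b) (p ^ Λ b)) (λ b → pick (suc e Nat.≤? b) D)))
       (trans (abel-cong I {λ b → pick (e Nat.≤? b) (p ^ Λ b) Nat.+ pick (suc e Nat.≤? b) D} {λ b → pick (e Nat.≤? b) D Nat.+ pick (suc e Nat.≤? b) (p ^ Λ b)} (λ b _ → go b (e Nat.≤? b) (suc e Nat.≤? b)))
       (trans (abel-+ I (λ b → pick (e Nat.≤? b) D) (λ b → pick (suc e Nat.≤? b) (p ^ Λ b))) (cong (_+ η (suc e)) (abel-single e D I (Nat.<⇒≤ lt))))))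
       where
       D = p ^ Λ e
       go : ∀ b (u : Dec (e ≤ b)) (u′ : Dec (suc e ≤ b)) → pick u (p ^ Λ b) Nat.+ pick u′ D ≡ pick u D Nat.+ pick u′ (p ^ Λ b)
       go b (yes _) (yes _) = Nat.+-comm (p ^ Λ b) D
       go b (yes u) (no n)  = cong (λ z → p ^ Λ z Nat.+ 0) (sym (Nat.≤-antisym u (Nat.≤-pred (Nat.≰⇒> n))))
       go b (no n)  (yes u) = ⊥-elim (n (Nat.<⇒≤ u))
       go b (no _)  (no _)  = refl

     move : ∀ a b c e → a + c ≡ e + b → a ≡ e + - c + b
     move a b c e h = trans (sym (Fₚ.+-identityʳ a)) (trans (cong (a +_) (sym (Fₚ.-‿inverseʳ c))) (trans (sym (Fₚ.+-assoc a c (- c))) (trans (cong (_+ - c) h)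
       (solve 3 (λ e b c → e :+ b :+ c := e :+ c :+ b) refl e b (- c)))))

     each : ∀ b → b < I → ρ b * η b ≡ P (C b) * (x b + - x (suc b)) + ρ b * η (suc b)
     each b lt = trans (cong (ρ b *_) (trans (move (η b) (η (suc b)) (P (Λ b) * x (suc b)) (P (Λ b) * x b) (step b lt)) (cong (λ z → P (Λ b) * x b + z + η (suc b)) (-‿distribʳ-* (P (Λ b)) (x (suc b))))))
       (trans (solve 5 (λ r l x y e → r :* (l :* x :+ l :* y :+ e) := (r :* l) :* (x :+ y) :+ r :* e) refl (ρ b) (P (Λ b)) (x b) (- x (suc b)) (η (suc b)))
         (cong (λ z → z * (x b + - x (suc b)) + ρ b * η (suc b)) (ρ-cancel b)))

   -- The product formula for `F` in terms of logarithmic derivatives, with the factors of negative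
   -- exponent moved to the left.
   byParts : sumTo I (λ b → ρ b * η (suc b)) + abelSum I (λ b → p ^ C b) ≡ sumTo I (λ b → ρ b * η b) + ρ I * η I
   byParts = trans (solve 3 (λ s t u → s :+ (t :+ u) := (u :+ s) :+ t) refl (sumTo I (λ b → ρ b * η (suc b))) (P (C I) * x I) (sumTo I (λ b → P (C b) * (x b + - x (suc b)))))
     (cong₂ _+_ (go I Nat.≤-refl) (sym (trans (cong (ρ I *_) top) (trans (sym (Fₚ.*-assoc (ρ I) _ _)) (cong (_* x I) (ρ-cancel I))))))
     where
     go : ∀ M → M ≤ I → sumTo M (λ b → P (C b) * (x b + - x (suc b))) + sumTo M (λ b → ρ b * η (suc b)) ≡ sumTo M (λ b → ρ b * η b)
     go zero    _  = Fₚ.+-identityˡ 0F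
     go (suc M) le = trans (solve 4 (λ a b c e → (a :+ b) :+ (c :+ e) := (a :+ c) :+ (b :+ e)) refl (sumTo M (λ b → P (C b) * (x b + - x (suc b)))) (P (C M) * (x M + - x (suc M)))
         (sumTo M (λ b → ρ b * η (suc b))) (ρ M * η (suc M))) (cong₂ _+_ (go M (Nat.<⇒≤ le)) (sym (each M le)))

-- The coefficient as a multiple of the number of homomorphisms

module Coefficient where
 open import Defs
 open Counting
 open Rings
 open GL
 open Groups
 open Reps
 open Int using (+_)
 open import Data.Nat.Combinatorics using (_C_)
 open import Tactic.MonoidSolver using (solve)

 trivialHoms : ∀ K n → HomCount.numHom K [] n ≡ 1
 trivialHoms K n = trans (card-Rep n) (card-cong (finite-Rep n) (finite-Fin 1) (mk↔ₛ′ (λ _ → zero) (λ _ → trivial) (λ { zero → refl }) unique))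
   where
   open Matrices K
   open LinearMaps K
   open GLn K
   open FromList [] []
   open Homs K [] []
   invertible : ∀ (i : Fin 1) → IsInvertible (idM {n})
   invertible _ = lose (allMats-complete idM) (·-idˡ idM , ·-idˡ idM)
   multiplicative : ∀ (i j : Fin 1) → idM {n} ≡ idM · idM
   multiplicative _ _ = sym (·-idˡ idM)
   trivial : Rep n
   trivial = mkRep (λ _ → idM) invertible multiplicative
   only : (i j : Fin 1) → i ≡ j
   only zero zero = refl
   unique : ∀ ρ → trivial ≡ ρ
   unique ρ = rep-≡ (λ i → trans (mkRep-at (λ _ → idM) invertible multiplicative i) (sym (trans (cong (ρ ⟪_⟫) (only i ε)) (apply-injective {A = ρ ⟪ ε ⟫} {B = idM} (λ v → trans (rep-ε ρ v) (sym (apply-id v)))))))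

 private
   denominator : FiniteField → ℕ → ℤ
   denominator K n = + (FiniteField.size K Nat.^ (n C 2)) Int.* qPoch (FiniteField.size K) n

   -- The sign in coeffF is local to its definition, so the numerator is only reached by unification.
   numerator : ∀ K ms n → Σ Sign λ s → ∃ λ N → coeffF K ms n ≡ divℤ (s ◃ N) (denominator K n)
   numerator K ms n = _ , _ , refl

   modulus : ∀ K ms n → ℕ
   modulus K ms n = proj₁ (proj₂ (numerator K ms n))

   -- The factor |(−1)ⁿ| does not depend on the group and is read off from the trivial one.
   modulus-multiple : ∀ K ms n x → HomCount.numHom K ms n ≡ HomCount.numHom K [] n Nat.* x → modulus K ms n ≡ modulus K [] n Nat.* x
   modulus-multiple K ms n x e with HomCount.numHom K ms n | HomCount.numHom K [] n
   modulus-multiple K ms n x refl | .(h Nat.* x) | h = solve Nat.*-1-monoid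

 -- An integer multiple suffices for a lower bound of the valuation, so the sign is not computed.
 coeffF-multiple : ∀ K ms n → ∃ λ z → coeffF K ms n ≡ divℤ (z Int.* + HomCount.numHom K ms n) (+ (FiniteField.size K Nat.^ (n C 2)) Int.* qPoch (FiniteField.size K) n)
 coeffF-multiple K ms n = go (numerator K ms n) (modulus-multiple K ms n h (sym (trans (cong (Nat._* h) (trivialHoms K n)) (Nat.*-identityˡ h))))
   where
   h = HomCount.numHom K ms n
   go : (t : Σ Sign λ s → ∃ λ N → coeffF K ms n ≡ divℤ (s ◃ N) (denominator K n)) → proj₁ (proj₂ t) ≡ modulus K [] n Nat.* h →
        ∃ λ z → coeffF K ms n ≡ divℤ (z Int.* + h) (denominator K n)
   go (s , N , e) eq = s ◃ m , trans e (cong (λ y → divℤ y (denominator K n)) (trans (cong (s ◃_) eq)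
       (trans (cong (_◃ (m Nat.* h)) (sym (Signₚ.*-identityʳ s))) (trans (Int.◃-distrib-* s Sign.+ m h) (cong ((s ◃ m) Int.*_) (Int.+◃n≡+n h))))))
     where
     m = modulus K [] n

-- Proof of the bound

module Final where
 open import Defs
 open GL using (gl; glf; module GLn)
 open Rat renaming (_+_ to _⊕_; _*_ to _⊛_; -_ to ⊖_)
 open Series
 open SeriesBounds
 open MainCount
 open Levels
 open PElements using (cyclic-integral)
 open Assembly
 open Valuation
 open Numeric
 open Objective
 open Nat using (_+_; _*_; _^_; _/_)
 open import Data.Nat.Combinatorics using (_C_)
 open Int using (+_)
 open import Algebra.Properties.CommutativeMonoid.Sum Nat.+-0-commutativeMonoid using (sum; sum-cong-≗)

 -- The first factor is `q N − 1`, and each later one is `q N − q^(j+1) = q (N − q^j)`.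
 glf-scale : ∀ N q m → glf (q * N) q (suc m) ≡ (q * N ∸ 1) * (q ^ m * glf N q m)
 glf-scale N q zero    = arith (q * N ∸ 1)
   where
   arith : ∀ x → 1 * x ≡ x * (1 * 1)
   arith = solve-∀
 glf-scale N q (suc m) = trans (cong₂ _*_ (glf-scale N q m) (sym (Nat.*-distribˡ-∸ q N (q ^ m)))) (arith (q * N ∸ 1) (q ^ m) (glf N q m) q (N ∸ q ^ m))
   where
   arith : ∀ a b c d e → a * (b * c) * (d * e) ≡ a * (d * b * (c * e))
   arith = solve-∀

 gl≤ : ∀ N q m → glf N q m ≤ N ^ m
 gl≤ N q zero    = Nat.≤-refl
 gl≤ N q (suc m) = Nat.≤-trans (Nat.*-mono-≤ (gl≤ N q m) (Nat.m∸n≤m N (q ^ m))) (Nat.≤-reflexive (Nat.*-comm (N ^ m) N))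

 -- In `(q;q)ₙ` each factor `1 − q^i` is minus `q^i − 1`, so the sign alternates with `n`;
 -- `glf-scale` matches the absolute values.
 signed-gl : ∀ q → 0 < q → ∀ n → (+ (q ^ (n C 2)) Int.* qPoch q n ≡ + gl q n) ⊎ (+ (q ^ (n C 2)) Int.* qPoch q n ≡ Int.- + gl q n)
 signed-gl q q>0 zero    = inj₁ (cong (λ z → + (q ^ z) Int.* + 1) (k>n⇒nCk≡0 {0} {2} (s≤s z≤n)))
 signed-gl q q>0 (suc n) = go (signed-gl q q>0 n)
   where
   A = q ^ n
   X = q ^ suc n ∸ 1
   unfold : + (q ^ (suc n C 2)) Int.* qPoch q (suc n) ≡ Int.- ((+ X Int.* + A) Int.* (+ (q ^ (n C 2)) Int.* qPoch q n))
   unfold = trans (cong₂ (λ a b → a Int.* (qPoch q n Int.* b)) power minus) (arith (+ A) (+ (q ^ (n C 2))) (qPoch q n) (+ X))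
     where
     power : + (q ^ (suc n C 2)) ≡ + A Int.* + (q ^ (n C 2))
     power = trans (cong (λ z → + (q ^ z)) (trans (sym (nCk+nC[k+1]≡[n+1]C[k+1] n 1)) (cong (λ z → z + n C 2) (nC1≡n n)))) (trans (cong +_ (Nat.^-distribˡ-+-* q n (n C 2))) (Int.pos-* A (q ^ (n C 2))))
     minus : + 1 Int.- + (q ^ suc n) ≡ Int.- + X
     minus = trans (cong (λ z → + 1 Int.- + z) (sym (Nat.m+[n∸m]≡n {1} {q ^ suc n} (Nat.m^n>0 q {{Nat.>-nonZero q>0}} (suc n))))) (trans (cong (λ z → + 1 Int.- z) (Int.pos-+ 1 X)) (cancel (+ X)))
       where
       cancel : ∀ x → + 1 Int.- (+ 1 Int.+ x) ≡ Int.- x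
       cancel = ℤSolver.solve-∀
     arith : ∀ a c y x → a Int.* c Int.* (y Int.* Int.- x) ≡ Int.- (x Int.* a Int.* (c Int.* y))
     arith = ℤSolver.solve-∀
   collect : + X Int.* + A Int.* + gl q n ≡ + gl q (suc n)
   collect = trans (cong (Int._* + gl q n) (sym (Int.pos-* X A))) (trans (sym (Int.pos-* (X * A) (gl q n))) (cong +_ (trans (Nat.*-assoc X A (gl q n)) (sym (glf-scale (q ^ n) q n)))))
   go : _ → _
   go (inj₁ e) = inj₂ (trans unfold (cong Int.-_ (trans (cong (+ X Int.* + A Int.*_) e) collect)))
   go (inj₂ e) = inj₁ (trans unfold (trans (cong (λ z → Int.- (+ X Int.* + A Int.* z)) e) (trans (arith (+ X) (+ A) (+ gl q n)) collect)))
     where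
     arith : ∀ x a g → Int.- (x Int.* a Int.* (Int.- g)) ≡ x Int.* a Int.* g
     arith = ℤSolver.solve-∀

 module _ {p : ℕ} (pr : Prime p) where
   open PIntegral pr
   private
     instance
       p≢0 : NonZero p
       p≢0 = prime⇒nonZero pr

   den⇒vpℚ : ∀ {δ} x → Den δ (fromℚ x) → fin (Int.- + δ) ≤∞ vpℚ p x
   den⇒vpℚ {δ} x@(mkℚ a d-1 _) D = cases a refl
     where
     open Den D
     d = suc d-1
     clear′ : a Int.* + (w * p ^ δ) ≡ u Int.* + d
     clear′ = ⟦⟧-injective (begin
       ⟦ a Int.* + (w * p ^ δ) ⟧ ≡⟨ ⟦⟧-* a (+ (w * p ^ δ)) ⟩
       ⟦ a ⟧ ⊛ # (w * p ^ δ) ≡⟨ sym (trans (cong (⟦ a ⟧ ⊛ # (w * p ^ δ) ⊛_) (recip-inverse d)) (Fₚ.*-identityʳ _)) ⟩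
       ⟦ a ⟧ ⊛ # (w * p ^ δ) ⊛ (# d ⊛ recip d) ≡⟨ solve 4 (λ a b c e → a :* b :* (c :* e) := a :* e :* b :* c) refl ⟦ a ⟧ (# (w * p ^ δ)) (# d) (recip d) ⟩
       ⟦ a ⟧ ⊛ recip d ⊛ # (w * p ^ δ) ⊛ # d ≡⟨ cong (λ z → z ⊛ # (w * p ^ δ) ⊛ # d) (sym (trans (fromℚ-normal x) (fraction a d-1))) ⟩
       fromℚ x ⊛ # (w * p ^ δ) ⊛ # d ≡⟨ cong (_⊛ # d) clear ⟩
       ⟦ u ⟧ ⊛ # d ≡⟨ sym (⟦⟧-* u (+ d)) ⟩
       ⟦ u Int.* + d ⟧ ∎)
       where open ≡-Reasoning
     absolute : Int.∣ a ∣ * (w * p ^ δ) ≡ Int.∣ u ∣ * d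
     absolute = trans (sym (Int.abs-* a (+ (w * p ^ δ)))) (trans (cong Int.∣_∣ clear′) (Int.abs-* u (+ d)))
     bound : 0 < Int.∣ a ∣ → vpℕ p d ≤ vpℕ p Int.∣ a ∣ + δ
     bound a>0 = ∣⇒≤valued pr {a = vpℕ p d} (valued-* pr (vpℕ-valued pr Int.∣ a ∣ a>0) (valued-* pr (valued-unit pr unit) power))
         (subst (p ^ vpℕ p d ∣_) (sym absolute) (subst (λ z → p ^ vpℕ p d ∣ Int.∣ u ∣ * z) (sym (Valued.eq vd)) (divides (Int.∣ u ∣ * Valued.u vd) (arith Int.∣ u ∣ (p ^ vpℕ p d) (Valued.u vd)))))
       where
       vd : Valued pr d (vpℕ p d)
       vd = vpℕ-valued pr d (s≤s z≤n)
       power : Valued pr (p ^ δ) δ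
       power = mkValued 1 (p∤1 pr) (sym (Nat.*-identityʳ (p ^ δ)))
       arith : ∀ u x y → u * (x * y) ≡ u * y * x
       arith = solve-∀
     lower : 0 < Int.∣ a ∣ → Int.- + δ Int.≤ + vpℕ p Int.∣ a ∣ Int.- + vpℕ p d
     lower a>0 = subst₂ Int._≤_ (arith₁ (+ vpℕ p d) (+ δ)) (trans (cong (λ z → z Int.- (+ δ Int.+ + vpℕ p d)) (Int.pos-+ (vpℕ p Int.∣ a ∣) δ)) (arith₂ (+ vpℕ p Int.∣ a ∣) (+ vpℕ p d) (+ δ)))
       (Int.+-monoˡ-≤ (Int.- (+ δ Int.+ + vpℕ p d)) (Int.+≤+ (bound a>0)))
       where
       arith₁ : ∀ v e → v Int.- (e Int.+ v) ≡ Int.- e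
       arith₁ = ℤSolver.solve-∀
       arith₂ : ∀ a v e → a Int.+ e Int.- (e Int.+ v) ≡ a Int.- v
       arith₂ = ℤSolver.solve-∀
     cases : ∀ b → a ≡ b → fin (Int.- + δ) ≤∞ vpℚ p x
     cases (+ zero)  refl = _ ≤∞∞
     cases +[1+ _ ]  refl = fin≤fin (lower (s≤s z≤n))
     cases -[1+ _ ]  refl = fin≤fin (lower (s≤s z≤n))

   den-divℤ : ∀ {δ} z h g D → 0 < g → (D ≡ + g ⊎ D ≡ Int.- + g) → Den δ (# h ⊛ recip g) → Den δ (fromℚ (divℤ (z Int.* + h) D))
   den-divℤ {δ} z h (suc g) D _ s den = go s
     where
     scaled-den : ∀ z → Den δ (fromℚ ((z Int.* + h) ℚ./ suc g))
     scaled-den z = subst (Den δ) (sym (trans (fraction (z Int.* + h) g) (trans (cong (_⊛ recip (suc g)) (⟦⟧-* z (+ h))) (Fₚ.*-assoc ⟦ z ⟧ (# h) (recip (suc g)))))) (den-* {0} {δ} (den-ℤ z) den)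
     go : (D ≡ + suc g ⊎ D ≡ -[1+ g ]) → Den δ (fromℚ (divℤ (z Int.* + h) D))
     go (inj₁ refl) = scaled-den z
     go (inj₂ refl) = subst (λ y → Den δ (fromℚ (y ℚ./ suc g))) (sym (Int.neg-distribˡ-* z (+ h))) (scaled-den (Int.- z))

 exponents : ℕ → (ℕ → ℕ) → List ℕ
 exponents zero    k = []
 exponents (suc r) k = exponents r k ++ replicate (k (suc r)) (suc r)

 exponents-orders : ∀ p r k → List.map (p ^_) (exponents r k) ≡ cyclicOrders p r k
 exponents-orders p zero    k = refl
 exponents-orders p (suc r) k = trans (Listₚ.map-++ (p ^_) (exponents r k) (replicate (k (suc r)) (suc r)))
   (cong₂ _++_ (exponents-orders p r k) (Listₚ.map-replicate (p ^_) (k (suc r)) (suc r)))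

 exponents-≤ : ∀ r k → All (_≤ r) (exponents r k)
 exponents-≤ zero    k = []
 exponents-≤ (suc r) k = Allₚ.++⁺ (All.map Nat.m≤n⇒m≤1+n (exponents-≤ r k)) (Allₚ.replicate⁺ (k (suc r)) Nat.≤-refl)

 sumL-++ : ∀ (f : ℕ → ℕ) xs ys → sumL f (xs ++ ys) ≡ sumL f xs + sumL f ys
 sumL-++ f []       ys = refl
 sumL-++ f (x ∷ xs) ys = trans (cong (λ z → f x + z) (sumL-++ f xs ys)) (sym (Nat.+-assoc (f x) _ _))

 sumL-replicate : ∀ (f : ℕ → ℕ) n x → sumL f (replicate n x) ≡ f x * n
 sumL-replicate f zero    x = sym (Nat.*-zeroʳ (f x))
 sumL-replicate f (suc n) x = trans (cong (λ z → f x + z) (sumL-replicate f n x)) (sym (Nat.*-suc (f x) n))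

 sumL-exponents : ∀ b r k → sumL (b ⊓_) (exponents r k) ≡ cc r k b
 sumL-exponents b zero    k = refl
 sumL-exponents b (suc r) k = trans (sumL-++ (b ⊓_) (exponents r k) _) (cong₂ _+_ (sumL-exponents b r k) (sumL-replicate (b ⊓_) (k (suc r)) (suc r)))

 sumTo-scale : ∀ I c f → sumTo I (λ b → c ⊛ f b) ≡ c ⊛ sumTo I f
 sumTo-scale zero    c f = sym (Fₚ.zeroʳ c)
 sumTo-scale (suc I) c f = trans (cong (_⊕ (c ⊛ f I)) (sumTo-scale I c f)) (sym (Fₚ.distribˡ c (sumTo I f) (f I)))

 module Main (K : FiniteField) {ℓ c : ℕ} (ℓ-prime : Prime ℓ) (size≡ : FiniteField.size K ≡ ℓ ^ c)
   {p : ℕ} (pr : Prime p) (p∤q : ¬ (p ∣ FiniteField.size K)) (d : ℕ) (d>0 : 0 < d) (order∣ : p ∣ FiniteField.size K ^ d ∸ 1)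
   (order-min : ∀ m → 0 < m → p ∣ FiniteField.size K ^ m ∸ 1 → d ≤ m)
   (r : ℕ) (k : ℕ → ℕ) (r≥1 : 1 ≤ r) (kr>0 : 0 < k r) (l : ℕ) (least : IsLeastMinimizer (objective p (FiniteField.size K) d r k) l)
   (B : ℕ) (b-l : bb p (FiniteField.size K) d r k l ≡ Int.- + B) (n : ℕ) where

   open PIntegral pr
   private
     q = FiniteField.size K
     instance
       p≢0 : NonZero p
       p≢0 = prime⇒nonZero pr
     q≥2 : 2 ≤ q
     q≥2 = GLn.size≥2 K
     q>0 : 0 < q
     q>0 = Nat.<⇒≤ q≥2
     valued : ∀ i → Valued pr (q ^ (d * p ^ i) ∸ 1) (lam p q d i)
     valued = lam-valued pr q q≥2 d d>0 order∣ r k r≥1 kr>0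
     i<λ : ∀ i → i < lam p q d i
     i<λ = i<lam pr q q≥2 d d>0 order∣ r k r≥1 kr>0
     lam∣ : ∀ i → p ^ lam p q d i ∣ q ^ (d * p ^ i) ∸ 1
     lam∣ i = subst (p ^ lam p q d i ∣_) (sym (Valued.eq (valued i))) (m∣m*n (Valued.u (valued i)))

     open Level pr q q≥2 d d>0 order∣ order-min (lam p q d) lam∣ (λ i a h → ∣⇒≤valued pr {a = a} (valued i) h)

     Λ-mono : ∀ {a b} → a ≤ b → Λ a ≤ Λ b
     Λ-mono {a} {b} le = subst (λ z → Λ a ≤ Λ z) (Nat.m+[n∸m]≡n le) (go (b ∸ a))
       where
       step : ∀ a → Λ a ≤ Λ (suc a)
       step zero    = z≤n
       step (suc i) = Nat.<⇒≤ (lam-mono pr q q≥2 d d>0 order∣ r k r≥1 kr>0 i)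
       go : ∀ t → Λ a ≤ Λ (a + t)
       go zero    = Nat.≤-reflexive (cong Λ (sym (Nat.+-identityʳ a)))
       go (suc t) = Nat.≤-trans (go t) (Nat.≤-trans (step (a + t)) (Nat.≤-reflexive (cong Λ (sym (Nat.+-suc a t)))))

     -- A level whose exponent exceeds r and all valuations of group orders relevant up to degree n.
     I : ℕ
     I = suc (r + q ^ (n * n))

     r≤ΛI : r ≤ Λ I
     r≤ΛI = Nat.≤-trans (Nat.m≤m+n r (q ^ (n * n))) (Nat.<⇒≤ (i<λ (r + q ^ (n * n))))

     -- `v ≤ p^v ≤ |GL| ≤ q^(m e · t · t) ≤ q^(n · n)`, and `Λ I` was chosen above the last number.
     small : ∀ e t → m e * t ≤ n → ∀ v u → ¬ (p ∣ u) → gl (q ^ m e) t ≡ p ^ v * u → v ≤ Λ I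
     small e t le v u nu eq = Nat.≤-trans (v≤pow v) (Nat.≤-trans (Nat.≤-trans (Nat.m≤m*n (p ^ v) u {{Nat.>-nonZero (p∤⇒>0 pr nu)}}) (Nat.≤-reflexive (sym eq)))
         (Nat.≤-trans (gl≤ ((q ^ m e) ^ t) (q ^ m e) t) (Nat.≤-trans (Nat.≤-reflexive (trans (cong (_^ t) (Nat.^-*-assoc q (m e) t)) (Nat.^-*-assoc q (m e * t) t)))
         (Nat.≤-trans (Nat.^-monoʳ-≤ q {{Nat.>-nonZero q>0}} (Nat.*-mono-≤ le (Nat.≤-trans (Nat.m≤n*m t (m e) {{Nat.>-nonZero (m>0 e)}}) le)))
         (Nat.≤-trans (Nat.m≤n+m (q ^ (n * n)) r) (Nat.<⇒≤ (i<λ (r + q ^ (n * n)))))))))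
       where
       v≤pow : ∀ v → v ≤ p ^ v
       v≤pow zero    = z≤n
       v≤pow (suc v) = Nat.≤-trans (Nat.+-mono-≤ (Nat.m^n>0 p v) (v≤pow v)) (Nat.≤-trans (Nat.≤-reflexive (cong (λ z → p ^ v + z) (sym (Nat.+-identityʳ (p ^ v))))) (Nat.*-monoˡ-≤ (p ^ v) (p>1 pr)))

     -- The endomorphism field of a simple module on which C_(p^λ) acts faithfully.
     fieldOf : ∀ e → Σ FiniteField (λ L → FiniteField.size L ≡ q ^ m e)
     fieldOf zero    = K , sym (Nat.*-identityʳ q)
     fieldOf (suc i) = found (Finₚ.any? (λ s → lam p q d i Nat.≤? C.a s))
       where
       data-i : CountingData K p (lam p q d i ∷ []) (lam p q d i)
       data-i = countingData K ℓ-prime c size≡ pr (lam p q d i ∷ []) (lam p q d i) (Nat.≤-refl ∷ []) (m (suc i)) (m>0 (suc i)) (lam∣ i)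
       module C = CountingData data-i
       at : ∀ s → AtLevel 0 (C.a s) (C.d s)
       at s = atLevel 0 (suc i) (C.a s) (C.d s) z≤n (C.bounded s) (C.d-pos s) (subst (λ z → p ^ C.a s ∣ z ^ C.d s ∸ 1) (sym (Nat.*-identityʳ q)) (C.divide s))
         (λ x x>0 h → C.minimal s x x>0 (subst (λ z → p ^ C.a s ∣ z ^ x ∸ 1) (Nat.*-identityʳ q) h))
       found : Dec (∃ λ s → lam p q d i ≤ C.a s) → Σ FiniteField (λ L → FiniteField.size L ≡ q ^ m (suc i))
       found (yes (s , le)) = C.field-of s , trans (C.size-of s) (cong (q ^_) (trans (sym (Nat.+-identityʳ (C.d s))) (trans (AtLevel.degree (at s)) (cong m exact))))
         where
         exact : AtLevel.level (at s) ≡ suc i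
         exact = Nat.≤-antisym (AtLevel.low⇒ (at s) (suc i) z≤n (C.bounded s)) (Nat.≮⇒≥ (λ lt → absurd i (Nat.≤-trans le (AtLevel.low⇐ (at s) i (Nat.≤-pred lt)))))
           where
           absurd : ∀ i → ¬ (lam p q d i ≤ Λ i)
           absurd zero    h = Nat.<⇒≱ (i<λ 0) h
           absurd (suc i) h = Nat.<⇒≱ (lam-mono pr q q≥2 d d>0 order∣ r k r≥1 kr>0 i) h
       -- Without a faithful simple module the total degrees for the exponents `λ − 1` and `λ` would
       -- coincide, but they are `p^(λ−1)` and `p^λ`.
       found (no none) = ⊥-elim (Nat.<-irrefl (trans (sym (C.degrees below-λ)) (trans (sum-cong-≗ same) (C.degrees (lam p q d i)))) strictly)
         where
         below-λ = lam p q d i ∸ 1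
         suc-below : suc below-λ ≡ lam p q d i
         suc-below = Nat.m+[n∸m]≡n (Nat.≤-trans (s≤s z≤n) (i<λ i))
         same : ∀ s → pick (C.a s Nat.≤? below-λ) (C.d s) ≡ pick (C.a s Nat.≤? lam p q d i) (C.d s)
         same s = trans (Abel.pick-yes (λ _ → 0F) (C.a s Nat.≤? below-λ) (C.d s) (Nat.≤-pred (subst (C.a s <_) (sym suc-below) (Nat.≰⇒> (λ h → none (s , h))))))
           (sym (Abel.pick-yes (λ _ → 0F) (C.a s Nat.≤? lam p q d i) (C.d s) (C.bounded s)))
         strictly : p ^ sumL (below-λ ⊓_) (lam p q d i ∷ []) < p ^ sumL (lam p q d i ⊓_) (lam p q d i ∷ [])
         strictly = Nat.^-monoʳ-< p (p>1 pr) (Nat.+-monoˡ-< 0 (subst₂ _<_ (sym (Nat.m≤n⇒m⊓n≡m (Nat.m∸n≤m (lam p q d i) 1))) (sym (Nat.⊓-idem (lam p q d i))) (subst (below-λ <_) suc-below Nat.≤-refl)))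

     L : ℕ → FiniteField
     L e = proj₁ (fieldOf e)

     size-L : ∀ e → FiniteField.size (L e) ≡ q ^ m e
     size-L e = proj₂ (fieldOf e)

     J : ℕ → Series
     J e = homSeries (L e) (Λ I ∷ [])

     J-data : ∀ e → e ≤ I → CountingData (L e) p (Λ I ∷ []) (Λ I)
     J-data e le = countingData (L e) ℓ-prime (c * m e) (trans (size-L e) (trans (cong (_^ m e) size≡) (Nat.^-*-assoc ℓ c (m e)))) pr (Λ I ∷ []) (Λ I) (Nat.≤-refl ∷ [])
       (ratio e I) (ratio>0 e I le) (subst (λ z → p ^ Λ I ∣ z ^ ratio e I ∸ 1) (sym (size-L e)) (Λ∣ e I le))

     J-0 : ∀ e → e ≤ I → J e 0 ≡ 1F
     J-0 e le = homSeries-0 {n} {I} e le (L e) (size-L e) (Λ I ∷ []) (J-data e le)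

     J-int : ∀ e t → suc (m e ∸ 1) * t ≤ n → Den 0 (J e t)
     J-int e t le = go (valuation pr (gl (FiniteField.size (L e)) t) (gl-pos (FiniteField.size (L e)) (GLn.size≥2 (L e)) t))
       where
       go : Val pr (gl (FiniteField.size (L e)) t) → Den 0 (J e t)
       go val@(mkVal v u nu eq) = cyclic-integral (L e) pr (Λ I) t val (small e t (subst (λ z → z * t ≤ n) (m-suc e) le) v u nu (trans (cong (λ z → gl z t) (sym (size-L e))) eq))

     js : List ℕ
     js = exponents r k

     C : ℕ → ℕ
     C b = sumL (Λ b ⊓_) js

     module BP (t : ℕ) = ByParts p (λ b → ε b t) I C Λ

     J-lder : ∀ e → e ≤ I → LDer n (spread (m e ∸ 1) (J e)) (λ t → # (m e) ⊛ BP.η t e)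
     J-lder e le = lder-cong (λ t _ → cong (# (m e) ⊛_) (Abel.abel-cong (λ b → ε b t) I {weights e (Λ I ∷ [])} {λ b → pick (e Nat.≤? b) (p ^ Λ b)}
         (λ b b≤I → cong (λ z → pick (e Nat.≤? b) (p ^ z)) (trans (Nat.+-identityʳ _) (Nat.m≤n⇒m⊓n≡m (Λ-mono b≤I))))))
       (lder-homSeries {n} {I} e le (L e) (size-L e) (Λ I ∷ []) (J-data e le))

     M : ℕ
     M = d * p ^ l

     instance
       M≢0 : NonZero M
       M≢0 = Nat.>-nonZero (m>0 (suc l))

     w : ℕ → ℕ
     w i = γ pr B (i / M)

     open Pieces pr n (vf pr) (λ k → Valued.u (vf-valued pr k) , Valued.unit (vf-valued pr k) , Valued.eq (vf-valued pr k)) (vf-mono pr) w (γ-floor-super pr B M)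

     to-b : ∀ s a → C (suc s) + a ≡ lam p q d s + s → bb p q d r k s ≡ Int.- + a
     to-b s a h = ℕ→ℤ pr q q≥2 d d>0 order∣ r k r≥1 kr>0 s a (trans (cong (λ z → z + a) (sym (sumL-exponents (lam p q d s) r k))) h)

     bound : ∀ s a → C (suc s) + a ≡ lam p q d s + s → ∀ x → a * x + vf pr x ≤ w (d * p ^ s * x)
     bound s a h = local-bound pr q q≥2 d d>0 order∣ r k r≥1 kr>0 l least B b-l s a (to-b s a h)

     term : ∀ b e → Series
     term b e t = # d ⊛ (BP.ρ t b ⊛ BP.η t e)

     piece-at : ∀ b s → suc s ≤ I → (∀ a → C b + suc a ≡ Λ b + s → ∀ x → suc a * x + vf pr x ≤ w (d * p ^ s * x)) → Piece (term b (suc s))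
     piece-at b s le bnd = piece (m (suc s) ∸ 1) (J (suc s)) (J-0 (suc s) le) (J-int (suc s)) (λ t → # (m (suc s)) ⊛ BP.η t (suc s)) (J-lder (suc s) le) d s (C b) (Λ b) (λ t → BP.η t (suc s)) (λ _ _ → refl)
       (λ a h x → subst (λ z → suc a * x + vf pr x ≤ w (z * x)) (sym (m-suc (suc s))) (bnd a h x))

     C-0 : C 0 ≡ 0
     C-0 = go js
       where
       go : ∀ xs → sumL (0 ⊓_) xs ≡ 0
       go []       = refl
       go (x ∷ xs) = go xs

     diagonal : ∀ b → b ≤ I → Piece (term b b)
     -- This is the factor `J 0 ^ d` of the base field; `ρ` is 1 because `C 0` and `Λ 0` vanish.
     diagonal zero    le = piece-cong (λ t _ → cong (# d ⊛_) (trans (cong (_⊛ BP.η t 0) ⟦⟧-1) (cong (_⊛ BP.η t 0) (sym ρ-0))))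
         (power-piece 0 (J 0) (J-0 0 z≤n) (J-int 0) (λ t → # 1 ⊛ BP.η t 0) (J-lder 0 z≤n) d)
       where
       ρ-0 : # (p ^ C 0) ⊛ recip (p ^ 0) ≡ 1F
       ρ-0 = trans (cong (λ z → # (p ^ z) ⊛ recip 1) C-0) (recip-inverse 1)
     diagonal (suc s) le = piece-at (suc s) s le (λ a h x → bound s (suc a) h x)

     off-diagonal : ∀ b → b < I → Piece (term b (suc b))
     -- Here `J 1` occurs to the first power: a root would require `C 0 + suc a = 0`.
     off-diagonal zero    lt = piece-at 0 0 lt (λ a h → ⊥-elim (Nat.1+n≢0 (trans (sym (Nat.+-suc (C 0) a)) h)))
     off-diagonal (suc s) lt = piece-at (suc s) (suc s) lt (λ a h x → shifted a x (bound s a (Nat.suc-injective (trans (sym (Nat.+-suc (C (suc s)) a)) (trans h (Nat.+-suc (lam p q d s) s)))) (p * x)))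
       where
       -- The exponent has one more `p` in the denominator than on the diagonal, but the variable is
       -- `z^(d p^(s+1))`. In the bound for level `s` at `p x`, the summand `x` of
       -- `v((p x)!) = x + v(x!)` pays for the additional root.
       shifted : ∀ a x → a * (p * x) + vf pr (p * x) ≤ w (d * p ^ s * (p * x)) → suc a * x + vf pr x ≤ w (d * p ^ suc s * x)
       shifted a x h = Nat.≤-trans (Nat.≤-reflexive (arith a x (vf pr x))) (Nat.≤-trans (Nat.+-mono-≤ (Nat.*-monoʳ-≤ a (Nat.m≤n*m x p)) (Nat.≤-reflexive (sym (vf-multiple pr x))))
           (Nat.≤-trans h (Nat.≤-reflexive (cong w (arith′ d (p ^ s) p x)))))
         where
         arith : ∀ a x v → (1 + a) * x + v ≡ a * x + (x + v)
         arith = solve-∀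
         arith′ : ∀ d y p x → d * y * (p * x) ≡ d * (p * y) * x
         arith′ = solve-∀

     base-data : CountingData K p js (Λ I)
     base-data = countingData K ℓ-prime c size≡ pr js (Λ I) (All.map (λ le → Nat.≤-trans le r≤ΛI) (exponents-≤ r k)) (m I) (m>0 I) (lam∣ (r + q ^ (n * n)))

     size-K : q ≡ q ^ m 0
     size-K = sym (Nat.*-identityʳ q)

     F-lder : LDer n (spread 0 (homSeries K js)) (λ t → Abel.abelSum (λ b → ε b t) I (λ b → p ^ C b))
     F-lder = lder-cong (λ t _ → trans (cong (_⊛ Abel.abelSum (λ b → ε b t) I (weights 0 js)) ⟦⟧-1) (trans (Fₚ.*-identityˡ _)
         (Abel.abel-cong (λ b → ε b t) I {weights 0 js} {λ b → p ^ C b} (λ b _ → Abel.pick-yes (λ b → ε b t) (0 Nat.≤? b) (p ^ C b) z≤n))))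
       (lder-homSeries {n} {I} 0 z≤n K size-K js base-data)

     -- The order satisfies `d < p`; this is what permits the `d`-th root in `conclude`.
     p∤d : ¬ (p ∣ d)
     p∤d h = Nat.<⇒≱ (order<p pr q q≥2 p∤q d order-min) (∣⇒≤ {{Nat.>-nonZero d>0}} h)

     identity : ∀ t → t ≤ n → sumTo I (λ b → term b (suc b) t) ⊕ # d ⊛ Abel.abelSum (λ b → ε b t) I (λ b → p ^ C b) ≡ sumTo I (λ b → term b b t) ⊕ term I I t
     identity t _ = trans (cong (_⊕ (# d ⊛ A)) (sumTo-scale I (# d) (λ b → BP.ρ t b ⊛ BP.η t (suc b)))) (trans (sym (Fₚ.distribˡ (# d) (sumTo I (λ b → BP.ρ t b ⊛ BP.η t (suc b))) A))
         (trans (cong (# d ⊛_) (BP.byParts t)) (trans (Fₚ.distribˡ (# d) (sumTo I (λ b → BP.ρ t b ⊛ BP.η t b)) _) (cong (_⊕ term I I t) (sym (sumTo-scale I (# d) (λ b → BP.ρ t b ⊛ BP.η t b)))))))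
       where
       A = Abel.abelSum (λ b → ε b t) I (λ b → p ^ C b)

   homSeries-den : Den (γ pr B (n / (d * p ^ l))) (# (HomCount.numHom K (cyclicOrders p r k) n) ⊛ recip (gl q n))
   homSeries-den = subst (λ z → Den (w n) (# (HomCount.numHom K z n) ⊛ recip (gl q n))) (exponents-orders p r k)
     (subst (Den (w n)) (cnt-identity (homSeries K js) n)
       (conclude {spread 0 (homSeries K js)} d p∤d (homSeries-0 {n} {I} 0 z≤n K size-K js base-data) F-lder
         (piece-sum I (λ b → term b (suc b)) off-diagonal) (piece-⋆ (piece-sum I (λ b → term b b) (λ b lt → diagonal b (Nat.<⇒≤ lt))) (diagonal I Nat.≤-refl)) identity n Nat.≤-refl))

-- From denominators to the valuation of the coefficient

open import Defs
open GL using (gl; module GLn)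
open Rat using (fromℚ; module PIntegral)
open MainCount using (gl-pos)
open Numeric using (vf; γ)
open Objective using (minimum≤0)
open Final
open Coefficient using (coeffF-multiple)
open Nat using (_^_; _*_; _!)
open Int using (+_)

divℕ-/ : ∀ n m .{{_ : Nat.NonZero m}} → divℕ n m ≡ n Nat./ m
divℕ-/ n (Nat.suc m) = refl

theorem2p11 : (p q d r : ℕ) (k : ℕ → ℕ) (K : FiniteField) →
    Prime p → IsPrimePower q → ¬ (p ∣ q) → FiniteField.size K ≡ q →
    IsMultOrder p q d → 1 ≤ r → 0 < k r →
    (l : ℕ) → IsLeastMinimizer (objective p q d r k) l →
    (n : ℕ) →
    fin ((bb p q d r k l Int.* + divℕ n (d * p ^ l))
    Int.- + vpℕ p (divℕ n (d * p ^ l) !))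
    ≤∞ vpℚ p (coeffF K (cyclicOrders p r k) n)
theorem2p11 p q d r k K pr (ℓ , e , ℓ-prime , _ , q≡) p∤q refl (d>0 , order∣ , order-min) r≥1 kr>0 l least n =
  main (minimum≤0 pr q q≥2 d d>0 order∣ r k r≥1 kr>0 l least)
  where
  q≥2 : 2 ≤ q
  q≥2 = GLn.size≥2 K
  instance
    p≢0 : Nat.NonZero p
    p≢0 = prime⇒nonZero pr
    M≢0 : Nat.NonZero (d * p ^ l)
    M≢0 = Nat.>-nonZero (Nat.*-mono-≤ d>0 (Nat.m^n>0 p l))
  main : (∃ λ B → bb p q d r k l ≡ Int.- + B) → _
  main (B , b-l) = subst (λ z → fin z ≤∞ vpℚ p (coeffF K (cyclicOrders p r k) n)) exponent
      (den⇒vpℚ pr (coeffF K (cyclicOrders p r k) n) (subst (λ x → Den _ (fromℚ x)) (sym (proj₂ coefficient))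
        (den-divℤ pr (proj₁ coefficient) (HomCount.numHom K (cyclicOrders p r k) n) (gl q n) _ (gl-pos q q≥2 n) (signed-gl q (Nat.<⇒≤ q≥2) n)
          (Main.homSeries-den K {ℓ} {e} ℓ-prime q≡ pr p∤q d d>0 order∣ (λ m m>0 h → Nat.≮⇒≥ (λ lt → order-min m m>0 lt h)) r k r≥1 kr>0 l least B b-l n))))
    where
    open PIntegral pr using (Den)
    coefficient = coeffF-multiple K (cyclicOrders p r k) n
    T = n Nat./ (d * p ^ l)
    exponent : Int.- + γ pr B T ≡ bb p q d r k l Int.* + divℕ n (d * p ^ l) Int.- + vpℕ p (divℕ n (d * p ^ l) !)
    exponent = trans (cong Int.-_ (trans (Int.pos-+ (B * T) (vf pr T)) (cong (Int._+ + vf pr T) (Int.pos-* B T)))) (trans (arith (+ B) (+ T) (+ vf pr T))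
      (cong₂ (λ b t → b Int.* + t Int.- + vpℕ p (t !)) (sym b-l) (sym (divℕ-/ n (d * p ^ l)))))
      where
      arith : ∀ b t v → Int.- (b Int.* t Int.+ v) ≡ (Int.- b) Int.* t Int.- v
      arith = ℤSolver.solve-∀
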